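{- Let $\mathcal X$ be a quasinormal circulant scheme over a finite cyclic group $G$. Then every algebraic automorphism $\varphi$ of $\mathcal X$ that is extendable at a base tuple for $\mathcal X$ is induced by an isomorphism, i.e., there is a permutation $f$ of $G$ with $s^f=\varphi(s)$ for every basis relation $s$ of $\mathcal X$.
   Context: A coherent configuration on $\Omega$ is $(\Omega,S)$, $S$ a partition of $\Omega\times\Omega$ (basis relations) such that $1_\Omega$ is a union of basis relations, $S$ is closed under transposition, and $c^t_{rs}=|\{\gamma:(\alpha,\gamma)\in r,(\gamma,\beta)\in s\}|$ is independent of $(\alpha,\beta)\in t$; trivial if its basis relations are $1_\Omega$ and its complement (only $1_\Omega$ if $|\Omega|=1$). An algebraic automorphism is a permutation of $S$ preserving all $c^t_{rs}$ (extended to unions of basis relations). $\mathrm{Aut}(\mathcal X)$ is the group of permutations fixing each basis relation. For a tuple $x$ with entry set $\Omega(x)$, the point extension $\mathcal X_x$ is the smallest coherent configuration refining $\mathcal X$ in which each $\{(x_i,x_i)\}$ is a basis relation. $\varphi$ is extendable at a tuple $x\in G^m$ if for some $x'\in G^m$ there is an algebraic isomorphism $\psi:\mathcal X_x\to\mathcal X_{x'}$ with $\psi(s)=\varphi(s)$ for every basis relation $s$ of $\mathcal X$ and $\psi(\{(x_i,x_i)\})=\{(x'_i,x'_i)\}$ for all $i$. A circulant scheme over a cyclic group $G$ is a coherent configuration $(G,S)$ with $(\alpha,\beta)\in s\Rightarrow(\alpha g,\beta g)\in s$. $H\le G$ is an $\mathcal X$-group if its coset partition is a union of basis relations. For $\mathcal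 X$-groups $L\le U$, $\mathfrak S=U/L$ is a section, $U(\mathfrak S)=U$, $L(\mathfrak S)=L$; $\mathrm{Sec}_1(\mathcal X)$ is the set of these. $\mathcal X_{\mathfrak S}$ is the circulant scheme over $U/L$ with basis relations $s_{\mathfrak S}=\{(\Gamma,\Gamma')\in\mathfrak S^2:s\cap(\Gamma\times\Gamma')\ne\varnothing\}$ for $s\in S$ meeting $U\times U$. $\mathfrak S$ is a subsection of $\mathfrak T$ if $L(\mathfrak T)\le L(\mathfrak S)\le U(\mathfrak S)\le U(\mathfrak T)$. A section is trivial/normal if $\mathcal X_{\mathfrak S}$ is trivial/normal, where a circulant scheme $\mathcal Y$ over $K$ is normal if the right translations of $K$ form a normal subgroup of $\mathrm{Aut}(\mathcal Y)$. $\mathfrak S$ is a multiple of $\mathfrak T$ if $L(\mathfrak T)=U(\mathfrak T)\cap L(\mathfrak S)$ and $U(\mathfrak S)=U(\mathfrak T)L(\mathfrak S)$; projective equivalence is the equivalence relation on $\mathrm{Sec}_1(\mathcal X)$ generated by this. $\mathcal X$ is quasinormal if every trivial section in $\mathrm{Sec}_1(\mathcal X)$ is projectively equivalent to a subsection of a normal section. For $g\in G$, $g_{\mathfrak S}=gL$ if $g\in U$, else $\varnothing$. A tuple $x$ is a base tuple for $\mathcal X$ if $1_G\in\Omega(x)$ and for every $\mathfrak S\in\mathrm{Sec}_1(\mathcal X)$ of prime power order there is $g\in\Omega(x)\cap U(\mathfrak S)$ with $\mathfrak S=\langle g_{\mathfrak S}\rangle$. -}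

module Defs where

open import Level using (0ℓ)
open import Data.Nat using (ℕ; zero; suc; _+_; _*_; _∸_; _^_)
open import Data.Nat.DivMod using (_mod_)
open import Data.Nat.Divisibility using (_∣_)
open import Data.Nat.Primality using (Prime)
open import Data.Fin using (Fin; toℕ) renaming (zero to fzero)
open import Data.Fin.Properties using (_≟_)
open import Data.List using (List; length; filter; allFin)
open import Data.Product using (Σ; ∃; ∃-syntax; _×_; _,_)
open import Relation.Nullary.Decidable using (_×-dec_)
open import Relation.Binary.PropositionalEquality using (_≡_)
open import Relation.Binary.Construct.Closure.Equivalence using (EqClosure)
open import Function.Bundles using (_↔_; _⇔_; Inverse)

-- Colourings: a partition of Ω × Ω (Ω = Fin N) into k classes is given
-- by a colouring  c : Ω → Ω → Fin k ; the basis relations are the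
-- (nonempty, by surjectivity) colour classes  { (α,β) : c α β ≡ r }.

Colouring : ℕ → ℕ → Set
Colouring N k = Fin N → Fin N → Fin k

inum : ∀ {N k} → Colouring N k → Fin N → Fin N → Fin k → Fin k → ℕ
inum {N} c α β r s =
  length (filter (λ γ → (c α γ ≟ r) ×-dec (c γ β ≟ s)) (allFin N))

record IsCC {N k : ℕ} (c : Colouring N k) : Set where
  field
    nonempty : ∀ r → ∃[ α ] ∃[ β ] c α β ≡ r
    diagonal : ∀ α β γ → c α α ≡ c β γ → β ≡ γ
    transpose : ∀ α β α' β' → c α β ≡ c α' β' → c β α ≡ c β' α'
    intersection : ∀ r s α β α' β' → c α β ≡ c α' β' →
                   inum c α β r s ≡ inum c α' β' r s

IsAlgIso : ∀ {N k N' k'} → Colouring N k → Colouring N' k' →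
           (Fin k ↔ Fin k') → Set
IsAlgIso c c' ψ = ∀ r s α β α' β' → c' α' β' ≡ to (c α β) →
                  inum c α β r s ≡ inum c' α' β' (to r) (to s)
  where open Inverse ψ

Refines : ∀ {N k k'} → Colouring N k' → Colouring N k → Set
Refines d c = ∀ α β α' β' → d α β ≡ d α' β' → c α β ≡ c α' β'

SingletonsAt : ∀ {N k m} → Colouring N k → (Fin m → Fin N) → Set
SingletonsAt d x = ∀ i α β → d α β ≡ d (x i) (x i) → (α ≡ x i) × (β ≡ x i)

IsPointExt : ∀ {N k k' m} → Colouring N k → (Fin m → Fin N) →
             Colouring N k' → Set
IsPointExt {N} c x d =
  IsCC d × Refines d c × SingletonsAt d x ×
  (∀ k'' (e : Colouring N k'') → IsCC e → Refines e c → SingletonsAt e x →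
     Refines e d)

Extendable : ∀ {N k m} → Colouring N k → (Fin k ↔ Fin k) →
             (Fin m → Fin N) → Set
Extendable {N} {k} {m} c φ x =
  ∃[ x' ] Σ ℕ λ k₁ → Σ (Colouring N k₁) λ d₁ → Σ ℕ λ k₂ →
  Σ (Colouring N k₂) λ d₂ → Σ (Fin k₁ ↔ Fin k₂) λ ψ →
    IsPointExt c x d₁ × IsPointExt c x' d₂ × IsAlgIso d₁ d₂ ψ ×
    -- ψ(s) = φ(s) for each basis relation s of X
    (∀ α β α' β' → d₂ α' β' ≡ Inverse.to ψ (d₁ α β) →
       c α' β' ≡ Inverse.to φ (c α β)) ×
    (∀ i → d₂ (x' i) (x' i) ≡ Inverse.to ψ (d₁ (x i) (x i)))

IsAlgAut : ∀ {N k} → Colouring N k → (Fin k ↔ Fin k) → Set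
IsAlgAut c φ = IsAlgIso c c φ

_⊕_ : ∀ {m} → Fin m → Fin m → Fin m
_⊕_ {suc m} a b = (toℕ a + toℕ b) mod suc m

⊖_ : ∀ {m} → Fin m → Fin m
⊖_ {suc m} a = (suc m ∸ toℕ a) mod suc m

_⊝_ : ∀ {m} → Fin m → Fin m → Fin m
a ⊝ b = a ⊕ (⊖ b)

_·_ : ∀ {m} → ℕ → Fin m → Fin m
_·_ {suc m} j g = (j * toℕ g) mod suc m

record IsCirculant {n k : ℕ} (c : Colouring (suc n) k) : Set where
  field
    coherent : IsCC c
    invariant : ∀ α β g → c (α ⊕ g) (β ⊕ g) ≡ c α β

-- Subgroups of the cyclic group Z_(suc n) are exactly the groups
-- H_e = { g : e ∣ g } for the divisors e of suc n (|H_e| = (suc n)/e).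
_∈H_ : ∀ {n} → Fin (suc n) → ℕ → Set
g ∈H e = e ∣ toℕ g

-- H_e is an X-group: e ∣ |G| and the coset partition of H_e is a union
-- of basis relations
IsXGroup : ∀ {n k} → Colouring (suc n) k → ℕ → Set
IsXGroup {n} c e = (e ∣ suc n) ×
  (∀ α β α' β' → c α β ≡ c α' β' → (β ⊝ α) ∈H e → (β' ⊝ α') ∈H e)

-- A section U/L with U = H_eU, L = H_(m * eU); its order |U/L| is m.
record Section {n k : ℕ} (c : Colouring (suc n) k) : Set where
  field
    eU : ℕ
    m : ℕ
    U-X : IsXGroup c eU
    L-X : IsXGroup c (m * eU)
  eL : ℕ
  eL = m * eU

open Section public

module _ {n k : ℕ} {c : Colouring (suc n) k} where

  -- U/L is cyclic of order m generated by the coset of eU; we identify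
  -- it with Z_m via  i ↦ (i·eU)L, so  Γ_i = (i * eU) + L
  InCoset : (S : Section c) → Fin (m S) → Fin (suc n) → Set
  InCoset S i α = (α ⊝ ((toℕ i * eU S) mod suc n)) ∈H eL S

  SecRel : (S : Section c) → Fin k → Fin (m S) → Fin (m S) → Set
  SecRel S s i j = ∃[ α ] ∃[ β ] InCoset S i α × InCoset S j β × c α β ≡ s

  -- X_S is trivial: every basis relation s_S is 1 or its complement
  TrivialSec : Section c → Set
  TrivialSec S = ∀ s i j i' j' → SecRel S s i j →
                 SecRel S s i' j' ⇔ (i ≡ j ⇔ i' ≡ j')

  -- X_S is normal: the right translations of Z_m form a normal subgroup
  -- of Aut(X_S)
  NormalSec : Section c → Set
  NormalSec S = ∀ (f : Fin (m S) ↔ Fin (m S)) →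
    (∀ s i j → SecRel S s i j ⇔ SecRel S s (Inverse.to f i) (Inverse.to f j)) →
    ∀ g → ∃[ h ] ∀ i → Inverse.to f (Inverse.from f i ⊕ g) ≡ i ⊕ h

  _≤H_ : ℕ → ℕ → Set
  a ≤H b = ∀ (g : Fin (suc n)) → g ∈H a → g ∈H b

  Subsection : Section c → Section c → Set
  Subsection S T = (eL T ≤H eL S) × (eL S ≤H eU S) × (eU S ≤H eU T)

  Multiple : Section c → Section c → Set
  Multiple S T =
    (∀ (g : Fin (suc n)) → g ∈H eL T ⇔ (g ∈H eU T × g ∈H eL S)) ×
    (∀ (g : Fin (suc n)) → g ∈H eU S ⇔
       (∃[ a ] ∃[ b ] a ∈H eU T × b ∈H eL S × g ≡ a ⊕ b))

  ProjEquiv : Section c → Section c → Set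
  ProjEquiv = EqClosure Multiple

IsQuasinormal : ∀ {n k} → Colouring (suc n) k → Set
IsQuasinormal c = ∀ (S : Section c) → TrivialSec S →
  ∃[ S' ] ∃[ T ] ProjEquiv S S' × Subsection S' T × NormalSec T

IsBaseTuple : ∀ {n k t} → Colouring (suc n) k → (Fin t → Fin (suc n)) → Set
IsBaseTuple {n} c x =
  (∃[ i ] x i ≡ fzero) ×
  (∀ (S : Section c) → (∃[ p ] ∃[ a ] Prime p × m S ≡ p ^ a) →
     ∃[ i ] (x i ∈H eU S) ×
       (∀ (u : Fin (suc n)) → u ∈H eU S → ∃[ j ] (u ⊝ (j · x i)) ∈H eL S))

-- Write χ z for the colour of (0, z) and R x y when φ maps the colour of x to that of y, with x, y in ℤ taken modulo
-- N = |G|. An A-set is a union of classes, and an A-group an X-group, given by its index e as the set of multiples of e.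
-- Since the p-th power of an element of the Schur ring is, modulo p, its push-forward along multiplication by p, R is
-- stable under multiplication by units.
--
-- Let a class X generate the group of index E and let its radical have index M. Either X is regular (no element of X lies
-- in the group of index qE, for any prime q with qE dividing M), or every element of X is a sum h + w with h in a
-- difference H ∖ V of two A-groups and w in a class generating a smaller group, and all such sums lie in X.
-- The elements regular for X are unit multiples of one another modulo M. The base points and their images under the
-- extension of φ show that φ acts on them, at each prime q dividing M/E, as multiplication by a scalar depending only on q
-- and on the power of q dividing E. These scalars are compatible for different levels, because a unit that is 1 outside q,
-- is 1 modulo q (modulo 4 if q = 2) and stabilises X acts trivially modulo M.
--
-- Hence the map multiplying the i-th q-adic digit by the scalar of its level, for each q, induces φ on the regular classes.
-- It preserves divisibility of differences by the divisors of N, so that induction on E takes care of the other classes.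

module Submission where

open import Algebra.Bundles using (CommutativeSemiring)
open import Algebra.Structures.Biased using (IsCommutativeSemiringˡ)
open import Data.Empty using (⊥; ⊥-elim)
open import Data.Fin using (Fin; toℕ; fromℕ; fromℕ<; inject₁; punchOut) renaming (zero to fzero; suc to fsuc)
open import Data.Fin.Properties using (toℕ-fromℕ; toℕ-inject₁; toℕ<n; toℕ-injective; toℕ-fromℕ<; any?; all?; injective⇒≤; punchOut-injective) renaming (_≟_ to _≟F_)
open import Data.Integer using (ℤ; +_; -[1+_]; ∣_∣; _+_; _*_; _-_; -_; _^_; 0ℤ; 1ℤ; -1ℤ; NonZero; ≢-nonZero)
open import Data.Integer.DivMod using (_%ℕ_; _/ℕ_; n%ℕd<d; a≡a%ℕn+[a/ℕn]*n)
open import Data.Integer.Divisibility.Signed using (_∣_; divides; _∣?_; ∣ᵤ⇒∣; ∣⇒∣ᵤ; ∣-refl; ∣-trans; ∣m∣n⇒∣m+n; ∣m∣n⇒∣m-n; ∣m⇒∣-m; ∣n⇒∣m*n; ∣m⇒∣m*n; *-cancelˡ-∣; *-monoʳ-∣; 0∣⇒≡0)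
import Data.Integer.Properties as ℤₚ
open import Data.Integer.Tactic.RingSolver using (solve-∀)
open import Data.List using (List; []; _∷_; length; filter; tabulate; allFin)
open import Data.List.Membership.Propositional using (_∈_)
open import Data.List.Membership.Propositional.Properties using (∈-filter⁺; ∈-filter⁻; ∈-allFin)
open import Data.List.Relation.Unary.All using (All; []; _∷_)
open import Data.List.Relation.Unary.Any using (here; there)
open import Data.Nat as ℕ using (ℕ; zero; suc; z≤n; s≤s; _!)
open import Data.Nat.Combinatorics using (_C_; nCn≡1; k![n∸k]!∣n!)
open import Data.Nat.Combinatorics.Specification using (nCk≡n!/k![n-k]!)
open import Data.Nat.DivMod using (_mod_; m/n*n≡m)
import Data.Nat.Divisibility as ℕ∣
import Data.Nat.GCD as GCD
import Data.Nat.Induction as ℕI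
open import Data.Nat.ListAction using (product)
open import Data.Nat.Primality using (Prime; prime?; prime[2]; prime⇒nonZero; prime⇒irreducible; prime⇒nonTrivial; euclidsLemma)
open import Data.Nat.Primality.Factorisation using (PrimeFactorisation; factorise)
import Data.Nat.Properties as ℕₚ
open import Data.Nat.Properties using (_!*_!≢0)
import Data.Nat.Tactic.RingSolver as ℕRing
open import Data.Product using (Σ; ∃; _×_; _,_; proj₁; proj₂)
open import Data.Sum using (_⊎_; inj₁; inj₂)
open import Defs hiding (m)
open import Function using (_∘_)
open import Function.Bundles using (_↔_; Inverse; mk↔ₛ′)
open import Function.Construct.Identity using (↔-id)
open import Induction.WellFounded using (Acc; acc)
import Level as L
open import Relation.Binary.Definitions using (tri<; tri≈; tri>)
open import Relation.Binary.PropositionalEquality using (_≡_; _≢_; refl; sym; trans; cong; cong₂; subst; subst₂; module ≡-Reasoning)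
open import Relation.Binary.Structures using (IsEquivalence)
open import Relation.Nullary using (¬_; Dec; yes; no)
open import Relation.Nullary.Decidable using (map′; _×-dec_; ¬?; _→-dec_; decidable-stable; _⊎-dec_)
open import Relation.Unary using (Decidable)

-- Congruences and Bézout coprimality in ℤ

-- Write M = q e₀ for a prime q. The push-forward along q, read modulo q, sees exactly the cosets of
-- e₀ℤ modulo M that a set meets without containing. This produces new A-sets even when q divides N,
-- where multiplication by q is no permutation. A class X that is not regular is handled by a
-- majority argument: more than half of X stays in X under shifts by e₀ℤ, hence X fills more than
-- half of every H-coset that it meets. Two such halves intersect, so a unit moving a point of X by
-- an element of H stabilises X. The scalars need one more A-group, of index q^a E with a the
-- exponent of q in M/E. Among multiples of E, membership in it is congruence modulo the full power
-- of q in M, and this passes to images. It arises by pushing X forward a times, unless q = 2 and X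
-- is stable under a unit that is -1 modulo 4 and 1 modulo the odd part of M. There the push-forward
-- vanishes before stage a, and the number of ways to write an element as a sum of two elements of
-- X, taken modulo 4, replaces it.

infix 4 _≋_[_]

record _≋_[_] (x y m : ℤ) : Set where
  constructor ≋⟨_⟩
  field ≋⇒∣ : m ∣ x - y
open _≋_[_] public

opaque
  lin : ∀ {m a b z} s t → m ∣ a → m ∣ b → z ≡ s * a + t * b → m ∣ z
  lin s t p q refl = ∣m∣n⇒∣m+n (∣n⇒∣m*n s p) (∣n⇒∣m*n t q)

opaque
  ∣-self : ∀ {m} k → m ∣ k * m
  ∣-self k = divides k refl

opaque
  ∣0 : ∀ {m} → m ∣ 0ℤ
  ∣0 = divides 0ℤ refl

opaque
  1∣ : ∀ {x} → 1ℤ ∣ x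
  1∣ {x} = divides x (sym (ℤₚ.*-identityʳ x))

opaque
  ≋-reflexive : ∀ {m x y} → x ≡ y → x ≋ y [ m ]
  ≋-reflexive {m} {x} refl = ≋⟨ subst (m ∣_) (sym (ℤₚ.+-inverseʳ x)) ∣0 ⟩

opaque
  ≋-refl : ∀ {m x} → x ≋ x [ m ]
  ≋-refl = ≋-reflexive refl

opaque
  ≋-sym : ∀ {m x y} → x ≋ y [ m ] → y ≋ x [ m ]
  ≋-sym {m} {x} {y} ≋⟨ p ⟩ = ≋⟨ subst (m ∣_) (eq x y) (∣m⇒∣-m p) ⟩
    where
    eq : ∀ x y → - (x - y) ≡ y - x
    eq = solve-∀

opaque
  ≋-trans : ∀ {m x y z} → x ≋ y [ m ] → y ≋ z [ m ] → x ≋ z [ m ]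
  ≋-trans {m} {x} {y} {z} ≋⟨ p ⟩ ≋⟨ q ⟩ = ≋⟨ subst (m ∣_) (eq x y z) (∣m∣n⇒∣m+n p q) ⟩
    where
    eq : ∀ x y z → (x - y) + (y - z) ≡ x - z
    eq = solve-∀

opaque
  ≋-+ : ∀ {m x y z w} → x ≋ y [ m ] → z ≋ w [ m ] → x + z ≋ y + w [ m ]
  ≋-+ {m} {x} {y} {z} {w} ≋⟨ p ⟩ ≋⟨ q ⟩ = ≋⟨ subst (m ∣_) (eq x y z w) (∣m∣n⇒∣m+n p q) ⟩
    where
    eq : ∀ x y z w → (x - y) + (z - w) ≡ (x + z) - (y + w)
    eq = solve-∀

≋-+ˡ : ∀ {m y z} x → y ≋ z [ m ] → x + y ≋ x + z [ m ]
≋-+ˡ x = ≋-+ (≋-refl {x = x})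

≋-+ʳ : ∀ {m y z} x → y ≋ z [ m ] → y + x ≋ z + x [ m ]
≋-+ʳ x p = ≋-+ p (≋-refl {x = x})

opaque
  ≋-neg : ∀ {m x y} → x ≋ y [ m ] → - x ≋ - y [ m ]
  ≋-neg {m} {x} {y} ≋⟨ p ⟩ = ≋⟨ subst (m ∣_) (eq x y) (∣m⇒∣-m p) ⟩
    where
    eq : ∀ x y → - (x - y) ≡ - x - - y
    eq = solve-∀

opaque
  ≋-- : ∀ {m x y z w} → x ≋ y [ m ] → z ≋ w [ m ] → x - z ≋ y - w [ m ]
  ≋-- p q = ≋-+ p (≋-neg q)

opaque
  ≋-* : ∀ {m x y z w} → x ≋ y [ m ] → z ≋ w [ m ] → x * z ≋ y * w [ m ]
  ≋-* {m} {x} {y} {z} {w} ≋⟨ p ⟩ ≋⟨ q ⟩ = ≋⟨ lin z y p q (eq x y z w) ⟩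
    where
    eq : ∀ x y z w → x * z - y * w ≡ z * (x - y) + y * (z - w)
    eq = solve-∀

opaque
  ≋-*ˡ : ∀ {m y z} x → y ≋ z [ m ] → x * y ≋ x * z [ m ]
  ≋-*ˡ x = ≋-* (≋-refl {x = x})

opaque
  ≋-*ʳ : ∀ {m y z} x → y ≋ z [ m ] → y * x ≋ z * x [ m ]
  ≋-*ʳ x p = ≋-* p (≋-refl {x = x})

opaque
  ≋-weaken : ∀ {m k x y} → k ∣ m → x ≋ y [ m ] → x ≋ y [ k ]
  ≋-weaken d ≋⟨ p ⟩ = ≋⟨ ∣-trans d p ⟩

opaque
  ∣⇒≋0 : ∀ {m x} → m ∣ x → x ≋ 0ℤ [ m ]
  ∣⇒≋0 {m} {x} d = ≋⟨ subst (m ∣_) (sym (ℤₚ.+-identityʳ x)) d ⟩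

opaque
  ≋0⇒∣ : ∀ {m x} → x ≋ 0ℤ [ m ] → m ∣ x
  ≋0⇒∣ {m} {x} ≋⟨ d ⟩ = subst (m ∣_) (ℤₚ.+-identityʳ x) d

opaque
  ∣-≋ : ∀ {m x y} → x ≋ y [ m ] → m ∣ x → m ∣ y
  ∣-≋ p q = ≋0⇒∣ (≋-trans (≋-sym p) (∣⇒≋0 q))

opaque
  ≋-shift : ∀ {m} x k → x + k * m ≋ x [ m ]
  ≋-shift {m} x k = ≋⟨ divides k (eq x k m) ⟩
    where
    eq : ∀ x k m → (x + k * m) - x ≡ k * m
    eq = solve-∀

opaque
  ≋-unshift : ∀ {m x y} → y ≋ x [ m ] → ∃ λ k → y ≡ x + k * m
  ≋-unshift {m} {x} {y} ≋⟨ divides k e ⟩ = k , trans (eq x y) (cong (λ z → x + z) e)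
    where
    eq : ∀ x y → y ≡ x + (y - x)
    eq = solve-∀

Cop : ℤ → ℤ → Set
Cop a b = ∃ λ s → ∃ λ t → s * a + t * b ≡ 1ℤ

opaque
  cop-sym : ∀ {a b} → Cop a b → Cop b a
  cop-sym {a} {b} (s , t , e) = t , s , trans (ℤₚ.+-comm (t * b) (s * a)) e

opaque
  cop-cancel : ∀ {a b c} → Cop a b → a ∣ b * c → a ∣ c
  cop-cancel {a} {b} {c} (s , t , e) p = lin (s * c) t ∣-refl p
    (trans (sym (ℤₚ.*-identityˡ c)) (trans (cong (_* c) (sym e)) (eq s t a b c)))
    where
    eq : ∀ s t a b c → (s * a + t * b) * c ≡ (s * c) * a + t * (b * c)
    eq = solve-∀

opaque
  cop-∣-* : ∀ {a b c} → Cop a b → a ∣ c → b ∣ c → a * b ∣ c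
  cop-∣-* {a} {b} (s , t , e) (divides q refl) (divides r h) = divides (s * r + t * q)
    (trans (sym (ℤₚ.*-identityˡ (q * a))) (trans (cong (_* (q * a)) (sym e))
      (trans (eq₁ s t a b q) (trans (cong (λ z → s * a * z + t * q * (a * b)) h) (eq₂ s t a b q r)))))
    where
    eq₁ : ∀ s t a b q → (s * a + t * b) * (q * a) ≡ s * a * (q * a) + t * q * (a * b)
    eq₁ = solve-∀
    eq₂ : ∀ s t a b q r → s * a * (r * b) + t * q * (a * b) ≡ (s * r + t * q) * (a * b)
    eq₂ = solve-∀

opaque
  cop-1 : ∀ {a} → Cop a 1ℤ
  cop-1 {a} = 0ℤ , 1ℤ , refl

opaque
  cop-*ʳ : ∀ {a b c} → Cop a b → Cop a c → Cop a (b * c)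
  cop-*ʳ {a} {b} {c} (s , t , e) (s' , t' , e') = s * s' * a + s * t' * c + s' * t * b , t * t' ,
    trans (eq s t s' t' a b c) (cong₂ _*_ e e')
    where
    eq : ∀ s t s' t' a b c → (s * s' * a + s * t' * c + s' * t * b) * a + t * t' * (b * c) ≡ (s * a + t * b) * (s' * a + t' * c)
    eq = solve-∀

opaque
  cop-*ˡ : ∀ {a b c} → Cop a c → Cop b c → Cop (a * b) c
  cop-*ˡ p q = cop-sym (cop-*ʳ (cop-sym p) (cop-sym q))

opaque
  cop-∣ʳ : ∀ {a b c} → c ∣ b → Cop a b → Cop a c
  cop-∣ʳ {a} {_} {c} (divides q refl) (s , t , e) = s , t * q , trans (eq s t q a c) e
    where
    eq : ∀ s t q a c → s * a + t * q * c ≡ s * a + t * (q * c)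
    eq = solve-∀

opaque
  cop-∣ˡ : ∀ {a b c} → c ∣ a → Cop a b → Cop c b
  cop-∣ˡ d p = cop-sym (cop-∣ʳ d (cop-sym p))

opaque
  cop-≋ : ∀ {m x y} → x ≋ y [ m ] → Cop m x → Cop m y
  cop-≋ {m} {x} {y} ≋⟨ divides q h ⟩ (s , t , e) = s + t * q , t ,
    trans (eq₁ s t q m y) (trans (cong (λ z → s * m + t * (z + y)) (sym h)) (trans (eq₂ s t m x y) e))
    where
    eq₁ : ∀ s t q m y → (s + t * q) * m + t * y ≡ s * m + t * (q * m + y)
    eq₁ = solve-∀
    eq₂ : ∀ s t m x y → s * m + t * ((x - y) + y) ≡ s * m + t * x
    eq₂ = solve-∀

opaque
  cop-inv : ∀ {m x} → Cop m x → ∃ λ y → x * y ≋ 1ℤ [ m ]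
  cop-inv {m} {x} (s , t , e) = t , ≋⟨ divides (- s) (trans (cong (λ z → x * t - z) (sym e)) (eq s t m x)) ⟩
    where
    eq : ∀ s t m x → x * t - (s * m + t * x) ≡ - s * m
    eq = solve-∀

opaque
  inv-cop : ∀ {m x} y → x * y ≋ 1ℤ [ m ] → Cop m x
  inv-cop {m} {x} y ≋⟨ divides q h ⟩ = - q , y ,
    trans (eq₁ q m x y) (trans (cong (λ z → x * y - z) (sym h)) (eq₂ (x * y)))
    where
    eq₁ : ∀ q m x y → - q * m + y * x ≡ x * y - q * m
    eq₁ = solve-∀
    eq₂ : ∀ w → w - (w - 1ℤ) ≡ 1ℤ
    eq₂ = solve-∀

opaque
  CRT₂ : ∀ {m k} → Cop m k → ∀ x y → ∃ λ z → (z ≋ x [ m ]) × (z ≋ y [ k ])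
  CRT₂ {m} {k} (s , t , e) x y = s * m * y + t * k * x ,
    ≋⟨ divides (s * (y - x)) (trans (cong (λ w → s * m * y + t * k * x - w) (trans (sym (ℤₚ.*-identityˡ x)) (cong (_* x) (sym e)))) (eq₁ s t m k x y)) ⟩ ,
    ≋⟨ divides (t * (x - y)) (trans (cong (λ w → s * m * y + t * k * x - w) (trans (sym (ℤₚ.*-identityˡ y)) (cong (_* y) (sym e)))) (eq₂ s t m k x y)) ⟩
    where
    eq₁ : ∀ s t m k x y → s * m * y + t * k * x - (s * m + t * k) * x ≡ s * (y - x) * m
    eq₁ = solve-∀
    eq₂ : ∀ s t m k x y → s * m * y + t * k * x - (s * m + t * k) * y ≡ t * (x - y) * k
    eq₂ = solve-∀

-- Primes in ℤ

opaque
  gcdℤ : ∀ a b → ∃ λ g → (g ∣ a) × (g ∣ b) × ∃ λ s → ∃ λ t → s * a + t * b ≡ g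
  gcdℤ a b = let (u , v , h) = lem in
    + g , ∣ᵤ⇒∣ (GCD.gcd[m,n]∣m ∣ a ∣ ∣ b ∣) , ∣ᵤ⇒∣ (GCD.gcd[m,n]∣n ∣ a ∣ ∣ b ∣) , u * sg a , v * sg b ,
    trans (cong₂ _+_ (trans (ℤₚ.*-assoc u (sg a) a) (cong (u *_) (sg-eq a))) (trans (ℤₚ.*-assoc v (sg b) b) (cong (v *_) (sg-eq b)))) h
    where
    g : ℕ
    g = GCD.gcd ∣ a ∣ ∣ b ∣
    sg : ℤ → ℤ
    sg (+ _) = 1ℤ
    sg -[1+ _ ] = -1ℤ
    sg-eq : ∀ x → sg x * x ≡ + ∣ x ∣
    sg-eq (+ n) = ℤₚ.*-identityˡ (+ n)
    sg-eq -[1+ n ] = ℤₚ.-1*i≡-i -[1+ n ]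
    pos : ∀ {x y z : ℕ} → x ℕ.+ y ≡ z → + x ≡ + z - + y
    pos {x} {y} refl = trans (eq (+ x) (+ y)) (cong (_- + y) (sym (ℤₚ.pos-+ x y)))
      where
      eq : ∀ x y → x ≡ (x + y) - y
      eq = solve-∀
    lem : ∃ λ u → ∃ λ v → u * + ∣ a ∣ + v * + ∣ b ∣ ≡ + g
    lem with GCD.Bézout.identity (GCD.gcd-GCD ∣ a ∣ ∣ b ∣)
    ... | GCD.Bézout.+- x y e = + x , - + y , trans (cong₂ (λ z w → z + w) (sym (ℤₚ.pos-* x ∣ a ∣)) (trans (sym (ℤₚ.neg-distribˡ-* (+ y) (+ ∣ b ∣))) (cong -_ (sym (ℤₚ.pos-* y ∣ b ∣))))) (sym (pos e))
    ... | GCD.Bézout.-+ x y e = - + x , + y , trans (cong₂ _+_ (trans (sym (ℤₚ.neg-distribˡ-* (+ x) (+ ∣ a ∣))) (cong -_ (sym (ℤₚ.pos-* x ∣ a ∣)))) (sym (ℤₚ.pos-* y ∣ b ∣))) (trans (ℤₚ.+-comm (- + (x ℕ.* ∣ a ∣)) _) (sym (pos e)))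

infixr 8 _↑_

opaque
  _↑_ : ℕ → ℕ → ℤ
  p ↑ k = (+ p) ^ k

  opaque
    ↑-0 : ∀ p → p ↑ 0 ≡ 1ℤ
    ↑-0 p = refl

  opaque
    ↑-suc : ∀ p k → p ↑ suc k ≡ + p * p ↑ k
    ↑-suc p k = refl

  opaque
    ↑-+ : ∀ p a b → p ↑ (a ℕ.+ b) ≡ p ↑ a * p ↑ b
    ↑-+ p a b = ℤₚ.^-distribˡ-+-* (+ p) a b

  opaque
    ↑-abs : ∀ p k → ∣ p ↑ k ∣ ≡ p ℕ.^ k
    ↑-abs p zero = refl
    ↑-abs p (suc k) = trans (ℤₚ.abs-* (+ p) ((+ p) ^ k)) (cong (p ℕ.*_) (↑-abs p k))

opaque
  ↑-1 : ∀ p → p ↑ 1 ≡ + p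
  ↑-1 p = trans (↑-suc p 0) (trans (cong (+ p *_) (↑-0 p)) (ℤₚ.*-identityʳ (+ p)))

opaque
  cop-↑ˡ : ∀ {p b} k → Cop (+ p) b → Cop (p ↑ k) b
  cop-↑ˡ {p} {b} zero c = subst (λ z → Cop z b) (sym (↑-0 p)) (cop-sym cop-1)
  cop-↑ˡ {p} {b} (suc k) c = subst (λ z → Cop z b) (sym (↑-suc p k)) (cop-*ˡ c (cop-↑ˡ k c))

opaque
  cop-↑ʳ : ∀ {p b} k → Cop b (+ p) → Cop b (p ↑ k)
  cop-↑ʳ k c = cop-sym (cop-↑ˡ k (cop-sym c))

opaque
  ↑-∣ : ∀ p {a b} → a ℕ.≤ b → p ↑ a ∣ p ↑ b
  ↑-∣ p {a} {b} l = divides (p ↑ (b ℕ.∸ a)) (trans (cong (p ↑_) (sym (ℕₚ.m∸n+n≡m l))) (↑-+ p (b ℕ.∸ a) a))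

opaque
  p∣↑ : ∀ p k → + p ∣ p ↑ suc k
  p∣↑ p k = divides (p ↑ k) (trans (↑-suc p k) (ℤₚ.*-comm (+ p) (p ↑ k)))

opaque
  0↑∣ : ∀ {p x} → p ↑ 0 ∣ x
  0↑∣ {p} {x} = subst (_∣ x) (sym (↑-0 p)) 1∣

module _ {p : ℕ} (pr : Prime p) where

  opaque
    prime-∤1 : ¬ + p ∣ 1ℤ
    prime-∤1 h with ℕ∣.∣1⇒≡1 (∣⇒∣ᵤ h)
    ... | refl = ℕ.nonTrivial⇒≢1 {{prime⇒nonTrivial pr}} refl

  opaque
    prime-cop : ∀ {x} → ¬ + p ∣ x → Cop (+ p) x
    prime-cop {x} ¬d with gcdℤ (+ p) x
    ... | g , g∣p , g∣x , s , t , e with prime⇒irreducible pr (∣⇒∣ᵤ g∣p)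
    ... | inj₂ q = ⊥-elim (¬d (∣ᵤ⇒∣ (subst (ℕ∣._∣ ∣ x ∣) q (∣⇒∣ᵤ g∣x))))
    ... | inj₁ q with g
    ...   | + m with q
    ...     | refl = s , t , e
    -- `gcdℤ` is opaque, so the divisor that it returns may be -1 here; the coefficients are then
    -- negated.
    prime-cop {x} ¬d | _ , _ , _ , s , t , e | inj₁ refl | -[1+ 0 ] = - s , - t , trans (eq s t (+ p) x) (cong -_ e)
      where
      eq : ∀ s t p x → - s * p + - t * x ≡ - (s * p + t * x)
      eq = solve-∀

  opaque
    cop-∤ : ∀ {x} → Cop (+ p) x → ¬ + p ∣ x
    cop-∤ (s , t , e) d = prime-∤1 (lin s t ∣-refl d (sym e))

  opaque
    prime-∣* : ∀ {x y} → + p ∣ x * y → ¬ + p ∣ x → + p ∣ y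
    prime-∣* d ¬d = cop-cancel (prime-cop ¬d) d

  instance
    prime-nonZero : NonZero (+ p)
    prime-nonZero = prime⇒nonZero pr

  opaque
    ∤-* : ∀ {x y} → ¬ + p ∣ x → ¬ + p ∣ y → ¬ + p ∣ x * y
    ∤-* a b c = b (prime-∣* c a)

  opaque
    cop-↑-∤ : ∀ {x} k → ¬ + p ∣ x → Cop (p ↑ k) x
    cop-↑-∤ k ¬d = cop-↑ˡ k (prime-cop ¬d)

  opaque
    ↑-nonZero : ∀ k → p ↑ k ≢ 0ℤ
    ↑-nonZero zero e with trans (sym (↑-0 p)) e
    ... | ()
    ↑-nonZero (suc k) e with ℤₚ.i*j≡0⇒i≡0∨j≡0 (+ p) (trans (sym (↑-suc p k)) e)
    ... | inj₁ q = ℕ.≢-nonZero⁻¹ p {{prime⇒nonZero pr}} (ℤₚ.+-injective q)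
    ... | inj₂ q = ↑-nonZero k q

  opaque
    cancel-↑ : ∀ k {x y} → p ↑ k * x ∣ p ↑ k * y → x ∣ y
    cancel-↑ k = *-cancelˡ-∣ (p ↑ k) {{≢-nonZero (↑-nonZero k)}}

opaque
  ∣-nonZero : ∀ {d n} → n ≢ 0ℤ → d ∣ n → d ≢ 0ℤ
  ∣-nonZero nz d refl = nz (0∣⇒≡0 d)

opaque
  -- The bound `b` makes this total: 0 has no valuation, and modulo `p ↑ b` no larger exponent can
  -- be told apart.
  valuation : ∀ {p} → Prime p → ∀ b x → (p ↑ b ∣ x) ⊎ ∃ λ w → ∃ λ x' → w ℕ.< b × (x ≡ p ↑ w * x') × ¬ + p ∣ x'
  valuation pr zero x = inj₁ 0↑∣
  valuation {p} pr (suc b) x with + p ∣? x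
  ... | no ¬d = inj₂ (0 , x , s≤s z≤n , sym (trans (cong (_* x) (↑-0 p)) (ℤₚ.*-identityˡ x)) , ¬d)
  ... | yes (divides q refl) with valuation pr b q
  ...   | inj₁ (divides r refl) = inj₁ (divides r (trans (eq r (p ↑ b) (+ p)) (cong (r *_) (sym (↑-suc p b)))))
    where
    eq : ∀ r a p → r * a * p ≡ r * (p * a)
    eq = solve-∀
  ...   | inj₂ (w , x' , l , refl , ¬d) = inj₂ (suc w , x' , s≤s l , trans (eq (p ↑ w) x' (+ p)) (cong (_* x') (sym (↑-suc p w))) , ¬d)
    where
    eq : ∀ a x p → a * x * p ≡ p * a * x
    eq = solve-∀

opaque
  ∣↑-≤ : ∀ {p} → Prime p → ∀ {w k x} → ¬ + p ∣ x → p ↑ k ∣ p ↑ w * x → k ℕ.≤ w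
  ∣↑-≤ {p} pr {w} {k} {x} ¬d h with k ℕ.≤? w
  ... | yes l = l
  ... | no ¬l = ⊥-elim (¬d (cancel-↑ pr w
         (∣-trans (subst (_∣ p ↑ k) (trans (↑-suc p w) (ℤₚ.*-comm (+ p) (p ↑ w))) (↑-∣ p (ℕₚ.≰⇒> ¬l))) h)))

opaque
  -- Because k < p^k for all k. The exponent `∣ n ∣` is a crude bound that makes the valuation of a
  -- nonzero `n` computable.
  ↑abs∤ : ∀ {p} → Prime p → ∀ {n} → n ≢ 0ℤ → ¬ (p ↑ ∣ n ∣ ∣ n)
  ↑abs∤ {p} pr {n} nz d = ℕₚ.<-irrefl refl (ℕₚ.<-≤-trans (lem ∣ n ∣) (ℕ∣.∣⇒≤ {{ℕ.≢-nonZero (nz ∘ ℤₚ.∣i∣≡0⇒i≡0)}} (subst (ℕ∣._∣ ∣ n ∣) (↑-abs p ∣ n ∣) (∣⇒∣ᵤ d))))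
    where
    lem : ∀ k → k ℕ.< p ℕ.^ k
    lem zero = s≤s z≤n
    lem (suc k) = ℕₚ.≤-trans (s≤s (lem k)) (ℕₚ.≤-trans (ℕₚ.+-monoˡ-≤ (p ℕ.^ k) (ℕₚ.≤-trans (s≤s z≤n) (lem k)))
      (ℕₚ.≤-trans (ℕₚ.≤-reflexive (cong (p ℕ.^ k ℕ.+_) (sym (ℕₚ.+-identityʳ (p ℕ.^ k)))))
        (ℕₚ.*-monoˡ-≤ (p ℕ.^ k) (ℕ.nonTrivial⇒n>1 p {{prime⇒nonTrivial pr}}))))

opaque
  prime-split : ∀ {p} → Prime p → ∀ {n} → n ≢ 0ℤ → ∃ λ b → ∃ λ s → (n ≡ p ↑ b * s) × ¬ + p ∣ s
  prime-split pr {n} nz with valuation pr ∣ n ∣ n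
  ... | inj₁ d = ⊥-elim (↑abs∤ pr nz d)
  ... | inj₂ (w , x' , _ , e , ¬d) = w , x' , e , ¬d

-- Local-to-global principles

opaque
  exists-prime : ∀ n → ∣ n ∣ ≢ 1 → n ≢ 0ℤ → ∃ λ p → Prime p × + p ∣ n
  exists-prime n n≢1 nz with ∣ n ∣ in eq
  ... | 0 = ⊥-elim (nz (ℤₚ.∣i∣≡0⇒i≡0 eq))
  ... | 1 = ⊥-elim (n≢1 refl)
  ... | m@(suc (suc _)) with factorise m
  ...   | record { factors = [] ; isFactorisation = e } = ⊥-elim (n≢1 e)
  ...   | record { factors = p ∷ ps ; isFactorisation = e ; factorsPrime = pr ∷ _ } =
    p , pr , ∣ᵤ⇒∣ (subst (p ℕ∣.∣_) (sym (trans eq e)) (ℕ∣.m∣m*n (product ps)))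

opaque
  abs-<-split : ∀ {p} → Prime p → ∀ b s {n} → n ≢ 0ℤ → n ≡ p ↑ suc b * s → ∣ s ∣ ℕ.< ∣ n ∣
  abs-<-split {p} pr b s {n} nz e = ℕₚ.<-≤-trans lt (ℕ∣.∣⇒≤ {{ℕ.≢-nonZero (nz ∘ ℤₚ.∣i∣≡0⇒i≡0)}} (∣⇒∣ᵤ d))
    where
    d : + p * s ∣ n
    d = divides (p ↑ b) (trans e (trans (cong (_* s) (↑-suc p b)) (eq (+ p) (p ↑ b) s)))
      where
      eq : ∀ p a s → p * a * s ≡ a * (p * s)
      eq = solve-∀
    s≢0 : ∣ s ∣ ≢ 0
    s≢0 q = nz (trans e (trans (cong (p ↑ suc b *_) (ℤₚ.∣i∣≡0⇒i≡0 q)) (ℤₚ.*-zeroʳ (p ↑ suc b))))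
    lt : ∣ s ∣ ℕ.< ∣ + p * s ∣
    lt = subst (∣ s ∣ ℕ.<_) (sym (ℤₚ.abs-* (+ p) s))
      (ℕₚ.<-≤-trans (ℕₚ.m<m*n ∣ s ∣ p {{ℕ.≢-nonZero s≢0}} (ℕ.nonTrivial⇒n>1 p {{prime⇒nonTrivial pr}})) (ℕₚ.≤-reflexive (ℕₚ.*-comm ∣ s ∣ p)))

opaque
  prime-power-ind : (Q : ℤ → Set) → (∀ n → ∣ n ∣ ≡ 1 → Q n) →
    (∀ p b s → Prime p → ¬ + p ∣ s → p ↑ suc b * s ≢ 0ℤ → Q s → Q (p ↑ suc b * s)) → ∀ n → n ≢ 0ℤ → Q n
  prime-power-ind Q base step n nz = go n nz (ℕI.<-wellFounded ∣ n ∣)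
    where
    go : ∀ n → n ≢ 0ℤ → Acc ℕ._<_ ∣ n ∣ → Q n
    go n nz (acc rs) with ∣ n ∣ ℕ.≟ 1
    ... | yes e = base n e
    ... | no ne with exists-prime n ne nz
    ...   | p , pr , d with prime-split pr nz
    ...     | zero , s , e , ¬d = ⊥-elim (¬d (subst (+ p ∣_) (trans e (trans (cong (_* s) (↑-0 p)) (ℤₚ.*-identityˡ s))) d))
    ...     | suc b , s , refl , ¬d = step p b s pr ¬d nz
      (go s (λ q → nz (trans (cong (p ↑ suc b *_) q) (ℤₚ.*-zeroʳ (p ↑ suc b)))) (rs (abs-<-split pr b s nz refl)))

opaque
  other-prime-power : ∀ {p q} → Prime p → Prime q → q ≢ p → ∀ b k s → q ↑ k ∣ p ↑ b * s → q ↑ k ∣ s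
  other-prime-power {p} {q} pr qr ne b k s d = cop-cancel (cop-↑ˡ k (cop-↑ʳ b (prime-cop qr q∤p))) d
    where
    q∤p : ¬ + q ∣ + p
    q∤p h with prime⇒irreducible pr (∣⇒∣ᵤ h)
    ... | inj₁ refl = ℕ.nonTrivial⇒≢1 {{prime⇒nonTrivial qr}} refl
    ... | inj₂ e = ne e

opaque
  same-prime-power : ∀ {p} → Prime p → ∀ b k s → ¬ + p ∣ s → p ↑ k ∣ p ↑ b * s → p ↑ k ∣ p ↑ b
  same-prime-power {p} pr b k s ¬d d = ↑-∣ p (∣↑-≤ pr ¬d d)

PrimePowers : ℤ → (ℕ → ℤ → Set) → Set
PrimePowers n Q = ∀ p → Prime p → ∀ k → p ↑ k ∣ n → Q p (p ↑ k)

opaque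
  abs1-∣ : ∀ {n x} → ∣ n ∣ ≡ 1 → n ∣ x
  abs1-∣ {n} {x} e = ∣ᵤ⇒∣ (subst (ℕ∣._∣ ∣ x ∣) (sym e) (ℕ∣.1∣ ∣ x ∣))

opaque
  local-∣ : ∀ n → n ≢ 0ℤ → ∀ {x} → PrimePowers n (λ _ m → m ∣ x) → n ∣ x
  local-∣ = prime-power-ind (λ n → ∀ {x} → PrimePowers n (λ _ m → m ∣ x) → n ∣ x) (λ n e h → abs1-∣ e) step
    where
    step : ∀ p b s → Prime p → ¬ + p ∣ s → p ↑ suc b * s ≢ 0ℤ → (∀ {x} → PrimePowers s (λ _ m → m ∣ x) → s ∣ x) →
           ∀ {x} → PrimePowers (p ↑ suc b * s) (λ _ m → m ∣ x) → p ↑ suc b * s ∣ x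
    step p b s pr ¬d _ ih h = cop-∣-* (cop-↑-∤ pr (suc b) ¬d) (h p pr (suc b) (∣m⇒∣m*n s ∣-refl))
      (ih (λ q qr k d → h q qr k (∣n⇒∣m*n (p ↑ suc b) d)))

opaque
  -- One residue `r p` serves all powers of `p` at once, so the factorisation of `n` never has to be
  -- named.
  CRT : ∀ n → n ≢ 0ℤ → (r : ℕ → ℤ) → ∃ λ z → PrimePowers n (λ p m → z ≋ r p [ m ])
  CRT n nz r = prime-power-ind (λ n → ∃ λ z → PrimePowers n (λ p m → z ≋ r p [ m ])) base step n nz
    where
    base : ∀ n → ∣ n ∣ ≡ 1 → ∃ λ z → PrimePowers n (λ p m → z ≋ r p [ m ])
    base n e = 0ℤ , λ p pr k d → ≋⟨ ∣-trans d (abs1-∣ e) ⟩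
    step : ∀ p b s → Prime p → ¬ + p ∣ s → p ↑ suc b * s ≢ 0ℤ → (∃ λ z → PrimePowers s (λ p m → z ≋ r p [ m ])) →
           ∃ λ z → PrimePowers (p ↑ suc b * s) (λ p m → z ≋ r p [ m ])
    step p b s pr ¬d _ (z , h) with CRT₂ (cop-↑-∤ pr (suc b) ¬d) (r p) z
    ... | w , w₁ , w₂ = w , go
      where
      go : PrimePowers (p ↑ suc b * s) (λ p m → w ≋ r p [ m ])
      go q qr k d with q ℕ.≟ p
      ... | yes refl = ≋-weaken (same-prime-power pr (suc b) k s ¬d d) w₁
      ... | no ne = let d' = other-prime-power pr qr ne (suc b) k s d in
        ≋-trans (≋-weaken d' w₂) (h q qr k d')

opaque
  local-cop : ∀ n → n ≢ 0ℤ → ∀ {u} → (∀ p → Prime p → + p ∣ n → ¬ + p ∣ u) → Cop n u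
  local-cop = prime-power-ind (λ n → ∀ {u} → (∀ p → Prime p → + p ∣ n → ¬ + p ∣ u) → Cop n u) base step
    where
    base : ∀ n → ∣ n ∣ ≡ 1 → ∀ {u} → (∀ p → Prime p → + p ∣ n → ¬ + p ∣ u) → Cop n u
    base n e {u} _ = cop-sym (cop-∣ʳ (abs1-∣ {x = 1ℤ} e) cop-1)
    step : ∀ p b s → Prime p → ¬ + p ∣ s → p ↑ suc b * s ≢ 0ℤ → (∀ {u} → (∀ p → Prime p → + p ∣ s → ¬ + p ∣ u) → Cop s u) →
           ∀ {u} → (∀ q → Prime q → + q ∣ p ↑ suc b * s → ¬ + q ∣ u) → Cop (p ↑ suc b * s) u
    step p b s pr ¬d _ ih h = cop-*ˡ (cop-↑-∤ pr (suc b) (h p pr (∣m⇒∣m*n s (p∣↑ p b))))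
      (ih (λ q qr d → h q qr (∣n⇒∣m*n (p ↑ suc b) d)))

opaque
  inverse-mod : ∀ {p} → Prime p → ∀ b {x} → ¬ + p ∣ x → ∃ λ y → (x * y ≋ 1ℤ [ p ↑ b ]) × ¬ + p ∣ y
  inverse-mod {p} pr b {x} ¬d with cop-inv (cop-↑-∤ pr (suc b) ¬d)
  ... | y , h = y , ≋-weaken (↑-∣ p (ℕₚ.n≤1+n b)) h ,
    λ d → prime-∤1 pr (∣-≋ (≋-weaken (p∣↑ p b) h) (∣n⇒∣m*n x d))

opaque
  quotient-mod : ∀ {p} → Prime p → ∀ b {x y} → ¬ + p ∣ x → ¬ + p ∣ y →
    ∃ λ t → (t * x ≋ y [ p ↑ b ]) × ¬ + p ∣ t
  quotient-mod pr b {x} {y} ¬x ¬y with inverse-mod pr b ¬x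
  ... | z , h , ¬z = y * z , ≋-trans (≋-reflexive (eq x y z)) (≋-trans (≋-*ˡ y h) (≋-reflexive (ℤₚ.*-identityʳ y))) , ∤-* pr ¬y ¬z
    where
    eq : ∀ x y z → y * z * x ≡ y * (x * z)
    eq = solve-∀

opaque
  -- The quotient y/x modulo the full power of `p` in `n` is glued with 1 modulo the rest of `n`; so
  -- `u` is a unit for all of `n`, although only `p ↑ b * s` is of interest. If `x` and `y` agree
  -- modulo `p ↑ c`, cancelling `x` shows that `u` is 1 there.
  unit-taking : ∀ {p} → Prime p → ∀ {n} → n ≢ 0ℤ → ∀ b s → p ↑ b * s ∣ n → ¬ + p ∣ s → ∀ c x y →
    ¬ + p ∣ x → ¬ + p ∣ y → x ≋ y [ p ↑ c ] → c ℕ.≤ b →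
    ∃ λ u → Cop n u × (u ≋ 1ℤ [ s ]) × (u ≋ 1ℤ [ p ↑ c ]) × (u * x ≋ y [ p ↑ b ])
  unit-taking {p} pr {n} nz b s d ¬ps c x y ¬x ¬y x≋y c≤b with prime-split pr nz
  ... | b' , s' , refl , ¬s' with quotient-mod pr b' ¬x ¬y
  ...   | t , tx , ¬t with CRT₂ (cop-↑-∤ pr b' ¬s') t 1ℤ
  ...     | u , u₁ , u₂ = u , cop , ≋-weaken s∣s' u₂ , u≋1 , ≋-weaken b∣b' ux
    where
    b≤b' : b ℕ.≤ b'
    b≤b' = ∣↑-≤ pr ¬s' (∣-trans (∣m⇒∣m*n s ∣-refl) d)
    b∣b' : p ↑ b ∣ p ↑ b'
    b∣b' = ↑-∣ p b≤b'
    s∣s' : s ∣ s'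
    s∣s' = cop-cancel (cop-sym (cop-↑-∤ pr b' ¬ps)) (∣-trans (∣n⇒∣m*n (p ↑ b) ∣-refl) d)
    ux : u * x ≋ y [ p ↑ b' ]
    ux = ≋-trans (≋-*ʳ x u₁) tx
    u≋1 : u ≋ 1ℤ [ p ↑ c ]
    u≋1 = ≋⟨ cop-cancel (cop-↑-∤ pr c ¬x) (subst (p ↑ c ∣_) (eq u x)
        (≋⇒∣ (≋-trans (≋-weaken (∣-trans (↑-∣ p c≤b) b∣b') ux) (≋-sym x≋y)))) ⟩
      where
      eq : ∀ u x → u * x - x ≡ x * (u - 1ℤ)
      eq = solve-∀
    cop : Cop (p ↑ b' * s') u
    cop = cop-*ˡ (cop-sym (cop-≋' )) (cop-≋ (≋-sym u₂) cop-1)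
      where
      cop-≋' : Cop u (p ↑ b')
      cop-≋' = cop-sym (cop-≋ (≋-sym u₁) (cop-↑-∤ pr b' ¬t))

-- Lifting the exponent

geom : ℤ → ℕ → ℤ
geom t zero = 0ℤ
geom t (suc k) = geom t k + t ^ k

opaque
  geom-eq : ∀ t k → (t - 1ℤ) * geom t k ≡ t ^ k - 1ℤ
  geom-eq t zero = ℤₚ.*-zeroʳ (t - 1ℤ)
  geom-eq t (suc k) = trans (ℤₚ.*-distribˡ-+ (t - 1ℤ) (geom t k) (t ^ k))
    (trans (cong (_+ (t - 1ℤ) * t ^ k) (geom-eq t k)) (eq t (t ^ k)))
    where
    eq : ∀ t a → a - 1ℤ + (t - 1ℤ) * a ≡ t * a - 1ℤ
    eq = solve-∀

opaque
  pow-step : ∀ m t → m ∣ t - 1ℤ → ∀ k → t ^ k ≋ 1ℤ + + k * (t - 1ℤ) [ m * m ]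
  pow-step m t d zero = ≋-reflexive (sym (trans (cong (λ z → 1ℤ + z) (ℤₚ.*-zeroˡ (t - 1ℤ))) refl))
  pow-step m t d@(divides q e) (suc k) = ≋-trans (≋-*ˡ t (pow-step m t d k))
    ≋⟨ divides (+ k * q * q) (trans (cong (λ z → t * (1ℤ + + k * (t - 1ℤ)) - (1ℤ + z * (t - 1ℤ))) (ℤₚ.pos-+ 1 k))
       (trans (eq₁ t (+ k)) (trans (cong (λ z → + k * (z * z)) e) (eq₂ (+ k) q m)))) ⟩
    where
    eq₁ : ∀ t k → t * (1ℤ + k * (t - 1ℤ)) - (1ℤ + (1ℤ + k) * (t - 1ℤ)) ≡ k * ((t - 1ℤ) * (t - 1ℤ))
    eq₁ = solve-∀
    eq₂ : ∀ k q m → k * (q * m * (q * m)) ≡ k * q * q * (m * m)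
    eq₂ = solve-∀

tri : ℕ → ℤ
tri zero = 0ℤ
tri (suc k) = tri k + + k

opaque
  tri-eq : ∀ k → + 2 * tri k ≡ + k * (+ k - 1ℤ)
  tri-eq zero = refl
  tri-eq (suc k) = trans (ℤₚ.*-distribˡ-+ (+ 2) (tri k) (+ k)) (trans (cong (_+ + 2 * + k) (tri-eq k))
    (trans (eq (+ k)) (cong (λ z → z * (z - 1ℤ)) (sym (ℤₚ.pos-+ 1 k)))))
    where
    eq : ∀ k → k * (k - 1ℤ) + + 2 * k ≡ (1ℤ + k) * (1ℤ + k - 1ℤ)
    eq = solve-∀

opaque
  geom-mod : ∀ m t → m ∣ t - 1ℤ → ∀ k → geom t k ≋ + k + tri k * (t - 1ℤ) [ m * m ]
  geom-mod m t d zero = ≋-reflexive (sym (cong (λ z → 0ℤ + z) (ℤₚ.*-zeroˡ (t - 1ℤ))))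
  geom-mod m t d (suc k) = ≋-trans (≋-+ (geom-mod m t d k) (pow-step m t d k))
    (≋-reflexive (trans (eq (+ k) (tri k) (t - 1ℤ)) (cong (_+ (tri k + + k) * (t - 1ℤ)) (sym (ℤₚ.pos-+ 1 k)))))
    where
    eq : ∀ k r z → k + r * z + (1ℤ + k * z) ≡ 1ℤ + k + (r + k) * z
    eq = solve-∀

opaque
  -- For odd `p` the sum is p + p(p-1)/2 (t-1) modulo p², and p² divides the second term. For p = 2
  -- it is 2 + (t-1), which is twice an odd number as soon as t is 1 modulo 4.
  geom-unit : ∀ {p} → Prime p → ∀ t → + p ∣ t - 1ℤ → (p ≡ 2 → + 4 ∣ t - 1ℤ) →
    ∃ λ w → (geom t p ≡ + p * w) × ¬ + p ∣ w
  geom-unit {p} pr t d d4 with p ℕ.≟ 2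
  ... | yes refl with d4 refl
  ...   | divides q e = 1ℤ + + 2 * q , trans (eq t) (trans (cong (λ z → + 2 + z) e) (eq₁ q)) ,
          λ h → prime-∤1 pr (lin 1ℤ (- q) h (∣-refl {+ 2}) (eq₂ q))
    where
    eq : ∀ t → 0ℤ + 1ℤ + t * 1ℤ ≡ + 2 + (t - 1ℤ)
    eq = solve-∀
    eq₁ : ∀ q → + 2 + q * + 4 ≡ + 2 * (1ℤ + + 2 * q)
    eq₁ = solve-∀
    eq₂ : ∀ q → 1ℤ ≡ 1ℤ * (1ℤ + + 2 * q) + - q * + 2
    eq₂ = solve-∀
  geom-unit {p} pr t d@(divides q e) d4 | no p≢2 with geom-mod (+ p) t d p | p∣tri
    where
    p∣tri : + p ∣ tri p
    p∣tri = cop-cancel {+ p} {+ 2} {tri p} (prime-cop pr (λ h → p≢2 (2-case (prime⇒irreducible prime[2] (∣⇒∣ᵤ h)))))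
      (subst (+ p ∣_) (sym (tri-eq p)) (∣m⇒∣m*n (+ p - 1ℤ) ∣-refl))
      where
      2-case : (p ≡ 1) ⊎ (p ≡ 2) → p ≡ 2
      2-case (inj₁ refl) = ⊥-elim (ℕ.nonTrivial⇒≢1 {{prime⇒nonTrivial pr}} refl)
      2-case (inj₂ x) = x
  ... | ≋⟨ divides r h ⟩ | divides v f = 1ℤ + + p * (r + v * q) ,
    trans (eq₀ (geom t p) (+ p + tri p * (t - 1ℤ))) (trans (cong₂ (λ x y → x + (+ p + y)) h (cong₂ _*_ f e)) (eq₁ r v q (+ p))) ,
    λ k → prime-∤1 pr (lin 1ℤ (- (r + v * q)) k (∣-refl {+ p}) (eq₂ (r + v * q) (+ p)))
    where
    eq₀ : ∀ a b → a ≡ (a - b) + b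
    eq₀ = solve-∀
    eq₁ : ∀ r v q p → r * (p * p) + (p + v * p * (q * p)) ≡ p * (1ℤ + p * (r + v * q))
    eq₁ = solve-∀
    eq₂ : ∀ z p → 1ℤ ≡ 1ℤ * (1ℤ + p * z) + - z * p
    eq₂ = solve-∀

opaque
  lift-exponent : ∀ {p} → Prime p → ∀ t s w → t - 1ℤ ≡ p ↑ suc s * w → ¬ + p ∣ w → (p ≡ 2 → + 4 ∣ t - 1ℤ) →
    ∃ λ w' → (t ^ p - 1ℤ ≡ p ↑ suc (suc s) * w') × ¬ + p ∣ w'
  lift-exponent {p} pr t s w e ¬w d4 with geom-unit pr t (subst (+ p ∣_) (sym e) (∣m⇒∣m*n w (p∣↑ p s))) d4
  ... | v , g , ¬v = w * v , trans (sym (geom-eq t p)) (trans (cong₂ _*_ (trans e (cong (_* w) (↑-suc p s))) g) (trans (eq (+ p) (p ↑ s) w v) (cong (_* (w * v)) (sym (trans (↑-suc p (suc s)) (cong (+ p *_) (↑-suc p s))))))) , ∤-* pr ¬w ¬v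
    where
    eq : ∀ p a w v → p * a * w * (p * v) ≡ p * (p * a) * (w * v)
    eq = solve-∀

-- Sums over residues

ind : ∀ {A : Set} → Dec A → ℕ
ind (yes _) = 1
ind (no _) = 0

ind-yes : ∀ {A : Set} (d : Dec A) → A → ind d ≡ 1
ind-yes (yes _) a = refl
ind-yes (no ¬a) a = ⊥-elim (¬a a)

ind-no : ∀ {A : Set} (d : Dec A) → ¬ A → ind d ≡ 0
ind-no (yes a) ¬a = ⊥-elim (¬a a)
ind-no (no _) _ = refl

ind-⇔ : ∀ {A B : Set} (d : Dec A) (d' : Dec B) → (A → B) → (B → A) → ind d ≡ ind d'
ind-⇔ (yes a) d' f g = sym (ind-yes d' (f a))
ind-⇔ (no ¬a) d' f g = sym (ind-no d' (¬a ∘ g))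

ind-pos : ∀ {A : Set} (d : Dec A) → ind d ≢ 0 → A
ind-pos (yes a) _ = a
ind-pos (no _) h = ⊥-elim (h refl)

ind-≤1 : ∀ {A : Set} (d : Dec A) → ind d ℕ.≤ 1
ind-≤1 (yes _) = s≤s z≤n
ind-≤1 (no _) = z≤n

infix 4 _≋?_[_]

_≋?_[_] : ∀ x y m → Dec (x ≋ y [ m ])
x ≋? y [ m ] = map′ ≋⟨_⟩ ≋⇒∣ (m ∣? (x - y))

opaque
  S : ℕ → (ℤ → ℕ) → ℕ
  S zero F = 0
  S (suc k) F = S k F ℕ.+ F (+ k)

  S-cong : ∀ k {F G : ℤ → ℕ} → (∀ x → F x ≡ G x) → S k F ≡ S k G
  S-cong zero h = refl
  S-cong (suc k) h = cong₂ ℕ._+_ (S-cong k h) (h (+ k))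

  S-≤ : ∀ k {F G : ℤ → ℕ} → (∀ x → F x ℕ.≤ G x) → S k F ℕ.≤ S k G
  S-≤ zero h = z≤n
  S-≤ (suc k) h = ℕₚ.+-mono-≤ (S-≤ k h) (h (+ k))

  S-+ : ∀ k F G → S k (λ x → F x ℕ.+ G x) ≡ S k F ℕ.+ S k G
  S-+ zero F G = refl
  S-+ (suc k) F G = trans (cong (ℕ._+ (F (+ k) ℕ.+ G (+ k))) (S-+ k F G)) (eq (S k F) (S k G) (F (+ k)) (G (+ k)))
    where
    eq : ∀ a b c d → a ℕ.+ b ℕ.+ (c ℕ.+ d) ≡ a ℕ.+ c ℕ.+ (b ℕ.+ d)
    eq = ℕRing.solve-∀

  S-*ˡ : ∀ k c F → S k (λ x → c ℕ.* F x) ≡ c ℕ.* S k F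
  S-*ˡ zero c F = sym (ℕₚ.*-zeroʳ c)
  S-*ˡ (suc k) c F = trans (cong (ℕ._+ c ℕ.* F (+ k)) (S-*ˡ k c F)) (sym (ℕₚ.*-distribˡ-+ c (S k F) (F (+ k))))

  S-const : ∀ k c → S k (λ _ → c) ≡ k ℕ.* c
  S-const zero c = refl
  S-const (suc k) c = trans (cong (ℕ._+ c) (S-const k c)) (ℕₚ.+-comm (k ℕ.* c) c)

  S-swap : ∀ k l (F : ℤ → ℤ → ℕ) → S k (λ x → S l (F x)) ≡ S l (λ y → S k (λ x → F x y))
  S-swap zero l F = sym (trans (S-const l 0) (ℕₚ.*-zeroʳ l))
  S-swap (suc k) l F = trans (cong (ℕ._+ S l (F (+ k))) (S-swap k l F)) (sym (S-+ l _ _))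

  S-nonzero : ∀ k F → S k F ≢ 0 → ∃ λ x → F x ≢ 0
  S-nonzero zero F h = ⊥-elim (h refl)
  S-nonzero (suc k) F h with F (+ k) ℕ.≟ 0
  ... | no h' = + k , h'
  ... | yes e = S-nonzero k F (λ e' → h (cong₂ ℕ._+_ e' e))

  S-below : ∀ k F r → r ℕ.< k → (∀ i → i ℕ.< k → i ≢ r → F (+ i) ≡ 0) → S k F ≡ F (+ r)
  S-below (suc k) F r l h with r ℕ.≟ k
  ... | yes refl = cong (ℕ._+ F (+ k)) (zeros k ℕₚ.≤-refl)
    where
    zeros : ∀ j → j ℕ.≤ k → S j F ≡ 0
    zeros zero _ = refl
    zeros (suc j) l = cong₂ ℕ._+_ (zeros j (ℕₚ.≤-trans (ℕₚ.n≤1+n j) l)) (h j (ℕₚ.≤-trans l (ℕₚ.n≤1+n k)) (ℕₚ.<⇒≢ l))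
  ... | no ne = trans (cong₂ ℕ._+_ (S-below k F r (ℕₚ.≤∧≢⇒< (ℕₚ.≤-pred l) ne) (λ i l' → h i (ℕₚ.≤-trans l' (ℕₚ.n≤1+n k)))) (h k ℕₚ.≤-refl (ne ∘ sym)))
    (ℕₚ.+-identityʳ _)

  S-split : ∀ k l F → S (k ℕ.+ l) F ≡ S k F ℕ.+ S l (λ x → F (+ k + x))
  S-split k zero F = trans (cong (λ z → S z F) (ℕₚ.+-identityʳ k)) (sym (ℕₚ.+-identityʳ (S k F)))
  S-split k (suc l) F = trans (cong (λ z → S z F) (ℕₚ.+-suc k l))
    (trans (cong₂ ℕ._+_ (S-split k l F) (cong F (ℤₚ.pos-+ k l))) (ℕₚ.+-assoc (S k F) _ _))

  S-0 : ∀ F → S 0 F ≡ 0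
  S-0 F = refl

  S-1 : ∀ F → S 1 F ≡ F 0ℤ
  S-1 F = refl

S-*ʳ : ∀ k c F → S k (λ x → F x ℕ.* c) ≡ S k F ℕ.* c
S-*ʳ k c F = trans (S-cong k (λ x → ℕₚ.*-comm (F x) c)) (trans (S-*ˡ k c F) (ℕₚ.*-comm c (S k F)))

Per : ℕ → (ℤ → ℕ) → Set
Per N F = ∀ x y → x ≋ y [ + N ] → F x ≡ F y

module _ (N : ℕ) .{{nz : ℕ.NonZero N}} where

  residue : ∀ g → ∃ λ r → r ℕ.< N × (+ r ≋ g [ + N ])
  residue g = g %ℕ N , n%ℕd<d g N , ≋-sym ≋⟨ divides (g /ℕ N) (trans (cong (_- + (g %ℕ N)) (a≡a%ℕn+[a/ℕn]*n g N)) (eq (+ (g %ℕ N)) (g /ℕ N * + N))) ⟩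
    where
    eq : ∀ a b → a + b - a ≡ b
    eq = solve-∀

  opaque
    residue-unique-≤ : ∀ {i r} → r ℕ.< N → i ℕ.≤ r → + i ≋ + r [ + N ] → i ≡ r
    residue-unique-≤ {i} {r} lr l h with r ℕ.∸ i in eq
    ... | zero = ℕₚ.≤-antisym l (ℕₚ.m∸n≡0⇒m≤n eq)
    ... | suc k = ⊥-elim (ℕₚ.<-irrefl refl (ℕₚ.≤-<-trans (ℕ∣.∣⇒≤ (subst (N ℕ∣.∣_) eq N∣r∸i)) (ℕₚ.≤-<-trans (ℕₚ.≤-trans (ℕₚ.≤-reflexive (sym eq)) (ℕₚ.m∸n≤m r i)) lr)))
      where
      N∣r∸i : N ℕ∣.∣ r ℕ.∸ i
      N∣r∸i = ∣⇒∣ᵤ (subst (+ N ∣_) (trans (ℤₚ.m-n≡m⊖n r i) (ℤₚ.⊖-≥ l)) (≋⇒∣ (≋-sym h)))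

    residue-unique : ∀ {i r} → i ℕ.< N → r ℕ.< N → + i ≋ + r [ + N ] → i ≡ r
    residue-unique {i} {r} li lr h with ℕₚ.≤-total i r
    ... | inj₁ l = residue-unique-≤ lr l h
    ... | inj₂ l = sym (residue-unique-≤ li l (≋-sym h))

  opaque
    S-δ : ∀ {F} → Per N F → ∀ g → S N (λ x → ind (x ≋? g [ + N ]) ℕ.* F x) ≡ F g
    S-δ {F} per g with residue g
    ... | r , l , h = trans (S-below N _ r l (λ i li ne → cong (ℕ._* F (+ i)) (ind-no (+ i ≋? g [ + N ]) (λ q → ne (residue-unique li l (≋-trans q (≋-sym h)))))))
      (trans (cong (ℕ._* F (+ r)) (ind-yes (+ r ≋? g [ + N ]) h)) (trans (ℕₚ.+-identityʳ (F (+ r))) (per _ _ h)))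

  S-δ1 : ∀ g → S N (λ x → ind (x ≋? g [ + N ])) ≡ 1
  S-δ1 g = trans (S-cong N (λ x → sym (ℕₚ.*-identityʳ _))) (S-δ {λ _ → 1} (λ _ _ _ → refl) g)

  opaque
    -- Each value `F (σ x)` is expanded as a sum over delta functions and the double sum is swapped;
    -- `τ` then identifies the only `x` hitting a given `y`. No permutation of the range 0, ..., N-1
    -- has to be built.
    S-perm : ∀ {F} → Per N F → (σ τ : ℤ → ℤ) → (∀ {x y} → x ≋ y [ + N ] → σ x ≋ σ y [ + N ]) → (∀ {x y} → x ≋ y [ + N ] → τ x ≋ τ y [ + N ]) →
      (∀ x → σ (τ x) ≋ x [ + N ]) → (∀ x → τ (σ x) ≋ x [ + N ]) → S N (F ∘ σ) ≡ S N F
    S-perm {F} per σ τ σc τc στ τσ = begin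
      S N (F ∘ σ) ≡⟨ S-cong N (λ x → sym (S-δ per (σ x))) ⟩
      S N (λ x → S N (λ y → ind (y ≋? σ x [ + N ]) ℕ.* F y)) ≡⟨ S-swap N N _ ⟩
      S N (λ y → S N (λ x → ind (y ≋? σ x [ + N ]) ℕ.* F y)) ≡⟨ S-cong N (λ y → S-*ʳ N (F y) (λ x → ind (y ≋? σ x [ + N ]))) ⟩
      S N (λ y → S N (λ x → ind (y ≋? σ x [ + N ])) ℕ.* F y) ≡⟨ S-cong N (λ y → cong (ℕ._* F y) (trans (S-cong N (λ x → ind-⇔ (y ≋? σ x [ + N ]) (x ≋? τ y [ + N ]) (λ p → ≋-trans (≋-sym (τσ x)) (≋-sym (τc p))) (λ p → ≋-trans (≋-sym (στ y)) (≋-sym (σc p))))) (S-δ1 (τ y)))) ⟩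
      S N (λ y → 1 ℕ.* F y) ≡⟨ S-cong N (λ y → ℕₚ.*-identityˡ (F y)) ⟩
      S N F ∎
      where open ≡-Reasoning

  S-shift : ∀ {F} → Per N F → ∀ t → S N (λ x → F (t + x)) ≡ S N F
  S-shift per t = S-perm per (λ x → t + x) (λ x → - t + x) (≋-+ˡ t) (≋-+ˡ (- t)) (λ x → ≋-reflexive (e₁ t x)) (λ x → ≋-reflexive (e₂ t x))
    where
    e₁ : ∀ t x → t + (- t + x) ≡ x
    e₁ = solve-∀
    e₂ : ∀ t x → - t + (t + x) ≡ x
    e₂ = solve-∀

  S-neg : ∀ {F} → Per N F → S N (λ x → F (- x)) ≡ S N F
  S-neg per = S-perm per -_ -_ ≋-neg ≋-neg (λ x → ≋-reflexive (ℤₚ.neg-involutive x)) (λ x → ≋-reflexive (ℤₚ.neg-involutive x))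

  S-reflect : ∀ {F} → Per N F → ∀ g → S N (λ x → F (g - x)) ≡ S N F
  S-reflect {F} per g = trans (S-neg {λ x → F (g + x)} (λ x y p → per _ _ (≋-+ˡ g p))) (S-shift per g)

  S-unit : ∀ {F} → Per N F → ∀ u v → u * v ≋ 1ℤ [ + N ] → S N (λ x → F (u * x)) ≡ S N F
  S-unit per u v h = S-perm per (u *_) (v *_) (≋-*ˡ u) (≋-*ˡ v)
    (λ x → ≋-trans (≋-reflexive (sym (ℤₚ.*-assoc u v x))) (≋-trans (≋-*ʳ x h) (≋-reflexive (ℤₚ.*-identityˡ x))))
    (λ x → ≋-trans (≋-reflexive (trans (sym (ℤₚ.*-assoc v u x)) (cong (_* x) (ℤₚ.*-comm v u)))) (≋-trans (≋-*ʳ x h) (≋-reflexive (ℤₚ.*-identityˡ x))))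

  opaque
    S-term≤ : ∀ {F} → Per N F → ∀ g → F g ℕ.≤ S N F
    S-term≤ {F} per g = subst (ℕ._≤ S N F) (S-δ per g) (S-≤ N (λ x → ℕₚ.≤-trans (ℕₚ.*-monoˡ-≤ (F x) (ind-≤1 (x ≋? g [ + N ]))) (ℕₚ.≤-reflexive (ℕₚ.+-identityʳ (F x)))))

    S-multiple : ∀ {F} → Per N F → ∀ k → S (k ℕ.* N) F ≡ k ℕ.* S N F
    S-multiple {F} per zero = S-0 F
    S-multiple {F} per (suc k) = trans (S-split N (k ℕ.* N) F) (cong (S N F ℕ.+_)
      (trans (S-cong (k ℕ.* N) (λ x → per _ _ (≋-trans (≋-reflexive (trans (ℤₚ.+-comm (+ N) x) (cong (λ z → x + z) (sym (ℤₚ.*-identityˡ (+ N)))))) (≋-shift x 1ℤ)))) (S-multiple per k)))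

-- The Frobenius congruence in a commutative semiring

opaque
  prime-∤! : ∀ {p} → Prime p → ∀ k → k ℕ.< p → ¬ p ℕ∣.∣ k !
  prime-∤! pr zero l d with ℕ∣.∣1⇒≡1 d
  ... | refl = ℕ.nonTrivial⇒≢1 {{prime⇒nonTrivial pr}} refl
  prime-∤! pr (suc k) l d with euclidsLemma (suc k) (k !) pr d
  ... | inj₁ h = ℕₚ.<-irrefl refl (ℕₚ.<-≤-trans l (ℕ∣.∣⇒≤ h))
  ... | inj₂ h = prime-∤! pr k (ℕₚ.<-trans (ℕₚ.n<1+n k) l) h

  prime-∣C : ∀ {p} → Prime p → ∀ k → 0 ℕ.< k → k ℕ.< p → p ℕ∣.∣ p C k
  prime-∣C {suc p} pr (suc k) _ l with euclidsLemma (suc p C suc k) (suc k ! ℕ.* (suc p ℕ.∸ suc k) !) pr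
      (subst (suc p ℕ∣.∣_) (sym fact) (ℕ∣.m∣m*n (p !)))
    where
    instance
      nz : ℕ.NonZero (suc k ! ℕ.* (suc p ℕ.∸ suc k) !)
      nz = suc k !* (suc p ℕ.∸ suc k) !≢0
    fact : (suc p C suc k) ℕ.* (suc k ! ℕ.* (suc p ℕ.∸ suc k) !) ≡ suc p !
    fact = trans (cong (ℕ._* (suc k ! ℕ.* (suc p ℕ.∸ suc k) !)) (nCk≡n!/k![n-k]! (ℕₚ.<⇒≤ l)))
      (m/n*n≡m (k![n∸k]!∣n! (ℕₚ.<⇒≤ l)))
  ... | inj₁ h = h
  ... | inj₂ h with euclidsLemma (suc k !) ((suc p ℕ.∸ suc k) !) pr h
  ...   | inj₁ h' = ⊥-elim (prime-∤! pr (suc k) l h')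
  ...   | inj₂ h' = ⊥-elim (prime-∤! pr (p ℕ.∸ k) (s≤s (ℕₚ.m∸n≤m p k)) h')

module Frobenius {c ℓ} (R : CommutativeSemiring c ℓ) {p : ℕ} (pr : Prime p) where
  open CommutativeSemiring R renaming (_+_ to _⊹_; _*_ to _⋆_; refl to ≈-refl; sym to ≈-sym; trans to ≈-trans)
  open import Algebra.Properties.Semiring.Mult semiring using (×-homo-1; ×-congʳ; ×-congˡ; ×-assocˡ; ×-comm-*; ×-assoc-*) renaming (_×_ to _⨯_)
  open import Algebra.Properties.CommutativeMonoid.Mult +-commutativeMonoid using () renaming (×-distrib-+ to ⨯-distrib-+)
  open import Algebra.Properties.Semiring.Exp semiring using (^-congˡ; ^-assocʳ) renaming (_^_ to _↟_)
  open import Algebra.Properties.Semiring.Sum semiring using (sum; sum-init-last; sum-cong-≋)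
  open import Algebra.Properties.CommutativeSemiring.Binomial R using (theorem; binomialExpansion; binomialTerm)
  open import Relation.Binary.Reasoning.Setoid setoid

  infix 4 _≡ₚ_

  -- Congruence modulo `p` without subtraction, as the coefficients are natural numbers.
  _≡ₚ_ : Carrier → Carrier → Set (c L.⊔ ℓ)
  x ≡ₚ y = ∃ λ z → ∃ λ w → x ⊹ p ⨯ z ≈ y ⊹ p ⨯ w

  ≈⇒≡ₚ : ∀ {x y} → x ≈ y → x ≡ₚ y
  ≈⇒≡ₚ e = 0# , 0# , +-congʳ e

  interchange : ∀ a b c d → (a ⊹ b) ⊹ (c ⊹ d) ≈ (a ⊹ c) ⊹ (b ⊹ d)
  interchange a b c d = begin
    (a ⊹ b) ⊹ (c ⊹ d) ≈⟨ +-assoc a b (c ⊹ d) ⟩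
    a ⊹ (b ⊹ (c ⊹ d)) ≈⟨ +-congˡ (≈-sym (+-assoc b c d)) ⟩
    a ⊹ ((b ⊹ c) ⊹ d) ≈⟨ +-congˡ (+-congʳ (+-comm b c)) ⟩
    a ⊹ ((c ⊹ b) ⊹ d) ≈⟨ +-congˡ (+-assoc c b d) ⟩
    a ⊹ (c ⊹ (b ⊹ d)) ≈⟨ ≈-sym (+-assoc a c (b ⊹ d)) ⟩
    (a ⊹ c) ⊹ (b ⊹ d) ∎

  ≡ₚ-+ : ∀ {x y x' y'} → x ≡ₚ y → x' ≡ₚ y' → x ⊹ x' ≡ₚ y ⊹ y'
  ≡ₚ-+ {x} {y} {x'} {y'} (z , w , e) (z' , w' , e') = z ⊹ z' , w ⊹ w' , (begin
    (x ⊹ x') ⊹ p ⨯ (z ⊹ z') ≈⟨ +-congˡ (⨯-distrib-+ z z' p) ⟩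
    (x ⊹ x') ⊹ (p ⨯ z ⊹ p ⨯ z') ≈⟨ interchange x x' (p ⨯ z) (p ⨯ z') ⟩
    (x ⊹ p ⨯ z) ⊹ (x' ⊹ p ⨯ z') ≈⟨ +-cong e e' ⟩
    (y ⊹ p ⨯ w) ⊹ (y' ⊹ p ⨯ w') ≈⟨ interchange y (p ⨯ w) y' (p ⨯ w') ⟩
    (y ⊹ y') ⊹ (p ⨯ w ⊹ p ⨯ w') ≈⟨ +-congˡ (≈-sym (⨯-distrib-+ w w' p)) ⟩
    (y ⊹ y') ⊹ p ⨯ (w ⊹ w') ∎)

  ≡ₚ-trans : ∀ {x y z} → x ≡ₚ y → y ≡ₚ z → x ≡ₚ z
  ≡ₚ-trans {x} {y} {z} (a , b , e) (a' , b' , e') = a ⊹ a' , b' ⊹ b , (begin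
    x ⊹ p ⨯ (a ⊹ a') ≈⟨ +-congˡ (⨯-distrib-+ a a' p) ⟩
    x ⊹ (p ⨯ a ⊹ p ⨯ a') ≈⟨ ≈-sym (+-assoc x _ _) ⟩
    (x ⊹ p ⨯ a) ⊹ p ⨯ a' ≈⟨ +-congʳ e ⟩
    (y ⊹ p ⨯ b) ⊹ p ⨯ a' ≈⟨ +-assoc y _ _ ⟩
    y ⊹ (p ⨯ b ⊹ p ⨯ a') ≈⟨ +-congˡ (+-comm _ _) ⟩
    y ⊹ (p ⨯ a' ⊹ p ⨯ b) ≈⟨ ≈-sym (+-assoc y _ _) ⟩
    (y ⊹ p ⨯ a') ⊹ p ⨯ b ≈⟨ +-congʳ e' ⟩
    (z ⊹ p ⨯ b') ⊹ p ⨯ b ≈⟨ +-assoc z _ _ ⟩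
    z ⊹ (p ⨯ b' ⊹ p ⨯ b) ≈⟨ +-congˡ (≈-sym (⨯-distrib-+ b' b p)) ⟩
    z ⊹ p ⨯ (b' ⊹ b) ∎)

  ≡ₚ-*ˡ : ∀ {x y} a → x ≡ₚ y → a ⋆ x ≡ₚ a ⋆ y
  ≡ₚ-*ˡ {x} {y} a (z , w , e) = a ⋆ z , a ⋆ w , (begin
    a ⋆ x ⊹ p ⨯ (a ⋆ z) ≈⟨ +-congˡ (≈-sym (×-comm-* p a z)) ⟩
    a ⋆ x ⊹ a ⋆ (p ⨯ z) ≈⟨ ≈-sym (distribˡ a x (p ⨯ z)) ⟩
    a ⋆ (x ⊹ p ⨯ z) ≈⟨ *-congˡ e ⟩
    a ⋆ (y ⊹ p ⨯ w) ≈⟨ distribˡ a y (p ⨯ w) ⟩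
    a ⋆ y ⊹ a ⋆ (p ⨯ w) ≈⟨ +-congˡ (×-comm-* p a w) ⟩
    a ⋆ y ⊹ p ⨯ (a ⋆ w) ∎)

  ≡ₚ-* : ∀ {x y x' y'} → x ≡ₚ y → x' ≡ₚ y' → x ⋆ x' ≡ₚ y ⋆ y'
  ≡ₚ-* {x} {y} {x'} {y'} h h' = ≡ₚ-trans (≡ₚ-*ˡ x h')
    (≡ₚ-trans (≈⇒≡ₚ (*-comm x y')) (≡ₚ-trans (≡ₚ-*ˡ y' h) (≈⇒≡ₚ (*-comm y' y))))

  ≡ₚ-^ : ∀ k {x y} → x ≡ₚ y → x ↟ k ≡ₚ y ↟ k
  ≡ₚ-^ zero h = ≈⇒≡ₚ ≈-refl
  ≡ₚ-^ (suc k) h = ≡ₚ-* h (≡ₚ-^ k h)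

  sum-multiple : ∀ {n} (t : Fin n → Carrier) → (∀ i → ∃ λ z → t i ≈ p ⨯ z) → ∃ λ z → sum t ≈ p ⨯ z
  sum-multiple {zero} t h = 0# , ≈-sym (zero-× p)
    where
    zero-× : ∀ k → k ⨯ 0# ≈ 0#
    zero-× zero = ≈-refl
    zero-× (suc k) = ≈-trans (+-identityˡ _) (zero-× k)
  sum-multiple {suc n} t h with h fzero | sum-multiple (t ∘ fsuc) (h ∘ fsuc)
  ... | z , e | w , f = z ⊹ w , ≈-trans (+-cong e f) (≈-sym (⨯-distrib-+ z w p))

  opaque
    freshman-+ : ∀ x y → (x ⊹ y) ↟ p ≡ₚ x ↟ p ⊹ y ↟ p
    freshman-+ x y = go (middle-dvd p≢0)
      where
      p≢0 : ∃ λ m → p ≡ suc m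
      p≢0 = ℕ.pred p , sym (ℕₚ.suc-pred p {{prime⇒nonZero pr}})
      T : ∀ q → Fin (suc q) → Carrier
      T q = binomialTerm x y q
      middle-dvd : (∃ λ m → p ≡ suc m) → ∃ λ m → (p ≡ suc m) × ∃ λ z → sum (λ (i : Fin m) → T (suc m) (fsuc (inject₁ i))) ≈ p ⨯ z
      middle-dvd (m , e) = m , e , sum-multiple (λ i → T (suc m) (fsuc (inject₁ i))) dv
        where
        dv : ∀ i → ∃ λ z → T (suc m) (fsuc (inject₁ i)) ≈ p ⨯ z
        dv i with prime-∣C (subst Prime e pr) (suc (toℕ (inject₁ i))) (s≤s z≤n) (s≤s (subst (ℕ._< m) (sym (toℕ-inject₁ i)) (toℕ<n i)))
        ... | ℕ∣.divides q f = q ⨯ t , ≈-trans (×-congˡ (trans f (trans (ℕₚ.*-comm q (suc m)) (cong (ℕ._* q) (sym e))))) (≈-sym (×-assocˡ t p q))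
          where
          t : Carrier
          t = (x ↟ suc (toℕ (inject₁ i))) ⋆ (y ↟ (suc m ℕ.∸ suc (toℕ (inject₁ i))))
      go : (∃ λ m → (p ≡ suc m) × ∃ λ z → sum (λ (i : Fin m) → T (suc m) (fsuc (inject₁ i))) ≈ p ⨯ z) → (x ⊹ y) ↟ p ≡ₚ x ↟ p ⊹ y ↟ p
      go (m , refl , z , e) = 0# , z , (begin
        (x ⊹ y) ↟ p ⊹ p ⨯ 0# ≈⟨ +-congˡ (zero-× p) ⟩
        (x ⊹ y) ↟ p ⊹ 0# ≈⟨ +-identityʳ _ ⟩
        (x ⊹ y) ↟ p ≈⟨ theorem p x y ⟩
        T p fzero ⊹ sum (λ i → T p (fsuc i)) ≈⟨ +-cong first (sum-init-last (λ i → T p (fsuc i))) ⟩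
        y ↟ p ⊹ (sum (λ i → T p (fsuc (inject₁ i))) ⊹ T p (fsuc (fromℕ m))) ≈⟨ +-congˡ (+-cong e last') ⟩
        y ↟ p ⊹ (p ⨯ z ⊹ x ↟ p) ≈⟨ +-congˡ (+-comm _ _) ⟩
        y ↟ p ⊹ (x ↟ p ⊹ p ⨯ z) ≈⟨ ≈-sym (+-assoc _ _ _) ⟩
        (y ↟ p ⊹ x ↟ p) ⊹ p ⨯ z ≈⟨ +-congʳ (+-comm _ _) ⟩
        (x ↟ p ⊹ y ↟ p) ⊹ p ⨯ z ∎)
        where
        zero-× : ∀ k → k ⨯ 0# ≈ 0#
        zero-× zero = ≈-refl
        zero-× (suc k) = ≈-trans (+-identityˡ _) (zero-× k)
        first : T p fzero ≈ y ↟ p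
        first = ≈-trans (×-homo-1 _) (*-identityˡ _)
        last' : T p (fsuc (fromℕ m)) ≈ x ↟ p
        last' = begin
          (p C suc (toℕ (fromℕ m))) ⨯ (x ↟ suc (toℕ (fromℕ m)) ⋆ y ↟ (m ℕ.∸ toℕ (fromℕ m))) ≈⟨ reflexive (cong (λ k → (p C suc k) ⨯ (x ↟ suc k ⋆ y ↟ (m ℕ.∸ k))) (toℕ-fromℕ m)) ⟩
          (p C p) ⨯ (x ↟ p ⋆ y ↟ (m ℕ.∸ m)) ≈⟨ ×-congˡ (nCn≡1 p) ⟩
          1 ⨯ (x ↟ p ⋆ y ↟ (m ℕ.∸ m)) ≈⟨ ×-homo-1 _ ⟩
          x ↟ p ⋆ y ↟ (m ℕ.∸ m) ≈⟨ reflexive (cong (λ k → x ↟ p ⋆ y ↟ k) (ℕₚ.n∸n≡0 m)) ⟩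
          x ↟ p ⋆ 1# ≈⟨ *-identityʳ _ ⟩
          x ↟ p ∎

    freshman-^ : ∀ a x y → (x ⊹ y) ↟ (p ℕ.^ a) ≡ₚ x ↟ (p ℕ.^ a) ⊹ y ↟ (p ℕ.^ a)
    freshman-^ zero x y = ≈⇒≡ₚ (≈-trans (*-identityʳ _) (≈-sym (+-cong (*-identityʳ x) (*-identityʳ y))))
    freshman-^ (suc a) x y = ≡ₚ-trans (≈⇒≡ₚ (pw (x ⊹ y))) (≡ₚ-trans (≡ₚ-^ p (freshman-^ a x y))
      (≡ₚ-trans (freshman-+ _ _) (≈⇒≡ₚ (+-cong (≈-sym (pw x)) (≈-sym (pw y))))))
      where
      pw : ∀ z → z ↟ (p ℕ.^ suc a) ≈ (z ↟ (p ℕ.^ a)) ↟ p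
      pw z = ≈-trans (reflexive (cong (z ↟_) (ℕₚ.*-comm p (p ℕ.^ a)))) (≈-sym (^-assocʳ z (p ℕ.^ a) p))

-- The group semiring of the residues modulo N

module GroupSemiring (N : ℕ) .{{nz : ℕ.NonZero N}} where

  conv : (ℤ → ℕ) → (ℤ → ℕ) → ℤ → ℕ
  conv F K g = S N (λ x → F x ℕ.* K (g - x))

  δ : ℤ → ℤ → ℕ
  δ a g = ind (g ≋? a [ + N ])

  δ-Per : ∀ a → Per N (δ a)
  δ-Per a x y p = ind-⇔ (x ≋? a [ + N ]) (y ≋? a [ + N ]) (≋-trans (≋-sym p)) (≋-trans p)

  conv-Per : ∀ F {K} → Per N K → Per N (conv F K)
  conv-Per F per x y p = S-cong N (λ z → cong (F z ℕ.*_) (per _ _ (≋-+ʳ (- z) p)))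

  opaque
    conv-comm : ∀ {F K} → Per N F → Per N K → ∀ g → conv F K g ≡ conv K F g
    conv-comm {F} {K} pF pK g = trans (sym (S-reflect N {λ x → F x ℕ.* K (g - x)} (λ x y p → cong₂ ℕ._*_ (pF _ _ p) (pK _ _ (≋-+ˡ g (≋-neg p)))) g))
      (S-cong N (λ x → trans (ℕₚ.*-comm (F (g - x)) (K (g - (g - x)))) (cong (λ z → K z ℕ.* F (g - x)) (eq g x))))
      where
      eq : ∀ g x → g - (g - x) ≡ x
      eq = solve-∀

    conv-assoc : ∀ {F K J} → Per N F → Per N K → Per N J → ∀ g → conv (conv F K) J g ≡ conv F (conv K J) g
    conv-assoc {F} {K} {J} pF pK pJ g = begin
      S N (λ z → S N (λ x → F x ℕ.* K (z - x)) ℕ.* J (g - z)) ≡⟨ S-cong N (λ z → sym (S-*ʳ N (J (g - z)) (λ x → F x ℕ.* K (z - x)))) ⟩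
      S N (λ z → S N (λ x → F x ℕ.* K (z - x) ℕ.* J (g - z))) ≡⟨ S-swap N N _ ⟩
      S N (λ x → S N (λ z → F x ℕ.* K (z - x) ℕ.* J (g - z))) ≡⟨ S-cong N (λ x → trans (S-cong N (λ z → ℕₚ.*-assoc (F x) (K (z - x)) (J (g - z)))) (S-*ˡ N (F x) (λ z → K (z - x) ℕ.* J (g - z)))) ⟩
      S N (λ x → F x ℕ.* S N (λ z → K (z - x) ℕ.* J (g - z))) ≡⟨ S-cong N (λ x → cong (F x ℕ.*_) (trans (sym (S-shift N {λ z → K (z - x) ℕ.* J (g - z)} (λ a b p → cong₂ ℕ._*_ (pK _ _ (≋-+ʳ (- x) p)) (pJ _ _ (≋-+ˡ g (≋-neg p)))) x))
           (S-cong N (λ z → cong₂ (λ a b → K a ℕ.* J b) (e₁ x z) (e₂ g x z))))) ⟩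
      S N (λ x → F x ℕ.* S N (λ z → K z ℕ.* J (g - x - z))) ∎
      where
      open ≡-Reasoning
      e₁ : ∀ x z → x + z - x ≡ z
      e₁ = solve-∀
      e₂ : ∀ g x z → g - (x + z) ≡ g - x - z
      e₂ = solve-∀

    conv-δ : ∀ {K} → Per N K → ∀ a g → conv (δ a) K g ≡ K (g - a)
    conv-δ {K} pK a g = S-δ N {λ x → K (g - x)} (λ x y p → pK _ _ (≋-+ˡ g (≋-neg p))) a

    conv-δδ : ∀ a b g → conv (δ a) (δ b) g ≡ δ (a + b) g
    conv-δδ a b g = trans (conv-δ (δ-Per b) a g) (ind-⇔ (g - a ≋? b [ + N ]) (g ≋? a + b [ + N ])
      (λ { ≋⟨ p ⟩ → ≋⟨ subst (+ N ∣_) (eq g a b) p ⟩ }) (λ { ≋⟨ p ⟩ → ≋⟨ subst (+ N ∣_) (sym (eq g a b)) p ⟩ }))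
      where
      eq : ∀ g a b → g - a - b ≡ g - (a + b)
      eq = solve-∀

    conv-distribʳ : ∀ J F K g → conv (λ x → F x ℕ.+ K x) J g ≡ conv F J g ℕ.+ conv K J g
    conv-distribʳ J F K g = trans (S-cong N (λ x → ℕₚ.*-distribʳ-+ (J (g - x)) (F x) (K x))) (S-+ N _ _)

    conv-cong : ∀ {F F' K K'} → (∀ x → F x ≡ F' x) → (∀ x → K x ≡ K' x) → ∀ g → conv F K g ≡ conv F' K' g
    conv-cong p q g = S-cong N (λ x → cong₂ ℕ._*_ (p x) (q (g - x)))

    conv-0 : ∀ K g → conv (λ _ → 0) K g ≡ 0
    conv-0 K g = trans (S-const N 0) (ℕₚ.*-zeroʳ N)

  record _≐_ (F K : ∃ (Per N)) : Set where
    constructor ≐⟨_⟩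
    field at : ∀ g → proj₁ F g ≡ proj₁ K g
  open _≐_ public

  groupSemiring : CommutativeSemiring _ _
  groupSemiring = record
    { Carrier = ∃ (Per N)
    ; _≈_ = _≐_
    ; _+_ = λ { (F , pF) (K , pK) → (λ x → F x ℕ.+ K x) , λ x y p → cong₂ ℕ._+_ (pF x y p) (pK x y p) }
    ; _*_ = λ { (F , pF) (K , pK) → conv F K , conv-Per F pK }
    ; 0# = (λ _ → 0) , λ _ _ _ → refl
    ; 1# = δ 0ℤ , δ-Per 0ℤ
    ; isCommutativeSemiring = IsCommutativeSemiringˡ.isCommutativeSemiring record
      { +-isCommutativeMonoid = record
        { isMonoid = record
          { isSemigroup = record
            { isMagma = record { isEquivalence = eqv ; ∙-cong = λ p q → ≐⟨ (λ g → cong₂ ℕ._+_ (at p g) (at q g)) ⟩ }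
            ; assoc = λ F K J → ≐⟨ (λ g → ℕₚ.+-assoc (proj₁ F g) (proj₁ K g) (proj₁ J g)) ⟩ }
          ; identity = (λ F → ≐⟨ (λ g → refl) ⟩) , λ F → ≐⟨ (λ g → ℕₚ.+-identityʳ (proj₁ F g)) ⟩ }
        ; comm = λ F K → ≐⟨ (λ g → ℕₚ.+-comm (proj₁ F g) (proj₁ K g)) ⟩ }
      ; *-isCommutativeMonoid = record
        { isMonoid = record
          { isSemigroup = record
            { isMagma = record { isEquivalence = eqv ; ∙-cong = λ p q → ≐⟨ conv-cong (at p) (at q) ⟩ }
            ; assoc = λ F K J → ≐⟨ conv-assoc (proj₂ F) (proj₂ K) (proj₂ J) ⟩ }
          ; identity = (λ F → ≐⟨ idˡ F ⟩) , λ F → ≐⟨ (λ g → trans (conv-comm (proj₂ F) (δ-Per 0ℤ) g) (idˡ F g)) ⟩ }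
        ; comm = λ F K → ≐⟨ conv-comm (proj₂ F) (proj₂ K) ⟩ }
      ; distribʳ = λ J F K → ≐⟨ conv-distribʳ (proj₁ J) (proj₁ F) (proj₁ K) ⟩
      ; zeroˡ = λ F → ≐⟨ conv-0 (proj₁ F) ⟩ }
    }
    where
    eqv : IsEquivalence _≐_
    eqv = record { refl = ≐⟨ (λ _ → refl) ⟩ ; sym = λ p → ≐⟨ (λ g → sym (at p g)) ⟩ ; trans = λ p q → ≐⟨ (λ g → trans (at p g) (at q g)) ⟩ }
    idˡ : ∀ (F : ∃ (Per N)) g → conv (δ 0ℤ) (proj₁ F) g ≡ proj₁ F g
    idˡ (F , pF) g = trans (conv-δ pF 0ℤ g) (cong F (ℤₚ.+-identityʳ g))

  pow : (ℤ → ℕ) → ℕ → ℤ → ℕ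
  pow F zero = δ 0ℤ
  pow F (suc k) = conv F (pow F k)

  push : ℤ → (ℤ → ℕ) → ℤ → ℕ
  push k F g = S N (λ x → ind (k * x ≋? g [ + N ]) ℕ.* F x)

  module _ {p : ℕ} (pr : Prime p) where
    open CommutativeSemiring groupSemiring using (_≈_; 0#; 1#; semiring) renaming (_+_ to _⊹_; _*_ to _⋆_; zeroˡ to ⋆-zeroˡ; refl to ≈-refl; trans to ≈-trans; *-congˡ to ⋆-congˡ; Carrier to Fn)
    open Frobenius groupSemiring pr using (_≡ₚ_; ≈⇒≡ₚ; ≡ₚ-+; ≡ₚ-trans; ≡ₚ-^; freshman-^)
    open import Algebra.Properties.Semiring.Mult semiring using () renaming (_×_ to _⨯_)
    open import Algebra.Properties.Semiring.Exp semiring using (^-congˡ) renaming (_^_ to _↟_)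

    private
      ⨯-eval : ∀ k (F : Fn) g → proj₁ (k ⨯ F) g ≡ k ℕ.* proj₁ F g
      ⨯-eval zero F g = refl
      ⨯-eval (suc k) F g = cong (proj₁ F g ℕ.+_) (⨯-eval k F g)

      ↟-eval : ∀ (F : Fn) k g → proj₁ (F ↟ k) g ≡ pow (proj₁ F) k g
      ↟-eval F zero g = refl
      ↟-eval F (suc k) g = conv-cong {proj₁ F} (λ _ → refl) (↟-eval F k) g

      -- The element Σ F(x) δ(m x) over 0 ≤ x < k. Splitting off the last summand lets the
      -- additivity of p^a-th powers modulo p be applied to two terms at a time.
      part : (F : ℤ → ℕ) → ℤ → ℕ → Fn
      part F m k = (λ g → S k (λ x → ind (g ≋? m * x [ + N ]) ℕ.* F x)) ,
        λ x y p → S-cong k (λ z → cong (ℕ._* F z) (δ-Per (m * z) x y p))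

      single : ℕ → ℤ → Fn
      single c a = (λ g → ind (g ≋? a [ + N ]) ℕ.* c) , λ x y p → cong (ℕ._* c) (δ-Per a x y p)

      δ-pow : ∀ a k → (single 1 a ↟ k) ≈ single 1 (+ k * a)
      δ-pow a zero = ≐⟨ (λ g → trans (ind-⇔ (g ≋? 0ℤ [ + N ]) (g ≋? 0ℤ * a [ + N ]) (λ p → ≋-trans p (≋-reflexive (sym (ℤₚ.*-zeroˡ a)))) (λ p → ≋-trans p (≋-reflexive (ℤₚ.*-zeroˡ a)))) (sym (ℕₚ.*-identityʳ _))) ⟩
      δ-pow a (suc k) = ≐⟨ (λ g → trans (conv-cong (λ x → ℕₚ.*-identityʳ (δ a x)) (λ x → trans (at (δ-pow a k) x) (ℕₚ.*-identityʳ (δ (+ k * a) x))) g)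
        (trans (conv-δδ a (+ k * a) g) (trans (cong (λ z → δ z g) (trans (eq a (+ k)) (cong (_* a) (sym (ℤₚ.pos-+ 1 k))))) (sym (ℕₚ.*-identityʳ _))))) ⟩
        where
        eq : ∀ a k → a + k * a ≡ (1ℤ + k) * a
        eq = solve-∀

      0-pow : ∀ k → (0# ↟ suc k) ≈ 0#
      0-pow k = ⋆-zeroˡ (0# ↟ k)

    opaque
      unfolding S
      private
        part-pow : ∀ F → (∀ x → F x ℕ.≤ 1) → ∀ a k → (part F 1ℤ k ↟ (p ℕ.^ a)) ≡ₚ part F (+ (p ℕ.^ a)) k
        part-pow F b a zero with p ℕ.^ a in eq
        ... | zero = ⊥-elim (ℕ.≢-nonZero⁻¹ (p ℕ.^ a) {{ℕₚ.m^n≢0 p a {{prime⇒nonZero pr}}}} eq)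
        ... | suc m = ≈⇒≡ₚ (0-pow m)
        part-pow F b a (suc k) = ≡ₚ-trans (≈⇒≡ₚ (^-congˡ (p ℕ.^ a) {part F 1ℤ (suc k)} {part F 1ℤ k ⊹ single (F (+ k)) (+ k)} ≐⟨ (λ g → cong (S k (λ x → ind (g ≋? 1ℤ * x [ + N ]) ℕ.* F x) ℕ.+_) (cong (ℕ._* F (+ k)) (ind-⇔ (g ≋? 1ℤ * + k [ + N ]) (g ≋? + k [ + N ]) (λ p → ≋-trans p (≋-reflexive (ℤₚ.*-identityˡ (+ k)))) (λ p → ≋-trans p (≋-reflexive (sym (ℤₚ.*-identityˡ (+ k)))))))) ⟩))
          (≡ₚ-trans (freshman-^ a (part F 1ℤ k) (single (F (+ k)) (+ k))) (≡ₚ-+ (part-pow F b a k) (≈⇒≡ₚ (last (F (+ k)) (b (+ k))))))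
          where
          last : ∀ c → c ℕ.≤ 1 → (single c (+ k) ↟ (p ℕ.^ a)) ≈ single c (+ (p ℕ.^ a) * + k)
          last 0 _ with p ℕ.^ a in eq
          ... | zero = ⊥-elim (ℕ.≢-nonZero⁻¹ (p ℕ.^ a) {{ℕₚ.m^n≢0 p a {{prime⇒nonZero pr}}}} eq)
          ... | suc m = ≈-trans (^-congˡ (suc m) {single 0 (+ k)} {0#} ≐⟨ (λ g → ℕₚ.*-zeroʳ (δ (+ k) g)) ⟩) (≈-trans (0-pow m) ≐⟨ (λ g → sym (ℕₚ.*-zeroʳ (δ (+ suc m * + k) g))) ⟩)
          last 1 _ = δ-pow (+ k) (p ℕ.^ a)
          last (suc (suc _)) (s≤s ())

    opaque
      -- Modulo p the p^a-th power of Σ F(x) δ(x) is the sum of the powers of its terms, and the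
      -- p^a-th power of δ(x) is δ(p^a x). The values 0 and 1 of `F` are their own powers.
      pow-≡-push : ∀ {F} → Per N F → (∀ x → F x ℕ.≤ 1) → ∀ a →
        ∃ λ (z : ℤ → ℕ) → ∃ λ (w : ℤ → ℕ) → ∀ g → pow F (p ℕ.^ a) g ℕ.+ p ℕ.* z g ≡ push (+ (p ℕ.^ a)) F g ℕ.+ p ℕ.* w g
      pow-≡-push {F} pF b a with ≡ₚ-trans (≡ₚ-^ (p ℕ.^ a) {F , pF} {part F 1ℤ N} (≈⇒≡ₚ whole)) (part-pow F b a N)
        where
        whole : (F , pF) ≈ part F 1ℤ N
        whole = ≐⟨ (λ g → sym (trans (S-cong N (λ x → cong (ℕ._* F x) (ind-⇔ (g ≋? 1ℤ * x [ + N ]) (x ≋? g [ + N ])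
          (λ p → ≋-sym (≋-trans p (≋-reflexive (ℤₚ.*-identityˡ x)))) (λ p → ≋-trans (≋-sym p) (≋-reflexive (sym (ℤₚ.*-identityˡ x))))))) (S-δ N pF g))) ⟩
      ... | (z , _) , (w , _) , e = z , w , λ g → trans (cong₂ ℕ._+_ (sym (↟-eval (F , pF) (p ℕ.^ a) g)) (sym (⨯-eval p (z , _) g)))
        (trans (at e g) (cong₂ ℕ._+_ (S-cong N (λ x → cong (ℕ._* F x) (ind-⇔ (g ≋? + (p ℕ.^ a) * x [ + N ]) (+ (p ℕ.^ a) * x ≋? g [ + N ]) ≋-sym ≋-sym))) (⨯-eval p (w , _) g)))

-- The Schur ring of a circulant scheme

opaque
  ΣF : ∀ {k} → (Fin k → ℕ) → ℕ
  ΣF {zero} h = 0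
  ΣF {suc k} h = h fzero ℕ.+ ΣF (h ∘ fsuc)

  ΣF-cong : ∀ {k} {h h' : Fin k → ℕ} → (∀ i → h i ≡ h' i) → ΣF h ≡ ΣF h'
  ΣF-cong {zero} e = refl
  ΣF-cong {suc k} e = cong₂ ℕ._+_ (e fzero) (ΣF-cong (e ∘ fsuc))

  ΣF-0 : ∀ {k} {h : Fin k → ℕ} → (∀ i → h i ≡ 0) → ΣF h ≡ 0
  ΣF-0 {zero} e = refl
  ΣF-0 {suc k} e = cong₂ ℕ._+_ (e fzero) (ΣF-0 (e ∘ fsuc))

  ΣF-δ : ∀ {k} (h : Fin k → ℕ) a → ΣF (λ r → ind (a ≟F r) ℕ.* h r) ≡ h a
  ΣF-δ {suc k} h fzero = trans (cong₂ ℕ._+_ (ℕₚ.+-identityʳ (h fzero)) (ΣF-0 (λ i → cong (ℕ._* h (fsuc i)) (ind-no (fzero ≟F fsuc i) (λ ()))))) (ℕₚ.+-identityʳ (h fzero))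
  ΣF-δ {suc k} h (fsuc a) = trans (ΣF-cong (λ i → cong (ℕ._* h (fsuc i)) (ind-⇔ (fsuc a ≟F fsuc i) (a ≟F i) (λ { refl → refl }) (λ { refl → refl })))) (ΣF-δ (h ∘ fsuc) a)

  S-ΣF : ∀ N {k} (h : ℤ → Fin k → ℕ) → S N (λ x → ΣF (h x)) ≡ ΣF (λ i → S N (λ x → h x i))
  S-ΣF N {zero} h = trans (S-const N 0) (ℕₚ.*-zeroʳ N)
  S-ΣF N {suc k} h = trans (S-+ N _ _) (cong (S N (λ x → h x fzero) ℕ.+_) (S-ΣF N (λ x i → h x (fsuc i))))

  S-as-ΣF : ∀ N (G : ℤ → ℕ) → S N G ≡ ΣF {N} (λ i → G (+ toℕ i))
  S-as-ΣF zero G = S-0 G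
  S-as-ΣF (suc N) G = trans (S-split 1 N G) (cong₂ ℕ._+_ (S-1 G) (trans (S-as-ΣF N (λ x → G (+ 1 + x))) refl))

  length-filter : ∀ {A : Set} {P : A → Set} (P? : Decidable P) {k} (f : Fin k → A) → length (filter P? (tabulate f)) ≡ ΣF (λ i → ind (P? (f i)))
  length-filter P? {zero} f = refl
  length-filter P? {suc k} f with P? (f fzero)
  ... | yes _ = cong suc (length-filter P? (f ∘ fsuc))
  ... | no _ = length-filter P? (f ∘ fsuc)

  ΣF-*ˡ : ∀ {k} a (h : Fin k → ℕ) → a ℕ.* ΣF h ≡ ΣF (λ i → a ℕ.* h i)
  ΣF-*ˡ {zero} a h = ℕₚ.*-zeroʳ a
  ΣF-*ˡ {suc k} a h = trans (ℕₚ.*-distribˡ-+ a (h fzero) (ΣF (h ∘ fsuc))) (cong (a ℕ.* h fzero ℕ.+_) (ΣF-*ˡ a (h ∘ fsuc)))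

ind-× : ∀ {A B : Set} (a : Dec A) (b : Dec B) → ind (a ×-dec b) ≡ ind a ℕ.* ind b
ind-× (yes _) (yes _) = refl
ind-× (yes _) (no _) = refl
ind-× (no _) _ = refl

opaque
  -- Expanding both factors in indicators of colours isolates the structure constants, the only
  -- numbers that an algebraic automorphism is known to preserve.
  S-by-colour : ∀ N {k} (f f' : Fin k → ℕ) (u v : ℤ → Fin k) →
    S N (λ x → f (u x) ℕ.* f' (v x)) ≡ ΣF (λ r → ΣF (λ s → S N (λ x → ind (u x ≟F r) ℕ.* ind (v x ≟F s)) ℕ.* (f r ℕ.* f' s)))
  S-by-colour N f f' u v = trans (S-cong N point) (trans (S-ΣF N _) (ΣF-cong (λ r → trans (S-ΣF N _) (ΣF-cong (λ s → S-*ʳ N (f r ℕ.* f' s) (λ x → ind (u x ≟F r) ℕ.* ind (v x ≟F s)))))))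
    where
    point : ∀ x → f (u x) ℕ.* f' (v x) ≡ ΣF (λ r → ΣF (λ s → ind (u x ≟F r) ℕ.* ind (v x ≟F s) ℕ.* (f r ℕ.* f' s)))
    point x = trans (sym (ΣF-δ (λ r → f r ℕ.* f' (v x)) (u x))) (ΣF-cong (λ r → trans (cong (ind (u x ≟F r) ℕ.*_) (sym (ΣF-δ (λ s → f r ℕ.* f' s) (v x))))
      (trans (ΣF-*ˡ (ind (u x ≟F r)) _) (ΣF-cong (λ s → sym (ℕₚ.*-assoc (ind (u x ≟F r)) (ind (v x ≟F s)) (f r ℕ.* f' s)))))))

module SchurRing {n k : ℕ} (c : Colouring (suc n) k) (circ : IsCirculant c) where
  open IsCirculant circ
  open IsCC coherent

  N : ℕ
  N = suc n

  opaque
    toF : ℤ → Fin N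
    toF z = fromℕ< (n%ℕd<d z N)

    toF-≋ : ∀ z → + toℕ (toF z) ≋ z [ + N ]
    toF-≋ z = subst (λ i → + i ≋ z [ + N ]) (sym (toℕ-fromℕ< (n%ℕd<d z N))) (proj₂ (proj₂ (residue N z)))

    toF-cong : ∀ {x y} → x ≋ y [ + N ] → toF x ≡ toF y
    toF-cong {x} {y} h = toℕ-injective (residue-unique N (toℕ<n (toF x)) (toℕ<n (toF y)) (≋-trans (toF-≋ x) (≋-trans h (≋-sym (toF-≋ y)))))

    toF-toℕ : ∀ α → toF (+ toℕ α) ≡ α
    toF-toℕ α = toℕ-injective (residue-unique N (toℕ<n (toF (+ toℕ α))) (toℕ<n α) (toF-≋ (+ toℕ α)))

    mod-≋ : ∀ j → + toℕ (j mod N) ≋ + j [ + N ]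
    mod-≋ j = subst (λ i → + i ≋ + j [ + N ]) (sym (toℕ-fromℕ< _)) (proj₂ (proj₂ (residue N (+ j))))

    ⊕-≋ : ∀ (α β : Fin N) → + toℕ (α ⊕ β) ≋ + toℕ α + + toℕ β [ + N ]
    ⊕-≋ α β = ≋-trans (mod-≋ (toℕ α ℕ.+ toℕ β)) (≋-reflexive (ℤₚ.pos-+ (toℕ α) (toℕ β)))

    ⊖-≋ : ∀ (α : Fin N) → + toℕ (⊖ α) ≋ - + toℕ α [ + N ]
    ⊖-≋ α = ≋-trans (mod-≋ (N ℕ.∸ toℕ α)) (≋-trans (≋-reflexive (sym (trans (ℤₚ.m-n≡m⊖n N (toℕ α)) (ℤₚ.⊖-≥ (ℕₚ.<⇒≤ (toℕ<n α))))))
      (≋-trans (≋-reflexive (eq (+ N) (+ toℕ α))) (≋-shift (- + toℕ α) 1ℤ)))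
      where
      eq : ∀ a b → a - b ≡ - b + 1ℤ * a
      eq = solve-∀

    ⊝-≋ : ∀ (α β : Fin N) → + toℕ (α ⊝ β) ≋ + toℕ α - + toℕ β [ + N ]
    ⊝-≋ α β = ≋-trans (⊕-≋ α (⊖ β)) (≋-+ˡ (+ toℕ α) (⊖-≋ β))

  opaque
    χ : ℤ → Fin k
    χ z = c fzero (toF z)

    χ-def : ∀ z → χ z ≡ c fzero (toF z)
    χ-def z = refl

    χ-cong : ∀ {x y} → x ≋ y [ + N ] → χ x ≡ χ y
    χ-cong h = cong (c fzero) (toF-cong h)

  opaque
    unfolding χ
    c-as-χ : ∀ α β → c α β ≡ χ (+ toℕ β - + toℕ α)
    c-as-χ α β = trans (sym (invariant α β (⊖ α))) (cong₂ c (same α (≋-reflexive (ℤₚ.+-inverseʳ (+ toℕ α)))) (sym (trans (toF-cong (≋-sym (⊝-≋ β α))) (toF-toℕ (β ⊝ α)))))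
      where
      same : ∀ (α : Fin N) → + toℕ α - + toℕ α ≋ 0ℤ [ + N ] → α ⊝ α ≡ fzero
      same α h = toℕ-injective (residue-unique N (toℕ<n (α ⊝ α)) (toℕ<n {N} fzero) (≋-trans (⊝-≋ α α) h))

    c-toF : ∀ x y → c (toF x) (toF y) ≡ χ (y - x)
    c-toF x y = trans (c-as-χ (toF x) (toF y)) (χ-cong (≋-- (toF-≋ y) (toF-≋ x)))

    χ-onto : ∀ r → ∃ λ z → χ z ≡ r
    χ-onto r with nonempty r
    ... | α , β , e = + toℕ β - + toℕ α , trans (sym (c-as-χ α β)) e

    χ-0 : ∀ {x} → χ x ≡ χ 0ℤ → + N ∣ x
    χ-0 {x} h = ≋0⇒∣ (≋-trans (≋-sym (toF-≋ x)) (≋-trans (≋-reflexive (cong (λ α → + toℕ α) (sym (diagonal (toF 0ℤ) fzero (toF x) (trans (c-toF 0ℤ 0ℤ) (sym h)))))) ≋-refl))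

    χ-neg : ∀ {x y} → χ x ≡ χ y → χ (- x) ≡ χ (- y)
    χ-neg {x} {y} h = trans (e x) (trans (transpose (toF 0ℤ) (toF x) (toF 0ℤ) (toF y) (trans (c0 x) (trans h (sym (c0 y))))) (sym (e y)))
      where
      c0 : ∀ x → c (toF 0ℤ) (toF x) ≡ χ x
      c0 x = trans (c-toF 0ℤ x) (cong χ (ℤₚ.+-identityʳ x))
      e : ∀ x → χ (- x) ≡ c (toF x) (toF 0ℤ)
      e x = trans (cong χ (sym (ℤₚ.+-identityˡ (- x)))) (sym (c-toF x 0ℤ))

    inum-as-S : ∀ g r s → inum c fzero (toF g) r s ≡ S N (λ x → ind (χ x ≟F r) ℕ.* ind (χ (g - x) ≟F s))
    inum-as-S g r s = trans (length-filter (λ γ → (c fzero γ ≟F r) ×-dec (c γ (toF g) ≟F s)) (λ γ → γ))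
      (trans (ΣF-cong (λ γ → trans (ind-× (c fzero γ ≟F r) (c γ (toF g) ≟F s)) (cong₂ (λ a b → ind (a ≟F r) ℕ.* ind (b ≟F s)) (cong (c fzero) (sym (toF-toℕ γ))) (trans (cong (λ z → c z (toF g)) (sym (toF-toℕ γ))) (c-toF (+ toℕ γ) g)))))
        (sym (S-as-ΣF N _)))

  module Morphism (ρ : Fin k ↔ Fin k) (alg : IsAlgAut c ρ) where
    open Inverse ρ using (to; from; strictlyInverseˡ; strictlyInverseʳ)

    R : ℤ → ℤ → Set
    R x y = χ y ≡ to (χ x)

    Related : (F F' : ℤ → ℕ) → Set
    Related F F' = ∀ x y → R x y → F x ≡ F' y

    R-total : ∀ x → ∃ (R x)
    R-total x = χ-onto (to (χ x))

    R-cototal : ∀ y → ∃ λ x → R x y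
    R-cototal y with χ-onto (from (χ y))
    ... | x , e = x , sym (trans (cong to e) (strictlyInverseˡ (χ y)))

    R-resp : ∀ {x x' y y'} → χ x ≡ χ x' → χ y ≡ χ y' → R x y → R x' y'
    R-resp p q h = trans (sym q) (trans h (cong to p))

    R-inj : ∀ {x x' y y'} → R x y → R x' y' → χ y ≡ χ y' → χ x ≡ χ x'
    R-inj {x} {x'} h h' e = trans (sym (strictlyInverseʳ (χ x))) (trans (cong from (trans (sym h) (trans e h'))) (strictlyInverseʳ (χ x')))

    R-fun : ∀ {x x' y y'} → R x y → R x' y' → χ x ≡ χ x' → χ y ≡ χ y'
    R-fun h h' e = trans h (trans (cong to e) (sym h'))

    open GroupSemiring using (conv; push; pow; δ; pow-≡-push)

    private
      rep : Fin k → ℤ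
      rep r = proj₁ (χ-onto r)

      rep-eq : ∀ r → χ (rep r) ≡ r
      rep-eq r = proj₂ (χ-onto r)

      pre : ∀ y → R (rep (from (χ y))) y
      pre y = sym (trans (cong to (rep-eq (from (χ y)))) (strictlyInverseˡ (χ y)))

      at-rep : ∀ {F F'} → Related F F' → ∀ x → F x ≡ F (rep (χ x))
      at-rep h x with R-total x
      ... | y , r = trans (h x y r) (sym (h _ y (R-resp (sym (rep-eq (χ x))) refl r)))

    opaque
      conv-Related-N : ∀ {F F' K K'} → Related F F' → Related K K' → Related (conv N F K) (conv N F' K')
      conv-Related-N {F} {F'} {K} {K'} hF hK g g' rg = begin
        S N (λ x → F x ℕ.* K (g - x)) ≡⟨ S-cong N (λ x → cong₂ ℕ._*_ (at-rep hF x) (at-rep hK (g - x))) ⟩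
        S N (λ x → F (rep (χ x)) ℕ.* K (rep (χ (g - x)))) ≡⟨ S-by-colour N (F ∘ rep) (K ∘ rep) χ (λ x → χ (g - x)) ⟩
        ΣF (λ r → ΣF (λ s → S N (λ x → ind (χ x ≟F r) ℕ.* ind (χ (g - x) ≟F s)) ℕ.* (F (rep r) ℕ.* K (rep s)))) ≡⟨ ΣF-cong (λ r → ΣF-cong (λ s → cong (ℕ._* (F (rep r) ℕ.* K (rep s))) (count r s))) ⟩
        ΣF (λ r → ΣF (λ s → S N (λ x → ind (from (χ x) ≟F r) ℕ.* ind (from (χ (g' - x)) ≟F s)) ℕ.* (F (rep r) ℕ.* K (rep s)))) ≡⟨ sym (S-by-colour N (F ∘ rep) (K ∘ rep) (λ x → from (χ x)) (λ x → from (χ (g' - x)))) ⟩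
        S N (λ x → F (rep (from (χ x))) ℕ.* K (rep (from (χ (g' - x))))) ≡⟨ S-cong N (λ x → cong₂ ℕ._*_ (hF _ x (pre x)) (hK _ (g' - x) (pre (g' - x)))) ⟩
        S N (λ x → F' x ℕ.* K' (g' - x)) ∎
        where
        open ≡-Reasoning
        flip : ∀ (a r : Fin k) → ind (a ≟F to r) ≡ ind (from a ≟F r)
        flip a r = ind-⇔ (a ≟F to r) (from a ≟F r) (λ e → trans (cong from e) (strictlyInverseʳ r)) (λ e → trans (sym (strictlyInverseˡ a)) (cong to e))
        count : ∀ r s → S N (λ x → ind (χ x ≟F r) ℕ.* ind (χ (g - x) ≟F s)) ≡ S N (λ x → ind (from (χ x) ≟F r) ℕ.* ind (from (χ (g' - x)) ≟F s))
        count r s = trans (sym (inum-as-S g r s)) (trans (alg r s fzero (toF g) fzero (toF g') (trans (sym (χ-def g')) (trans rg (cong to (χ-def g))))) (trans (inum-as-S g' (to r) (to s)) (S-cong N (λ x → cong₂ ℕ._*_ (flip (χ x) r) (flip (χ (g' - x)) s)))))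

      -- For M-periodic functions a sum over N terms is N/M times a sum over M terms, and this
      -- factor cancels.
      conv-Related : ∀ M .{{_ : ℕ.NonZero M}} → + M ∣ + N → ∀ {F F' K K'} → Per M F → Per M F' → Per M K → Per M K' →
        Related F F' → Related K K' → Related (conv M F K) (conv M F' K')
      conv-Related M d {F} {F'} {K} {K'} pF pF' pK pK' hF hK g g' r = go (∣⇒∣ᵤ d)
       where
       go : M ℕ∣.∣ N → conv M F K g ≡ conv M F' K' g'
       go (ℕ∣.divides (suc q) e) = ℕₚ.*-cancelˡ-≡ _ _ (suc q) (trans (sym (big F K pF pK g)) (trans (conv-Related-N hF hK g g' r) (big F' K' pF' pK' g')))
        where
        big : ∀ F K → Per M F → Per M K → ∀ g → conv N F K g ≡ suc q ℕ.* conv M F K g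
        big F K pF pK g = trans (cong (λ L → S L (λ x → F x ℕ.* K (g - x))) e) (S-multiple M (λ x y p → cong₂ ℕ._*_ (pF x y p) (pK _ _ (≋-+ˡ g (≋-neg p)))) (suc q))

    cls : Fin k → ℤ → ℕ
    cls r z = ind (χ z ≟F r)

    opaque
      cls-Related : ∀ r → Related (cls r) (cls (to r))
      cls-Related r z z' rz = ind-⇔ (χ z ≟F r) (χ z' ≟F to r) (λ e → trans rz (cong to e))
        (λ e → trans (sym (strictlyInverseʳ (χ z))) (trans (cong from (trans (sym rz) e)) (strictlyInverseʳ r)))

      conv-cls-≢0 : ∀ x a → conv N (cls (χ a)) (cls (χ (x - a))) x ≢ 0
      conv-cls-≢0 x a e = ℕₚ.<⇒≢ (ℕₚ.<-≤-trans (s≤s z≤n) (ℕₚ.≤-trans (ℕₚ.≤-reflexive (sym (cong₂ ℕ._*_ (ind-yes (χ a ≟F χ a) refl) (ind-yes (χ (x - a) ≟F χ (x - a)) refl))))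
          (S-term≤ N {λ z → cls (χ a) z ℕ.* cls (χ (x - a)) (x - z)} (λ z w p → cong₂ (λ u v → ind (u ≟F χ a) ℕ.* ind (v ≟F χ (x - a))) (χ-cong p) (χ-cong (≋-+ˡ x (≋-neg p)))) a))) (sym e)

      conv-cls-hit : ∀ r s x → conv N (cls r) (cls s) x ≢ 0 → ∃ λ z → (χ z ≡ r) × (χ (x - z) ≡ s)
      conv-cls-hit r s x ne = hit (S-nonzero N (λ z → cls r z ℕ.* cls s (x - z)) ne)
        where
        hit : (∃ λ z → cls r z ℕ.* cls s (x - z) ≢ 0) → ∃ λ z → (χ z ≡ r) × (χ (x - z) ≡ s)
        hit (z , ne) = z , ind-pos (χ z ≟F r) (λ e → ne (cong (ℕ._* cls s (x - z)) e)) , ind-pos (χ (x - z) ≟F s) (λ e → ne (trans (cong (cls r z ℕ.*_) e) (ℕₚ.*-zeroʳ (cls r z))))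

      -- The splitting of `x` as a + (x - a) makes a structure constant nonzero; the corresponding
      -- constant at `y` is equal, so `y` has a splitting of the same kind.
      R-decompose : ∀ {x y} → R x y → ∀ a → ∃ λ a' → R a a' × R (x - a) (y - a')
      R-decompose {x} {y} r a = conv-cls-hit _ _ y (λ e → conv-cls-≢0 x a (trans (conv-Related-N (cls-Related (χ a)) (cls-Related (χ (x - a))) x y r) e))

      R-codecompose : ∀ {x y} → R x y → ∀ a' → ∃ λ a → R a a' × R (x - a) (y - a')
      R-codecompose {x} {y} r a' = fin (conv-cls-hit (from (χ a')) (from (χ (y - a'))) x
          (λ e → conv-cls-≢0 y a' (trans (cong₂ (λ u v → conv N (cls u) (cls v) y) (sym (strictlyInverseˡ (χ a'))) (sym (strictlyInverseˡ (χ (y - a')))))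
            (trans (sym (conv-Related-N (cls-Related (from (χ a'))) (cls-Related (from (χ (y - a')))) x y r)) e))))
        where
        fin : (∃ λ z → (χ z ≡ from (χ a')) × (χ (x - z) ≡ from (χ (y - a')))) → ∃ λ a → R a a' × R (x - a) (y - a')
        fin (z , e , e') = z , sym (trans (cong to e) (strictlyInverseˡ _)) , sym (trans (cong to e') (strictlyInverseˡ _))

      -- Take any image y of 0 and split it along y itself: this relates 0 - a to 0, where a lies in
      -- the class of 0 and is therefore 0 modulo N.
      R-0 : R 0ℤ 0ℤ
      R-0 = go (R-total 0ℤ)
        where
        go : ∃ (R 0ℤ) → R 0ℤ 0ℤ
        go (y , r) = go' (R-codecompose r y)
          where
          go' : (∃ λ a → R a y × R (0ℤ - a) (y - y)) → R 0ℤ 0ℤ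
          go' (a , ra , rb) = R-resp (χ-cong {0ℤ - a} {0ℤ} (≋-trans (≋-reflexive (ℤₚ.+-identityˡ (- a))) (∣⇒≋0 (∣m⇒∣-m (χ-0 (R-inj ra r refl)))))) (cong χ (ℤₚ.+-inverseʳ y)) rb

      R-neg : ∀ {x y} → R x y → R (- x) (- y)
      R-neg {x} {y} r = go (R-decompose R-0 x)
        where
        go : (∃ λ z → R x z × R (0ℤ - x) (0ℤ - z)) → R (- x) (- y)
        go (z , rz , r') = trans (χ-neg (R-fun r rz refl)) (trans (cong χ (sym (ℤₚ.+-identityˡ (- z)))) (trans r' (cong (λ w → to (χ w)) (ℤₚ.+-identityˡ (- x)))))

      pow-Related : ∀ M .{{_ : ℕ.NonZero M}} → + M ∣ + N → ∀ {F F'} → Per M F → Per M F' → Related F F' → Related (δ M 0ℤ) (δ M 0ℤ) →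
        ∀ j → Related (pow M F j) (pow M F' j)
      pow-Related M d pF pF' h h0 zero = h0
      pow-Related M d {F} {F'} pF pF' h h0 (suc j) = conv-Related M d pF pF' (pw F pF j) (pw F' pF' j) h (pow-Related M d pF pF' h h0 j)
        where
        pw : ∀ F → Per M F → ∀ j → Per M (pow M F j)
        pw F pF zero = GroupSemiring.δ-Per M 0ℤ
        pw F pF (suc j) = GroupSemiring.conv-Per M F (pw F pF j)

      push-Related : ∀ M .{{_ : ℕ.NonZero M}} → + M ∣ + N → ∀ {F F'} → Per M F → Per M F' → (∀ x → F x ℕ.≤ 1) → (∀ x → F' x ℕ.≤ 1) →
        Related F F' → Related (δ M 0ℤ) (δ M 0ℤ) → ∀ {p} → Prime p → ∀ a {g g'} → R g g' →
        + push M (+ (p ℕ.^ a)) F g ≋ + push M (+ (p ℕ.^ a)) F' g' [ + p ]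
      push-Related M d {F} {F'} pF pF' b b' h h0 {p} pr a {g} {g'} r = go (pow-≡-push M pr pF b a) (pow-≡-push M pr pF' b' a)
       where
       Eqv : (ℤ → ℕ) → Set
       Eqv F = ∃ λ (z : ℤ → ℕ) → ∃ λ (w : ℤ → ℕ) → ∀ g → pow M F (p ℕ.^ a) g ℕ.+ p ℕ.* z g ≡ push M (+ (p ℕ.^ a)) F g ℕ.+ p ℕ.* w g
       go : Eqv F → Eqv F' → + push M (+ (p ℕ.^ a)) F g ≋ + push M (+ (p ℕ.^ a)) F' g' [ + p ]
       go (z , w , e) (z' , w' , e') = ≋-trans (≋-sym (step e g)) (≋-trans (≋-reflexive (cong +_ (pow-Related M d pF pF' h h0 (p ℕ.^ a) g g' r))) (step e' g'))
        where
        step : ∀ {A B z w : ℤ → ℕ} → (∀ g → A g ℕ.+ p ℕ.* z g ≡ B g ℕ.+ p ℕ.* w g) → ∀ g → + A g ≋ + B g [ + p ]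
        step {A} {B} {z} {w} e g = ≋-trans (≋-sym (sh (A g) (z g))) (≋-trans (≋-reflexive (cong +_ (e g))) (sh (B g) (w g)))
          where
          sh : ∀ x y → + (x ℕ.+ p ℕ.* y) ≋ + x [ + p ]
          sh x y = ≋-trans (≋-reflexive (trans (ℤₚ.pos-+ x (p ℕ.* y)) (cong (λ q → + x + q) (trans (cong +_ (ℕₚ.*-comm p y)) (ℤₚ.pos-* y p))))) (≋-shift (+ x) (+ y))

module Units {n k : ℕ} (c : Colouring (suc n) k) (circ : IsCirculant c) (ρ : Fin k ↔ Fin k) (alg : IsAlgAut c ρ) where
  open SchurRing c circ
  open Morphism ρ alg
  open GroupSemiring using (push; δ)
  open Inverse ρ using (to)

  -- Stated for functions, with an inverse `v` of `m`, so that the property multiplies along a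
  -- factorisation of `m` into primes.
  Scales : ℕ → Set
  Scales m = ∀ v → + m * v ≋ 1ℤ [ + N ] → ∀ {F F'} → Per N F → Per N F' → (∀ x → F x ℕ.≤ 1) → (∀ x → F' x ℕ.≤ 1) →
    Related F F' → Related (λ x → F (v * x)) (λ x → F' (v * x))

  δ-Related : Related (δ N 0ℤ) (δ N 0ℤ)
  δ-Related x y r = ind-⇔ (x ≋? 0ℤ [ + N ]) (y ≋? 0ℤ [ + N ])
    (λ h → ∣⇒≋0 (χ-0 (R-fun r R-0 (χ-cong h)))) (λ h → ∣⇒≋0 (χ-0 (R-inj r R-0 (χ-cong h))))

  opaque
    push-unit : ∀ m v → m * v ≋ 1ℤ [ + N ] → ∀ {F} → Per N F → ∀ g → push N m F g ≡ F (v * g)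
    push-unit m v h {F} pF g = trans (S-cong N (λ x → cong (ℕ._* F x) (ind-⇔ (m * x ≋? g [ + N ]) (x ≋? v * g [ + N ])
      (λ e → ≋-trans (≋-sym (back x)) (≋-*ˡ v e)) (λ e → ≋-trans (≋-*ˡ m e) (forth g))))) (S-δ N pF (v * g))
      where
      forth : ∀ g → m * (v * g) ≋ g [ + N ]
      forth g = ≋-trans (≋-reflexive (sym (ℤₚ.*-assoc m v g))) (≋-trans (≋-*ʳ g h) (≋-reflexive (ℤₚ.*-identityˡ g)))
      back : ∀ x → v * (m * x) ≋ x [ + N ]
      back x = ≋-trans (≋-reflexive (eq v m x)) (forth x)
        where
        eq : ∀ v m x → v * (m * x) ≡ m * (v * x)
        eq = solve-∀

    ≤1-≋ : ∀ {p a b} → Prime p → a ℕ.≤ 1 → b ℕ.≤ 1 → + a ≋ + b [ + p ] → a ≡ b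
    ≤1-≋ {p} pr la lb h = residue-unique p {{prime⇒nonZero pr}} (ℕₚ.≤-<-trans la (ℕ.nonTrivial⇒n>1 p {{prime⇒nonTrivial pr}})) (ℕₚ.≤-<-trans lb (ℕ.nonTrivial⇒n>1 p {{prime⇒nonTrivial pr}})) h

    -- When `p` is invertible modulo N, pushing forward along `p` is composition with the inverse.
    -- The Frobenius congruence modulo `p` then compares values 0 and 1, so it is an equality.
    prime-Scales : ∀ {p} → Prime p → Scales p
    prime-Scales {p} pr v h {F} {F'} pF pF' b b' rel x y r = ≤1-≋ pr (b (v * x)) (b' (v * y))
      (subst (λ m → + p' m F x ≋ + p' m F' y [ + p ]) (ℕₚ.*-identityʳ p) (push-Related N ∣-refl pF pF' b b' rel δ-Related pr 1 r) ⟫ (pF , pF'))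
      where
      p' : ℕ → (ℤ → ℕ) → ℤ → ℕ
      p' m = push N (+ m)
      _⟫_ : + p' p F x ≋ + p' p F' y [ + p ] → Per N F × Per N F' → + F (v * x) ≋ + F' (v * y) [ + p ]
      e ⟫ (pF , pF') = ≋-trans (≋-reflexive (cong +_ (sym (push-unit (+ p) v h pF x)))) (≋-trans e (≋-reflexive (cong +_ (push-unit (+ p) v h pF' y))))

    *-Scales : ∀ {a b} → Scales a → Scales b → Scales (a ℕ.* b)
    *-Scales {a} {b} sa sb v h {F} {F'} pF pF' bF bF' rel x y r =
      trans (pF _ _ (≋-sym (comb x))) (trans
        (sb (+ a * v) hb {λ z → F (+ b * v * z)} {λ z → F' (+ b * v * z)} (λ z w p → pF _ _ (≋-*ˡ (+ b * v) p)) (λ z w p → pF' _ _ (≋-*ˡ (+ b * v) p)) (λ z → bF _) (λ z → bF' _)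
          (sa (+ b * v) ha pF pF' bF bF' rel) x y r)
        (pF' _ _ (comb y)))
      where
      h' : + a * + b * v ≋ 1ℤ [ + N ]
      h' = ≋-trans (≋-reflexive (cong (_* v) (sym (ℤₚ.pos-* a b)))) h
      ha : + a * (+ b * v) ≋ 1ℤ [ + N ]
      ha = ≋-trans (≋-reflexive (sym (ℤₚ.*-assoc (+ a) (+ b) v))) h'
      hb : + b * (+ a * v) ≋ 1ℤ [ + N ]
      hb = ≋-trans (≋-reflexive (eq (+ a) (+ b) v)) h'
        where
        eq : ∀ a b v → b * (a * v) ≡ a * b * v
        eq = solve-∀
      comb : ∀ x → + b * v * (+ a * v * x) ≋ v * x [ + N ]
      comb x = ≋-trans (≋-reflexive (eq (+ a) (+ b) v x)) (≋-trans (≋-*ʳ (v * x) h') (≋-reflexive (ℤₚ.*-identityˡ (v * x))))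
        where
        eq : ∀ a b v x → b * v * (a * v * x) ≡ a * b * v * (v * x)
        eq = solve-∀

    1-Scales : Scales 1
    1-Scales v h pF pF' _ _ rel x y r = trans (pF _ _ (one x)) (trans (rel x y r) (sym (pF' _ _ (one y))))
      where
      one : ∀ x → v * x ≋ x [ + N ]
      one x = ≋-trans (≋-*ʳ x (≋-trans (≋-reflexive (sym (ℤₚ.*-identityˡ v))) h)) (≋-reflexive (ℤₚ.*-identityˡ x))

    all-Scales : ∀ m .{{_ : ℕ.NonZero m}} → Scales m
    all-Scales m = subst Scales (sym (PrimeFactorisation.isFactorisation f)) (go (PrimeFactorisation.factors f) (PrimeFactorisation.factorsPrime f))
      where
      f : PrimeFactorisation m
      f = factorise m
      go : ∀ ps → All Prime ps → Scales (product ps)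
      go [] [] = 1-Scales
      go (p ∷ ps) (pr ∷ prs) = *-Scales {p} {product ps} (prime-Scales pr) (go ps prs)

    R-unit : ∀ {u} → Cop (+ N) u → ∀ {x y} → R x y → R (u * x) (u * y)
    R-unit {u} cu {x} {y} r = go (cop-inv cu)
      where
      go : (∃ λ v → u * v ≋ 1ℤ [ + N ]) → R (u * x) (u * y)
      go (v , h) = ind-pos (χ (u * y) ≟F to (χ (u * x))) (λ e → ℕₚ.<⇒≢ (s≤s z≤n)
          (trans (sym e) (trans (sym (all-Scales m u inv {cls (χ (u * x))} {cls (to (χ (u * x)))} (λ a b p → cong (λ z → ind (z ≟F χ (u * x))) (χ-cong p)) (λ a b p → cong (λ z → ind (z ≟F to (χ (u * x)))) (χ-cong p))
            (λ z → ind-≤1 (χ z ≟F χ (u * x))) (λ z → ind-≤1 (χ z ≟F to (χ (u * x)))) (cls-Related (χ (u * x))) x y r)) (ind-yes (χ (u * x) ≟F χ (u * x)) refl))))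
        where
        w : ∃ λ r → r ℕ.< N × (+ r ≋ v [ + N ])
        w = residue N v
        -- A natural number representing the inverse of `u`, so that scaling by `m` composes
        -- functions with `u`. The summand `N` ensures that it is not 0.
        m : ℕ
        m = N ℕ.+ proj₁ w
        inv : + m * u ≋ 1ℤ [ + N ]
        inv = ≋-trans (≋-*ʳ u (≋-trans (≋-reflexive (trans (ℤₚ.pos-+ N (proj₁ w)) (eq (+ N) (+ proj₁ w)))) (≋-trans (≋-shift (+ proj₁ w) 1ℤ) (proj₂ (proj₂ w))))) (≋-trans (≋-reflexive (ℤₚ.*-comm v u)) h)
          where
          eq : ∀ a b → a + b ≡ b + 1ℤ * a
          eq = solve-∀

module Sets {n k : ℕ} (c : Colouring (suc n) k) (circ : IsCirculant c) where
  open SchurRing c circ public using (N; χ; χ-cong; χ-0; χ-neg; χ-onto)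
  open SchurRing c circ using (module Morphism)

  opaque
    -- With the identity as automorphism, `R` becomes equality of colours up to direction, and all
    -- results on `R` become results on the classes themselves.
    id-alg : IsAlgAut c (↔-id (Fin k))
    id-alg r s α β α' β' e = sym (IsCC.intersection (IsCirculant.coherent circ) r s α' β' α β e)

  open Morphism (↔-id (Fin k)) id-alg public using () renaming (conv-Related to conv-Inv; push-Related to push-Inv; R-decompose to ~-decompose′)
  open Units c circ (↔-id (Fin k)) id-alg using () renaming (R-unit to ~-unit′)

  Inv : (ℤ → ℕ) → Set
  Inv F = ∀ {x y} → χ x ≡ χ y → F x ≡ F y

  opaque
    ~-unit : ∀ {u} → Cop (+ N) u → ∀ {x y} → χ x ≡ χ y → χ (u * x) ≡ χ (u * y)
    ~-unit cu h = sym (~-unit′ cu (sym h))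

    ~-decompose : ∀ {x y} → χ x ≡ χ y → ∀ a → ∃ λ a' → (χ a' ≡ χ a) × (χ (y - a') ≡ χ (x - a))
    ~-decompose h a = ~-decompose′ (sym h) a

    search : ∀ {P : ℤ → Set} → (∀ x → Dec (P x)) → (∀ {x y} → x ≋ y [ + N ] → P x → P y) → Dec (∃ P)
    search {P} P? per with any? {N} (λ i → P? (+ toℕ i))
    ... | yes (i , h) = yes (+ toℕ i , h)
    ... | no ¬h = no λ { (x , px) → ¬h (SchurRing.toF c circ x , per (≋-sym (SchurRing.toF-≋ c circ x)) px) }

    search-all : ∀ {P : ℤ → Set} → (∀ x → Dec (P x)) → (∀ {x y} → x ≋ y [ + N ] → P x → P y) → Dec (∀ x → P x)
    search-all {P} P? per with search {λ x → ¬ P x} (λ x → ¬? (P? x)) (λ e np p → np (per (≋-sym e) p))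
    ... | yes (x , np) = no λ h → np (h x)
    ... | no ¬h = yes λ x → decidable-stable (P? x) (λ np → ¬h (x , np))

  record ASet : Set₁ where
    field
      mem : ℤ → Set
      mem? : ∀ x → Dec (mem x)
      inv : ∀ {x y} → χ x ≡ χ y → mem x → mem y
    mem-≋ : ∀ {x y} → x ≋ y [ + N ] → mem x → mem y
    mem-≋ h = inv (χ-cong h)
    ι : ℤ → ℕ
    ι x = ind (mem? x)
    ι-Inv : Inv ι
    ι-Inv {x} {y} h = ind-⇔ (mem? x) (mem? y) (inv h) (inv (sym h))
  open ASet public

  Periodic : ℕ → ASet → Set
  Periodic M A = ∀ {x y} → x ≋ y [ + M ] → mem A x → mem A y

  ι-Per : ∀ {M} A → Periodic M A → Per M (ι A)
  ι-Per A per x y h = ind-⇔ (mem? A x) (mem? A y) (per h) (per (≋-sym h))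

  record IsAGroup (e : ℕ) : Set where
    field
      ∣N : + e ∣ + N
      ag-inv : ∀ {x y} → χ x ≡ χ y → + e ∣ x → + e ∣ y
    instance
      nz : ℕ.NonZero e
      nz = ℕ.≢-nonZero λ { refl → λ0 (0∣⇒≡0 ∣N) }
        where
        λ0 : + N ≢ 0ℤ
        λ0 ()
  open IsAGroup public

  subgroup : ∀ {e} → IsAGroup e → ASet
  subgroup {e} ag = record { mem = + e ∣_ ; mem? = + e ∣?_ ; inv = ag-inv ag }

  subgroup-Periodic : ∀ {e M} (ag : IsAGroup e) → + e ∣ + M → Periodic M (subgroup ag)
  subgroup-Periodic ag d h = ∣-≋ (≋-weaken d h)

  class : ℤ → ASet
  class x = record { mem = λ y → χ y ≡ χ x ; mem? = λ y → χ y ≟F χ x ; inv = λ h e → trans (sym h) e }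

  opaque
    -- A subgroup of ℤ containing N is generated by its least positive element.
    subgroup-index : ∀ {P : ℤ → Set} → (∀ x → Dec (P x)) → P (+ N) → (∀ {x y} → P x → P y → P (x - y)) →
      ∃ λ (e : ℕ) → (∀ x → P x → + e ∣ x) × (∀ x → + e ∣ x → P x)
    subgroup-index {P} P? pN sub = go least
      where
      Least : ℕ → Set
      Least e = 0 ℕ.< e × P (+ e) × (∀ j → 0 ℕ.< j → j ℕ.< e → ¬ P (+ j))
      none : ∀ m → (∃ Least) ⊎ (∀ j → 0 ℕ.< j → j ℕ.≤ m → ¬ P (+ j))
      none zero = inj₂ λ { (suc _) _ () }
      none (suc m) with none m
      ... | inj₁ h = inj₁ h
      ... | inj₂ h with P? (+ suc m)
      ...   | yes p = inj₁ (suc m , s≤s z≤n , p , λ j l l' → h j l (ℕₚ.≤-pred l'))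
      ...   | no np = inj₂ none'
        where
        none' : ∀ j → 0 ℕ.< j → j ℕ.≤ suc m → ¬ P (+ j)
        none' j l l' with ℕₚ.m≤n⇒m<n∨m≡n l'
        ... | inj₁ l″ = h j l (ℕₚ.≤-pred l″)
        ... | inj₂ refl = np
      least : ∃ Least
      least with none N
      ... | inj₁ h = h
      ... | inj₂ h = ⊥-elim (h N (s≤s z≤n) ℕₚ.≤-refl pN)
      p0 : P 0ℤ
      p0 = subst P (ℤₚ.+-inverseʳ (+ N)) (sub pN pN)
      neg : ∀ {x} → P x → P (- x)
      neg {x} p = subst P (ℤₚ.+-identityˡ (- x)) (sub p0 p)
      add : ∀ {x y} → P x → P y → P (x + y)
      add {x} {y} p q = subst P (cong (λ z → x + z) (ℤₚ.neg-involutive y)) (sub p (neg q))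
      mulℕ : ∀ {x} m → P x → P (+ m * x)
      mulℕ {x} zero p = subst P (sym (ℤₚ.*-zeroˡ x)) p0
      mulℕ {x} (suc m) p = subst P (sym (ℤₚ.suc-* (+ m) x)) (add p (mulℕ m p))
      mul : ∀ {x} k → P x → P (k * x)
      mul (+ m) p = mulℕ m p
      mul {x} -[1+ m ] p = subst P (ℤₚ.neg-distribˡ-* (+ suc m) x) (neg (mulℕ (suc m) p))
      go : ∃ Least → ∃ λ (e : ℕ) → (∀ x → P x → + e ∣ x) × (∀ x → + e ∣ x → P x)
      go (suc e , _ , pe , min) = suc e , to , λ { x (divides q refl) → mul q pe }
        where
        to : ∀ x → P x → + suc e ∣ x
        to x px with x %ℕ suc e in eq | n%ℕd<d x (suc e) | a≡a%ℕn+[a/ℕn]*n x (suc e)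
        ... | zero | _ | d = divides (x /ℕ suc e) (trans d (ℤₚ.+-identityˡ _))
        ... | suc r | l | d = ⊥-elim (min (suc r) (s≤s z≤n) l (subst P (trans (cong (_- (x /ℕ suc e) * + suc e) d) (eq' (+ suc r) ((x /ℕ suc e) * + suc e))) (sub px (mul (x /ℕ suc e) pe))))
          where
          eq' : ∀ a b → a + b - b ≡ a
          eq' = solve-∀

-- A-sets and A-groups

opaque
  ind-split : ∀ q e M .{{_ : ℕ.NonZero q}} .{{_ : ℕ.NonZero e}} → M ≡ q ℕ.* e → ∀ x y →
    ind (x ≋? y [ + e ]) ≡ S q (λ k → ind (x ≋? y + k * + e [ + M ]))
  ind-split q e M refl x y with x ≋? y [ + e ]
  ... | yes h = sym (trans (S-cong q (λ k → ind-⇔ (x ≋? y + k * + e [ + M ]) (k ≋? k₁ [ + q ]) (to k) (from k))) (S-δ1 q k₁))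
    where
    k₁ : ℤ
    k₁ = proj₁ (≋-unshift h)
    x≡ : x ≡ y + k₁ * + e
    x≡ = proj₂ (≋-unshift h)
    eq' : ∀ y k k₁ e → (y + k₁ * e) - (y + k * e) ≡ e * (k₁ - k)
    eq' = solve-∀
    M≡ : + M ≡ + e * + q
    M≡ = trans (ℤₚ.pos-* q e) (ℤₚ.*-comm (+ q) (+ e))
    to : ∀ k → x ≋ y + k * + e [ + M ] → k ≋ k₁ [ + q ]
    to k ≋⟨ d ⟩ = ≋-sym ≋⟨ *-cancelˡ-∣ (+ e) {+ q} {k₁ - k} (subst (_∣ + e * (k₁ - k)) M≡ (subst (+ M ∣_) (trans (cong (_- (y + k * + e)) x≡) (eq' y k k₁ (+ e))) d)) ⟩
    from : ∀ k → k ≋ k₁ [ + q ] → x ≋ y + k * + e [ + M ]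
    from k h = ≋⟨ subst (+ M ∣_) (sym (trans (cong (_- (y + k * + e)) x≡) (eq' y k k₁ (+ e)))) (subst (_∣ + e * (k₁ - k)) (sym M≡) (*-monoʳ-∣ (+ e) (≋⇒∣ (≋-sym h)))) ⟩
  ... | no ¬h = sym (trans (S-cong q (λ k → ind-no (x ≋? y + k * + e [ + M ]) (λ h → ¬h (≋-trans (≋-weaken (divides (+ q) (ℤₚ.pos-* q e)) h) (≋-shift y k))))) (trans (S-const q 0) (ℕₚ.*-zeroʳ q)))

  S-coset : ∀ q e M .{{_ : ℕ.NonZero q}} .{{_ : ℕ.NonZero e}} .{{_ : ℕ.NonZero M}} → M ≡ q ℕ.* e → ∀ {F} → Per M F → ∀ y →
    S M (λ x → ind (x ≋? y [ + e ]) ℕ.* F x) ≡ S q (λ k → F (y + k * + e))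
  S-coset q e M M≡ {F} pF y = begin
    S M (λ x → ind (x ≋? y [ + e ]) ℕ.* F x) ≡⟨ S-cong M (λ x → trans (cong (ℕ._* F x) (ind-split q e M M≡ x y)) (sym (S-*ʳ q (F x) _))) ⟩
    S M (λ x → S q (λ k → ind (x ≋? y + k * + e [ + M ]) ℕ.* F x)) ≡⟨ S-swap M q _ ⟩
    S q (λ k → S M (λ x → ind (x ≋? y + k * + e [ + M ]) ℕ.* F x)) ≡⟨ S-cong q (λ k → S-δ M pF (y + k * + e)) ⟩
    S q (λ k → F (y + k * + e)) ∎
    where open ≡-Reasoning

module Theory {n k : ℕ} (c : Colouring (suc n) k) (circ : IsCirculant c) where
  open Sets c circ
  open GroupSemiring using (conv; push; δ)

  Corr : ℕ → (ℤ → ℕ) → (ℤ → ℕ) → ℤ → ℕ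
  Corr M F K g = S M (λ x → F x ℕ.* K (g + x))

  opaque
    Corr-Inv : ∀ M .{{_ : ℕ.NonZero M}} → + M ∣ + N → ∀ {F K} → Per M F → Per M K → Inv F → Inv K → Inv (Corr M F K)
    Corr-Inv M d {F} {K} pF pK iF iK {x} {y} h = trans (as-conv x) (trans (sym (conv-Inv M d {λ z → F (- z)} {λ z → F (- z)} {K} {K} (λ a b p → pF _ _ (≋-neg p)) (λ a b p → pF _ _ (≋-neg p)) pK pK
        (λ a b r → iF (χ-neg (sym r))) (λ a b r → iK (sym r)) y x h)) (sym (as-conv y)))
      where
      as-conv : ∀ g → Corr M F K g ≡ conv M (λ z → F (- z)) K g
      as-conv g = trans (sym (S-neg M {λ x → F x ℕ.* K (g + x)} (λ a b p → cong₂ ℕ._*_ (pF _ _ p) (pK _ _ (≋-+ˡ g p))))) refl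

  -- This serves to spread a containment: once g + Q ⊆ P is known for one g, it holds for the whole
  -- class of g. Invariance follows by splitting g + w, as a related element, along -w.
  translators : ASet → ASet → ASet
  translators P Q = record
    { mem = λ g → ∀ w → mem Q w → mem P (g + w)
    ; mem? = λ g → search-all (λ w → mem? Q w →-dec mem? P (g + w)) (λ e h q → mem-≋ P (≋-+ˡ g e) (h (mem-≋ Q (≋-sym e) q)))
    ; inv = λ {x} {y} h t w q → go {x} {y} h t w q (~-decompose (sym h) (- w))
    }
    where
    go : ∀ {x y} → χ x ≡ χ y → (∀ w → mem Q w → mem P (x + w)) → ∀ w → mem Q w → (∃ λ a' → (χ a' ≡ χ (- w)) × (χ (x - a') ≡ χ (y - - w))) → mem P (y + w)
    go {x} {y} h t w q (a , e₁ , e₂) = inv P (trans e₂ (cong (λ z → χ (y + z)) (ℤₚ.neg-involutive w)))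
      (t (- a) (inv Q (trans (cong χ (sym (ℤₚ.neg-involutive w))) (χ-neg (sym e₁))) q))

  opaque
    -- Negatives are multiples: `n` times `y` is `- y` modulo N = n + 1.
    add⇒sub : ∀ {P : ℤ → Set} → (∀ {x y} → x ≋ y [ + N ] → P x → P y) → P 0ℤ → (∀ {x y} → P x → P y → P (x + y)) → ∀ {x y} → P x → P y → P (x - y)
    add⇒sub {P} resp p0 add {x} {y} px py = add px (resp eq (mulℕ n))
      where
      mulℕ : ∀ m → P (+ m * y)
      mulℕ zero = subst P (sym (ℤₚ.*-zeroˡ y)) p0
      mulℕ (suc m) = subst P (sym (ℤₚ.suc-* (+ m) y)) (add py (mulℕ m))
      eq : + n * y ≋ - y [ + N ]
      eq = ≋⟨ divides y (trans (e (+ n) y) (cong (y *_) (sym (ℤₚ.pos-+ 1 n)))) ⟩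
        where
        e : ∀ n y → n * y - - y ≡ y * (1ℤ + n)
        e = solve-∀

  record Indexed (P : ℤ → Set) : Set where
    field
      index : ℕ
      isAGroup : IsAGroup index
      ∈⇒∣ : ∀ {x} → P x → + index ∣ x
      ∣⇒∈ : ∀ {x} → + index ∣ x → P x
  open Indexed public

  opaque
    agroup-of : (A : ASet) → mem A 0ℤ → (∀ {x y} → mem A x → mem A y → mem A (x + y)) → Indexed (mem A)
    agroup-of A a0 add = go (subgroup-index (mem? A) (mem-≋ A (≋-sym (∣⇒≋0 ∣-refl)) a0) (add⇒sub (mem-≋ A) a0 add))
      where
      go : (∃ λ (e : ℕ) → (∀ x → mem A x → + e ∣ x) × (∀ x → + e ∣ x → mem A x)) → Indexed (mem A)
      go (e , to , from) = record
        { index = e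
        ; isAGroup = record { ∣N = to _ (mem-≋ A (≋-sym (∣⇒≋0 ∣-refl)) a0) ; ag-inv = λ h d → to _ (inv A h (from _ d)) }
        ; ∈⇒∣ = λ {x} → to x ; ∣⇒∈ = λ {x} → from x }

    radical : (A : ASet) → Indexed (λ t → ∀ x → mem A x → mem A (t + x))
    radical A = agroup-of (translators A A) (λ w m → subst (mem A) (sym (ℤₚ.+-identityˡ w)) m)
      (λ {x} {y} p q w m → subst (mem A) (sym (ℤₚ.+-assoc x y w)) (p (y + w) (q w m)))

  module _ (A : ASet) where
    -- Keeping the summands in the data lets a sum be carried to a related element one summand at a
    -- time, which is why the group generated by an A-set is an A-group.
    data Sum : ℤ → Set where
      nil : ∀ {z} → + N ∣ z → Sum z
      add : ∀ {z} a → mem A a → Sum (z - a) → Sum z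

    opaque
      Sum-inv : ∀ {z y} → χ z ≡ χ y → Sum z → Sum y
      Sum-inv h (nil d) = nil (χ-0 (trans (sym h) (χ-cong (∣⇒≋0 d))))
      Sum-inv {z} {y} h (add a m s) = go (~-decompose h a)
        where
        go : (∃ λ a' → (χ a' ≡ χ a) × (χ (y - a') ≡ χ (z - a))) → Sum y
        go (a' , e , e') = add a' (inv A (sym e) m) (Sum-inv (sym e') s)

      Sum-+ : ∀ {x y} → Sum x → Sum y → Sum (x + y)
      Sum-+ {x} {y} (nil d) t = Sum-inv (χ-cong (≋-sym (≋-trans (≋-+ʳ y (∣⇒≋0 d)) (≋-reflexive (ℤₚ.+-identityˡ y))))) t
      Sum-+ {x} {y} (add a m s) t = add a m (subst Sum (eq x y a) (Sum-+ s t))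
        where
        eq : ∀ x y a → x - a + y ≡ x + y - a
        eq = solve-∀

      Sum-mulℕ : ∀ {x} m → Sum x → Sum (+ m * x)
      Sum-mulℕ {x} zero s = nil (subst (+ N ∣_) (sym (ℤₚ.*-zeroˡ x)) ∣0)
      Sum-mulℕ {x} (suc m) s = subst Sum (sym (ℤₚ.suc-* (+ m) x)) (Sum-+ s (Sum-mulℕ m s))

      Sum-mul : ∀ {x} k → Sum x → Sum (k * x)
      Sum-mul (+ m) s = Sum-mulℕ m s
      Sum-mul {x} -[1+ m ] s = subst Sum (trans (ℤₚ.+-identityˡ _) (ℤₚ.neg-distribˡ-* (+ suc m) x)) (add⇒sub (λ h → Sum-inv (χ-cong h)) (nil ∣0) Sum-+ (nil {0ℤ} ∣0) (Sum-mulℕ (suc m) s))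

      Sum-∣ : ∀ {k} → k ∣ + N → (∀ x → mem A x → k ∣ x) → ∀ {z} → Sum z → k ∣ z
      Sum-∣ d h (nil d') = ∣-trans d d'
      Sum-∣ {k} d h {z} (add a m s) = subst (k ∣_) (eq z a) (∣m∣n⇒∣m+n (Sum-∣ d h s) (h a m))
        where
        eq : ∀ z a → z - a + a ≡ z
        eq = solve-∀

      generator : ∀ m → ∃ λ (e : ℕ) → (+ e ∣ + N) × Sum (+ e) × (∀ i → i ℕ.< m → mem A (+ i) → + e ∣ + i)
      generator zero = N , ∣-refl , nil ∣-refl , λ i ()
      generator (suc m) with generator m | mem? A (+ m)
      ... | e , d , s , h | no ¬a = e , d , s , h'
        where
        h' : ∀ i → i ℕ.< suc m → mem A (+ i) → + e ∣ + i
        h' i l a with ℕₚ.m≤n⇒m<n∨m≡n (ℕₚ.≤-pred l)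
        ... | inj₁ l' = h i l' a
        ... | inj₂ refl = ⊥-elim (¬a a)
      ... | e , d , s , h | yes a = step (gcdℤ (+ e) (+ m))
        where
        step : (∃ λ g → (g ∣ + e) × (g ∣ + m) × ∃ λ u → ∃ λ t → u * + e + t * + m ≡ g) → ∃ λ (e : ℕ) → (+ e ∣ + N) × Sum (+ e) × (∀ i → i ℕ.< suc m → mem A (+ i) → + e ∣ + i)
        step (g , ge , gm , u , t , eq) = ∣ g ∣ , ∣-trans (abs∣ ge) d , abs-Sum g (subst Sum eq (Sum-+ (Sum-mul u s) (Sum-mul t (add (+ m) a (nil (subst (+ N ∣_) (sym (ℤₚ.+-inverseʳ (+ m))) ∣0)))))) , h'
          where
          abs∣ : ∀ {x} → g ∣ x → + ∣ g ∣ ∣ x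
          abs∣ d = ∣-trans (∣ᵤ⇒∣ ℕ∣.∣-refl) d
          abs-Sum : ∀ g → Sum g → Sum (+ ∣ g ∣)
          abs-Sum (+ g) s = s
          abs-Sum -[1+ g ] s = subst Sum (ℤₚ.-1*i≡-i -[1+ g ]) (Sum-mul -1ℤ s)
          h' : ∀ i → i ℕ.< suc m → mem A (+ i) → + ∣ g ∣ ∣ + i
          h' i l a with ℕₚ.m≤n⇒m<n∨m≡n (ℕₚ.≤-pred l)
          ... | inj₁ l' = abs∣ (∣-trans ge (h i l' a))
          ... | inj₂ refl = abs∣ gm

    record Generated : Set where
      field
        gen : ℕ
        gen-AG : IsAGroup gen
        gen-∣ : ∀ {x} → mem A x → + gen ∣ x
        gen-least : ∀ {k} → k ∣ + N → (∀ x → mem A x → k ∣ x) → k ∣ + gen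
    open Generated public

    opaque
      generated : Generated
      generated = go (generator N)
        where
        go : (∃ λ (e : ℕ) → (+ e ∣ + N) × Sum (+ e) × (∀ i → i ℕ.< N → mem A (+ i) → + e ∣ + i)) → Generated
        go (e , d , s , h) = record
          { gen = e
          ; gen-AG = record { ∣N = d ; ag-inv = λ { x~y (divides q refl) → Sum-∣ d all (Sum-inv x~y (Sum-mul q s)) } }
          ; gen-∣ = λ {x} → all x
          ; gen-least = λ kN kA → Sum-∣ kN kA s }
          where
          all : ∀ x → mem A x → + e ∣ x
          all x a with residue N x
          ... | r , l , x≋ = ∣-≋ (≋-weaken d x≋) (h r l (mem-≋ A (≋-sym x≋) a))

  -- An A-set because modulo p the push-forward agrees with a power in the Schur ring.
  frobenius-set : ∀ {M} → IsAGroup M → (A : ASet) → Periodic M A → ∀ {p} → Prime p → ℕ → ASet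
  frobenius-set {M} ag A per {p} pr a = record
    { mem = λ g → ¬ + p ∣ + push M {{nz ag}} (+ (p ℕ.^ a)) (ι A) g
    ; mem? = λ g → ¬? (+ p ∣? + push M {{nz ag}} (+ (p ℕ.^ a)) (ι A) g)
    ; inv = λ h ¬d d → ¬d (∣-≋ (rel h) d) }
    where
    rel : ∀ {x y} → χ x ≡ χ y → + push M {{nz ag}} (+ (p ℕ.^ a)) (ι A) y ≋ + push M {{nz ag}} (+ (p ℕ.^ a)) (ι A) x [ + p ]
    rel h = push-Inv M {{nz ag}} (∣N ag) (ι-Per A per) (ι-Per A per) (λ x → ind-≤1 (mem? A x)) (λ x → ind-≤1 (mem? A x)) (λ x y r → ι-Inv A (sym r))
      (λ x y r → ind-⇔ (x ≋? 0ℤ [ + M ]) (y ≋? 0ℤ [ + M ]) (λ e → ∣⇒≋0 (ag-inv ag (sym r) (≋0⇒∣ e))) (λ e → ∣⇒≋0 (ag-inv ag r (≋0⇒∣ e)))) pr a h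

  module _ {M} (ag : IsAGroup M) (A : ASet) (per : Periodic M A) {p} (pr : Prime p) (e₀ : ℕ) (M≡ : M ≡ p ℕ.* e₀) where
    private
      instance
        _ = nz ag
        _ = prime⇒nonZero pr
        e₀-nz : ℕ.NonZero e₀
        e₀-nz = ℕ.≢-nonZero λ { refl → ℕ.≢-nonZero⁻¹ M (trans M≡ (ℕₚ.*-zeroʳ p)) }

    -- Modulo M = p e₀ the elements whose p-fold is p x form the coset x + e₀ℤ, which has p
    -- elements. The number of them in `A` is nonzero modulo p exactly if the coset meets `A`
    -- without lying in it; such a coset is called broken below. Thus `Ω` is p times the part of `A`
    -- in broken cosets.
    Ω : ASet
    Ω = frobenius-set ag A per pr 1

    Ω-Periodic : Periodic M Ω
    Ω-Periodic h ¬d d = ¬d (subst (λ z → + p ∣ + z) (sym (S-cong M (λ x → cong (ℕ._* ι A x) (ind-⇔ (+ (p ℕ.^ 1) * x ≋? _ [ + M ]) (+ (p ℕ.^ 1) * x ≋? _ [ + M ]) (λ e → ≋-trans e h) (λ e → ≋-trans e (≋-sym h)))))) d)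

    opaque
      private
        count : ∀ {x g} → + p * x ≋ g [ + M ] → push M (+ (p ℕ.^ 1)) (ι A) g ≡ S p (λ k → ι A (x + k * + e₀))
        count {x} {g} h = trans (S-cong M (λ z → cong (ℕ._* ι A z) (ind-⇔ (+ (p ℕ.^ 1) * z ≋? g [ + M ]) (z ≋? x [ + e₀ ]) (to z) (from z)))) (S-coset p e₀ M M≡ (ι-Per A per) x)
          where
          p1 : ∀ z → + (p ℕ.^ 1) * z ≡ + p * z
          p1 z = cong (λ m → + m * z) (ℕₚ.*-identityʳ p)
          M≡ᶻ : + M ≡ + p * + e₀
          M≡ᶻ = trans (cong +_ M≡) (ℤₚ.pos-* p e₀)
          eq : ∀ p z x → p * z - p * x ≡ p * (z - x)
          eq = solve-∀
          to : ∀ z → + (p ℕ.^ 1) * z ≋ g [ + M ] → z ≋ x [ + e₀ ]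
          to z r = ≋⟨ *-cancelˡ-∣ (+ p) (subst (_∣ + p * (z - x)) M≡ᶻ (subst (+ M ∣_) (eq (+ p) z x) (≋⇒∣ (≋-trans (≋-reflexive (sym (p1 z))) (≋-trans r (≋-sym h)))))) ⟩
          from : ∀ z → z ≋ x [ + e₀ ] → + (p ℕ.^ 1) * z ≋ g [ + M ]
          from z r = ≋-trans (≋-reflexive (p1 z)) (≋-trans ≋⟨ subst (+ M ∣_) (sym (eq (+ p) z x)) (subst (_∣ + p * (z - x)) (sym M≡ᶻ) (*-monoʳ-∣ (+ p) (≋⇒∣ r))) ⟩ h)

        ≤p : ∀ x → S p (λ k → ι A (x + k * + e₀)) ℕ.≤ p
        ≤p x = ℕₚ.≤-trans (S-≤ p (λ k → ind-≤1 (mem? A (x + k * + e₀)))) (ℕₚ.≤-reflexive (trans (S-const p 1) (ℕₚ.*-identityʳ p)))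

        perₖ : ∀ x → Per p (λ k → ι A (x + k * + e₀))
        perₖ x k k' h = ι-Per A per _ _ (≋-+ˡ x ≋⟨ subst (_∣ k * + e₀ - k' * + e₀) (sym (trans (cong +_ M≡) (ℤₚ.pos-* p e₀))) (subst (+ p * + e₀ ∣_) (eq k k' (+ e₀)) (subst (_∣ + e₀ * (k - k')) (ℤₚ.*-comm (+ e₀) (+ p)) (*-monoʳ-∣ (+ e₀) (≋⇒∣ h)))) ⟩)
          where
          eq : ∀ k k' e → e * (k - k') ≡ k * e - k' * e
          eq = solve-∀

      Ω-in : ∀ {x} k → mem A x → ¬ mem A (x + k * + e₀) → mem Ω (+ p * x)
      Ω-in {x} k m ¬m d = ℕₚ.<⇒≢ lt (ℕₚ.≤-antisym (≤p x) (ℕ∣.∣⇒≤ {{ℕ.≢-nonZero (ℕₚ.>⇒≢ (ℕₚ.<-≤-trans (s≤s z≤n) ge1))}} (∣⇒∣ᵤ (subst (λ z → + p ∣ + z) (count {x} ≋-refl) d))))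
        where
        ge1 : 1 ℕ.≤ S p (λ k → ι A (x + k * + e₀))
        ge1 = ℕₚ.≤-trans (ℕₚ.≤-reflexive (sym (ind-yes (mem? A (x + 0ℤ * + e₀)) (subst (mem A) (eq x (+ e₀)) m)))) (S-term≤ p (perₖ x) 0ℤ)
          where
          eq : ∀ x e → x ≡ x + 0ℤ * e
          eq = solve-∀
        lt : S p (λ k → ι A (x + k * + e₀)) ℕ.< p
        lt = ℕₚ.≤-trans (ℕₚ.≤-trans (ℕₚ.≤-reflexive (ℕₚ.+-comm 1 _)) (ℕₚ.≤-trans (ℕₚ.+-monoʳ-≤ (S p (λ k → ι A (x + k * + e₀))) one) (ℕₚ.≤-reflexive (sym (S-+ p _ _)))))
          (ℕₚ.≤-trans (S-≤ p (λ k' → compl (mem? A (x + k' * + e₀)))) (ℕₚ.≤-reflexive (trans (S-const p 1) (ℕₚ.*-identityʳ p))))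
          where
          compl : ∀ {B : Set} (d : Dec B) → ind d ℕ.+ (1 ℕ.∸ ind d) ℕ.≤ 1
          compl (yes _) = s≤s z≤n
          compl (no _) = s≤s z≤n
          one : 1 ℕ.≤ S p (λ k' → 1 ℕ.∸ ι A (x + k' * + e₀))
          one = ℕₚ.≤-trans (ℕₚ.≤-reflexive (sym (cong (1 ℕ.∸_) (ind-no (mem? A (x + k * + e₀)) ¬m)))) (S-term≤ p {λ k' → 1 ℕ.∸ ι A (x + k' * + e₀)} (λ a b h → cong (1 ℕ.∸_) (perₖ x a b h)) k)

      Ω-out : ∀ {g} → mem Ω g → ∃ λ x → mem A x × (∃ λ k → ¬ mem A (x + k * + e₀)) × (+ p * x ≋ g [ + M ])
      Ω-out {g} ω = go (S-nonzero M _ (λ e → ω (subst (λ z → + p ∣ + z) (sym e) ∣0)))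
        where
        go : (∃ λ x → ind (+ (p ℕ.^ 1) * x ≋? g [ + M ]) ℕ.* ι A x ≢ 0) → ∃ λ x → mem A x × (∃ λ k → ¬ mem A (x + k * + e₀)) × (+ p * x ≋ g [ + M ])
        go (x , ne) = x , m , out , h
          where
          m : mem A x
          m = ind-pos (mem? A x) (λ e → ne (trans (cong (ind (+ (p ℕ.^ 1) * x ≋? g [ + M ]) ℕ.*_) e) (ℕₚ.*-zeroʳ (ind (+ (p ℕ.^ 1) * x ≋? g [ + M ])))))
          h : + p * x ≋ g [ + M ]
          h = ≋-trans (≋-reflexive (cong (λ m → + m * x) (sym (ℕₚ.*-identityʳ p)))) (ind-pos (+ (p ℕ.^ 1) * x ≋? g [ + M ]) (λ e → ne (cong (ℕ._* ι A x) e)))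
          out : ∃ λ k → ¬ mem A (x + k * + e₀)
          out with any? {p} (λ i → ¬? (mem? A (x + + toℕ i * + e₀)))
          ... | yes (i , ¬m) = + toℕ i , ¬m
          ... | no all = ⊥-elim (ω (subst (λ z → + p ∣ + z) (sym (trans (count h) full)) ∣-refl))
            where
            in' : ∀ k → mem A (x + k * + e₀)
            in' k = go' (residue p k)
              where
              go' : (∃ λ r → r ℕ.< p × (+ r ≋ k [ + p ])) → mem A (x + k * + e₀)
              go' (r , l , h) = ind-pos (mem? A (x + k * + e₀)) (λ e → 0≢1 (trans (sym e) (trans (sym (perₖ x _ _ h)) (ind-yes (mem? A (x + + r * + e₀)) (subst (λ r → mem A (x + + r * + e₀)) (toℕ-fromℕ< l) (decidable-stable (mem? A _) (λ ¬m → all (fromℕ< l , ¬m))))))))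
                where
                0≢1 : 0 ≡ 1 → ⊥
                0≢1 ()
            full : S p (λ k → ι A (x + k * + e₀)) ≡ p
            full = trans (S-cong p (λ k → ind-yes (mem? A (x + k * + e₀)) (in' k))) (trans (S-const p 1) (ℕₚ.*-identityʳ p))

-- The q-part and the prime-to-q part of a modulus M = q^(b+1) s with e₀ = M/q

module Local {N M : ℕ} (N≢0 : + N ≢ 0ℤ) (M∣N : + M ∣ + N) {q : ℕ} (pr : Prime q) {e₀ : ℕ} (M≡ : M ≡ q ℕ.* e₀) {b : ℕ} {s : ℤ} (e₀≡ : + e₀ ≡ q ↑ b * s) (q∤s : ¬ + q ∣ s) where

  opaque
    M≡ᶻ : + M ≡ q ↑ suc b * s
    M≡ᶻ = trans (cong +_ M≡) (trans (ℤₚ.pos-* q e₀) (trans (cong (+ q *_) e₀≡) (trans (sym (ℤₚ.*-assoc (+ q) (q ↑ b) s)) (cong (_* s) (sym (↑-suc q b))))))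

    M≡qe₀ : + M ≡ + q * + e₀
    M≡qe₀ = trans (cong +_ M≡) (ℤₚ.pos-* q e₀)

    s∣e₀ : s ∣ + e₀
    s∣e₀ = divides (q ↑ b) e₀≡

    s∣M : s ∣ + M
    s∣M = divides (q ↑ suc b) M≡ᶻ

    e₀∣M : + e₀ ∣ + M
    e₀∣M = divides (+ q) M≡qe₀

    qb∣e₀ : q ↑ b ∣ + e₀
    qb∣e₀ = divides s (trans e₀≡ (ℤₚ.*-comm (q ↑ b) s))

    qb∣M : q ↑ suc b ∣ + M
    qb∣M = divides s (trans M≡ᶻ (ℤₚ.*-comm (q ↑ suc b) s))

    M∣-local : ∀ {x} → q ↑ suc b ∣ x → s ∣ x → + M ∣ x
    M∣-local {x} d d' = subst (_∣ x) (sym M≡ᶻ) (cop-∣-* (cop-↑-∤ pr (suc b) q∤s) d d')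

    ≋-local : ∀ {x y} → x ≋ y [ q ↑ suc b ] → x ≋ y [ s ] → x ≋ y [ + M ]
    ≋-local ≋⟨ d ⟩ ≋⟨ d' ⟩ = ≋⟨ M∣-local d d' ⟩

    M∤e₀ : ¬ + M ∣ + e₀
    M∤e₀ d = q∤s (cancel-↑ pr b (subst (_∣ q ↑ b * s) (trans (↑-suc q b) (ℤₚ.*-comm (+ q) (q ↑ b))) (subst (q ↑ suc b ∣_) e₀≡ (∣-trans qb∣M d))))

    associate-unit : ∀ {w x' y' x y} → x ≡ q ↑ w * x' → y ≡ q ↑ w * y' → ¬ + q ∣ x' → ¬ + q ∣ y' → x ≋ y [ s ] → ∀ c → c ℕ.≤ suc b → x' ≋ y' [ q ↑ c ] →
      ∃ λ u → Cop (+ N) u × (u ≋ 1ℤ [ s ]) × (u ≋ 1ℤ [ q ↑ c ]) × (u * x ≋ y [ + M ])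
    associate-unit {w} {x'} {y'} {x} {y} refl refl ¬x ¬y xy c l h = go (unit-taking pr N≢0 (suc b) s (subst (_∣ + N) M≡ᶻ M∣N) q∤s c x' y' ¬x ¬y h l)
      where
      go : (∃ λ u → Cop (+ N) u × (u ≋ 1ℤ [ s ]) × (u ≋ 1ℤ [ q ↑ c ]) × (u * x' ≋ y' [ q ↑ suc b ])) → ∃ λ u → Cop (+ N) u × (u ≋ 1ℤ [ s ]) × (u ≋ 1ℤ [ q ↑ c ]) × (u * x ≋ y [ + M ])
      go (u , cu , us , uc , ux) = u , cu , us , uc ,
        ≋-local (≋-trans (≋-reflexive (eq u (q ↑ w) x')) (≋-*ˡ (q ↑ w) ux)) (≋-trans (≋-*ʳ x us) (≋-trans (≋-reflexive (ℤₚ.*-identityˡ x)) xy))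
        where
        eq : ∀ u a x → u * (a * x) ≡ a * (u * x)
        eq = solve-∀

    -- If the valuation of x is below b, then x and x + k e₀ have the same valuation and agree
    -- modulo s, so they are unit multiples. Hence a set stable under these units can break a coset
    -- only at multiples of q^b. The congruence modulo q^(b-w) records how close u is to 1.
    shift-unit : ∀ {w x' x} → x ≡ q ↑ w * x' → ¬ + q ∣ x' → w ℕ.< b → ∀ k →
      ∃ λ u → Cop (+ N) u × (u ≋ 1ℤ [ s ]) × (u ≋ 1ℤ [ q ↑ (b ℕ.∸ w) ]) × (u * x ≋ x + k * + e₀ [ + M ])
    shift-unit {w} {x'} {x} refl ¬x l k = associate-unit {w} refl eq ¬x ¬y x≋y (b ℕ.∸ w) (ℕₚ.≤-trans (ℕₚ.m∸n≤m b w) (ℕₚ.n≤1+n b)) (≋-sym (≋-trans (≋-+ˡ x' (∣⇒≋0 (∣m⇒∣m*n s (∣n⇒∣m*n k ∣-refl)))) (≋-reflexive (ℤₚ.+-identityʳ x'))))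
      where
      y' : ℤ
      y' = x' + k * q ↑ (b ℕ.∸ w) * s
      eq : q ↑ w * x' + k * + e₀ ≡ q ↑ w * y'
      eq = trans (cong (λ z → q ↑ w * x' + k * z) (trans e₀≡ (cong (_* s) (trans (cong (q ↑_) (sym (ℕₚ.m+[n∸m]≡n (ℕₚ.<⇒≤ l)))) (↑-+ q w (b ℕ.∸ w)))))) (e (q ↑ w) (q ↑ (b ℕ.∸ w)) x' k s)
        where
        e : ∀ a a' x k s → a * x + k * (a * a' * s) ≡ a * (x + k * a' * s)
        e = solve-∀
      q∣ : + q ∣ q ↑ (b ℕ.∸ w)
      q∣ = subst (λ z → + q ∣ q ↑ z) (sym (ℕₚ.+-∸-assoc 1 l)) (p∣↑ q (b ℕ.∸ suc w))
      ¬y : ¬ + q ∣ y'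
      ¬y d = ¬x (∣-≋ (≋-trans (≋-+ˡ x' (∣⇒≋0 (∣m⇒∣m*n s (∣n⇒∣m*n k q∣)))) (≋-reflexive (ℤₚ.+-identityʳ x'))) d)
      x≋y : q ↑ w * x' ≋ q ↑ w * x' + k * + e₀ [ s ]
      x≋y = ≋-sym (≋-weaken s∣e₀ (≋-shift (q ↑ w * x') k))

    top-unit : ∀ {x y} → q ↑ b ∣ x → ¬ q ↑ suc b ∣ x → q ↑ b ∣ y → ¬ q ↑ suc b ∣ y → x ≋ y [ s ] →
      ∃ λ u → Cop (+ N) u × (u ≋ 1ℤ [ s ]) × (u * x ≋ y [ + M ])
    top-unit {x} {y} (divides x' ex) ¬x (divides y' ey) ¬y xy = go (associate-unit {b} (trans ex (ℤₚ.*-comm x' (q ↑ b))) (trans ey (ℤₚ.*-comm y' (q ↑ b)))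
        (prim ex ¬x) (prim ey ¬y) xy 0 z≤n ≋⟨ 0↑∣ ⟩)
      where
      prim : ∀ {x x'} → x ≡ x' * q ↑ b → ¬ q ↑ suc b ∣ x → ¬ + q ∣ x'
      prim refl ¬x (divides r refl) = ¬x (divides r (trans (ℤₚ.*-assoc r (+ q) (q ↑ b)) (cong (r *_) (sym (↑-suc q b)))))
      go : (∃ λ u → Cop (+ N) u × (u ≋ 1ℤ [ s ]) × (u ≋ 1ℤ [ q ↑ 0 ]) × (u * x ≋ y [ + M ])) → ∃ λ u → Cop (+ N) u × (u ≋ 1ℤ [ s ]) × (u * x ≋ y [ + M ])
      go (u , cu , us , _ , ux) = u , cu , us , ux

    -- As e₀ is q^b s with s invertible modulo q, a multiple of e₀ cancels the q^b-digit of x. The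
    -- resulting element is called the foot of the coset x + e₀ℤ below; it is unique modulo M.
    coset-zero : ∀ {x} → q ↑ b ∣ x → ∃ λ k → q ↑ suc b ∣ x - k * + e₀
    coset-zero {x} (divides x' refl) = go (inverse-mod pr 1 q∤s)
      where
      go : (∃ λ t → (s * t ≋ 1ℤ [ q ↑ 1 ]) × ¬ + q ∣ t) → ∃ λ k → q ↑ suc b ∣ x' * q ↑ b - k * + e₀
      go (t , ≋⟨ divides r h ⟩ , _) = x' * t , divides (- (x' * r)) (trans (cong (λ z → x' * q ↑ b - x' * t * z) e₀≡)
        (trans (eq₁ x' t s (q ↑ b)) (trans (cong (λ z → - (x' * z * q ↑ b)) (trans h (cong (r *_) (↑-1 q)))) (trans (eq₂ x' r (+ q) (q ↑ b)) (cong (- (x' * r) *_) (sym (↑-suc q b)))))))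
        where
        eq₁ : ∀ x t s a → x * a - x * t * (a * s) ≡ - (x * (s * t - 1ℤ) * a)
        eq₁ = solve-∀
        eq₂ : ∀ x r q a → - (x * (r * q) * a) ≡ - (x * r) * (q * a)
        eq₂ = solve-∀

    -- On multiples of q^(b+1) this unit acts modulo M as multiplication by q. Since units respect
    -- classes, it allows the factor q in `Ω` to be undone within A-sets.
    q-unit : ∃ λ u → Cop (+ N) u × (u ≋ + q [ s ])
    q-unit = go (prime-split pr N≢0)
      where
      go : (∃ λ b' → ∃ λ s' → (+ N ≡ q ↑ b' * s') × ¬ + q ∣ s') → ∃ λ u → Cop (+ N) u × (u ≋ + q [ s ])
      go (b' , s' , N≡ , ¬s') = fin (CRT₂ (cop-↑-∤ pr b' ¬s') 1ℤ (+ q))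
        where
        fin : (∃ λ u → (u ≋ 1ℤ [ q ↑ b' ]) × (u ≋ + q [ s' ])) → ∃ λ u → Cop (+ N) u × (u ≋ + q [ s ])
        fin (u , h , h') = u , subst (λ z → Cop z u) (sym N≡) (cop-*ˡ (cop-≋ (≋-sym h) cop-1) (cop-≋ (≋-sym h') (cop-sym (prime-cop pr ¬s')))) ,
          ≋-weaken (cop-cancel (cop-sym (cop-↑-∤ pr b' q∤s)) (∣-trans s∣M (subst (+ M ∣_) N≡ M∣N))) h'

-- The classes meeting e₀ℤ outside Mℤ

module TopLayer {n k : ℕ} (c : Colouring (suc n) k) (circ : IsCirculant c) where
  open Sets c circ
  open Theory c circ

  N≢0 : + N ≢ 0ℤ
  N≢0 ()

  class-shift : ∀ {M} → IsAGroup M → ∀ {x y g} → x ≋ y [ + M ] → χ x ≡ χ g → ∃ λ g' → (g' ≋ g [ + M ]) × (χ y ≡ χ g')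
  class-shift {M} ag {x} {y} {g} h e = go (~-decompose e (x - y))
    where
    eq : ∀ x y → x - (x - y) ≡ y
    eq = solve-∀
    eq' : ∀ g a → g - a - g ≡ - a
    eq' = solve-∀
    go : (∃ λ a' → (χ a' ≡ χ (x - y)) × (χ (g - a') ≡ χ (x - (x - y)))) → ∃ λ g' → (g' ≋ g [ + M ]) × (χ y ≡ χ g')
    go (a , e₁ , e₂) = g - a , ≋⟨ subst (+ M ∣_) (sym (eq' g a)) (∣m⇒∣-m (ag-inv ag (sym e₁) (≋⇒∣ h))) ⟩ , sym (trans e₂ (cong χ (eq x y)))

  module _ {M} (ag : IsAGroup M) {q} (pr : Prime q) {e₀} (M≡ : M ≡ q ℕ.* e₀) {b s} (e₀≡ : + e₀ ≡ q ↑ b * s) (q∤s : ¬ + q ∣ s) where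
    open Local N≢0 (∣N ag) pr M≡ e₀≡ q∤s

    Top : ℤ → Set
    Top g = (+ e₀ ∣ g) × (¬ + M ∣ g)

    Β : ASet
    Β = record { mem = λ x → ∃ λ g → Top g × (χ x ≡ χ g)
      ; mem? = λ x → search (λ g → ((+ e₀ ∣? g) ×-dec ¬? (+ M ∣? g)) ×-dec (χ x ≟F χ g)) (λ h ((d , ¬d) , e) → (∣-≋ (≋-weaken (∣-trans e₀∣M (∣N ag)) h) d , λ d' → ¬d (∣-≋ (≋-weaken (∣N ag) (≋-sym h)) d')) , trans e (χ-cong h))
      ; inv = λ h (g , t , e) → g , t , trans (sym h) e }

    -- The classes of the elements of e₀ℤ ∖ Mℤ make up a difference H ∖ V of A-groups.
    record Layer : Set where
      field
        V H : ℕ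
        V-AG : IsAGroup V
        H-AG : IsAGroup H
        V∣M : + V ∣ + M
        H∣e₀ : + H ∣ + e₀
        H∣V : + H ∣ + V
        Β⇒H : ∀ {x} → mem Β x → + H ∣ x
        Β⇒¬V : ∀ {x} → mem Β x → ¬ + V ∣ x
        H∖V⇒Β : ∀ {x} → + H ∣ x → ¬ + V ∣ x → mem Β x

    opaque
      Β-Periodic : Periodic M Β
      Β-Periodic {x} {y} h (g , (d , ¬d) , e) = go (class-shift ag h e)
        where
        go : (∃ λ g' → (g' ≋ g [ + M ]) × (χ y ≡ χ g')) → mem Β y
        go (g' , h' , e') = g' , (∣-≋ (≋-weaken e₀∣M (≋-sym h')) d , λ d' → ¬d (∣-≋ h' d')) , e'

      Β-unit : ∀ {u} → Cop (+ N) u → ∀ {x} → mem Β x → mem Β (u * x)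
      Β-unit {u} cu (g , (d , ¬d) , e) = u * g , (∣n⇒∣m*n u d , λ d' → ¬d (cop-cancel (cop-∣ˡ (∣N ag) cu) d')) , ~-unit cu e

      Top⇒Β : ∀ {g} → Top g → mem Β g
      Top⇒Β {g} t = g , t , refl

      -- `Β` is stable under all units, so by `shift-unit` the cosets that it breaks consist of
      -- multiples of q^b and have feet. The feet form an A-set `W`; the group generated by it is V,
      -- and `Β` together with V is the group H.
      layer : Layer
      layer = record { V = gen W-gen ; H = index Z-grp ; V-AG = gen-AG W-gen ; H-AG = isAGroup Z-grp ; V∣M = V∣M′
        ; H∣e₀ = ∈⇒∣ Z-grp (inj₁ (Top⇒Β top-e₀)) ; H∣V = ∈⇒∣ Z-grp (inj₂ ∣-refl)
        ; Β⇒H = λ m → ∈⇒∣ Z-grp (inj₁ m) ; Β⇒¬V = Β∩V ; H∖V⇒Β = λ d ¬d → pick (∣⇒∈ Z-grp d) ¬d }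
        where
        star-div : ∀ {x} k → mem Β x → ¬ mem Β (x + k * + e₀) → q ↑ b ∣ x
        star-div {x} k m ¬m = go (valuation pr b x)
          where
          go : (q ↑ b ∣ x) ⊎ (∃ λ w → ∃ λ x' → w ℕ.< b × (x ≡ q ↑ w * x') × ¬ + q ∣ x') → q ↑ b ∣ x
          go (inj₁ d) = d
          go (inj₂ (w , x' , l , e , ¬d)) = ⊥-elim (fin (shift-unit e ¬d l k))
            where
            fin : (∃ λ u → Cop (+ N) u × (u ≋ 1ℤ [ s ]) × (u ≋ 1ℤ [ q ↑ (b ℕ.∸ w) ]) × (u * x ≋ x + k * + e₀ [ + M ])) → ⊥
            fin (u , cu , _ , _ , h) = ¬m (Β-Periodic h (Β-unit cu m))
        top-e₀ : Top (+ e₀)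
        top-e₀ = ∣-refl , M∤e₀
        u* : ℤ
        u* = proj₁ q-unit
        cu* : Cop (+ N) u*
        cu* = proj₁ (proj₂ q-unit)
        hu* : u* ≋ + q [ s ]
        hu* = proj₂ (proj₂ q-unit)
        Ωq : ASet
        Ωq = Ω ag Β Β-Periodic pr e₀ M≡
        per-Ω : Periodic M Ωq
        per-Ω = Ω-Periodic ag Β Β-Periodic pr e₀ M≡
        -- The feet of the cosets broken by `Β`: by `W-div` a member is a multiple of q^(b+1), and
        -- there the unit acts as q.
        W : ASet
        W = record { mem = λ w → mem Ωq (u* * w) ; mem? = λ w → mem? Ωq (u* * w) ; inv = λ h → inv Ωq (~-unit cu* h) }
        conv-u : ∀ {w} → q ↑ suc b ∣ w → u* * w ≋ + q * w [ + M ]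
        conv-u {w} d = ≋-local ≋⟨ ∣m∣n⇒∣m-n (∣n⇒∣m*n u* d) (∣n⇒∣m*n (+ q) d) ⟩ (≋-*ʳ w hu*)
        q↑∣q* : ∀ {x} → q ↑ b ∣ x → q ↑ suc b ∣ + q * x
        q↑∣q* {x} d = subst (_∣ + q * x) (sym (↑-suc q b)) (*-monoʳ-∣ (+ q) d)
        W-div : ∀ {w} → mem W w → q ↑ suc b ∣ w
        W-div {w} ω = go (Ω-out ag Β Β-Periodic pr e₀ M≡ ω)
          where
          go : (∃ λ x → mem Β x × (∃ λ k → ¬ mem Β (x + k * + e₀)) × (+ q * x ≋ u* * w [ + M ])) → q ↑ suc b ∣ w
          go (x , m , (k , ¬m) , h) = cop-cancel (cop-∣ˡ (∣-trans qb∣M (∣N ag)) cu*) (∣-≋ (≋-weaken qb∣M h) (q↑∣q* (star-div k m ¬m)))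
        W-Ω : ∀ {w} → mem W w → mem Ωq (+ q * w)
        W-Ω ω = per-Ω (conv-u (W-div ω)) ω
        Ω-W : ∀ {w} → q ↑ suc b ∣ w → mem Ωq (+ q * w) → mem W w
        Ω-W d ω = per-Ω (≋-sym (conv-u d)) ω
        0∉Β : ¬ mem Β 0ℤ
        0∉Β (g , (_ , ¬d) , e) = ¬d (∣-trans (∣N ag) (χ-0 (sym e)))
        -- The coset e₀ℤ is broken, since e₀ lies in `Β` and 0 does not; this puts M into V.
        Ω-0 : mem Ωq 0ℤ
        Ω-0 = per-Ω (∣⇒≋0 (divides 1ℤ (trans (sym M≡qe₀) (sym (ℤₚ.*-identityˡ (+ M)))))) (Ω-in ag Β Β-Periodic pr e₀ M≡ -1ℤ (Top⇒Β top-e₀) (λ m → 0∉Β (subst (mem Β) (e (+ e₀)) m)))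
          where
          e : ∀ a → a + -1ℤ * a ≡ 0ℤ
          e = solve-∀
        W-gen : Generated W
        W-gen = generated W
        V∣M′ : + gen W-gen ∣ + M
        V∣M′ = gen-∣ W-gen (Ω-W qb∣M (per-Ω (≋-sym (∣⇒≋0 (∣-self (+ q)))) Ω-0))
        V-div : ∀ {x} → + gen W-gen ∣ x → q ↑ suc b ∣ x
        V-div d = ∣-trans (gen-least W-gen (∣-trans qb∣M (∣N ag)) (λ _ → W-div)) d
        Β∩V : ∀ {x} → mem Β x → ¬ + gen W-gen ∣ x
        Β∩V (g , (d , ¬d) , e) v = ¬d (M∣-local (V-div (ag-inv (gen-AG W-gen) e v)) (∣-trans s∣e₀ d))
        star-not : ∀ {x} k → mem Β x → ¬ mem Β (x + k * + e₀) → ¬ q ↑ suc b ∣ x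
        star-not {x} k m ¬m d = Β∩V m (gen-∣ W-gen (Ω-W d (Ω-in ag Β Β-Periodic pr e₀ M≡ k m ¬m)))
        -- An element x of `Β` in the coset of the foot w has valuation exactly b at q, and so has w
        -- + e'. They agree modulo s, so a unit carries one to the other.
        W-Top : ∀ {w e'} → mem W w → Top e' → mem Β (w + e')
        W-Top {w} {e'} ω (d , ¬d) = go (Ω-out ag Β Β-Periodic pr e₀ M≡ (W-Ω ω))
          where
          go : (∃ λ x → mem Β x × (∃ λ k → ¬ mem Β (x + k * + e₀)) × (+ q * x ≋ + q * w [ + M ])) → mem Β (w + e')
          go (x , m , (k , ¬m) , ≋⟨ h ⟩) = fin (top-unit (star-div k m ¬m) (star-not k m ¬m) (∣m∣n⇒∣m+n (∣-trans (↑-∣ q (ℕₚ.n≤1+n b)) (W-div ω)) (∣-trans qb∣e₀ d))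
              (λ h' → ¬d (M∣-local (∣-≋ (≋-trans (≋-+ʳ e' (∣⇒≋0 (W-div ω))) (≋-reflexive (ℤₚ.+-identityˡ e'))) h') (∣-trans s∣e₀ d)))
              (≋-weaken s∣e₀ (≋-trans x≋w (≋-sym (≋-trans (≋-+ˡ w (∣⇒≋0 d)) (≋-reflexive (ℤₚ.+-identityʳ w)))))))
            where
            eq : ∀ q x w → q * x - q * w ≡ q * (x - w)
            eq = solve-∀
            x≋w : x ≋ w [ + e₀ ]
            x≋w = ≋⟨ *-cancelˡ-∣ (+ q) {{prime-nonZero pr}} (subst (_∣ + q * (x - w)) M≡qe₀ (subst (+ M ∣_) (eq (+ q) x w) h)) ⟩
            fin : (∃ λ u → Cop (+ N) u × (u ≋ 1ℤ [ s ]) × (u * x ≋ w + e' [ + M ])) → mem Β (w + e')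
            fin (u , cu , _ , h) = Β-Periodic h (Β-unit cu m)
        -- The translators of `W` into `Β` form an A-set that contains e₀ℤ outside Mℤ, hence all of
        -- `Β`.
        W-rad : ∀ {w} → mem W w → ∀ x → mem Β x → mem Β (w + x)
        W-rad {w} ω x (g , t , e) = subst (mem Β) (ℤₚ.+-comm x w) (inv (translators Β W) (sym e) (λ w' ω' → subst (mem Β) (ℤₚ.+-comm w' g) (W-Top ω' t)) w ω)
        rad : Indexed (λ t → ∀ x → mem Β x → mem Β (t + x))
        rad = radical Β
        V-rad : ∀ {v} → + gen W-gen ∣ v → ∀ x → mem Β x → mem Β (v + x)
        V-rad d = ∣⇒∈ rad (∣-trans (gen-least W-gen (∣N (isAGroup rad)) (λ w ω → ∈⇒∣ rad (W-rad ω))) d)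
        Z : ASet
        Z = record { mem = λ x → mem Β x ⊎ (+ gen W-gen ∣ x) ; mem? = λ x → mem? Β x ⊎-dec (+ gen W-gen ∣? x)
          ; inv = λ { h (inj₁ m) → inj₁ (inv Β h m) ; h (inj₂ d) → inj₂ (ag-inv (gen-AG W-gen) h d) } }
        Top-Z : ∀ {e'} → Top e' → ∀ z → mem Z z → mem Z (e' + z)
        Top-Z {e'} t z (inj₂ v) = inj₁ (subst (mem Β) (ℤₚ.+-comm z e') (V-rad v e' (Top⇒Β t)))
        Top-Z {e'} (divides k' refl , ¬d) z (inj₁ m) = go (mem? Β (z + k' * + e₀))
          where
          go : Dec (mem Β (z + k' * + e₀)) → mem Z (k' * + e₀ + z)
          go (yes m') = inj₁ (subst (mem Β) (ℤₚ.+-comm z (k' * + e₀)) m')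
          -- The coset of z is broken, and the sum is its foot w plus a multiple of e₀: it lies in V
          -- if this is a multiple of M, and in `Β` otherwise.
          go (no ¬m) = fin (coset-zero (star-div k' m ¬m))
            where
            fin : (∃ λ k → q ↑ suc b ∣ z - k * + e₀) → mem Z (k' * + e₀ + z)
            fin (k , d) = last (+ M ∣? ((k' + k) * + e₀))
              where
              w : ℤ
              w = z - k * + e₀
              ω : mem W w
              ω = Ω-W d (per-Ω ≋⟨ divides k (trans (eq (+ q) z k (+ e₀)) (cong (k *_) (sym M≡qe₀))) ⟩ (Ω-in ag Β Β-Periodic pr e₀ M≡ k' m ¬m))
                where
                eq : ∀ q z k e → q * z - q * (z - k * e) ≡ k * (q * e)
                eq = solve-∀
              eq : ∀ z k k' e → z - k * e + (k' + k) * e ≡ k' * e + z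
              eq = solve-∀
              last : Dec (+ M ∣ (k' + k) * + e₀) → mem Z (k' * + e₀ + z)
              last (yes d') = inj₂ (subst (+ gen W-gen ∣_) (eq z k k' (+ e₀)) (∣m∣n⇒∣m+n (gen-∣ W-gen ω) (∣-trans V∣M′ d')))
              last (no ¬d') = inj₁ (subst (mem Β) (eq z k k' (+ e₀)) (W-Top ω (∣-self (k' + k) , ¬d')))
        Z-add : ∀ {x y} → mem Z x → mem Z y → mem Z (x + y)
        Z-add {x} {y} (inj₁ (g , t , e)) m = inv (translators Z Z) (sym e) (λ z → Top-Z t z) y m
        Z-add {x} {y} (inj₂ v) (inj₁ m) = inj₁ (V-rad v y m)
        Z-add {x} {y} (inj₂ v) (inj₂ v') = inj₂ (∣m∣n⇒∣m+n v v')
        Z-grp : Indexed (mem Z)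
        Z-grp = agroup-of Z (inj₂ ∣0) Z-add
        pick : ∀ {x} → mem Z x → ¬ + gen W-gen ∣ x → mem Β x
        pick (inj₁ m) _ = m
        pick (inj₂ d) ¬d = ⊥-elim (¬d d)

-- Classes that are not regular

private
  -- Here X, B and V are the sizes of a class A, of `Β` and of the group V; β and l count the
  -- elements of A in x₀ + `Β` and x₀ + V. The first two hypotheses give B < 2β. If the conclusion
  -- failed, then 2l < V, and the third hypothesis would give 2β ≤ B.
  arith : ∀ X δ B β l V → X ℕ.< 2 ℕ.* δ → δ ℕ.* B ℕ.≤ X ℕ.* β → V ℕ.* β ℕ.≤ B ℕ.* l → 1 ℕ.≤ V → 1 ℕ.≤ B → V ℕ.+ B ℕ.< 2 ℕ.* (l ℕ.+ β)
  arith X δ B β l V h₁ h₂ h₃ v1 b1 = ℕₚ.≰⇒> λ h₄ → B≱2β (ℕₚ.*-cancelˡ-≤ V {{ℕ.>-nonZero v1}} (begin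
      V ℕ.* (2 ℕ.* β) ≡⟨ e₁ V β ⟩
      2 ℕ.* (V ℕ.* β) ≤⟨ ℕₚ.*-monoʳ-≤ 2 h₃ ⟩
      2 ℕ.* (B ℕ.* l) ≡⟨ e₂ B l ⟩
      (2 ℕ.* l) ℕ.* B ≤⟨ ℕₚ.*-monoˡ-≤ B (ℕₚ.<⇒≤ (2l<V h₄)) ⟩
      V ℕ.* B ∎))
    where
    open ℕₚ.≤-Reasoning
    e₁ : ∀ V β → V ℕ.* (2 ℕ.* β) ≡ 2 ℕ.* (V ℕ.* β)
    e₁ = ℕRing.solve-∀
    e₂ : ∀ B l → 2 ℕ.* (B ℕ.* l) ≡ (2 ℕ.* l) ℕ.* B
    e₂ = ℕRing.solve-∀
    e₃ : ∀ X β → 2 ℕ.* (X ℕ.* β) ≡ X ℕ.* (2 ℕ.* β)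
    e₃ = ℕRing.solve-∀
    B≱2β : ¬ 2 ℕ.* β ℕ.≤ B
    B≱2β h = ℕₚ.<-irrefl refl (begin-strict
      X ℕ.* B <⟨ ℕₚ.*-monoˡ-< B {{ℕ.>-nonZero b1}} h₁ ⟩
      2 ℕ.* δ ℕ.* B ≡⟨ ℕₚ.*-assoc 2 δ B ⟩
      2 ℕ.* (δ ℕ.* B) ≤⟨ ℕₚ.*-monoʳ-≤ 2 h₂ ⟩
      2 ℕ.* (X ℕ.* β) ≡⟨ e₃ X β ⟩
      X ℕ.* (2 ℕ.* β) ≤⟨ ℕₚ.*-monoʳ-≤ X h ⟩
      X ℕ.* B ∎)
    e₄ : ∀ l β → 2 ℕ.* l ℕ.+ 2 ℕ.* β ≡ 2 ℕ.* (l ℕ.+ β)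
    e₄ = ℕRing.solve-∀
    2l<V : 2 ℕ.* (l ℕ.+ β) ℕ.≤ V ℕ.+ B → 2 ℕ.* l ℕ.< V
    2l<V h₄ = ℕₚ.+-cancelʳ-< (2 ℕ.* β) (2 ℕ.* l) V (begin-strict
      2 ℕ.* l ℕ.+ 2 ℕ.* β ≡⟨ e₄ l β ⟩
      2 ℕ.* (l ℕ.+ β) ≤⟨ h₄ ⟩
      V ℕ.+ B <⟨ ℕₚ.+-monoʳ-< V (ℕₚ.≰⇒> B≱2β) ⟩
      V ℕ.+ 2 ℕ.* β ∎)

ind-*-≤ : ∀ {A B C : Set} (a : Dec A) (b : Dec B) (d : Dec C) → (A → B → C) → ind a ℕ.* ind b ℕ.≤ ind a ℕ.* ind d
ind-*-≤ (yes a) (yes b) d h = ℕₚ.≤-reflexive (cong (ℕ._+ 0) (sym (ind-yes d (h a b))))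
ind-*-≤ (yes _) (no _) d h = z≤n
ind-*-≤ (no _) b d h = z≤n

-- Classes that fill more than half of a coset

module Majority {n k : ℕ} (c : Colouring (suc n) k) (circ : IsCirculant c) where
  open Sets c circ
  open Theory c circ
  open TopLayer c circ

  opaque
    -- A coset that meets the class can be recentred at an element of it, and the count is then a
    -- correlation of A-sets, hence constant on the class. All other cosets count 0.
    coset-count-max : ∀ {M} → IsAGroup M → ∀ x₀ → Periodic M (class x₀) → ∀ {d} → IsAGroup d → + d ∣ + M → ∀ g →
      S M (λ h → ind (+ d ∣? h) ℕ.* ι (class x₀) (g + h)) ℕ.≤ S M (λ h → ind (+ d ∣? h) ℕ.* ι (class x₀) (x₀ + h))
    coset-count-max {M} ag x₀ per {d} dg dM g with S M (λ h → ind (+ d ∣? h) ℕ.* ι (class x₀) (g + h)) ℕ.≟ 0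
    ... | yes e = subst (ℕ._≤ _) (sym e) z≤n
    ... | no ne = go (S-nonzero M _ ne)
      where
      instance
        M-nz : ℕ.NonZero M
        M-nz = nz ag
      A : ASet
      A = class x₀
      D : ℤ → ℕ
      D h = ind (+ d ∣? h)
      D-Per : Per M D
      D-Per = ι-Per (subgroup dg) (subgroup-Periodic dg dM)
      go : (∃ λ h → D h ℕ.* ι A (g + h) ≢ 0) → S M (λ h → D h ℕ.* ι A (g + h)) ℕ.≤ S M (λ h → D h ℕ.* ι A (x₀ + h))
      go (h , ne) = ℕₚ.≤-reflexive (trans (sym (S-shift M {λ x → D x ℕ.* ι A (g + x)} (λ x y p → cong₂ ℕ._*_ (D-Per _ _ p) (ι-Per A per _ _ (≋-+ˡ g p))) h))
        (trans (S-cong M (λ x → cong₂ ℕ._*_ (ind-⇔ (+ d ∣? (h + x)) (+ d ∣? x) (λ e → subst (+ d ∣_) (eq h x) (∣m∣n⇒∣m-n e dh)) (∣m∣n⇒∣m+n dh)) (cong (ι A) (sym (ℤₚ.+-assoc g h x)))))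
          (Corr-Inv M (∣N ag) {D} {ι A} D-Per (ι-Per A per) (ι-Inv (subgroup dg)) (ι-Inv A) gh)))
        where
        dh : + d ∣ h
        dh = ind-pos (+ d ∣? h) (λ e → ne (cong (ℕ._* ι A (g + h)) e))
        gh : χ (g + h) ≡ χ x₀
        gh = ind-pos (mem? A (g + h)) (λ e → ne (trans (cong (D h ℕ.*_) e) (ℕₚ.*-zeroʳ (D h))))
        eq : ∀ h x → h + x - h ≡ x
        eq = solve-∀

  module _ {M} (ag : IsAGroup M) {q} (pr : Prime q) {e₀} (M≡ : M ≡ q ℕ.* e₀) {b s} (e₀≡ : + e₀ ≡ q ↑ b * s) (q∤s : ¬ + q ∣ s)
    (x₀ : ℤ) (per : Periodic M (class x₀)) where
    open Local N≢0 (∣N ag) pr M≡ e₀≡ q∤s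

    private
      instance
        _ = nz ag
      A : ASet
      A = class x₀
      ΒB : ASet
      ΒB = Β ag pr M≡ e₀≡ q∤s
      lay : Layer ag pr M≡ e₀≡ q∤s
      lay = layer ag pr M≡ e₀≡ q∤s
    open Layer lay

    λH : ℕ
    λH = S M (λ h → ind (+ H ∣? h) ℕ.* ι A (x₀ + h))

    opaque
      -- Double counting twice, with `arith` to combine the results: the pairs of elements of A
      -- whose difference lies in `Β`, and the sums of an element of V and one of `Β` that lead from
      -- x₀ into A.
      majority : (D : ℤ) → (∀ {x g} → mem A x → ¬ D ∣ x → Top ag pr M≡ e₀≡ q∤s g → mem A (g + x)) →
        S M (ι A) ℕ.< 2 ℕ.* S M (λ x → ι A x ℕ.* ind (¬? (D ∣? x))) → S M (λ h → ind (+ H ∣? h)) ℕ.< 2 ℕ.* λH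
      majority D h₁ h₂ = subst₂ ℕ._<_ (sym |H|) (cong (2 ℕ.*_) (sym λH≡)) (arith (S M (ι A)) δ (S M (ι ΒB)) β₀ λV (S M (ι V′)) h₂ δB≤ Vβ≤ V≥1 B≥1)
        where
        δ : ℕ
        δ = S M (λ x → ι A x ℕ.* ind (¬? (D ∣? x)))
        V′ : ASet
        V′ = subgroup V-AG
        pA : Per M (ι A)
        pA = ι-Per A per
        pV : Per M (ι V′)
        pV = ι-Per V′ (subgroup-Periodic V-AG V∣M)
        pB : Per M (ι ΒB)
        pB = ι-Per ΒB (Β-Periodic ag pr M≡ e₀≡ q∤s)
        β₀ : ℕ
        β₀ = Corr M (ι ΒB) (ι A) x₀
        λV : ℕ
        λV = Corr M (ι V′) (ι A) x₀
        split : ∀ h → ind (+ H ∣? h) ≡ ι V′ h ℕ.+ ι ΒB h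
        split h with + V ∣? h | mem? ΒB h
        ... | yes v | yes m = ⊥-elim (Β⇒¬V m v)
        ... | yes v | no _ = ind-yes (+ H ∣? h) (∣-trans H∣V v)
        ... | no ¬v | yes m = ind-yes (+ H ∣? h) (Β⇒H m)
        ... | no ¬v | no ¬m = ind-no (+ H ∣? h) (λ d → ¬m (H∖V⇒Β d ¬v))
        |H| : S M (λ h → ind (+ H ∣? h)) ≡ S M (ι V′) ℕ.+ S M (ι ΒB)
        |H| = trans (S-cong M split) (S-+ M _ _)
        λH≡ : λH ≡ λV ℕ.+ β₀
        λH≡ = trans (S-cong M (λ h → trans (cong (ℕ._* ι A (x₀ + h)) (split h)) (ℕₚ.*-distribʳ-+ (ι A (x₀ + h)) (ι V′ h) (ι ΒB h)))) (S-+ M _ _)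
        V≥1 : 1 ℕ.≤ S M (ι V′)
        V≥1 = ℕₚ.≤-trans (ℕₚ.≤-reflexive (sym (ind-yes (+ V ∣? 0ℤ) ∣0))) (S-term≤ M pV 0ℤ)
        B≥1 : 1 ℕ.≤ S M (ι ΒB)
        B≥1 = ℕₚ.≤-trans (ℕₚ.≤-reflexive (sym (ind-yes (mem? ΒB (+ e₀)) (Top⇒Β ag pr M≡ e₀≡ q∤s (∣-refl , M∤e₀))))) (S-term≤ M pB (+ e₀))
        auto : ℤ → ℕ
        auto = Corr M (ι A) (ι A)
        auto-Inv : Inv auto
        auto-Inv = Corr-Inv M (∣N ag) pA pA (ι-Inv A) (ι-Inv A)
        -- The autocorrelation of A is constant on classes, and every class in `Β` contains an
        -- element g of e₀ℤ outside Mℤ. For this g the hypothesis `h₁` shifts all elements not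
        -- divisible by D into A.
        δ≤auto : ∀ {h} → mem ΒB h → δ ℕ.≤ auto h
        δ≤auto (g , t , e) = subst (δ ℕ.≤_) (auto-Inv (sym e)) (S-≤ M (λ x → go x))
          where
          go : ∀ x → ι A x ℕ.* ind (¬? (D ∣? x)) ℕ.≤ ι A x ℕ.* ι A (g + x)
          go x = ind-*-≤ (mem? A x) (¬? (D ∣? x)) (mem? A (g + x)) (λ m ¬d → h₁ m ¬d t)
        β-const : ∀ {x} → mem A x → Corr M (ι ΒB) (ι A) x ≡ β₀
        β-const m = Corr-Inv M (∣N ag) pB pA (ι-Inv ΒB) (ι-Inv A) m
        δB≤ : δ ℕ.* S M (ι ΒB) ℕ.≤ S M (ι A) ℕ.* β₀
        δB≤ = begin
          δ ℕ.* S M (ι ΒB) ≡⟨ sym (S-*ˡ M δ (ι ΒB)) ⟩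
          S M (λ h → δ ℕ.* ι ΒB h) ≤⟨ S-≤ M (λ h → step h) ⟩
          S M (λ h → ι ΒB h ℕ.* auto h) ≡⟨ S-cong M (λ h → sym (S-*ˡ M (ι ΒB h) _)) ⟩
          S M (λ h → S M (λ x → ι ΒB h ℕ.* (ι A x ℕ.* ι A (h + x)))) ≡⟨ S-swap M M _ ⟩
          S M (λ x → S M (λ h → ι ΒB h ℕ.* (ι A x ℕ.* ι A (h + x)))) ≡⟨ S-cong M (λ x → trans (S-cong M (λ h → trans (re (ι ΒB h) (ι A x) (ι A (h + x))) (cong (λ z → ι A x ℕ.* (ι ΒB h ℕ.* ι A z)) (ℤₚ.+-comm h x)))) (S-*ˡ M (ι A x) _)) ⟩
          S M (λ x → ι A x ℕ.* Corr M (ι ΒB) (ι A) x) ≡⟨ S-cong M (λ x → const x) ⟩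
          S M (λ x → ι A x ℕ.* β₀) ≡⟨ S-*ʳ M β₀ (ι A) ⟩
          S M (ι A) ℕ.* β₀ ∎
          where
          open ℕₚ.≤-Reasoning
          re : ∀ a b c → a ℕ.* (b ℕ.* c) ≡ b ℕ.* (a ℕ.* c)
          re = ℕRing.solve-∀
          step : ∀ h → δ ℕ.* ι ΒB h ℕ.≤ ι ΒB h ℕ.* auto h
          step h with mem? ΒB h
          ... | yes m = ℕₚ.≤-trans (ℕₚ.≤-reflexive (ℕₚ.*-identityʳ δ)) (ℕₚ.≤-trans (δ≤auto m) (ℕₚ.≤-reflexive (sym (ℕₚ.+-identityʳ (auto h)))))
          ... | no _ = ℕₚ.≤-reflexive (ℕₚ.*-zeroʳ δ)
          const : ∀ x → ι A x ℕ.* Corr M (ι ΒB) (ι A) x ≡ ι A x ℕ.* β₀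
          const x with mem? A x
          ... | yes m = cong (ℕ._+ 0) (β-const m)
          ... | no _ = refl
        Β-V : ∀ {v} → + V ∣ v → ∀ h → ι ΒB (- v + h) ≡ ι ΒB h
        Β-V {v} d h = ind-⇔ (mem? ΒB (- v + h)) (mem? ΒB h)
          (λ m → H∖V⇒Β (subst (+ H ∣_) (eq v h) (∣m∣n⇒∣m+n (∣-trans H∣V d) (Β⇒H m))) (λ d' → Β⇒¬V m (∣m∣n⇒∣m+n (∣m⇒∣-m d) d')))
          (λ m → H∖V⇒Β (∣m∣n⇒∣m+n (∣m⇒∣-m (∣-trans H∣V d)) (Β⇒H m)) (λ d' → Β⇒¬V m (subst (+ V ∣_) (eq v h) (∣m∣n⇒∣m+n d d'))))
          where
          eq : ∀ v h → v + (- v + h) ≡ h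
          eq = solve-∀
        -- Count the pairs (v, h) in V × `Β` with x₀ + v + h in A. As `Β` is V-invariant, each v
        -- accounts for `β₀` of them; each h accounts for at most `λV`.
        Vβ≤ : S M (ι V′) ℕ.* β₀ ℕ.≤ S M (ι ΒB) ℕ.* λV
        Vβ≤ = begin
          S M (ι V′) ℕ.* β₀ ≡⟨ sym (S-*ʳ M β₀ (ι V′)) ⟩
          S M (λ v → ι V′ v ℕ.* β₀) ≡⟨ S-cong M (λ v → tr v) ⟩
          S M (λ v → ι V′ v ℕ.* S M (λ h → ι ΒB h ℕ.* ι A (x₀ + (v + h)))) ≡⟨ S-cong M (λ v → sym (S-*ˡ M (ι V′ v) _)) ⟩
          S M (λ v → S M (λ h → ι V′ v ℕ.* (ι ΒB h ℕ.* ι A (x₀ + (v + h))))) ≡⟨ S-swap M M _ ⟩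
          S M (λ h → S M (λ v → ι V′ v ℕ.* (ι ΒB h ℕ.* ι A (x₀ + (v + h))))) ≡⟨ S-cong M (λ h → trans (S-cong M (λ v → trans (re (ι V′ v) (ι ΒB h) (ι A (x₀ + (v + h)))) (cong (λ z → ι ΒB h ℕ.* (ι V′ v ℕ.* ι A z)) (as x₀ v h)))) (S-*ˡ M (ι ΒB h) _)) ⟩
          S M (λ h → ι ΒB h ℕ.* S M (λ v → ι V′ v ℕ.* ι A (x₀ + h + v))) ≤⟨ S-≤ M (λ h → ℕₚ.*-monoʳ-≤ (ι ΒB h) (coset-count-max ag x₀ per V-AG V∣M (x₀ + h))) ⟩
          S M (λ h → ι ΒB h ℕ.* λV) ≡⟨ S-*ʳ M λV (ι ΒB) ⟩
          S M (ι ΒB) ℕ.* λV ∎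
          where
          open ℕₚ.≤-Reasoning
          re : ∀ a b c → a ℕ.* (b ℕ.* c) ≡ b ℕ.* (a ℕ.* c)
          re = ℕRing.solve-∀
          as : ∀ x v h → x + (v + h) ≡ x + h + v
          as = solve-∀
          e : ∀ v h → v + (- v + h) ≡ h
          e = solve-∀
          tr : ∀ v → ι V′ v ℕ.* β₀ ≡ ι V′ v ℕ.* S M (λ h → ι ΒB h ℕ.* ι A (x₀ + (v + h)))
          tr v with + V ∣? v
          ... | no _ = refl
          ... | yes d = cong (ℕ._+ 0) (trans (S-cong M (λ h → cong₂ (λ a z → a ℕ.* ι A (x₀ + z)) (sym (Β-V d h)) (sym (e v h))))
            (S-shift M {λ h → ι ΒB h ℕ.* ι A (x₀ + (v + h))} (λ x y p → cong₂ ℕ._*_ (pB _ _ p) (pA _ _ (≋-+ˡ x₀ (≋-+ˡ v p)))) (- v)))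

      -- The unit `v` preserves the coset x + H. In it A and the preimage of A under `v` both fill
      -- more than half, so some z has both z and v z in A; as units permute the classes, this
      -- suffices.
      stabilise : S M (λ h → ind (+ H ∣? h)) ℕ.< 2 ℕ.* λH → ∀ {v} → Cop (+ N) v → ∀ {x} → mem A x → + H ∣ v * x - x → ∀ {y} → mem A y → mem A (v * y)
      stabilise maj {v} cv {x} mx d {y} my = go (search (λ z → mem? A z ×-dec mem? A (v * z)) (λ h (p , q) → mem-≋ A h p , mem-≋ A (≋-*ˡ v h) q))
        where
        go : Dec (∃ λ z → mem A z × mem A (v * z)) → mem A (v * y)
        go (yes (z , mz , mvz)) = trans (~-unit cv (trans my (sym mz))) mvz
        go (no none) = ⊥-elim (ℕₚ.<⇒≱ maj (begin
            2 ℕ.* λH ≡⟨ cong (λH ℕ.+_) (ℕₚ.+-identityʳ λH) ⟩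
            λH ℕ.+ λH ≡⟨ sym (cong₂ ℕ._+_ sum₁ sum₂) ⟩
            S M f ℕ.+ S M (λ z → f (v * z)) ≡⟨ sym (S-+ M f (λ z → f (v * z))) ⟩
            S M (λ z → f z ℕ.+ f (v * z)) ≤⟨ S-≤ M point ⟩
            S M (λ z → ind (+ H ∣? (- x + z))) ≡⟨ S-shift M {λ h → ind (+ H ∣? h)} pH (- x) ⟩
            S M (λ h → ind (+ H ∣? h)) ∎))
          where
          open ℕₚ.≤-Reasoning
          pH : Per M (λ h → ind (+ H ∣? h))
          pH = ι-Per (subgroup H-AG) (subgroup-Periodic H-AG (∣-trans H∣e₀ e₀∣M))
          f : ℤ → ℕ
          f z = ind (+ H ∣? (- x + z)) ℕ.* ι A z
          pf : Per M f
          pf a a' h = cong₂ ℕ._*_ (pH _ _ (≋-+ˡ (- x) h)) (ι-Per A per _ _ h)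
          e : ∀ x h → - x + (x + h) ≡ h
          e = solve-∀
          sum₁ : S M f ≡ λH
          sum₁ = trans (sym (S-shift M pf x)) (trans (S-cong M (λ h → cong (λ z → ind (+ H ∣? z) ℕ.* ι A (x + h)) (e x h)))
            (Corr-Inv M (∣N ag) {λ h → ind (+ H ∣? h)} {ι A} pH (ι-Per A per) (ι-Inv (subgroup H-AG)) (ι-Inv A) mx))
          inverse : ∃ λ u → v * u ≋ 1ℤ [ + N ]
          inverse = cop-inv cv
          sum₂ : S M (λ z → f (v * z)) ≡ λH
          sum₂ = trans (S-unit M pf v (proj₁ inverse) (≋-weaken (∣N ag) (proj₂ inverse))) sum₁
          same : ∀ z → + H ∣ - x + v * z → + H ∣ - x + z
          same z h = cop-cancel (cop-∣ˡ (∣N H-AG) cv) (subst (+ H ∣_) (e″ v x z) (∣m∣n⇒∣m-n h d))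
            where
            e″ : ∀ v x z → - x + v * z - (v * x - x) ≡ v * (- x + z)
            e″ = solve-∀
          point : ∀ z → f z ℕ.+ f (v * z) ℕ.≤ ind (+ H ∣? (- x + z))
          point z with + H ∣? (- x + z)
          ... | yes h with mem? A z | mem? A (v * z)
          ...   | yes a | yes b = ⊥-elim (none (z , a , b))
          ...   | yes a | no b = subst (λ w → 1 ℕ.+ w ℕ.≤ 1) (sym (ℕₚ.*-zeroʳ (ind (+ H ∣? (- x + v * z))))) (s≤s z≤n)
          ...   | no a | yes b = ℕₚ.≤-trans (ℕₚ.≤-reflexive (ℕₚ.*-identityʳ _)) (ind-≤1 (+ H ∣? (- x + v * z)))
          ...   | no a | no b = subst (ℕ._≤ 1) (sym (ℕₚ.*-zeroʳ (ind (+ H ∣? (- x + v * z))))) z≤n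
          point z | no ¬h = ℕₚ.≤-reflexive (cong (ℕ._* ι A (v * z)) (ind-no (+ H ∣? (- x + v * z)) (λ h → ¬h (same z h))))

-- Splitting a class that is not regular

module Reduction {n k : ℕ} (c : Colouring (suc n) k) (circ : IsCirculant c) where
  open Sets c circ
  open Theory c circ
  open TopLayer c circ
  open Majority c circ

  Stab : ℤ → ℤ → Set
  Stab x₀ t = ∀ x → mem (class x₀) x → mem (class x₀) (t + x)

  record Splitting (x₀ : ℤ) (d : ℤ) : Set where
    field
      V H : ℕ
      V-AG : IsAGroup V
      H-AG : IsAGroup H
      h₀ w₀ : ℤ
      H∣h₀ : + H ∣ h₀
      V∤h₀ : ¬ + V ∣ h₀
      sum-in : ∀ {h w} → + H ∣ h → ¬ + V ∣ h → χ w ≡ χ w₀ → χ (h + w) ≡ χ x₀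
      deep : ∀ {w} → χ w ≡ χ w₀ → d ∣ w

  module ClassLocal (x₀ : ℤ) (rad : Indexed (Stab x₀)) (G : Generated (class x₀)) {q} (pr : Prime q) {e₀} (M≡ : index rad ≡ q ℕ.* e₀)
    {b s} (e₀≡ : + e₀ ≡ q ↑ b * s) (q∤s : ¬ + q ∣ s) {j e'} (e≡ : + gen G ≡ q ↑ j * e') (q∤e' : ¬ + q ∣ e') (e∣e₀ : + gen G ∣ + e₀) where

    M : ℕ
    M = index rad
    ag : IsAGroup M
    ag = isAGroup rad
    e : ℤ
    e = + gen G
    A : ASet
    A = class x₀
    open Local N≢0 (∣N ag) pr M≡ e₀≡ q∤s public

    opaque
      A-Periodic : Periodic M A
      A-Periodic {x} {y} h m = subst (mem A) (eq x y) (∣⇒∈ rad (≋⇒∣ (≋-sym h)) x m)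
        where
        eq : ∀ x y → y - x + x ≡ y
        eq = solve-∀

      q∣e-div : ∀ {x} → e ∣ x → q ↑ suc j ∣ x → + q * e ∣ x
      q∣e-div {x} d d' = subst (_∣ x) (trans (cong (_* e') (↑-suc q j)) (trans (ℤₚ.*-assoc (+ q) (q ↑ j) e') (cong (+ q *_) (sym e≡)))) (cop-∣-* (cop-↑-∤ pr (suc j) q∤e') d' (∣-trans (divides (q ↑ j) e≡) d))

      qe-div : ∀ {x} → + q * e ∣ x → q ↑ suc j ∣ x
      qe-div {x} d = ∣-trans (divides e' (trans (cong (+ q *_) e≡) (trans (sym (ℤₚ.*-assoc (+ q) (q ↑ j) e')) (trans (cong (_* e') (sym (↑-suc q j))) (ℤₚ.*-comm (q ↑ suc j) e'))))) d

      primitive-part : ∀ {x} → e ∣ x → ¬ + q * e ∣ x → ∃ λ x' → (x ≡ q ↑ j * x') × ¬ + q ∣ x'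
      primitive-part {x} (divides t refl) ¬d = t * e' , trans (cong (t *_) e≡) (eq t (q ↑ j) e') , ∤-* pr {t} {e'} (λ { (divides r refl) → ¬d (divides r (ℤₚ.*-assoc r (+ q) e)) }) q∤e'
        where
        eq : ∀ t a e → t * (a * e) ≡ a * (t * e)
        eq = solve-∀

      qe∣M : + q * e ∣ + M
      qe∣M = subst (+ q * e ∣_) (sym M≡qe₀) (*-monoʳ-∣ (+ q) e∣e₀)

      -- Otherwise e₀ would lie in the radical, whose index M does not divide it.
      star₀ : ∃ λ x → mem A x × ¬ mem A (x + 1ℤ * + e₀)
      star₀ = go (search {λ x → mem A x × ¬ mem A (x + 1ℤ * + e₀)} (λ x → mem? A x ×-dec ¬? (mem? A (x + 1ℤ * + e₀))) (λ h (m , ¬m) → mem-≋ A h m , λ m' → ¬m (mem-≋ A (≋-+ʳ (1ℤ * + e₀) (≋-sym h)) m')))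
        where
        eq : ∀ x e → x + 1ℤ * e ≡ e + x
        eq = solve-∀
        go : Dec (∃ λ x → mem A x × ¬ mem A (x + 1ℤ * + e₀)) → ∃ λ x → mem A x × ¬ mem A (x + 1ℤ * + e₀)
        go (yes r) = r
        go (no none) = ⊥-elim (M∤e₀ (∈⇒∣ rad (λ x m → subst (mem A) (eq x (+ e₀)) (decidable-stable (mem? A (x + 1ℤ * + e₀)) (λ ¬m → none (x , m , ¬m))))))

  module _ (x₀ : ℤ) (rad : Indexed (Stab x₀)) (G : Generated (class x₀)) {q} (pr : Prime q) {e₀} (M≡ : index rad ≡ q ℕ.* e₀)
    {b s} (e₀≡ : + e₀ ≡ q ↑ b * s) (q∤s : ¬ + q ∣ s) {j e'} (e≡ : + gen G ≡ q ↑ j * e') (q∤e' : ¬ + q ∣ e') (e∣e₀ : + gen G ∣ + e₀)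
    (x₁ y₁ : ℤ) (m₁ : χ x₁ ≡ χ x₀) (d₁ : + q * + gen G ∣ x₁) (n₁ : χ y₁ ≡ χ x₀) (¬d₁ : ¬ + q * + gen G ∣ y₁) where
    open ClassLocal x₀ rad G pr M≡ e₀≡ q∤s e≡ q∤e' e∣e₀

    private
      ΩA : ASet
      ΩA = Ω ag A A-Periodic pr e₀ M≡
      x⋆ : ℤ
      x⋆ = proj₁ star₀
      m⋆ : mem A x⋆
      m⋆ = proj₁ (proj₂ star₀)
      ¬m⋆ : ¬ mem A (x⋆ + 1ℤ * + e₀)
      ¬m⋆ = proj₂ (proj₂ star₀)
      -- The index d of this group is a multiple of qe and a divisor of M, and D = d/q divides all
      -- elements in broken cosets. No element of A is divisible by d: the class would then be, but
      -- `y₁` is not divisible even by qe.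
      VX : Generated ΩA
      VX = generated ΩA
      d : ℤ
      d = + gen VX

    opaque
      Ω-Per : Periodic M ΩA
      Ω-Per = Ω-Periodic ag A A-Periodic pr e₀ M≡

      star-Ω : ∀ {x} k → mem A x → ¬ mem A (x + k * + e₀) → mem ΩA (+ q * x)
      star-Ω k m ¬m = Ω-in ag A A-Periodic pr e₀ M≡ k m ¬m

      qe∣d : + q * e ∣ d
      qe∣d = gen-least VX (∣-trans qe∣M (∣N ag)) (λ g ω → go (Ω-out ag A A-Periodic pr e₀ M≡ ω))
        where
        go : ∀ {g} → (∃ λ x → mem A x × (∃ λ k → ¬ mem A (x + k * + e₀)) × (+ q * x ≋ g [ + M ])) → + q * e ∣ g
        go (x , m , _ , h) = ∣-≋ (≋-weaken qe∣M h) (*-monoʳ-∣ (+ q) (gen-∣ G m))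

      d∤A : ∀ {x} → mem A x → ¬ d ∣ x
      d∤A m dv = ¬d₁ (∣-trans qe∣d (ag-inv (gen-AG VX) (trans m (sym n₁)) dv))

      d∣M : d ∣ + M
      d∣M = subst (d ∣_) (eq (+ q * x⋆) (+ M)) (∣m∣n⇒∣m-n (gen-∣ VX (Ω-Per (≋-sym (≋-shift (+ q * x⋆) 1ℤ)) ω)) (gen-∣ VX ω))
        where
        ω : mem ΩA (+ q * x⋆)
        ω = star-Ω 1ℤ m⋆ ¬m⋆
        eq : ∀ a m → a + 1ℤ * m - a ≡ m
        eq = solve-∀

      D-exists : ∃ λ (D : ℕ) → gen VX ≡ q ℕ.* D
      D-exists = go (∣⇒∣ᵤ (∣-trans (∣m⇒∣m*n e (∣-refl {+ q})) qe∣d))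
        where
        go : q ℕ∣.∣ gen VX → ∃ λ (D : ℕ) → gen VX ≡ q ℕ.* D
        go (ℕ∣.divides D h) = D , trans h (ℕₚ.*-comm D q)

    private
      D : ℕ
      D = proj₁ D-exists
      d≡ : gen VX ≡ q ℕ.* D
      d≡ = proj₂ D-exists
      D≢0 : + D ≢ 0ℤ
      D≢0 h = ℕ.≢-nonZero⁻¹ (gen VX) {{nz (gen-AG VX)}} (trans d≡ (trans (cong (q ℕ.*_) (ℤₚ.+-injective h)) (ℕₚ.*-zeroʳ q)))
      D-split : ∃ λ b₂ → ∃ λ s₂ → (+ D ≡ q ↑ b₂ * s₂) × ¬ + q ∣ s₂
      D-split = prime-split pr D≢0
      b₂ : ℕ
      b₂ = proj₁ D-split
      s₂ : ℤ
      s₂ = proj₁ (proj₂ D-split)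
      D≡ : + D ≡ q ↑ b₂ * s₂
      D≡ = proj₁ (proj₂ (proj₂ D-split))
      q∤s₂ : ¬ + q ∣ s₂
      q∤s₂ = proj₂ (proj₂ (proj₂ D-split))
      module LD = Local N≢0 (∣N (gen-AG VX)) pr d≡ D≡ q∤s₂

    opaque
      d≡ᶻ : d ≡ + q * + D
      d≡ᶻ = LD.M≡qe₀

      star-D : ∀ {x} k → mem A x → ¬ mem A (x + k * + e₀) → + D ∣ x
      star-D {x} k m ¬m = *-cancelˡ-∣ (+ q) {{prime-nonZero pr}} (subst (_∣ + q * x) d≡ᶻ (gen-∣ VX (star-Ω k m ¬m)))

      D⇒d : ∀ {x} → q ↑ suc b ∣ x → + D ∣ x → d ∣ x
      D⇒d {x} h dv = LD.M∣-local (∣-trans (↑-∣ q (∣↑-≤ pr q∤s (∣-trans LD.qb∣M (subst (d ∣_) M≡ᶻ d∣M)))) h) (∣-trans LD.s∣e₀ dv)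

    -- It exhibits q cosets of dℤ outside Dℤ, each meeting A and therefore holding the maximal
    -- number of its elements; Dℤ itself can hold only q - 1 such cosets.
    Spread : ℤ → Set
    Spread y = mem A y × (¬ + D ∣ y) × (∀ k → ∃ λ z → mem A z × (z ≋ y + k * + D [ d ]))

    opaque
      -- Units close to 1 fix `x₁`, hence stabilise A, so broken cosets can occur only at multiples
      -- of qe. This forces q^(j+1) to divide D. Then `y₁`, of valuation j, is shifted through the
      -- multiples of D by units that fix `x⋆` modulo d, and `class-shift` brings the results back
      -- into A.
      spread-deep : + q * e ∣ + e₀ → Spread y₁
      spread-deep qe∣e₀ = n₁ , D∤y₁ , λ k → go k (primitive-part (gen-∣ G n₁) ¬d₁)
        where
        j<b : j ℕ.< b
        j<b = ∣↑-≤ pr q∤s (subst (q ↑ suc j ∣_) e₀≡ (qe-div qe∣e₀))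
        star-qe : ∀ {x} k → mem A x → ¬ mem A (x + k * + e₀) → + q * e ∣ x
        star-qe {x} k m ¬m = fin (+ q * e ∣? x)
          where
          fin : Dec (+ q * e ∣ x) → + q * e ∣ x
          fin (yes r) = r
          fin (no ¬r) = ⊥-elim (go (primitive-part (gen-∣ G m) ¬r))
            where
            go : (∃ λ x' → (x ≡ q ↑ j * x') × ¬ + q ∣ x') → ⊥
            go (x' , ex , ¬x') = go' (shift-unit ex ¬x' j<b k)
              where
              go' : (∃ λ u → Cop (+ N) u × (u ≋ 1ℤ [ s ]) × (u ≋ 1ℤ [ q ↑ (b ℕ.∸ j) ]) × (u * x ≋ x + k * + e₀ [ + M ])) → ⊥
              go' (u , cu , us , uq , ux) = ¬m (A-Periodic ux (trans (~-unit cu (trans m (sym m₁))) (A-Periodic (≋-sym fix) m₁)))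
                where
                eq : ∀ u x → u * x - x ≡ (u - 1ℤ) * x
                eq = solve-∀
                *-∣ : ∀ {a b x y} → a ∣ x → b ∣ y → a * b ∣ x * y
                *-∣ {a} {b} (divides r refl) (divides t refl) = divides (r * t) (e″ r a t b)
                  where
                  e″ : ∀ r a t b → r * a * (t * b) ≡ r * t * (a * b)
                  e″ = solve-∀
                -- At q the exponents of u - 1 and `x₁` add up: (b - j) + (j + 1) = b + 1.
                fix : u * x₁ ≋ x₁ [ + M ]
                fix = ≋-local ≋⟨ subst (q ↑ suc b ∣_) (sym (eq u x₁)) (subst (_∣ (u - 1ℤ) * x₁) (trans (sym (↑-+ q (b ℕ.∸ j) (suc j))) (cong (q ↑_) (trans (ℕₚ.+-suc (b ℕ.∸ j) j) (cong suc (ℕₚ.m∸n+n≡m (ℕₚ.<⇒≤ j<b)))))) (*-∣ (≋⇒∣ uq) (qe-div d₁))) ⟩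
                  ≋⟨ subst (s ∣_) (sym (eq u x₁)) (∣m⇒∣m*n x₁ (≋⇒∣ us)) ⟩
        qj∣D : q ↑ suc j ∣ + D
        qj∣D = go (star-D 1ℤ m⋆ ¬m⋆) (qe-div (star-qe 1ℤ m⋆ ¬m⋆))
          where
          go : + D ∣ x⋆ → q ↑ suc j ∣ x⋆ → q ↑ suc j ∣ + D
          go (divides t ex) h = cop-cancel (cop-↑-∤ pr (suc j) q∤t) (subst (q ↑ suc j ∣_) ex h)
            where
            q∤t : ¬ + q ∣ t
            q∤t (divides r refl) = d∤A m⋆ (divides r (trans ex (trans (ℤₚ.*-assoc r (+ q) (+ D)) (cong (r *_) (sym d≡ᶻ)))))
        D∤y₁ : ¬ + D ∣ y₁
        D∤y₁ dv = ¬d₁ (q∣e-div (gen-∣ G n₁) (∣-trans qj∣D dv))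
        j<b₂ : j ℕ.< b₂
        j<b₂ = ∣↑-≤ pr q∤s₂ (subst (q ↑ suc j ∣_) D≡ qj∣D)
        go : ∀ k → (∃ λ x' → (y₁ ≡ q ↑ j * x') × ¬ + q ∣ x') → ∃ λ z → mem A z × (z ≋ y₁ + k * + D [ d ])
        go k (x' , ey , ¬x') = go' (LD.shift-unit ey ¬x' j<b₂ k)
          where
          go' : (∃ λ u → Cop (+ N) u × (u ≋ 1ℤ [ s₂ ]) × (u ≋ 1ℤ [ q ↑ (b₂ ℕ.∸ j) ]) × (u * y₁ ≋ y₁ + k * + D [ d ])) → ∃ λ z → mem A z × (z ≋ y₁ + k * + D [ d ])
          go' (u , cu , _ , uq , uy) = go″ (class-shift (gen-AG VX) fix (~-unit cu (trans m⋆ (sym n₁))))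
            where
            q∣u : + q ∣ u - 1ℤ
            q∣u = ∣-trans (subst (λ z → + q ∣ q ↑ z) (sym (ℕₚ.+-∸-assoc 1 j<b₂)) (p∣↑ q (b₂ ℕ.∸ suc j))) (≋⇒∣ uq)
            fix : u * x⋆ ≋ x⋆ [ d ]
            fix = go₀ q∣u (star-D 1ℤ m⋆ ¬m⋆)
              where
              go₀ : + q ∣ u - 1ℤ → + D ∣ x⋆ → u * x⋆ ≋ x⋆ [ d ]
              go₀ (divides r er) (divides t et) = ≋⟨ divides (r * t) (trans (eq u x⋆) (trans (cong₂ _*_ er et) (trans (eq' r (+ q) t (+ D)) (cong (r * t *_) (sym d≡ᶻ))))) ⟩
                where
                eq : ∀ u x → u * x - x ≡ (u - 1ℤ) * x
                eq = solve-∀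
                eq' : ∀ r a t b → r * a * (t * b) ≡ r * t * (a * b)
                eq' = solve-∀
            go″ : (∃ λ g' → (g' ≋ u * y₁ [ d ]) × (χ x⋆ ≡ χ g')) → ∃ λ z → mem A z × (z ≋ y₁ + k * + D [ d ])
            go″ (g' , h , e″) = g' , trans (sym e″) m⋆ , ≋-trans h uy

      -- Now b ≤ j, so `x₁` is a multiple of q^(b+1) and D cannot divide it, or else d would. Its
      -- coset is therefore not broken, and since e₀/D is prime to q, the shifts by e₀ reach all
      -- cosets of dℤ in x₁ + Dℤ.
      spread-shallow : ¬ + q * e ∣ + e₀ → Spread x₁
      spread-shallow ¬qe = m₁ , D∤x₁ , λ k → go k (∣⇒exists D∣e₀)
        where
        b≤j : b ℕ.≤ j
        b≤j = ℕₚ.≮⇒≥ (λ l → ¬qe (q∣e-div e∣e₀ (∣-trans (↑-∣ q l) qb∣e₀)))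
        D∤x₁ : ¬ + D ∣ x₁
        D∤x₁ dv = d∤A m₁ (D⇒d (∣-trans (↑-∣ q (s≤s b≤j)) (qe-div d₁)) dv)
        inv₁ : ∀ k → mem A (x₁ + k * + e₀)
        inv₁ k = decidable-stable (mem? A (x₁ + k * + e₀)) (λ ¬m → D∤x₁ (star-D k m₁ ¬m))
        D∣e₀ : + D ∣ + e₀
        D∣e₀ = *-cancelˡ-∣ (+ q) {{prime-nonZero pr}} (subst₂ _∣_ d≡ᶻ M≡qe₀ d∣M)
        ∣⇒exists : + D ∣ + e₀ → ∃ λ r → (+ e₀ ≡ r * + D) × ¬ + q ∣ r
        ∣⇒exists (divides r er) = r , er , λ { (divides t refl) → q∤s (cancel-↑ pr b (subst₂ _∣_ (trans (↑-suc q b) (ℤₚ.*-comm (+ q) (q ↑ b))) e₀≡ (∣-trans (∣-trans (↑-∣ q (s≤s b≤j)) (qe-div qe∣d)) (divides t (trans er (trans (ℤₚ.*-assoc t (+ q) (+ D)) (cong (t *_) (sym d≡ᶻ)))))))) }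
        go : ∀ k → (∃ λ r → (+ e₀ ≡ r * + D) × ¬ + q ∣ r) → ∃ λ z → mem A z × (z ≋ x₁ + k * + D [ d ])
        go k (r , er , ¬r) = go' (inverse-mod pr 1 ¬r)
          where
          go' : (∃ λ t → (r * t ≋ 1ℤ [ q ↑ 1 ]) × ¬ + q ∣ t) → ∃ λ z → mem A z × (z ≋ x₁ + k * + D [ d ])
          go' (t , ≋⟨ divides v ev ⟩ , _) = x₁ + k * t * + e₀ , inv₁ (k * t) , ≋⟨ divides (k * v) (trans (cong (λ z → x₁ + k * t * z - (x₁ + k * + D)) er)
              (trans (eq x₁ k t r (+ D)) (trans (cong (λ z → k * z * + D) (trans ev (cong (v *_) (↑-1 q)))) (trans (eq' k v (+ q) (+ D)) (cong (k * v *_) (sym d≡ᶻ)))))) ⟩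
            where
            eq : ∀ x k t r D → x + k * t * (r * D) - (x + k * D) ≡ k * (r * t - 1ℤ) * D
            eq = solve-∀
            eq' : ∀ k v q D → k * (v * q) * D ≡ k * v * (q * D)
            eq' = solve-∀

      spread : ∃ Spread
      spread = go (+ q * e ∣? + e₀)
        where
        go : Dec (+ q * e ∣ + e₀) → ∃ Spread
        go (yes h) = y₁ , spread-deep h
        go (no h) = x₁ , spread-shallow h

      -- Each coset of dℤ holds at most `top` elements of A, with equality if it meets A. Of the q
      -- cosets inside Dℤ the zero coset holds none, so Dℤ holds at most (q-1) `top`; by `Spread` at
      -- least q `top` elements lie outside Dℤ.
      half : S M (ι A) ℕ.< 2 ℕ.* S M (λ x → ι A x ℕ.* ind (¬? (+ D ∣? x)))
      half = go spread
        where
        instance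
          M-nz : ℕ.NonZero M
          M-nz = nz ag
          q-nz : ℕ.NonZero q
          q-nz = prime⇒nonZero pr
          D-nz : ℕ.NonZero D
          D-nz = ℕ.≢-nonZero (λ h → D≢0 (cong +_ h))
        lam : ℤ → ℕ
        lam g = S M (λ x → ind (x ≋? g [ d ]) ℕ.* ι A x)
        top : ℕ
        top = lam x₀
        pA : Per M (ι A)
        pA = ι-Per A A-Periodic
        lam-corr : ∀ g → lam g ≡ S M (λ h → ind (d ∣? h) ℕ.* ι A (g + h))
        lam-corr g = trans (sym (S-shift M {λ x → ind (x ≋? g [ d ]) ℕ.* ι A x} (λ x y p → cong₂ ℕ._*_ (ind-⇔ (x ≋? g [ d ]) (y ≋? g [ d ]) (≋-trans (≋-weaken d∣M (≋-sym p))) (≋-trans (≋-weaken d∣M p))) (pA x y p)) g))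
          (S-cong M (λ h → cong (ℕ._* ι A (g + h)) (ind-⇔ (g + h ≋? g [ d ]) (d ∣? h) (λ { ≋⟨ p ⟩ → subst (d ∣_) (eq g h) p }) (λ p → ≋⟨ subst (d ∣_) (sym (eq g h)) p ⟩))))
          where
          eq : ∀ g h → g + h - g ≡ h
          eq = solve-∀
        lam-≤ : ∀ g → lam g ℕ.≤ top
        lam-≤ g = subst₂ ℕ._≤_ (sym (lam-corr g)) (sym (lam-corr x₀)) (coset-count-max ag x₀ A-Periodic (gen-AG VX) d∣M g)
        lam-A : ∀ {z} → mem A z → lam z ≡ top
        lam-A {z} m = trans (lam-corr z) (trans (Corr-Inv M (∣N ag) {λ h → ind (d ∣? h)} {ι A} (ι-Per (subgroup (gen-AG VX)) (subgroup-Periodic (gen-AG VX) d∣M)) pA (ι-Inv (subgroup (gen-AG VX))) (ι-Inv A) m) (sym (lam-corr x₀)))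
        lam-≋ : ∀ {z g} → z ≋ g [ d ] → lam z ≡ lam g
        lam-≋ {z} {g} h = S-cong M (λ x → cong (ℕ._* ι A x) (ind-⇔ (x ≋? z [ d ]) (x ≋? g [ d ]) (λ p → ≋-trans p h) (λ p → ≋-trans p (≋-sym h))))
        layers : ∀ y → S M (λ x → ind (x ≋? y [ + D ]) ℕ.* ι A x) ≡ S q (λ k → lam (y + k * + D))
        layers y = trans (S-cong M (λ x → trans (cong (ℕ._* ι A x) (ind-split q D (gen VX) d≡ x y)) (sym (S-*ʳ q (ι A x) _)))) (S-swap M q _)
        top≥1 : 1 ℕ.≤ top
        top≥1 = ℕₚ.≤-trans (ℕₚ.≤-reflexive (sym (cong₂ ℕ._*_ (ind-yes (x₀ ≋? x₀ [ d ]) ≋-refl) (ind-yes (mem? A x₀) refl))))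
          (S-term≤ M {λ x → ind (x ≋? x₀ [ d ]) ℕ.* ι A x} (λ x y p → cong₂ ℕ._*_ (ind-⇔ (x ≋? x₀ [ d ]) (y ≋? x₀ [ d ]) (≋-trans (≋-weaken d∣M (≋-sym p))) (≋-trans (≋-weaken d∣M p))) (pA x y p)) x₀)
        lam-0 : lam 0ℤ ≡ 0
        lam-0 = trans (S-cong M zero′) (trans (S-const M 0) (ℕₚ.*-zeroʳ M))
          where
          zero′ : ∀ x → ind (x ≋? 0ℤ [ d ]) ℕ.* ι A x ≡ 0
          zero′ x with x ≋? 0ℤ [ d ] | mem? A x
          ... | yes h | yes m = ⊥-elim (d∤A m (≋0⇒∣ h))
          ... | yes h | no _ = refl
          ... | no _ | _ = refl
        τ : ℕ
        τ = S M (λ x → ι A x ℕ.* ind (+ D ∣? x))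
        δ : ℕ
        δ = S M (λ x → ι A x ℕ.* ind (¬? (+ D ∣? x)))
        τ+top≤ : τ ℕ.+ top ℕ.≤ q ℕ.* top
        τ+top≤ = begin
          τ ℕ.+ top ≡⟨ cong (ℕ._+ top) (trans (S-cong M (λ x → trans (ℕₚ.*-comm (ι A x) _) (cong (ℕ._* ι A x) (ind-⇔ (+ D ∣? x) (x ≋? 0ℤ [ + D ]) ∣⇒≋0 ≋0⇒∣)))) (layers 0ℤ)) ⟩
          S q (λ k → lam (0ℤ + k * + D)) ℕ.+ top ≡⟨ cong (S q (λ k → lam (0ℤ + k * + D)) ℕ.+_) (sym (S-δ q {λ _ → top} (λ _ _ _ → refl) 0ℤ)) ⟩
          S q (λ k → lam (0ℤ + k * + D)) ℕ.+ S q (λ k → ind (k ≋? 0ℤ [ + q ]) ℕ.* top) ≡⟨ sym (S-+ q _ _) ⟩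
          S q (λ k → lam (0ℤ + k * + D) ℕ.+ ind (k ≋? 0ℤ [ + q ]) ℕ.* top) ≤⟨ S-≤ q point ⟩
          S q (λ _ → top) ≡⟨ S-const q top ⟩
          q ℕ.* top ∎
          where
          open ℕₚ.≤-Reasoning
          point : ∀ k → lam (0ℤ + k * + D) ℕ.+ ind (k ≋? 0ℤ [ + q ]) ℕ.* top ℕ.≤ top
          point k with k ≋? 0ℤ [ + q ]
          ... | no _ = ℕₚ.≤-trans (ℕₚ.≤-reflexive (ℕₚ.+-identityʳ _)) (lam-≤ _)
          ... | yes h = ℕₚ.≤-reflexive (cong₂ ℕ._+_ (trans (lam-≋ z) lam-0) (ℕₚ.+-identityʳ top))
            where
            z : 0ℤ + k * + D ≋ 0ℤ [ d ]
            z = ∣⇒≋0 (subst (_∣ 0ℤ + k * + D) (sym d≡ᶻ) (go' (≋0⇒∣ h)))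
              where
              go' : + q ∣ k → + q * + D ∣ 0ℤ + k * + D
              go' (divides r refl) = divides r (trans (ℤₚ.+-identityˡ _) (ℤₚ.*-assoc r (+ q) (+ D)))
        whole : S M (ι A) ≡ τ ℕ.+ δ
        whole = trans (S-cong M point) (S-+ M _ _)
          where
          point : ∀ x → ι A x ≡ ι A x ℕ.* ind (+ D ∣? x) ℕ.+ ι A x ℕ.* ind (¬? (+ D ∣? x))
          point x with + D ∣? x
          ... | yes _ = trans (sym (ℕₚ.*-identityʳ (ι A x))) (trans (sym (ℕₚ.+-identityʳ _)) (cong (ι A x ℕ.* 1 ℕ.+_) (sym (ℕₚ.*-zeroʳ (ι A x)))))
          ... | no _ = trans (sym (ℕₚ.*-identityʳ (ι A x))) (cong (ℕ._+ ι A x ℕ.* 1) (sym (ℕₚ.*-zeroʳ (ι A x))))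
        go : ∃ Spread → S M (ι A) ℕ.< 2 ℕ.* δ
        go (y , my , ¬Dy , sp) = begin-strict
          S M (ι A) ≡⟨ whole ⟩
          τ ℕ.+ δ <⟨ ℕₚ.+-monoˡ-< δ (ℕₚ.<-≤-trans (ℕₚ.≤-trans (ℕₚ.≤-trans (ℕₚ.≤-reflexive (ℕₚ.+-comm 1 τ)) (ℕₚ.+-monoʳ-≤ τ top≥1)) τ+top≤) q≤δ) ⟩
          δ ℕ.+ δ ≡⟨ cong (δ ℕ.+_) (sym (ℕₚ.+-identityʳ δ)) ⟩
          2 ℕ.* δ ∎
          where
          open ℕₚ.≤-Reasoning
          q≤δ : q ℕ.* top ℕ.≤ δ
          q≤δ = ℕₚ.≤-trans (ℕₚ.≤-reflexive (trans (sym (S-const q top)) (trans (S-cong q (λ k → sym (trans (sym (lam-≋ (proj₂ (proj₂ (sp k))))) (lam-A (proj₁ (proj₂ (sp k))))))) (sym (layers y)))))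
            (S-≤ M (λ x → ℕₚ.≤-trans (ℕₚ.≤-reflexive (ℕₚ.*-comm _ (ι A x))) (ind-*-≤ (mem? A x) (x ≋? y [ + D ]) (¬? (+ D ∣? x)) (λ _ h dv → ¬Dy (∣-≋ h dv)))))

    private
      lay : Layer ag pr M≡ e₀≡ q∤s
      lay = layer ag pr M≡ e₀≡ q∤s

    opaque
      stable : ∀ {v} → Cop (+ N) v → ∀ {x} → mem A x → + Layer.H lay ∣ v * x - x → ∀ {y} → mem A y → mem A (v * y)
      stable = stabilise ag pr M≡ e₀≡ q∤s x₀ A-Periodic (majority ag pr M≡ e₀≡ q∤s x₀ A-Periodic (+ D) in′ half)
        where
        in′ : ∀ {x g} → mem A x → ¬ + D ∣ x → Top ag pr M≡ e₀≡ q∤s g → mem A (g + x)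
        in′ {x} {g} m ¬D (divides k refl , _) = subst (mem A) (ℤₚ.+-comm x (k * + e₀)) (decidable-stable (mem? A (x + k * + e₀)) (λ ¬m → ¬D (star-D k m ¬m)))

      -- At a smaller valuation the shift by k e₀ would be achieved by a unit. It moves x by an
      -- element of H, so it stabilises A, and the shifted element would be in A.
      star-div : ∀ {x} k → mem A x → ¬ mem A (x + k * + e₀) → q ↑ b ∣ x
      star-div {x} k m ¬m = go (valuation pr b x)
        where
        go : (q ↑ b ∣ x) ⊎ (∃ λ w → ∃ λ x' → w ℕ.< b × (x ≡ q ↑ w * x') × ¬ + q ∣ x') → q ↑ b ∣ x
        go (inj₁ r) = r
        go (inj₂ (w , x' , l , ex , ¬x')) = ⊥-elim (go' (shift-unit ex ¬x' l k))
          where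
          go' : (∃ λ u → Cop (+ N) u × (u ≋ 1ℤ [ s ]) × (u ≋ 1ℤ [ q ↑ (b ℕ.∸ w) ]) × (u * x ≋ x + k * + e₀ [ + M ])) → ⊥
          go' (u , cu , _ , _ , h) = ¬m (A-Periodic h (stable cu m (∣-≋ (≋-sym h′) ∣e₀) m))
            where
            eq : ∀ x k e → x + k * e - x ≡ k * e
            eq = solve-∀
            ∣e₀ : + Layer.H lay ∣ x + k * + e₀ - x
            ∣e₀ = subst (+ Layer.H lay ∣_) (sym (eq x k (+ e₀))) (∣n⇒∣m*n k (Layer.H∣e₀ lay))
            h′ : u * x - x ≋ x + k * + e₀ - x [ + Layer.H lay ]
            h′ = ≋-+ʳ (- x) (≋-weaken (∣-trans (Layer.H∣e₀ lay) e₀∣M) h)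

      -- Since q^b divides `x⋆` and s divides u - 1, such a unit moves `x⋆` by a multiple of e₀,
      -- thus within its H-coset.
      unit-stable : ∀ {u} → Cop (+ N) u → u ≋ 1ℤ [ s ] → ∀ {y} → mem A y → mem A (u * y)
      unit-stable {u} cu us = stable cu m⋆ (∣-trans (Layer.H∣e₀ lay) (go (star-div 1ℤ m⋆ ¬m⋆) (≋⇒∣ us)))
        where
        go : q ↑ b ∣ x⋆ → s ∣ u - 1ℤ → + e₀ ∣ u * x⋆ - x⋆
        go (divides t et) (divides r er) = divides (r * t) (trans (eq u x⋆) (trans (cong₂ _*_ er et) (trans (eq' r s t (q ↑ b)) (cong (r * t *_) (sym e₀≡)))))
          where
          eq : ∀ u x → u * x - x ≡ (u - 1ℤ) * x
          eq = solve-∀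
          eq' : ∀ r s t a → r * s * (t * a) ≡ r * t * (a * s)
          eq' = solve-∀

      -- `w₀` is the foot of the broken coset of `x⋆`. All feet plus elements of e₀ℤ outside Mℤ are
      -- in A by `unit-stable`, and `translators` extends this to sums with `Β`. The foot is
      -- divisible by D and by q^(b+1), hence by d and by qe.
      splitting : Splitting x₀ (+ q * e)
      splitting = go (coset-zero (star-div 1ℤ m⋆ ¬m⋆))
        where
        u* : ℤ
        u* = proj₁ q-unit
        cu* : Cop (+ N) u*
        cu* = proj₁ (proj₂ q-unit)
        hu* : u* ≋ + q [ s ]
        hu* = proj₂ (proj₂ q-unit)
        W : ASet
        W = record { mem = λ w → mem ΩA (u* * w) ; mem? = λ w → mem? ΩA (u* * w) ; inv = λ h → inv ΩA (~-unit cu* h) }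
        conv-u : ∀ {w} → q ↑ suc b ∣ w → u* * w ≋ + q * w [ + M ]
        conv-u {w} dv = ≋-local ≋⟨ ∣m∣n⇒∣m-n (∣n⇒∣m*n u* dv) (∣n⇒∣m*n (+ q) dv) ⟩ (≋-*ʳ w hu*)
        W-div : ∀ {w} → mem W w → q ↑ suc b ∣ w
        W-div {w} ω = fin (Ω-out ag A A-Periodic pr e₀ M≡ ω)
          where
          fin : (∃ λ x → mem A x × (∃ λ k → ¬ mem A (x + k * + e₀)) × (+ q * x ≋ u* * w [ + M ])) → q ↑ suc b ∣ w
          fin (x , m , (k , ¬m) , h) = cop-cancel (cop-∣ˡ (∣-trans qb∣M (∣N ag)) cu*) (∣-≋ (≋-weaken qb∣M h) (subst (_∣ + q * x) (sym (↑-suc q b)) (*-monoʳ-∣ (+ q) (star-div k m ¬m))))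
        W-Top : ∀ {w g} → mem W w → Top ag pr M≡ e₀≡ q∤s g → mem A (g + w)
        W-Top {w} {g} ω (dg , ¬dg) = fin (Ω-out ag A A-Periodic pr e₀ M≡ (Ω-Per (conv-u (W-div ω)) ω))
          where
          fin : (∃ λ x → mem A x × (∃ λ k → ¬ mem A (x + k * + e₀)) × (+ q * x ≋ + q * w [ + M ])) → mem A (g + w)
          fin (x , m , (k , ¬m) , ≋⟨ h ⟩) = last (top-unit (star-div k m ¬m) (λ r → d∤A m (D⇒d r (star-D k m ¬m))) (∣m∣n⇒∣m+n (∣-trans qb∣e₀ dg) (∣-trans (↑-∣ q (ℕₚ.n≤1+n b)) (W-div ω)))
              (λ h' → ¬dg (M∣-local (∣-≋ (≋-trans (≋-+ˡ g (∣⇒≋0 (W-div ω))) (≋-reflexive (ℤₚ.+-identityʳ g))) h') (∣-trans s∣e₀ dg)))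
              (≋-weaken s∣e₀ (≋-trans x≋w (≋-sym (≋-trans (≋-+ʳ w (∣⇒≋0 dg)) (≋-reflexive (ℤₚ.+-identityˡ w)))))))
            where
            eq : ∀ q x w → q * x - q * w ≡ q * (x - w)
            eq = solve-∀
            x≋w : x ≋ w [ + e₀ ]
            x≋w = ≋⟨ *-cancelˡ-∣ (+ q) {{prime-nonZero pr}} (subst (_∣ + q * (x - w)) M≡qe₀ (subst (+ M ∣_) (eq (+ q) x w) h)) ⟩
            last : (∃ λ u → Cop (+ N) u × (u ≋ 1ℤ [ s ]) × (u * x ≋ g + w [ + M ])) → mem A (g + w)
            last (u , cu , us , ux) = A-Periodic ux (unit-stable cu us m)
        go : (∃ λ k → q ↑ suc b ∣ x⋆ - k * + e₀) → Splitting x₀ (+ q * e)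
        go (k , dv) = record { V = Layer.V lay ; H = Layer.H lay ; V-AG = Layer.V-AG lay ; H-AG = Layer.H-AG lay
          ; h₀ = + e₀ ; w₀ = w₀ ; H∣h₀ = Layer.H∣e₀ lay ; V∤h₀ = Layer.Β⇒¬V lay (Top⇒Β ag pr M≡ e₀≡ q∤s (∣-refl , M∤e₀))
          ; sum-in = λ {h} {w} dh ¬dv ew → sums (Layer.H∖V⇒Β lay dh ¬dv) (inv W (sym ew) ω₀)
          ; deep = λ ew → ∣-trans qe∣d (ag-inv (gen-AG VX) (sym ew) (D⇒d dv (*-cancelˡ-∣ (+ q) {{prime-nonZero pr}} (subst (_∣ + q * w₀) d≡ᶻ (gen-∣ VX Ωw₀))))) }
          where
          w₀ : ℤ
          w₀ = x⋆ - k * + e₀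
          eq : ∀ q x k e → q * x - q * (x - k * e) ≡ k * (q * e)
          eq = solve-∀
          Ωw₀ : mem ΩA (+ q * w₀)
          Ωw₀ = Ω-Per ≋⟨ divides k (trans (eq (+ q) x⋆ k (+ e₀)) (cong (k *_) (sym M≡qe₀))) ⟩ (star-Ω 1ℤ m⋆ ¬m⋆)
          ω₀ : mem W w₀
          ω₀ = Ω-Per (≋-sym (conv-u dv)) Ωw₀
          sums : ∀ {h w} → mem (Β ag pr M≡ e₀≡ q∤s) h → mem W w → χ (h + w) ≡ χ x₀
          sums {h} {w} (g , t , e″) ω = inv (translators A W) (sym e″) (λ w' ω' → W-Top ω' t) w ω

-- Regular classes

opaque
  lift-unit : ∀ {n m} → n ≢ 0ℤ → m ∣ n → ∀ {u₀} → Cop m u₀ → ∃ λ u → Cop n u × (u ≋ u₀ [ m ])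
  lift-unit {n} {m} nz mn {u₀} cu = go (CRT n nz r)
    where
    -- At primes not dividing `m` the residue 1 keeps the lift prime to `n`.
    r : ℕ → ℤ
    r p with + p ∣? m
    ... | yes _ = u₀
    ... | no _ = 1ℤ
    r-yes : ∀ {p} → + p ∣ m → r p ≡ u₀
    r-yes {p} d with + p ∣? m
    ... | yes _ = refl
    ... | no ¬d = ⊥-elim (¬d d)
    r-unit : ∀ {p} → Prime p → ¬ + p ∣ r p
    r-unit {p} pr with + p ∣? m
    ... | yes d = cop-∤ pr (cop-∣ˡ d cu)
    ... | no _ = prime-∤1 pr
    go : (∃ λ z → PrimePowers n (λ p m → z ≋ r p [ m ])) → ∃ λ u → Cop n u × (u ≋ u₀ [ m ])
    go (u , h) = u , local-cop n nz (λ p pr d d' → r-unit pr (∣-≋ (subst (λ z → u ≋ r p [ z ]) (↑-1 p) (h p pr 1 (subst (_∣ n) (sym (↑-1 p)) d))) d')) ,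
      ≋⟨ local-∣ m (∣-nonZero nz mn) loc ⟩
      where
      loc : PrimePowers m (λ _ z → z ∣ u - u₀)
      loc p pr zero d = 0↑∣
      loc p pr (suc k) d = ≋⇒∣ (≋-trans (h p pr (suc k) (∣-trans d mn)) (≋-reflexive (r-yes (∣-trans (p∣↑ p k) d))))

  cop-pow : ∀ {n u} → Cop n u → ∀ i → Cop n (u ^ i)
  cop-pow cu zero = cop-1
  cop-pow cu (suc i) = cop-*ʳ cu (cop-pow cu i)

  ≋1-pow : ∀ {m u} → u ≋ 1ℤ [ m ] → ∀ i → u ^ i ≋ 1ℤ [ m ]
  ≋1-pow h zero = ≋-refl
  ≋1-pow h (suc i) = ≋-* h (≋1-pow h i)

  *-∣-* : ∀ {a b x y} → a ∣ x → b ∣ y → a * b ∣ x * y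
  *-∣-* {a} {b} (divides r refl) (divides t refl) = divides (r * t) (eq r a t b)
    where
    eq : ∀ r a t b → r * a * (t * b) ≡ r * t * (a * b)
    eq = solve-∀

  ↑-as-+ : ∀ p a → + (p ℕ.^ a) ≡ p ↑ a
  ↑-as-+ p zero = sym (↑-0 p)
  ↑-as-+ p (suc a) = trans (ℤₚ.pos-* p (p ℕ.^ a)) (trans (cong (+ p *_) (↑-as-+ p a)) (sym (↑-suc p a)))

module RegularClasses {n k : ℕ} (c : Colouring (suc n) k) (circ : IsCirculant c) where
  open Sets c circ
  open Theory c circ
  open TopLayer c circ
  open Reduction c circ

  radOf : ∀ x₀ → Indexed (Stab x₀)
  radOf x₀ = radical (class x₀)

  genOf : ∀ x₀ → Generated (class x₀)
  genOf x₀ = generated (class x₀)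

  E M : ℤ → ℕ
  E x₀ = gen (genOf x₀)
  M x₀ = index (radOf x₀)

  M-AG : ∀ x₀ → IsAGroup (M x₀)
  M-AG x₀ = isAGroup (radOf x₀)

  E-AG : ∀ x₀ → IsAGroup (E x₀)
  E-AG x₀ = gen-AG (genOf x₀)

  Regular : ℤ → Set
  Regular x₀ = ∀ q → Prime q → + q * + E x₀ ∣ + M x₀ → ∀ x → χ x ≡ χ x₀ → ¬ + q * + E x₀ ∣ x

  RegularAt : ℤ → ℤ → Set
  RegularAt x₀ y = (+ E x₀ ∣ y) × (∀ q → Prime q → + q * + E x₀ ∣ + M x₀ → ¬ + q * + E x₀ ∣ y)

  record PrimeData (x₀ : ℤ) (p : ℕ) : Set where
    field
      prime : Prime p
      e₀ : ℕ
      M≡ : M x₀ ≡ p ℕ.* e₀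
      b : ℕ
      s : ℤ
      e₀≡ : + e₀ ≡ p ↑ b * s
      p∤s : ¬ + p ∣ s
      j : ℕ
      e' : ℤ
      e≡ : + E x₀ ≡ p ↑ j * e'
      p∤e' : ¬ + p ∣ e'
      e∣e₀ : + E x₀ ∣ + e₀

  opaque
    E≢0 : ∀ x₀ → + E x₀ ≢ 0ℤ
    E≢0 x₀ = ∣-nonZero N≢0 (∣N (E-AG x₀))

    E∣M : ∀ x₀ → + E x₀ ∣ + M x₀
    E∣M x₀ = subst (+ E x₀ ∣_) (eq (+ M x₀) x₀) (∣m∣n⇒∣m-n (gen-∣ (genOf x₀) (∣⇒∈ (radOf x₀) ∣-refl x₀ refl)) (gen-∣ (genOf x₀) refl))
      where
      eq : ∀ m x → m + x - x ≡ m
      eq = solve-∀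

    prime-data : ∀ x₀ {p} → Prime p → + p * + E x₀ ∣ + M x₀ → PrimeData x₀ p
    prime-data x₀ {p} pr d = go (∣⇒∣ᵤ (∣-trans (∣m⇒∣m*n (+ E x₀) (∣-refl {+ p})) d)) (prime-split pr (E≢0 x₀))
      where
      go : p ℕ∣.∣ M x₀ → (∃ λ j → ∃ λ e' → (+ E x₀ ≡ p ↑ j * e') × ¬ + p ∣ e') → PrimeData x₀ p
      go (ℕ∣.divides e₀ h) (j , e' , e≡ , p∤e') = go' (prime-split pr {+ e₀} (λ z → ℕ.≢-nonZero⁻¹ (M x₀) {{nz (M-AG x₀)}} (trans h (cong (ℕ._* p) (ℤₚ.+-injective z)))))
        where
        go' : (∃ λ b → ∃ λ s → (+ e₀ ≡ p ↑ b * s) × ¬ + p ∣ s) → PrimeData x₀ p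
        go' (b , s , e₀≡ , p∤s) = record { prime = pr ; e₀ = e₀ ; M≡ = trans h (ℕₚ.*-comm e₀ p) ; b = b ; s = s ; e₀≡ = e₀≡ ; p∤s = p∤s ; j = j ; e' = e' ; e≡ = e≡ ; p∤e' = p∤e'
          ; e∣e₀ = *-cancelˡ-∣ (+ p) {{prime-nonZero pr}} (subst (+ p * + E x₀ ∣_) (trans (cong +_ (trans h (ℕₚ.*-comm e₀ p))) (ℤₚ.pos-* p e₀)) d) }

    dichotomy : ∀ x₀ → Regular x₀ ⊎ ∃ λ q → Prime q × (+ q * + E x₀ ∣ + M x₀) × Splitting x₀ (+ q * + E x₀)
    -- The primes in question divide `M x₀`, so a search up to `M x₀` is exhaustive.
    dichotomy x₀ = go (any? {suc (M x₀)} (λ i → dec-at (toℕ i)))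
      where
      Bad : ℕ → Set
      Bad q = Prime q × (+ q * + E x₀ ∣ + M x₀) × ∃ λ x → (χ x ≡ χ x₀) × (+ q * + E x₀ ∣ x)
      dec-at : ∀ q → Dec (Bad q)
      dec-at q with prime? q | + q * + E x₀ ∣? + M x₀
      ... | no ¬p | _ = no (¬p ∘ proj₁)
      ... | yes _ | no ¬d = no (¬d ∘ proj₁ ∘ proj₂)
      ... | yes p | yes d with search {λ x → (χ x ≡ χ x₀) × (+ q * + E x₀ ∣ x)} (λ x → (χ x ≟F χ x₀) ×-dec (+ q * + E x₀ ∣? x)) (λ h (m , d') → trans (χ-cong (≋-sym h)) m , ∣-≋ (≋-weaken (∣-trans d (∣N (M-AG x₀))) h) d')
      ...   | yes r = yes (p , d , r)
      ...   | no ¬r = no (¬r ∘ proj₂ ∘ proj₂)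
      go : Dec (∃ λ (i : Fin (suc (M x₀))) → Bad (toℕ i)) → Regular x₀ ⊎ ∃ λ q → Prime q × (+ q * + E x₀ ∣ + M x₀) × Splitting x₀ (+ q * + E x₀)
      go (no none) = inj₁ λ q pr d x m d' → none (fromℕ< (bound q d) , subst Bad (sym (toℕ-fromℕ< (bound q d))) (pr , d , x , m , d'))
        where
        bound : ∀ q → + q * + E x₀ ∣ + M x₀ → q ℕ.< suc (M x₀)
        bound q d = s≤s (ℕ∣.∣⇒≤ {{nz (M-AG x₀)}} (∣⇒∣ᵤ (∣-trans (∣m⇒∣m*n (+ E x₀) (∣-refl {+ q})) d)))
      go (yes (i , pr , d , x₁ , m₁ , d₁)) = inj₂ (q , pr , d , fin other)
        where
        q : ℕ
        q = toℕ i
        pd : PrimeData x₀ q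
        pd = prime-data x₀ pr d
        open PrimeData pd using (M≡; e₀≡; p∤s; e≡; p∤e'; e∣e₀)
        -- If all elements were divisible by qE, then so would be the index E of the group that they
        -- generate.
        other : ∃ λ y → (χ y ≡ χ x₀) × ¬ + q * + E x₀ ∣ y
        other with search {λ y → (χ y ≡ χ x₀) × ¬ + q * + E x₀ ∣ y} (λ y → (χ y ≟F χ x₀) ×-dec ¬? (+ q * + E x₀ ∣? y)) (λ h (m , ¬d') → trans (χ-cong (≋-sym h)) m , λ d' → ¬d' (∣-≋ (≋-weaken (∣-trans d (∣N (M-AG x₀))) (≋-sym h)) d'))
        ... | yes r = r
        ... | no ¬r = ⊥-elim (prime-∤1 pr (*-cancelˡ-∣ (+ E x₀) {{≢-nonZero (E≢0 x₀)}} (subst₂ _∣_ (ℤₚ.*-comm (+ q) (+ E x₀)) (sym (ℤₚ.*-identityʳ (+ E x₀)))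
            (gen-least (genOf x₀) (∣-trans d (∣N (M-AG x₀))) (λ y m → decidable-stable (+ q * + E x₀ ∣? y) (λ ¬d' → ¬r (y , m , ¬d')))))))
        fin : (∃ λ y → (χ y ≡ χ x₀) × ¬ + q * + E x₀ ∣ y) → Splitting x₀ (+ q * + E x₀)
        fin (y₁ , n₁ , ¬d₁) = splitting x₀ (radOf x₀) (genOf x₀) pr M≡ e₀≡ p∤s e≡ p∤e' e∣e₀ x₁ y₁ m₁ d₁ n₁ ¬d₁

    class-Periodic : ∀ x₀ → Periodic (M x₀) (class x₀)
    class-Periodic x₀ {x} {y} h m = subst (mem (class x₀)) (eq x y) (∣⇒∈ (radOf x₀) (≋⇒∣ (≋-sym h)) x m)
      where
      eq : ∀ x y → y - x + x ≡ y
      eq = solve-∀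

    -- Divided by E, both elements are prime to M/E; their ratio modulo M/E lifts to a unit modulo
    -- N.
    unit-between : ∀ {x₀ x y} → RegularAt x₀ x → RegularAt x₀ y → ∃ λ u → Cop (+ N) u × (u * x ≋ y [ + M x₀ ])
    unit-between {x₀} {x} {y} (dx , rx) (dy , ry) = go dx dy (E∣M x₀)
      where
      e : ℤ
      e = + E x₀
      go : e ∣ x → e ∣ y → e ∣ + M x₀ → ∃ λ u → Cop (+ N) u × (u * x ≋ y [ + M x₀ ])
      go (divides x' ex) (divides y' ey) (divides m em) = go' (cop-inv (cop x' (λ q pr d → rx q pr (∣q d) ∘ lift ex)))
        where
        m≢0 : m ≢ 0ℤ
        m≢0 refl = ℕ.≢-nonZero⁻¹ (M x₀) {{nz (M-AG x₀)}} (ℤₚ.+-injective em)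
        ∣q : ∀ {q} → + q ∣ m → + q * e ∣ + M x₀
        ∣q (divides r refl) = divides r (trans em (ℤₚ.*-assoc r _ e))
        lift : ∀ {q x x'} → x ≡ x' * e → + q ∣ x' → + q * e ∣ x
        lift ex (divides r refl) = divides r (trans ex (ℤₚ.*-assoc r _ e))
        cop : ∀ x' → (∀ q → Prime q → + q ∣ m → ¬ + q ∣ x') → Cop m x'
        cop x' h = local-cop m m≢0 h
        go' : (∃ λ z → x' * z ≋ 1ℤ [ m ]) → ∃ λ u → Cop (+ N) u × (u * x ≋ y [ + M x₀ ])
        go' (z , hz) = go″ (lift-unit N≢0 (∣-trans (divides e (trans em (ℤₚ.*-comm m e))) (∣N (M-AG x₀)))
            (cop-*ʳ (cop y' (λ q pr d → ry q pr (∣q d) ∘ lift ey)) (inv-cop x' (≋-trans (≋-reflexive (ℤₚ.*-comm z x')) hz))))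
          where
          go″ : (∃ λ u → Cop (+ N) u × (u ≋ y' * z [ m ])) → ∃ λ u → Cop (+ N) u × (u * x ≋ y [ + M x₀ ])
          go″ (u , cu , hu) = u , cu , ≋⟨ subst₂ _∣_ (sym em) (trans (eq u x' y' e) (cong₂ (λ a b → u * a - b) (sym ex) (sym ey))) (*-∣-* {m} {e} (≋⇒∣ h) ∣-refl) ⟩
            where
            h : u * x' ≋ y' [ m ]
            h = ≋-trans (≋-*ʳ x' hu) (≋-trans (≋-reflexive (eq' y' z x')) (≋-trans (≋-*ˡ y' hz) (≋-reflexive (ℤₚ.*-identityʳ y'))))
              where
              eq' : ∀ y z x → y * z * x ≡ y * (x * z)
              eq' = solve-∀
            eq : ∀ u x y e → (u * x - y) * e ≡ u * (x * e) - y * e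
            eq = solve-∀

    regular-self : ∀ {x₀} → Regular x₀ → ∀ {x} → χ x ≡ χ x₀ → RegularAt x₀ x
    regular-self {x₀} reg {x} m = gen-∣ (genOf x₀) m , λ q pr d → reg q pr d x m

    unit-class-Periodic : ∀ {x₀ u} → Cop (+ N) u → Periodic (M x₀) (class (u * x₀))
    unit-class-Periodic {x₀} {u} cu {x} {y} h m = go (cop-inv cu)
      where
      go : (∃ λ v → u * v ≋ 1ℤ [ + N ]) → χ y ≡ χ (u * x₀)
      go (v , hv) = trans (χ-cong (≋-sym (back y))) (~-unit cu (class-Periodic x₀ (≋-*ˡ v h) (trans (~-unit cv m) (χ-cong (≋-trans (≋-reflexive (eq v u x₀)) (back x₀))))))
        where
        cv : Cop (+ N) v
        cv = inv-cop u (≋-trans (≋-reflexive (ℤₚ.*-comm v u)) hv)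
        back : ∀ x → u * (v * x) ≋ x [ + N ]
        back x = ≋-trans (≋-reflexive (sym (ℤₚ.*-assoc u v x))) (≋-trans (≋-*ʳ x hv) (≋-reflexive (ℤₚ.*-identityˡ x)))
        eq : ∀ v u x → v * (u * x) ≡ u * (v * x)
        eq = solve-∀

    regular-class : ∀ {x₀} → Regular x₀ → ∀ {y} → RegularAt x₀ y → ∃ λ u → Cop (+ N) u × (u * x₀ ≋ y [ + M x₀ ]) × (χ y ≡ χ (u * x₀))
    regular-class {x₀} reg {y} ry = go (unit-between (regular-self reg refl) ry)
      where
      go : (∃ λ u → Cop (+ N) u × (u * x₀ ≋ y [ + M x₀ ])) → ∃ λ u → Cop (+ N) u × (u * x₀ ≋ y [ + M x₀ ]) × (χ y ≡ χ (u * x₀))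
      go (u , cu , h) = u , cu , h , unit-class-Periodic {x₀} cu h refl

    regular-Periodic : ∀ {x₀} → Regular x₀ → ∀ {y} → RegularAt x₀ y → Periodic (M x₀) (class y)
    regular-Periodic {x₀} reg {y} ry {_} {y′} h m = go (regular-class reg ry)
      where
      go : (∃ λ u → Cop (+ N) u × (u * x₀ ≋ y [ + M x₀ ]) × (χ y ≡ χ (u * x₀))) → mem (class y) y′
      go (u , cu , _ , e) = trans (unit-class-Periodic {x₀} cu h (trans m e)) (sym e)

  module AtPrime {x₀ : ℤ} (reg : Regular x₀) {p : ℕ} (pd : PrimeData x₀ p) where
    open PrimeData pd public
    open ClassLocal x₀ (radOf x₀) (genOf x₀) prime M≡ e₀≡ p∤s e≡ p∤e' e∣e₀ public renaming (M to Mx; e to ex)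

    opaque
      j≤b : j ℕ.≤ b
      j≤b = ∣↑-≤ prime p∤s (subst (p ↑ j ∣_) e₀≡ (∣-trans (divides e' (trans e≡ (ℤₚ.*-comm (p ↑ j) e'))) e∣e₀))

    -- The exponent of p in M/E: it is b + 1 in M and j in E.
    a : ℕ
    a = suc (b ℕ.∸ j)

    Stabilises : ℤ → Set
    Stabilises v = χ (v * x₀) ≡ χ x₀

    opaque
      a+j : a ℕ.+ j ≡ suc b
      a+j = cong suc (ℕₚ.m∸n+n≡m j≤b)

      local-form : ∀ {x} → RegularAt x₀ x → ∃ λ x' → (x ≡ p ↑ j * x') × ¬ + p ∣ x'
      local-form (d , r) = primitive-part d (r p prime qe∣M)

      form : ∀ {x} → mem A x → ∃ λ x' → (x ≡ p ↑ j * x') × ¬ + p ∣ x'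
      form m = local-form (regular-self reg m)

      stab-mem : ∀ {v} → Cop (+ N) v → Stabilises v → ∀ {x} → mem A x → mem A (v * x)
      stab-mem cv sv m = trans (~-unit cv m) sv

      stab-from : ∀ {v} → Cop (+ N) v → ∀ {x} → mem A x → mem A (v * x) → Stabilises v
      stab-from cv m m' = trans (~-unit cv (sym m)) m'

      stab-pow : ∀ {v} → Cop (+ N) v → Stabilises v → ∀ i → Stabilises (v ^ i)
      stab-pow cv sv zero = cong χ (ℤₚ.*-identityˡ x₀)
      stab-pow {v} cv sv (suc i) = trans (cong χ (ℤₚ.*-assoc v (v ^ i) x₀)) (stab-mem cv sv (stab-pow cv sv i))

      -- By regularity all elements of A have the same valuation j at p, so congruence modulo s
      -- makes them unit multiples; a unit that maps one element of A into A stabilises A.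
      fibre : ∀ {x y} → mem A x → mem A y → x ≋ y [ s ] → ∃ λ v → Cop (+ N) v × (v ≋ 1ℤ [ s ]) × (v * x ≋ y [ + Mx ]) × Stabilises v
      fibre {x} {y} mx my h = go (form mx) (form my)
        where
        go : (∃ λ x' → (x ≡ p ↑ j * x') × ¬ + p ∣ x') → (∃ λ x' → (y ≡ p ↑ j * x') × ¬ + p ∣ x') → ∃ λ v → Cop (+ N) v × (v ≋ 1ℤ [ s ]) × (v * x ≋ y [ + Mx ]) × Stabilises v
        go (x' , ex , ¬x') (y' , ey , ¬y') = go' (associate-unit ex ey ¬x' ¬y' h 0 z≤n ≋⟨ 0↑∣ ⟩)
          where
          go' : (∃ λ u → Cop (+ N) u × (u ≋ 1ℤ [ s ]) × (u ≋ 1ℤ [ p ↑ 0 ]) × (u * x ≋ y [ + Mx ])) → ∃ λ v → Cop (+ N) v × (v ≋ 1ℤ [ s ]) × (v * x ≋ y [ + Mx ]) × Stabilises v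
          go' (v , cv , vs , _ , vx) = v , cv , vs , vx , stab-from cv mx (A-Periodic (≋-sym vx) my)

      fix-of-≋1 : ∀ {v} → v ≋ 1ℤ [ s ] → p ↑ a ∣ v - 1ℤ → ∀ {x} → p ↑ j ∣ x → v * x ≋ x [ + Mx ]
      fix-of-≋1 {v} vs va {x} dx = ≋-local ≋⟨ subst₂ _∣_ (trans (sym (↑-+ p a j)) (cong (p ↑_) a+j)) (sym (eq v x)) (*-∣-* va dx) ⟩ ≋⟨ subst (s ∣_) (sym (eq v x)) (∣m⇒∣m*n x (≋⇒∣ vs)) ⟩
        where
        eq : ∀ v x → v * x - x ≡ (v - 1ℤ) * x
        eq = solve-∀

      ≋1-of-fix : ∀ {v x} → RegularAt x₀ x → v * x ≋ x [ + Mx ] → p ↑ a ∣ v - 1ℤ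
      ≋1-of-fix {v} {x} rx h = go (local-form rx)
        where
        go : (∃ λ x' → (x ≡ p ↑ j * x') × ¬ + p ∣ x') → p ↑ a ∣ v - 1ℤ
        go (x' , refl , ¬x') = cop-cancel (cop-↑-∤ prime a ¬x') (cancel-↑ prime j (subst₂ _∣_ (trans (cong (p ↑_) (trans (sym a+j) (ℕₚ.+-comm a j))) (↑-+ p j a)) (eq v (p ↑ j) x') (∣-trans qb∣M (≋⇒∣ h))))
          where
          eq : ∀ v q x → v * (q * x) - q * x ≡ q * (x * (v - 1ℤ))
          eq = solve-∀

      -- A stabilising unit with v − 1 of valuation exactly a − 1 would make A invariant under e₀.
      no-top : ∀ {v w} → Cop (+ N) v → v ≋ 1ℤ [ s ] → Stabilises v → + p ∣ v - 1ℤ → v - 1ℤ ≡ p ↑ (b ℕ.∸ j) * w → ¬ + p ∣ w → ⊥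
      no-top {v} {w} cv vs sv pv ev ¬w = M∤e₀ (∈⇒∣ (radOf x₀) (λ x m → add-e₀ m (form m)))
        where
        v-e₀ : v * + e₀ ≋ + e₀ [ + Mx ]
        v-e₀ = ≋⟨ subst₂ _∣_ (sym M≡qe₀) (eq v (+ e₀)) (*-∣-* pv (∣-refl {+ e₀})) ⟩
          where
          eq : ∀ v e → (v - 1ℤ) * e ≡ v * e - e
          eq = solve-∀
        add-e₀ : ∀ {x} → mem A x → (∃ λ x' → (x ≡ p ↑ j * x') × ¬ + p ∣ x') → mem A (+ e₀ + x)
        add-e₀ {x} m (x' , ex , ¬x') = step₀ (≋⇒∣ vs)
          where
          step₀ : s ∣ v - 1ℤ → mem A (+ e₀ + x)
          step₀ (divides r er) = go (quo (subst (s ∣_) ev (divides r er)))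
            where
            quo : s ∣ p ↑ (b ℕ.∸ j) * w → ∃ λ κ → w ≡ s * κ
            quo d = quo' (cop-cancel (cop-sym (cop-↑-∤ prime (b ℕ.∸ j) p∤s)) d)
              where
              quo' : s ∣ w → ∃ λ κ → w ≡ s * κ
              quo' (divides κ e) = κ , trans e (ℤₚ.*-comm κ s)
            go : (∃ λ κ → w ≡ s * κ) → mem A (+ e₀ + x)
            go (κ , refl) = last (inverse-mod prime 1 (∤-* prime {κ} {x'} (λ d → ¬w (∣n⇒∣m*n s d)) ¬x'))
              where
              K : ℤ
              K = κ * x'
              shift : v * x - x ≡ K * + e₀
              shift = trans (eq v x) (trans (cong₂ _*_ ev ex) (trans (eq' (p ↑ (b ℕ.∸ j)) s κ (p ↑ j) x') (cong (κ * x' *_) (trans (cong (_* s) (trans (sym (↑-+ p (b ℕ.∸ j) j)) (cong (p ↑_) (ℕₚ.m∸n+n≡m j≤b)))) (sym e₀≡)))))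
                where
                eq : ∀ v x → v * x - x ≡ (v - 1ℤ) * x
                eq = solve-∀
                eq' : ∀ c s κ q x → c * (s * κ) * (q * x) ≡ κ * x * (c * q * s)
                eq' = solve-∀
              -- `v` acts on the coset x + e₀ℤ as translation by K e₀ with K prime to p, so one of
              -- its powers is translation by e₀.
              powers : ∀ i → v ^ i * x ≋ x + + i * K * + e₀ [ + Mx ]
              powers zero = ≋-reflexive (eq x K (+ e₀))
                where
                eq : ∀ x K e → 1ℤ * x ≡ x + 0ℤ * K * e
                eq = solve-∀
              powers (suc i) = ≋-trans (≋-reflexive (ℤₚ.*-assoc v (v ^ i) x)) (≋-trans (≋-*ˡ v (powers i)) (≋-trans (≋-reflexive (eq v x (+ i) K (+ e₀)))
                (≋-trans (≋-+ˡ (v * x) (≋-*ˡ (+ i * K) v-e₀)) (≋-reflexive (trans (eq' v x (+ i) K (+ e₀)) (trans (cong (λ z → z + x + + i * K * + e₀) shift) (trans (eq″ K (+ e₀) x (+ i)) (cong (λ z → x + z * K * + e₀) (sym (ℤₚ.pos-+ 1 i))))))))))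
                where
                eq : ∀ v x i K e → v * (x + i * K * e) ≡ v * x + i * K * (v * e)
                eq = solve-∀
                eq' : ∀ v x i K e → v * x + i * K * e ≡ v * x - x + x + i * K * e
                eq' = solve-∀
                eq″ : ∀ K e x i → K * e + x + i * K * e ≡ x + (1ℤ + i) * K * e
                eq″ = solve-∀
              last : (∃ λ t → (K * t ≋ 1ℤ [ p ↑ 1 ]) × ¬ + p ∣ t) → mem A (+ e₀ + x)
              last (t , ht , _) = fin (residue p {{prime⇒nonZero prime}} t)
                where
                fin : (∃ λ r → r ℕ.< p × (+ r ≋ t [ + p ])) → mem A (+ e₀ + x)
                fin (i , _ , hi) = A-Periodic (≋-trans (powers i) h) (stab-mem (cop-pow cv i) (stab-pow cv sv i) m)
                  where
                  one : + i * K ≋ 1ℤ [ + p ]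
                  one = ≋-trans (≋-*ʳ K hi) (≋-trans (≋-reflexive (ℤₚ.*-comm t K)) (subst (λ z → K * t ≋ 1ℤ [ z ]) (↑-1 p) ht))
                  h : x + + i * K * + e₀ ≋ + e₀ + x [ + Mx ]
                  h = ≋⟨ subst₂ _∣_ (sym M≡qe₀) (eq (+ i * K) (+ e₀) x) (*-∣-* (≋⇒∣ one) (∣-refl {+ e₀})) ⟩
                    where
                    eq : ∀ k e x → (k - 1ℤ) * e ≡ x + k * e - (e + x)
                    eq = solve-∀

      -- Each p-th power raises the valuation of v - 1 by exactly one and still stabilises A. If the
      -- valuation were below a, some iterate would have valuation a - 1, which `no-top` excludes.
      rigid : ∀ {v} → Cop (+ N) v → v ≋ 1ℤ [ s ] → Stabilises v → + p ∣ v - 1ℤ → (p ≡ 2 → + 4 ∣ v - 1ℤ) → p ↑ a ∣ v - 1ℤ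
      rigid {v} cv vs sv pv v4 = go (valuation prime a (v - 1ℤ))
        where
        climb : ∀ f t v w → Cop (+ N) v → v ≋ 1ℤ [ s ] → Stabilises v → (p ≡ 2 → + 4 ∣ v - 1ℤ) → v - 1ℤ ≡ p ↑ suc t * w → ¬ + p ∣ w → f ℕ.+ suc t ≡ b ℕ.∸ j → ⊥
        climb zero t v w cv vs sv v4 ev ¬w e = no-top cv vs sv (subst (+ p ∣_) (sym ev) (∣m⇒∣m*n w (p∣↑ p t))) (trans ev (cong (λ z → p ↑ z * w) e)) ¬w
        climb (suc f) t v w cv vs sv v4 ev ¬w e = step (lift-exponent prime v t w ev ¬w v4)
          where
          step : (∃ λ w' → (v ^ p - 1ℤ ≡ p ↑ suc (suc t) * w') × ¬ + p ∣ w') → ⊥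
          step (w' , ev' , ¬w') = climb f (suc t) (v ^ p) w' (cop-pow cv p) (≋1-pow vs p) (stab-pow cv sv p)
            (λ e2 → ∣-trans (subst (λ z → + 4 ∣ v ^ z - 1ℤ) (sym e2) (4∣ v (v4 e2))) ∣-refl) ev' ¬w' (trans (ℕₚ.+-suc f (suc t)) e)
            where
            4∣ : ∀ v → + 4 ∣ v - 1ℤ → + 4 ∣ v ^ 2 - 1ℤ
            4∣ v d = subst (+ 4 ∣_) (eq v) (∣m⇒∣m*n (v + 1ℤ) d)
              where
              eq : ∀ v → (v - 1ℤ) * (v + 1ℤ) ≡ v * (v * 1ℤ) - 1ℤ
              eq = solve-∀
        go : (p ↑ a ∣ v - 1ℤ) ⊎ (∃ λ w → ∃ λ x' → w ℕ.< a × (v - 1ℤ ≡ p ↑ w * x') × ¬ + p ∣ x') → p ↑ a ∣ v - 1ℤ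
        go (inj₁ r) = r
        go (inj₂ (zero , x' , _ , ev , ¬x')) = ⊥-elim (¬x' (subst (+ p ∣_) (trans ev (trans (cong (_* x') (↑-0 p)) (ℤₚ.*-identityˡ x'))) pv))
        go (inj₂ (suc t , x' , l , ev , ¬x')) = ⊥-elim (climb (b ℕ.∸ j ℕ.∸ suc t) t v x' cv vs sv v4 ev ¬x' (ℕₚ.m∸n+n≡m (ℕₚ.≤-pred l)))

      -- A stabilising unit carries the element of `star₀` to x modulo M, and the missing shift with
      -- it. So all cosets meeting a regular class are broken.
      non-invariant : ∀ {x} → mem A x → ∃ λ k → ¬ mem A (x + k * + e₀)
      non-invariant {x} m = go star₀
        where
        go : (∃ λ x → mem A x × ¬ mem A (x + 1ℤ * + e₀)) → ∃ λ k → ¬ mem A (x + k * + e₀)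
        go (x⋆ , m⋆ , ¬m⋆) = go' (unit-between (regular-self reg m⋆) (regular-self reg m))
          where
          go' : (∃ λ u → Cop (+ N) u × (u * x⋆ ≋ x [ + Mx ])) → ∃ λ k → ¬ mem A (x + k * + e₀)
          go' (u , cu , h) = u , λ m' → ¬m⋆ (trans (back (cop-inv cu) (A-Periodic (≋-trans (≋-+ʳ (u * + e₀) (≋-sym h)) (≋-reflexive (eq u x⋆ (+ e₀)))) m')) refl)
            where
            eq : ∀ u x e → u * x + u * e ≡ u * (x + 1ℤ * e)
            eq = solve-∀
            su : Stabilises u
            su = stab-from cu m⋆ (A-Periodic (≋-sym h) m)
            back : (∃ λ v → u * v ≋ 1ℤ [ + N ]) → ∀ {z} → mem A (u * z) → mem A z
            back (v , hv) {z} mz = trans (χ-cong (≋-sym (vu z))) (trans (~-unit cv (trans mz (sym su))) (χ-cong (vu x₀)))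
              where
              cv : Cop (+ N) v
              cv = inv-cop u (≋-trans (≋-reflexive (ℤₚ.*-comm v u)) hv)
              vu : ∀ z → v * (u * z) ≋ z [ + N ]
              vu z = ≋-trans (≋-reflexive (eq' v u z)) (≋-trans (≋-*ʳ z hv) (≋-reflexive (ℤₚ.*-identityˡ z)))
                where
                eq' : ∀ v u z → v * (u * z) ≡ u * v * z
                eq' = solve-∀

-- A-groups obtained from a regular class

module RegularGroups {n k : ℕ} (c : Colouring (suc n) k) (circ : IsCirculant c) where
  open Sets c circ
  open Theory c circ
  open TopLayer c circ
  open RegularClasses c circ

  opaque
    AG-≡ : ∀ {g h} → IsAGroup g → + g ∣ + h → + h ∣ + g → IsAGroup h
    AG-≡ ag d d' = subst IsAGroup (ℕ∣.∣-antisym (∣⇒∣ᵤ d) (∣⇒∣ᵤ d')) ag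

    -- The index of the group generated by m A is a multiple of m; its quotient by m divides all of
    -- A, hence E.
    multiple-AG : ∀ x₀ m (P : ASet) → (∀ {x} → χ x ≡ χ x₀ → mem P (+ m * x)) → (∀ {g} → mem P g → ∃ λ x → (χ x ≡ χ x₀) × (+ m * x ≋ g [ + M x₀ ])) →
      + m * + E x₀ ∣ + M x₀ → IsAGroup (m ℕ.* E x₀)
    multiple-AG x₀ m P in′ out d = AG-≡ (gen-AG Gd) (subst (+ gen Gd ∣_) (sym (ℤₚ.pos-* m (E x₀))) g∣) (subst (_∣ + gen Gd) (sym (ℤₚ.pos-* m (E x₀))) ∣g)
      where
      Gd : Generated P
      Gd = generated P
      ∣g : + m * + E x₀ ∣ + gen Gd
      ∣g = gen-least Gd (∣-trans d (∣N (M-AG x₀))) (λ g mg → go (out mg))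
        where
        go : ∀ {g} → (∃ λ x → (χ x ≡ χ x₀) × (+ m * x ≋ g [ + M x₀ ])) → + m * + E x₀ ∣ g
        go (x , mx , h) = ∣-≋ (≋-weaken d h) (*-monoʳ-∣ (+ m) (gen-∣ (genOf x₀) mx))
      m≢0 : + m ≢ 0ℤ
      m≢0 = ∣-nonZero N≢0 (∣-trans (∣-trans (∣m⇒∣m*n (+ E x₀) ∣-refl) d) (∣N (M-AG x₀)))
      g∣ : + gen Gd ∣ + m * + E x₀
      g∣ = go (∣-trans (∣m⇒∣m*n (+ E x₀) (∣-refl {+ m})) ∣g)
        where
        go : + m ∣ + gen Gd → + gen Gd ∣ + m * + E x₀
        go (divides g' eg) = subst (_∣ + m * + E x₀) (trans (ℤₚ.*-comm (+ m) g') (sym eg)) (*-monoʳ-∣ (+ m) (gen-least (genOf x₀)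
          (∣-trans (divides (+ m) (trans eg (ℤₚ.*-comm g' (+ m)))) (∣N (gen-AG Gd)))
          (λ x mx → *-cancelˡ-∣ (+ m) {{≢-nonZero m≢0}} (subst (_∣ + m * x) (trans eg (ℤₚ.*-comm g' (+ m))) (gen-∣ Gd (in′ mx))))))

  module _ {x₀ : ℤ} (reg : Regular x₀) {p : ℕ} (pd : PrimeData x₀ p) where
    open AtPrime reg pd

    -- The condition of `rigid` with modulus p even for p = 2. It ensures that cosets stay broken
    -- while A is repeatedly pushed forward along p.
    Unramified : Set
    Unramified = ∀ {v} → Cop (+ N) v → v ≋ 1ℤ [ s ] → Stabilises v → + p ∣ v - 1ℤ → p ↑ a ∣ v - 1ℤ

    -- The obstruction for p = 2. Such a u has u - 1 equal to twice an odd number, so 2^(b-j-1) x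
    -- and 2^(b-j-1) u x differ by e₀ modulo M: the coset is full and the next push-forward is
    -- empty.
    Twist : ℤ → Set
    Twist u = Cop (+ N) u × (u ≋ 1ℤ [ s ]) × Stabilises u × ¬ p ↑ a ∣ u - 1ℤ

    StageSet : ℕ → Set₁
    StageSet i = Σ ASet λ P → Periodic Mx P × (∀ {x} → mem A x → mem P (p ↑ i * x)) × (∀ {g} → mem P g → ∃ λ x → mem A x × (p ↑ i * x ≋ g [ + Mx ]))

    opaque
      p↑a∣M : p ↑ a * + E x₀ ∣ + Mx
      p↑a∣M = subst (p ↑ a * + E x₀ ∣_) (sym M≡ᶻ) (subst (_∣ p ↑ suc b * s) (eq′) (*-∣-* (∣-refl {p ↑ suc b}) (e'∣s)))
        where
        e'∣s : e' ∣ s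
        e'∣s = cop-cancel (cop-sym (cop-↑-∤ prime b p∤e')) (subst (e' ∣_) e₀≡ (∣-trans (divides (p ↑ j) e≡) e∣e₀))
        eq′ : p ↑ suc b * e' ≡ p ↑ a * + E x₀
        eq′ = trans (cong (_* e') (trans (cong (p ↑_) (sym a+j)) (↑-+ p a j))) (trans (ℤₚ.*-assoc (p ↑ a) (p ↑ j) e') (cong (p ↑ a *_) (sym e≡)))

      stage-0 : StageSet 0
      stage-0 = A , A-Periodic , (λ {x} m → subst (mem A) (sym (one x)) m) , λ {g} m → g , m , ≋-reflexive (one g)
        where
        one : ∀ x → p ↑ 0 * x ≡ x
        one x = trans (cong (_* x) (↑-0 p)) (ℤₚ.*-identityˡ x)

      stage-step : ∀ i (S : StageSet i) → (∀ {g} → mem (proj₁ S) g → ∃ λ k → ¬ mem (proj₁ S) (g + k * + e₀)) → StageSet (suc i)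
      stage-step i (P , per , in′ , out) non = Ω ag P per prime e₀ M≡ , Ω-Periodic ag P per prime e₀ M≡ , in″ , out″
        where
        suc-* : ∀ x → + p * (p ↑ i * x) ≡ p ↑ suc i * x
        suc-* x = trans (sym (ℤₚ.*-assoc (+ p) (p ↑ i) x)) (cong (_* x) (sym (↑-suc p i)))
        in″ : ∀ {x} → mem A x → mem (Ω ag P per prime e₀ M≡) (p ↑ suc i * x)
        in″ {x} m = go (non (in′ m))
          where
          go : (∃ λ k → ¬ mem P (p ↑ i * x + k * + e₀)) → mem (Ω ag P per prime e₀ M≡) (p ↑ suc i * x)
          go (k , ¬m) = subst (mem (Ω ag P per prime e₀ M≡)) (suc-* x) (Ω-in ag P per prime e₀ M≡ k (in′ m) ¬m)
        out″ : ∀ {g} → mem (Ω ag P per prime e₀ M≡) g → ∃ λ x → mem A x × (p ↑ suc i * x ≋ g [ + Mx ])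
        out″ {g} ω = go (Ω-out ag P per prime e₀ M≡ ω)
          where
          go : (∃ λ x → mem P x × (∃ λ k → ¬ mem P (x + k * + e₀)) × (+ p * x ≋ g [ + Mx ])) → ∃ λ x → mem A x × (p ↑ suc i * x ≋ g [ + Mx ])
          go (y , my , _ , h) = go' (out my)
            where
            go' : (∃ λ x → mem A x × (p ↑ i * x ≋ y [ + Mx ])) → ∃ λ x → mem A x × (p ↑ suc i * x ≋ g [ + Mx ])
            go' (x , mx , h') = x , mx , ≋-trans (≋-reflexive (sym (suc-* x))) (≋-trans (≋-*ˡ (+ p) h') h)

      AG-p : IsAGroup (p ℕ.* E x₀)
      AG-p = go (stage-step 0 stage-0 non)
        where
        non : ∀ {g} → mem (proj₁ stage-0) g → ∃ λ k → ¬ mem (proj₁ stage-0) (g + k * + e₀)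
        non m = non-invariant m
        go : StageSet 1 → IsAGroup (p ℕ.* E x₀)
        go (P , per , in′ , out) = multiple-AG x₀ p P (λ {x} m → subst (λ z → mem P (z * x)) (↑-1 p) (in′ m))
          (λ {g} m → subst (λ z → ∃ λ x → (χ x ≡ χ x₀) × (z * x ≋ g [ + Mx ])) (↑-1 p) (out m)) qe∣M

      -- Every coset met by p^i A has to be broken. If i < b - j and p^i y were p^i x + e₀, then y =
      -- v x for a stabilising unit v with v = 1 modulo s and modulo p, so v fixes x and e₀ would
      -- vanish modulo M. If i = b - j, the members have valuation exactly b, so the foot of the
      -- coset is missing.
      stages : Unramified → ∀ i → i ℕ.≤ a → StageSet i
      stages Q zero l = stage-0
      stages Q (suc i) l = go (stages Q i (ℕₚ.≤-trans (ℕₚ.n≤1+n i) l))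
        where
        i≤ : i ℕ.≤ b ℕ.∸ j
        i≤ = ℕₚ.≤-pred l
        go : StageSet i → StageSet (suc i)
        go S@(P , per , in′ , out) = stage-step i S non
          where
          non : ∀ {g} → mem P g → ∃ λ k → ¬ mem P (g + k * + e₀)
          non {g} m = go₁ (out m) (ℕₚ.m≤n⇒m<n∨m≡n i≤)
            where
            go₁ : (∃ λ x → mem A x × (p ↑ i * x ≋ g [ + Mx ])) → (i ℕ.< b ℕ.∸ j) ⊎ (i ≡ b ℕ.∸ j) → ∃ λ k → ¬ mem P (g + k * + e₀)
            go₁ (x , mx , h) (inj₁ i<) = 1ℤ , λ m' → bad (out m')
              where
              bad : (∃ λ y → mem A y × (p ↑ i * y ≋ g + 1ℤ * + e₀ [ + Mx ])) → ⊥
              bad (y , my , h') = bad' (fibre mx my x≋y)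
                where
                diff : p ↑ i * y ≋ p ↑ i * x + 1ℤ * + e₀ [ + Mx ]
                diff = ≋-trans h' (≋-+ʳ (1ℤ * + e₀) (≋-sym h))
                x≋y : x ≋ y [ s ]
                x≋y = ≋-sym ≋⟨ cop-cancel (cop-sym (cop-↑-∤ prime i p∤s)) (subst (s ∣_) (eq (p ↑ i) y x (1ℤ * + e₀)) (∣m∣n⇒∣m+n (∣-trans s∣M (≋⇒∣ diff)) (∣n⇒∣m*n 1ℤ s∣e₀))) ⟩
                  where
                  eq : ∀ a y x e → a * y - (a * x + e) + e ≡ a * (y - x)
                  eq = solve-∀
                bad' : (∃ λ v → Cop (+ N) v × (v ≋ 1ℤ [ s ]) × (v * x ≋ y [ + Mx ]) × Stabilises v) → ⊥
                bad' (v , cv , vs , vx , sv) = bad″ (form mx)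
                  where
                  e₀-shift : p ↑ i * ((v - 1ℤ) * x) ≋ + e₀ [ + Mx ]
                  e₀-shift = ≋⟨ subst (+ Mx ∣_) (eq (p ↑ i) v x y (+ e₀)) (∣m∣n⇒∣m+n (∣n⇒∣m*n (p ↑ i) (≋⇒∣ vx)) (≋⇒∣ diff)) ⟩
                    where
                    eq : ∀ a v x y e → a * (v * x - y) + (a * y - (a * x + 1ℤ * e)) ≡ a * ((v - 1ℤ) * x) - e
                    eq = solve-∀
                  bad″ : (∃ λ x' → (x ≡ p ↑ j * x') × ¬ + p ∣ x') → ⊥
                  bad″ (x' , refl , ¬x') = M∤e₀ (∣-≋ (≋-trans (≋-*ˡ (p ↑ i) zero′) e₀-shift) (subst (+ Mx ∣_) (sym (ℤₚ.*-zeroʳ (p ↑ i))) ∣0))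
                    where
                    l< : suc (i ℕ.+ j) ℕ.≤ b
                    l< = ℕₚ.≤-trans (ℕₚ.+-monoˡ-≤ j i<) (ℕₚ.≤-reflexive (ℕₚ.m∸n+n≡m j≤b))
                    p∣v : + p ∣ v - 1ℤ
                    p∣v = cop-cancel (prime-cop prime ¬x') (cancel-↑ prime (i ℕ.+ j) (subst₂ _∣_ (trans (↑-suc p (i ℕ.+ j)) (ℤₚ.*-comm (+ p) (p ↑ (i ℕ.+ j)))) (trans (eq (p ↑ i) v (p ↑ j) x') (cong (_* (x' * (v - 1ℤ))) (sym (↑-+ p i j))))
                      (∣-≋ (≋-sym (≋-weaken (∣-trans (↑-∣ p (ℕₚ.≤-trans l< (ℕₚ.n≤1+n b))) qb∣M) e₀-shift)) (∣-trans (↑-∣ p l<) qb∣e₀))))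
                      where
                      eq : ∀ a v q x → a * ((v - 1ℤ) * (q * x)) ≡ a * q * (x * (v - 1ℤ))
                      eq = solve-∀
                    zero′ : 0ℤ ≋ (v - 1ℤ) * (p ↑ j * x') [ + Mx ]
                    zero′ = ≋-sym (≋-trans (≋-reflexive (eq v (p ↑ j * x'))) (≋-trans (≋-+ʳ (- (p ↑ j * x')) (fix-of-≋1 vs (Q cv vs sv p∣v) (∣m⇒∣m*n x' ∣-refl))) (≋-reflexive (ℤₚ.+-inverseʳ (p ↑ j * x')))))
                      where
                      eq : ∀ v x → (v - 1ℤ) * x ≡ v * x - x
                      eq = solve-∀
            go₁ (x , mx , h) (inj₂ refl) = go₂ (form mx)
              where
              i+j : i ℕ.+ j ≡ b
              i+j = ℕₚ.m∸n+n≡m j≤b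
              deep : ∀ {x x'} → x ≡ p ↑ j * x' → p ↑ i * x ≡ p ↑ b * x'
              deep {x} {x'} refl = trans (sym (ℤₚ.*-assoc (p ↑ i) (p ↑ j) x')) (cong (_* x') (trans (sym (↑-+ p i j)) (cong (p ↑_) i+j)))
              go₂ : (∃ λ x' → (x ≡ p ↑ j * x') × ¬ + p ∣ x') → ∃ λ k → ¬ mem P (g + k * + e₀)
              go₂ (x' , ex , _) = go₃ (coset-zero (∣-≋ (≋-weaken (∣-trans (↑-∣ p (ℕₚ.n≤1+n b)) qb∣M) h) (subst (p ↑ b ∣_) (sym (deep ex)) (∣m⇒∣m*n x' ∣-refl))))
                where
                go₃ : (∃ λ k → p ↑ suc b ∣ g - k * + e₀) → ∃ λ k → ¬ mem P (g + k * + e₀)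
                go₃ (k , dv) = - k , λ m' → bad (out m')
                  where
                  bad : (∃ λ y → mem A y × (p ↑ i * y ≋ g + - k * + e₀ [ + Mx ])) → ⊥
                  bad (y , my , h') = bad' (form my)
                    where
                    bad' : (∃ λ x' → (y ≡ p ↑ j * x') × ¬ + p ∣ x') → ⊥
                    bad' (y' , ey , ¬y') = ¬y' (cancel-↑ prime b (subst₂ _∣_ (trans (↑-suc p b) (ℤₚ.*-comm (+ p) (p ↑ b))) (deep ey) (∣-≋ (≋-sym (≋-weaken qb∣M h')) (subst (p ↑ suc b ∣_) (cong (λ z → g + z) (ℤₚ.neg-distribˡ-* k (+ e₀))) dv))))

      AG-pa : Unramified → IsAGroup (p ℕ.^ a ℕ.* E x₀)
      AG-pa Q = go (stages Q a ℕₚ.≤-refl)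
        where
        go : StageSet a → IsAGroup (p ℕ.^ a ℕ.* E x₀)
        go (P , per , in′ , out) = multiple-AG x₀ (p ℕ.^ a) P (λ {x} m → subst (λ z → mem P (z * x)) (sym (↑-as-+ p a)) (in′ m))
          (λ {g} m → subst (λ z → ∃ λ x → (χ x ≡ χ x₀) × (z * x ≋ g [ + Mx ])) (sym (↑-as-+ p a)) (out m)) (subst (λ z → z * + E x₀ ∣ + Mx) (sym (↑-as-+ p a)) p↑a∣M)

      -- For odd p this is `rigid`. For p = 2 a second element of A in the fibre of x₀ modulo s
      -- provides the twisting unit, and without one every unit in question fixes x₀.
      unramified-or-twist : Unramified ⊎ ((p ≡ 2) × ∃ Twist)
      unramified-or-twist with p ℕ.≟ 2
      ... | no ne = inj₁ λ cv vs sv pv → rigid cv vs sv pv (λ e → ⊥-elim (ne e))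
      ... | yes refl = go (search {λ x → mem A x × (x₀ ≋ x [ s ]) × ¬ (x₀ ≋ x [ + Mx ])} (λ x → mem? A x ×-dec ((x₀ ≋? x [ s ]) ×-dec ¬? (x₀ ≋? x [ + Mx ])))
          (λ h (m , hs , ¬h) → mem-≋ A h m , ≋-trans hs (≋-weaken (∣-trans s∣M (∣N ag)) h) , λ h' → ¬h (≋-trans h' (≋-weaken (∣N ag) (≋-sym h)))))
        where
        go : Dec (∃ λ x → mem A x × (x₀ ≋ x [ s ]) × ¬ (x₀ ≋ x [ + Mx ])) → Unramified ⊎ ((2 ≡ 2) × ∃ Twist)
        go (no none) = inj₁ λ {v} cv vs sv pv → ≋1-of-fix {v} (regular-self reg refl) (≋-sym (decidable-stable (x₀ ≋? v * x₀ [ + Mx ])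
          (λ ¬h → none (v * x₀ , sv , ≋-sym (≋-trans (≋-*ʳ x₀ vs) (≋-reflexive (ℤₚ.*-identityˡ x₀))) , ¬h))))
        go (yes (x , m , hs , ¬h)) = go' (fibre refl m hs)
          where
          go' : (∃ λ v → Cop (+ N) v × (v ≋ 1ℤ [ s ]) × (v * x₀ ≋ x [ + Mx ]) × Stabilises v) → Unramified ⊎ ((2 ≡ 2) × ∃ Twist)
          go' (u , cu , us , ux , su) = inj₂ (refl , u , cu , us , su , λ da → ¬h (≋-trans (≋-sym (fix-of-≋1 us da (j∣ (form refl)))) ux))
            where
            j∣ : (∃ λ x' → (x₀ ≡ 2 ↑ j * x') × ¬ + 2 ∣ x') → 2 ↑ j ∣ x₀
            j∣ (x' , e , _) = subst (2 ↑ j ∣_) (sym e) (∣m⇒∣m*n x' ∣-refl)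

opaque
  -- Comparing the least residues of x and σ x matches the smaller with the larger ones, so only
  -- fixed points survive modulo 2. It suffices that σ is an involution where the weight is nonzero.
  involution-parity : ∀ N .{{_ : ℕ.NonZero N}} {w} → Per N w → (σ τ : ℤ → ℤ) → (∀ {x y} → x ≋ y [ + N ] → σ x ≋ σ y [ + N ]) → (∀ {x y} → x ≋ y [ + N ] → τ x ≋ τ y [ + N ]) →
    (∀ x → σ (τ x) ≋ x [ + N ]) → (∀ x → τ (σ x) ≋ x [ + N ]) → (∀ x → w (σ x) ≡ w x) → (∀ x → w x ≢ 0 → σ (σ x) ≋ x [ + N ]) →
    + S N w ≋ + S N (λ x → w x ℕ.* ind (σ x ≋? x [ + N ])) [ + 2 ]
  involution-parity N {w} pw σ τ σc τc στ τσ wσ σσ = ≋-trans (≋-reflexive (cong +_ total)) (≋-trans (≋-reflexive (trans (ℤₚ.pos-+ (S N lt ℕ.+ S N lt) (S N fx)) (cong (_+ + S N fx) (trans (ℤₚ.pos-+ (S N lt) (S N lt)) refl)))) ≋⟨ divides (+ S N lt) (eq (+ S N lt) (+ S N fx)) ⟩)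
    where
    eq : ∀ a b → a + a + b - b ≡ a * + 2
    eq = solve-∀
    r : ℤ → ℕ
    r x = proj₁ (residue N x)
    r-< : ∀ x → r x ℕ.< N
    r-< x = proj₁ (proj₂ (residue N x))
    r-≋ : ∀ x → + r x ≋ x [ + N ]
    r-≋ x = proj₂ (proj₂ (residue N x))
    r-cong : ∀ {x y} → x ≋ y [ + N ] → r x ≡ r y
    r-cong {x} {y} h = residue-unique N (r-< x) (r-< y) (≋-trans (r-≋ x) (≋-trans h (≋-sym (r-≋ y))))
    lt gt fx : ℤ → ℕ
    lt x = w x ℕ.* ind (r x ℕ.<? r (σ x))
    gt x = w x ℕ.* ind (r (σ x) ℕ.<? r x)
    fx x = w x ℕ.* ind (σ x ≋? x [ + N ])
    three : ∀ x → w x ≡ lt x ℕ.+ gt x ℕ.+ fx x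
    three x = trans (sym (ℕₚ.*-identityʳ (w x))) (trans (cong (w x ℕ.*_) (sym one)) (trans (ℕₚ.*-distribˡ-+ (w x) (ind (r x ℕ.<? r (σ x)) ℕ.+ ind (r (σ x) ℕ.<? r x)) (ind (σ x ≋? x [ + N ]))) (cong (ℕ._+ fx x) (ℕₚ.*-distribˡ-+ (w x) _ _))))
      where
      one : ind (r x ℕ.<? r (σ x)) ℕ.+ ind (r (σ x) ℕ.<? r x) ℕ.+ ind (σ x ≋? x [ + N ]) ≡ 1
      one with ℕₚ.<-cmp (r x) (r (σ x))
      ... | tri< l ne _ = cong₂ ℕ._+_ (cong₂ ℕ._+_ (ind-yes (r x ℕ.<? r (σ x)) l) (ind-no (r (σ x) ℕ.<? r x) (ℕₚ.<-asym l))) (ind-no (σ x ≋? x [ + N ]) (λ h → ne (sym (r-cong h))))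
      ... | tri≈ nl e ng = cong₂ ℕ._+_ (cong₂ ℕ._+_ (ind-no (r x ℕ.<? r (σ x)) nl) (ind-no (r (σ x) ℕ.<? r x) ng)) (ind-yes (σ x ≋? x [ + N ]) (≋-trans (≋-sym (r-≋ (σ x))) (≋-trans (≋-reflexive (cong +_ (sym e))) (r-≋ x))))
      ... | tri> nl ne g = cong₂ ℕ._+_ (cong₂ ℕ._+_ (ind-no (r x ℕ.<? r (σ x)) nl) (ind-yes (r (σ x) ℕ.<? r x) g)) (ind-no (σ x ≋? x [ + N ]) (λ h → ne (sym (r-cong h))))
    gt-Per : Per N gt
    gt-Per x y p = cong₂ ℕ._*_ (pw x y p) (cong₂ (λ a b → ind (a ℕ.<? b)) (r-cong (σc p)) (r-cong p))
    gtσ : ∀ x → gt (σ x) ≡ lt x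
    gtσ x with w x ℕ.≟ 0
    ... | yes e = trans (cong (ℕ._* ind (r (σ (σ x)) ℕ.<? r (σ x))) (trans (wσ x) e)) (cong (ℕ._* ind (r x ℕ.<? r (σ x))) (sym e))
    ... | no ne = cong₂ ℕ._*_ (wσ x) (cong (λ a → ind (a ℕ.<? r (σ x))) (r-cong (σσ x ne)))
    total : S N w ≡ S N lt ℕ.+ S N lt ℕ.+ S N fx
    total = trans (S-cong N three) (trans (S-+ N _ _) (cong (ℕ._+ S N fx) (trans (S-+ N _ _) (cong (S N lt ℕ.+_) (trans (sym (S-perm N gt-Per σ τ σc τc στ τσ)) (S-cong N gtσ))))))

  odd-pred : ∀ {z} → ¬ + 2 ∣ z → + 2 ∣ z - 1ℤ
  odd-pred {z} ¬d = go (residue 2 z)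
    where
    go : (∃ λ r → r ℕ.< 2 × (+ r ≋ z [ + 2 ])) → + 2 ∣ z - 1ℤ
    go (0 , _ , h) = ⊥-elim (¬d (∣-≋ h ∣0))
    go (1 , _ , h) = ≋⇒∣ (≋-sym h)
    go (suc (suc _) , s≤s (s≤s ()) , _)

-- The twisted case at the prime 2

module Twisted {n k : ℕ} (c : Colouring (suc n) k) (circ : IsCirculant c) where
  open Sets c circ
  open Theory c circ
  open TopLayer c circ
  open RegularClasses c circ
  open RegularGroups c circ
  open GroupSemiring using (conv; push)

  module _ {x₀ : ℤ} (reg : Regular x₀) (pd : PrimeData x₀ 2) {u : ℤ} (tw : Twist reg pd u) where
    open AtPrime reg pd
    private
      instance
        M-nz : ℕ.NonZero Mx
        M-nz = nz ag
      cu : Cop (+ N) u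
      cu = proj₁ tw
      us : u ≋ 1ℤ [ s ]
      us = proj₁ (proj₂ tw)
      su : Stabilises u
      su = proj₁ (proj₂ (proj₂ tw))
      ¬ua : ¬ 2 ↑ a ∣ u - 1ℤ
      ¬ua = proj₂ (proj₂ (proj₂ tw))
      2∣N : + 2 ∣ + N
      2∣N = ∣-trans (∣-trans (p∣↑ 2 b) qb∣M) (∣N ag)

    opaque
      2∣u-1 : + 2 ∣ u - 1ℤ
      2∣u-1 = odd-pred (cop-∤ prime (cop-∣ˡ 2∣N cu))

      half-odd : ∃ λ w → (u - 1ℤ ≡ + 2 * w) × ¬ + 2 ∣ w
      half-odd = go 2∣u-1
        where
        go : + 2 ∣ u - 1ℤ → ∃ λ w → (u - 1ℤ ≡ + 2 * w) × ¬ + 2 ∣ w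
        go (divides w e) = w , trans e (ℤₚ.*-comm w (+ 2)) , λ { (divides r refl) → ¬ua (rigid cu us su 2∣u-1 (λ _ → divides r (trans e (ℤₚ.*-assoc r (+ 2) (+ 2))))) }

      4∣u+1 : + 4 ∣ u + 1ℤ
      4∣u+1 = go half-odd
        where
        go : (∃ λ w → (u - 1ℤ ≡ + 2 * w) × ¬ + 2 ∣ w) → + 4 ∣ u + 1ℤ
        go (w , e , ¬w) = go' (odd-pred ¬w)
          where
          go' : + 2 ∣ w - 1ℤ → + 4 ∣ u + 1ℤ
          go' (divides t et) = divides (t + 1ℤ) (trans (eq₁ u) (trans (cong (λ z → z + + 2) e) (trans (eq₂ w) (trans (cong (λ z → + 2 * z + + 4) et) (eq₃ t)))))
            where
            eq₁ : ∀ u → u + 1ℤ ≡ u - 1ℤ + + 2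
            eq₁ = solve-∀
            eq₂ : ∀ w → + 2 * w + + 2 ≡ + 2 * (w - 1ℤ) + + 4
            eq₂ = solve-∀
            eq₃ : ∀ t → + 2 * (t * + 2) + + 4 ≡ (t + 1ℤ) * + 4
            eq₃ = solve-∀

      uu-top : 2 ↑ a ∣ u * u - 1ℤ
      uu-top = rigid (cop-*ʳ cu cu) (≋-* us us) (trans (cong χ (ℤₚ.*-assoc u u x₀)) (stab-mem cu su su)) (subst (+ 2 ∣_) (eq u) (∣m⇒∣m*n (u + 1ℤ) 2∣u-1)) (λ _ → subst (+ 4 ∣_) (eq u) (∣n⇒∣m*n (u - 1ℤ) 4∣u+1))
        where
        eq : ∀ u → (u - 1ℤ) * (u + 1ℤ) ≡ u * u - 1ℤ
        eq = solve-∀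

      -- 2^a divides (u - 1)(u + 1), and u - 1 takes up only one factor 2.
      u+1-top : 2 ↑ (b ℕ.∸ j) ∣ u + 1ℤ
      u+1-top = go half-odd
        where
        go : (∃ λ w → (u - 1ℤ ≡ + 2 * w) × ¬ + 2 ∣ w) → 2 ↑ (b ℕ.∸ j) ∣ u + 1ℤ
        go (w , e , ¬w) = cop-cancel (cop-↑-∤ prime (b ℕ.∸ j) ¬w) (*-cancelˡ-∣ (+ 2) (subst₂ _∣_ (↑-suc 2 (b ℕ.∸ j)) (trans (eq u) (trans (cong (_* (u + 1ℤ)) e) (ℤₚ.*-assoc (+ 2) w (u + 1ℤ)))) uu-top))
          where
          eq : ∀ u → u * u - 1ℤ ≡ (u - 1ℤ) * (u + 1ℤ)
          eq = solve-∀

      -- For b = j the odd u would be 1 modulo 2^a, and for b = j + 1 the exact valuation 1 of u - 1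
      -- is the one excluded by `no-top`. So residues modulo 2^(j+2) make sense modulo M.
      j+2≤b : j ℕ.+ 2 ℕ.≤ b
      j+2≤b = go (b ℕ.∸ j) refl
        where
        go : ∀ d → b ℕ.∸ j ≡ d → j ℕ.+ 2 ℕ.≤ b
        go 0 e = ⊥-elim (¬ua (subst (_∣ u - 1ℤ) (sym (trans (cong (λ z → 2 ↑ suc z) e) (↑-1 2))) 2∣u-1))
        go 1 e = ⊥-elim (bad half-odd)
          where
          bad : (∃ λ w → (u - 1ℤ ≡ + 2 * w) × ¬ + 2 ∣ w) → ⊥
          bad (w , ew , ¬w) = no-top cu us su 2∣u-1 (trans ew (cong (_* w) (sym (trans (cong (2 ↑_) e) (↑-1 2))))) ¬w
        go (suc (suc d)) e = ℕₚ.≤-trans (ℕₚ.+-monoʳ-≤ j (ℕₚ.≤-trans (s≤s (s≤s z≤n)) (ℕₚ.≤-reflexive (sym e)))) (ℕₚ.≤-reflexive (ℕₚ.m+[n∸m]≡n j≤b))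

      j∣A : ∀ {x} → + E x₀ ∣ x → 2 ↑ j ∣ x
      j∣A d = ∣-trans (divides e' (trans e≡ (ℤₚ.*-comm (2 ↑ j) e'))) d

      uu-fix : ∀ {x} → + E x₀ ∣ x → u * (u * x) ≋ x [ + Mx ]
      uu-fix {x} d = ≋-trans (≋-reflexive (sym (ℤₚ.*-assoc u u x))) (fix-of-≋1 (≋-* us us) uu-top (j∣A d))

      u-fix : ∀ {g} → 2 ↑ b ∣ g → u * g ≋ g [ + Mx ]
      u-fix {g} d = ≋-local ≋⟨ subst₂ _∣_ (sym (↑-suc 2 b)) (eq u g) (*-∣-* 2∣u-1 d) ⟩ ≋⟨ subst (s ∣_) (eq u g) (∣m⇒∣m*n g (≋⇒∣ us)) ⟩
        where
        eq : ∀ u g → (u - 1ℤ) * g ≡ u * g - g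
        eq = solve-∀

      u-unfix : ∀ {g} → u * g ≋ g [ + Mx ] → 2 ↑ b ∣ g
      u-unfix {g} h = go half-odd
        where
        go : (∃ λ w → (u - 1ℤ ≡ + 2 * w) × ¬ + 2 ∣ w) → 2 ↑ b ∣ g
        go (w , e , ¬w) = cop-cancel (cop-↑-∤ prime b ¬w) (*-cancelˡ-∣ (+ 2) (subst₂ _∣_ (↑-suc 2 b) (trans (eq u g) (trans (cong (_* g) e) (ℤₚ.*-assoc (+ 2) w g))) (∣-trans qb∣M (≋⇒∣ h))))
          where
          eq : ∀ u g → u * g - g ≡ (u - 1ℤ) * g
          eq = solve-∀

      inverse : ∃ λ v → u * v ≋ 1ℤ [ + Mx ]
      inverse = go (cop-inv cu)
        where
        go : (∃ λ v → u * v ≋ 1ℤ [ + N ]) → ∃ λ v → u * v ≋ 1ℤ [ + Mx ]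
        go (v , h) = v , ≋-weaken (∣N ag) h

      uv-x : ∀ x → u * (proj₁ inverse * x) ≋ x [ + Mx ]
      uv-x x = ≋-trans (≋-reflexive (sym (ℤₚ.*-assoc u (proj₁ inverse) x))) (≋-trans (≋-*ʳ x (proj₂ inverse)) (≋-reflexive (ℤₚ.*-identityˡ x)))

      vu-x : ∀ x → proj₁ inverse * (u * x) ≋ x [ + Mx ]
      vu-x x = ≋-trans (≋-reflexive (eq (proj₁ inverse) u x)) (uv-x x)
        where
        eq : ∀ v u x → v * (u * x) ≡ u * (v * x)
        eq = solve-∀

      A-u : ∀ {z} → mem A (u * z) → mem A z
      A-u {z} m = go (cop-inv cu)
        where
        go : (∃ λ v → u * v ≋ 1ℤ [ + N ]) → mem A z
        go (v , hv) = trans (χ-cong (≋-sym (vu z))) (trans (~-unit cv (trans m (sym su))) (χ-cong (vu x₀)))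
          where
          cv : Cop (+ N) v
          cv = inv-cop u (≋-trans (≋-reflexive (ℤₚ.*-comm v u)) hv)
          vu : ∀ z → v * (u * z) ≋ z [ + N ]
          vu z = ≋-trans (≋-reflexive (eq' v u z)) (≋-trans (≋-*ʳ z hv) (≋-reflexive (ℤₚ.*-identityˡ z)))
            where
            eq' : ∀ v u z → v * (u * z) ≡ u * v * z
            eq' = solve-∀

      ι-u : ∀ z → ι A (u * z) ≡ ι A z
      ι-u z = ind-⇔ (mem? A (u * z)) (mem? A z) A-u (stab-mem cu su)

      ι-Perᴬ : Per Mx (ι A)
      ι-Perᴬ = ι-Per A A-Periodic

    C : ℤ → ℕ
    C = conv Mx (ι A) (ι A)

    Pair : ℤ → Set
    Pair g = ∃ λ x → mem A x × (x + u * x ≋ g [ + Mx ])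

    private
      -- The odd part of an element of A, modulo 4. As u is -1 modulo 4, it exchanges the two types,
      -- so `One` selects one element from each pair x, u x.
      One Three : ℤ → Set
      One x = 2 ↑ (j ℕ.+ 2) ∣ x - 2 ↑ j
      Three x = 2 ↑ (j ℕ.+ 2) ∣ x + 2 ↑ j
      one? : ∀ x → Dec (One x)
      one? x = 2 ↑ (j ℕ.+ 2) ∣? (x - 2 ↑ j)
      three? : ∀ x → Dec (Three x)
      three? x = 2 ↑ (j ℕ.+ 2) ∣? (x + 2 ↑ j)

    opaque
      j2∣M : 2 ↑ (j ℕ.+ 2) ∣ + Mx
      j2∣M = ∣-trans (↑-∣ 2 (ℕₚ.≤-trans j+2≤b (ℕₚ.n≤1+n b))) qb∣M

      ↑j2 : 2 ↑ (j ℕ.+ 2) ≡ 2 ↑ j * + 4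
      ↑j2 = trans (↑-+ 2 j 2) (cong (2 ↑ j *_) (trans (↑-suc 2 1) (cong (+ 2 *_) (↑-1 2))))

      one-u : ∀ {x} → + E x₀ ∣ x → Three x → One (u * x)
      one-u {x} d h = subst (2 ↑ (j ℕ.+ 2) ∣_) (eq u x (2 ↑ j)) (∣m∣n⇒∣m-n (subst (_∣ (u + 1ℤ) * x) (trans (ℤₚ.*-comm (+ 4) (2 ↑ j)) (sym ↑j2)) (*-∣-* 4∣u+1 (j∣A d))) h)
        where
        eq : ∀ u x t → (u + 1ℤ) * x - (x + t) ≡ u * x - t
        eq = solve-∀

      u-one : ∀ {x} → + E x₀ ∣ x → One (u * x) → Three x
      u-one {x} d h = subst (2 ↑ (j ℕ.+ 2) ∣_) (eq u x (2 ↑ j)) (∣m∣n⇒∣m-n (subst (_∣ (u + 1ℤ) * x) (trans (ℤₚ.*-comm (+ 4) (2 ↑ j)) (sym ↑j2)) (*-∣-* 4∣u+1 (j∣A d))) h)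
        where
        eq : ∀ u x t → (u + 1ℤ) * x - (u * x - t) ≡ x + t
        eq = solve-∀

      one-or-three : ∀ {x} → mem A x → One x ⊎ Three x
      one-or-three {x} m = go (form m)
        where
        go : (∃ λ x' → (x ≡ 2 ↑ j * x') × ¬ + 2 ∣ x') → One x ⊎ Three x
        go (x' , refl , ¬x') = go' (odd-pred ¬x')
          where
          go' : + 2 ∣ x' - 1ℤ → One (2 ↑ j * x') ⊎ Three (2 ↑ j * x')
          go' (divides t et) with + 2 ∣? t
          ... | yes (divides r refl) = inj₁ (divides r (trans (eq (2 ↑ j) x') (trans (cong (2 ↑ j *_) et) (trans (eq' (2 ↑ j) r) (cong (r *_) (sym ↑j2))))))
            where
            eq : ∀ a x → a * x - a ≡ a * (x - 1ℤ)
            eq = solve-∀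
            eq' : ∀ a r → a * (r * + 2 * + 2) ≡ r * (a * + 4)
            eq' = solve-∀
          ... | no ¬t = inj₂ (fin (odd-pred ¬t))
            where
            fin : + 2 ∣ t - 1ℤ → Three (2 ↑ j * x')
            fin (divides r er) = divides (r + 1ℤ) (trans (eq (2 ↑ j) x') (trans (cong (λ z → 2 ↑ j * (z + + 2)) et) (trans (eq₁ (2 ↑ j) t) (trans (cong (λ z → 2 ↑ j * (z * + 2 + + 4)) er) (trans (eq' (2 ↑ j) r) (cong ((r + 1ℤ) *_) (sym ↑j2)))))))
              where
              eq : ∀ a x → a * x + a ≡ a * (x - 1ℤ + + 2)
              eq = solve-∀
              eq₁ : ∀ a t → a * (t * + 2 + + 2) ≡ a * ((t - 1ℤ) * + 2 + + 4)
              eq₁ = solve-∀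
              eq' : ∀ a r → a * (r * + 2 * + 2 + + 4) ≡ (r + 1ℤ) * (a * + 4)
              eq' = solve-∀

      not-both : ∀ {x} → One x → ¬ Three x
      not-both {x} h h' = 4∤2 (cancel-↑ prime j (subst₂ _∣_ ↑j2 (eq x (2 ↑ j)) (∣m∣n⇒∣m-n h' h)))
        where
        eq : ∀ x a → x + a - (x - a) ≡ a * + 2
        eq = solve-∀
        4∤2 : ¬ + 4 ∣ + 2
        4∤2 d with ℕ∣.∣⇒≤ (∣⇒∣ᵤ d)
        ... | s≤s (s≤s ())

      sum-pair : ∀ {x} → mem A x → 2 ↑ b ∣ x + u * x
      sum-pair {x} m = subst₂ _∣_ (trans (sym (↑-+ 2 (b ℕ.∸ j) j)) (cong (2 ↑_) (ℕₚ.m∸n+n≡m j≤b))) (eq u x) (*-∣-* u+1-top (j∣A (gen-∣ (genOf x₀) m)))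
        where
        eq : ∀ u x → (u + 1ℤ) * x ≡ x + u * x
        eq = solve-∀

      pair-cong : ∀ {x y} → mem A x → mem A y → x ≋ y [ s ] → x + u * x ≋ y + u * y [ + Mx ]
      pair-cong {x} {y} mx my h = ≋-local (go (form mx) (form my) u+1-top) (≋-+ h (≋-*ˡ u h))
        where
        go : (∃ λ x' → (x ≡ 2 ↑ j * x') × ¬ + 2 ∣ x') → (∃ λ x' → (y ≡ 2 ↑ j * x') × ¬ + 2 ∣ x') → 2 ↑ (b ℕ.∸ j) ∣ u + 1ℤ → x + u * x ≋ y + u * y [ 2 ↑ suc b ]
        go (x' , refl , ¬x') (y' , refl , ¬y') d = ≋⟨ subst₂ _∣_ (trans (cong (_* + 2) (trans (sym (↑-+ 2 (b ℕ.∸ j) j)) (cong (2 ↑_) (ℕₚ.m∸n+n≡m j≤b)))) (trans (ℤₚ.*-comm (2 ↑ b) (+ 2)) (sym (↑-suc 2 b)))) (eq u (2 ↑ j) x' y')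
            (*-∣-* (*-∣-* d (∣-refl {2 ↑ j})) (subst (+ 2 ∣_) (eq' x' y') (∣m∣n⇒∣m-n (odd-pred ¬x') (odd-pred ¬y')))) ⟩
          where
          eq' : ∀ x y → x - 1ℤ - (y - 1ℤ) ≡ x - y
          eq' = solve-∀
          eq : ∀ u a x y → (u + 1ℤ) * a * (x - y) ≡ a * x + u * (a * x) - (a * y + u * (a * y))
          eq = solve-∀

      pair-rep : ∀ {g} → Pair g → ∃ λ x → mem A x × One x × (x + u * x ≋ g [ + Mx ])
      pair-rep {g} (x , m , h) = go (one-or-three m)
        where
        go : One x ⊎ Three x → ∃ λ x → mem A x × One x × (x + u * x ≋ g [ + Mx ])
        go (inj₁ o) = x , m , o , h
        go (inj₂ t) = u * x , stab-mem cu su m , one-u (gen-∣ (genOf x₀) m) t , ≋-trans (≋-+ˡ (u * x) (uu-fix (gen-∣ (genOf x₀) m))) (≋-trans (≋-reflexive (ℤₚ.+-comm (u * x) x)) h)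

      -- The unit between the two elements is 1 modulo 4, because they agree modulo 2^(j+2); `rigid`
      -- then makes it trivial.
      unique-one : ∀ {x y} → mem A x → mem A y → One x → One y → x ≋ y [ s ] → x ≋ y [ + Mx ]
      unique-one {x} {y} mx my ox oy h = go (fibre mx my h)
        where
        go : (∃ λ v → Cop (+ N) v × (v ≋ 1ℤ [ s ]) × (v * x ≋ y [ + Mx ]) × Stabilises v) → x ≋ y [ + Mx ]
        go (v , cv , vs , vx , sv) = ≋-trans (≋-sym (fix-of-≋1 vs (rigid cv vs sv (∣-trans (divides (+ 2) refl) (4∣ (form mx))) (λ _ → 4∣ (form mx))) (j∣A (gen-∣ (genOf x₀) mx)))) vx
          where
          4∣ : (∃ λ x' → (x ≡ 2 ↑ j * x') × ¬ + 2 ∣ x') → + 4 ∣ v - 1ℤ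
          4∣ (x' , refl , ¬x') = cop-cancel (4-cop ¬x') (cancel-↑ prime j (subst₂ _∣_ ↑j2 (eq v (2 ↑ j) x' y) (∣m∣n⇒∣m+n (∣-trans j2∣M (≋⇒∣ vx)) (∣m∣n⇒∣m-n oy ox))))
            where
            4-cop : ∀ {z} → ¬ + 2 ∣ z → Cop (+ 4) z
            4-cop ¬z = cop-*ˡ {+ 2} {+ 2} (prime-cop prime ¬z) (prime-cop prime ¬z)
            eq : ∀ v a x y → v * (a * x) - y + (y - a - (a * x - a)) ≡ a * (x * (v - 1ℤ))
            eq = solve-∀

      -- Since u fixes g, x ↦ u x exchanges the solutions of type `One` and `Three`, whence the
      -- factor 2. On those of type `One` the involution `γ` leaves fixed exactly the solutions of x
      -- + u x = g, and by `unique-one` there is at most one.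
      pair-count : ∀ {g} → 2 ↑ b ∣ g → ∃ λ h → (C g ≡ 2 ℕ.* h) × ((Pair g × ¬ + 2 ∣ + h) ⊎ ((¬ Pair g) × + 2 ∣ + h))
      pair-count {g} dg = S Mx h , total , decide (search {λ x → mem A x × (x + u * x ≋ g [ + Mx ])} (λ x → mem? A x ×-dec (x + u * x ≋? g [ + Mx ])) (λ e (m , q) → mem-≋ A e m , ≋-trans (≋-weaken (∣N ag) (≋-+ (≋-sym e) (≋-*ˡ u (≋-sym e)))) q))
        where
        f h h₃ : ℤ → ℕ
        f x = ι A x ℕ.* ι A (g - x)
        h x = f x ℕ.* ind (one? x)
        h₃ x = f x ℕ.* ind (three? x)
        f-Per : Per Mx f
        f-Per x y p = cong₂ ℕ._*_ (ι-Perᴬ x y p) (ι-Perᴬ _ _ (≋-+ˡ g (≋-neg p)))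
        one-Per : ∀ {x y} → x ≋ y [ + Mx ] → One x → One y
        one-Per {x} {y} p o = ∣-≋ (≋-weaken j2∣M (≋-+ʳ (- 2 ↑ j) p)) o
        h-Per : Per Mx h
        h-Per x y p = cong₂ ℕ._*_ (f-Per x y p) (ind-⇔ (one? x) (one? y) (one-Per p) (one-Per (≋-sym p)))
        ug : u * g ≋ g [ + Mx ]
        ug = u-fix dg
        sub-u : ∀ x → g - u * x ≋ u * (g - x) [ + Mx ]
        sub-u x = ≋-trans (≋-+ʳ (- (u * x)) (≋-sym ug)) (≋-reflexive (eq u g x))
          where
          eq : ∀ u g x → u * g - u * x ≡ u * (g - x)
          eq = solve-∀
        f-u : ∀ x → f (u * x) ≡ f x
        f-u x = cong₂ ℕ._*_ (ι-u x) (trans (ι-Perᴬ _ _ (sub-u x)) (ι-u (g - x)))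
        f≢0 : ∀ {x} → f x ≢ 0 → mem A x × mem A (g - x)
        f≢0 {x} ne = ind-pos (mem? A x) (λ e → ne (cong (ℕ._* ι A (g - x)) e)) , ind-pos (mem? A (g - x)) (λ e → ne (trans (cong (ι A x ℕ.*_) e) (ℕₚ.*-zeroʳ (ι A x))))
        h-u : ∀ x → h (u * x) ≡ h₃ x
        h-u x with f x ℕ.≟ 0
        ... | yes e = trans (cong (ℕ._* ind (one? (u * x))) (trans (f-u x) e)) (cong (ℕ._* ind (three? x)) (sym e))
        ... | no ne = cong₂ ℕ._*_ (f-u x) (ind-⇔ (one? (u * x)) (three? x) (u-one (gen-∣ (genOf x₀) (proj₁ (f≢0 ne)))) (one-u (gen-∣ (genOf x₀) (proj₁ (f≢0 ne)))))
        f-split : ∀ x → f x ≡ h x ℕ.+ h₃ x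
        f-split x with f x ℕ.≟ 0
        ... | yes e = trans e (sym (cong₂ ℕ._+_ (cong (ℕ._* ind (one? x)) e) (cong (ℕ._* ind (three? x)) e)))
        ... | no ne = trans (sym (ℕₚ.*-identityʳ (f x))) (trans (cong (f x ℕ.*_) (sym (exact (one-or-three (proj₁ (f≢0 ne)))))) (ℕₚ.*-distribˡ-+ (f x) (ind (one? x)) (ind (three? x))))
          where
          exact : One x ⊎ Three x → ind (one? x) ℕ.+ ind (three? x) ≡ 1
          exact (inj₁ o) = cong₂ ℕ._+_ (ind-yes (one? x) o) (ind-no (three? x) (not-both {x} o))
          exact (inj₂ t) = cong₂ ℕ._+_ (ind-no (one? x) (λ o → not-both {x} o t)) (ind-yes (three? x) t)
        total : C g ≡ 2 ℕ.* S Mx h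
        total = trans (S-cong Mx f-split) (trans (S-+ Mx h h₃) (cong (S Mx h ℕ.+_) (trans (S-cong Mx (λ x → sym (h-u x))) (trans (S-unit Mx h-Per u (proj₁ inverse) (proj₂ inverse)) (sym (ℕₚ.+-identityʳ (S Mx h)))))))
        γ τ : ℤ → ℤ
        γ x = u * (g - x)
        τ x = g - proj₁ inverse * x
        gγ : ∀ x → g - γ x ≋ u * x [ + Mx ]
        gγ x = ≋-trans (≋-+ʳ (- γ x) (≋-sym ug)) (≋-reflexive (eq u g x))
          where
          eq : ∀ u g x → u * g - u * (g - x) ≡ u * x
          eq = solve-∀
        h-γ : ∀ x → h (γ x) ≡ h x
        h-γ x with f x ℕ.≟ 0
        ... | yes e = trans (cong (ℕ._* ind (one? (γ x))) (trans fγ e)) (cong (ℕ._* ind (one? x)) (sym e))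
          where
          fγ : f (γ x) ≡ f x
          fγ = trans (cong₂ ℕ._*_ (ι-u (g - x)) (trans (ι-Perᴬ _ _ (gγ x)) (ι-u x))) (ℕₚ.*-comm (ι A (g - x)) (ι A x))
        ... | no ne = cong₂ ℕ._*_ (trans (cong₂ ℕ._*_ (ι-u (g - x)) (trans (ι-Perᴬ _ _ (gγ x)) (ι-u x))) (ℕₚ.*-comm (ι A (g - x)) (ι A x)))
            (ind-⇔ (one? (γ x)) (one? x) (λ o → back (u-one ∈e o)) (λ o → one-u ∈e (forth o)))
          where
          ∈e : + E x₀ ∣ g - x
          ∈e = gen-∣ (genOf x₀) (proj₂ (f≢0 ne))
          dg4 : 2 ↑ (j ℕ.+ 2) ∣ g
          dg4 = ∣-trans (↑-∣ 2 j+2≤b) dg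
          back : Three (g - x) → One x
          back t = subst (2 ↑ (j ℕ.+ 2) ∣_) (eq g x (2 ↑ j)) (∣m∣n⇒∣m-n dg4 t)
            where
            eq : ∀ g x a → g - (g - x + a) ≡ x - a
            eq = solve-∀
          forth : One x → Three (g - x)
          forth o = subst (2 ↑ (j ℕ.+ 2) ∣_) (eq g x (2 ↑ j)) (∣m∣n⇒∣m-n dg4 o)
            where
            eq : ∀ g x a → g - (x - a) ≡ g - x + a
            eq = solve-∀
        γγ : ∀ x → h x ≢ 0 → γ (γ x) ≋ x [ + Mx ]
        γγ x ne = ≋-trans (≋-*ˡ u (gγ x)) (uu-fix (gen-∣ (genOf x₀) (proj₁ (f≢0 {x} (λ e → ne (cong (ℕ._* ind (one? x)) e))))))
        parity : + S Mx h ≋ + S Mx (λ x → h x ℕ.* ind (γ x ≋? x [ + Mx ])) [ + 2 ]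
        parity = involution-parity Mx h-Per γ τ (λ p → ≋-*ˡ u (≋-+ˡ g (≋-neg p))) (λ p → ≋-+ˡ g (≋-neg (≋-*ˡ (proj₁ inverse) p)))
          (λ x → ≋-trans (≋-reflexive (cong (u *_) (eq g (proj₁ inverse * x)))) (uv-x x)) (λ x → ≋-trans (≋-+ˡ g (≋-neg (vu-x (g - x)))) (≋-reflexive (eq g x))) h-γ γγ
          where
          eq : ∀ g y → g - (g - y) ≡ y
          eq = solve-∀
        fixed : ∀ {x} → γ x ≋ x [ + Mx ] → x + u * x ≋ g [ + Mx ]
        fixed {x} e = ≋-trans (≋-+ʳ (u * x) (≋-sym e)) (≋-trans (≋-reflexive (eq u g x)) ug)
          where
          eq : ∀ u g x → u * (g - x) + u * x ≡ u * g
          eq = solve-∀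
        h≢0 : ∀ {x} → h x ≢ 0 → mem A x × One x
        h≢0 {x} ne = proj₁ (f≢0 {x} (λ e → ne (cong (ℕ._* ind (one? x)) e))) , ind-pos (one? x) (λ e → ne (trans (cong (f x ℕ.*_) e) (ℕₚ.*-zeroʳ (f x))))
        decide : Dec (Pair g) → (Pair g × ¬ + 2 ∣ + S Mx h) ⊎ ((¬ Pair g) × + 2 ∣ + S Mx h)
        decide (no ¬p) = inj₂ (¬p , ∣-≋ (≋-sym (≋-trans parity (≋-reflexive (cong +_ (trans (S-cong Mx none) (trans (S-const Mx 0) (ℕₚ.*-zeroʳ Mx))))))) ∣0)
          where
          none : ∀ x → h x ℕ.* ind (γ x ≋? x [ + Mx ]) ≡ 0
          none x with h x ℕ.≟ 0 | γ x ≋? x [ + Mx ]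
          ... | yes e | d = cong (ℕ._* ind d) e
          ... | no _ | no _ = ℕₚ.*-zeroʳ (h x)
          ... | no ne | yes e = ⊥-elim (¬p (x , proj₁ (h≢0 {x} ne) , fixed e))
        decide (yes p) = inj₁ (p , λ d → prime-∤1 prime (∣-≋ (≋-trans parity (≋-reflexive (cong +_ (one (pair-rep p))))) d))
          where
          one : (∃ λ x → mem A x × One x × (x + u * x ≋ g [ + Mx ])) → S Mx (λ x → h x ℕ.* ind (γ x ≋? x [ + Mx ])) ≡ 1
          one (x₁ , m₁ , o₁ , e₁) = trans (S-cong Mx point) (S-δ1 Mx x₁)
            where
            ux₁ : g - x₁ ≋ u * x₁ [ + Mx ]
            ux₁ = ≋-trans (≋-+ʳ (- x₁) (≋-sym e₁)) (≋-reflexive (eq x₁ (u * x₁)))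
              where
              eq : ∀ x y → x + y - x ≡ y
              eq = solve-∀
            point : ∀ x → h x ℕ.* ind (γ x ≋? x [ + Mx ]) ≡ ind (x ≋? x₁ [ + Mx ])
            point x with x ≋? x₁ [ + Mx ]
            ... | yes q = trans (cong₂ ℕ._*_ (trans (h-Per x x₁ q) (cong₂ ℕ._*_ (cong₂ ℕ._*_ (ind-yes (mem? A x₁) m₁) (ind-yes (mem? A (g - x₁)) (A-Periodic (≋-sym ux₁) (stab-mem cu su m₁)))) (ind-yes (one? x₁) o₁)))
                (ind-yes (γ x ≋? x [ + Mx ]) (≋-trans (≋-*ˡ u (≋-+ˡ g (≋-neg q))) (≋-trans (≋-*ˡ u ux₁) (≋-trans (uu-fix (gen-∣ (genOf x₀) m₁)) (≋-sym q)))))) refl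
            ... | no ¬q with h x ℕ.≟ 0 | γ x ≋? x [ + Mx ]
            ...   | yes e | d = cong (ℕ._* ind d) e
            ...   | no _ | no _ = ℕₚ.*-zeroʳ (h x)
            ...   | no ne | yes e = ⊥-elim (¬q (unique-one (proj₁ (h≢0 {x} ne)) m₁ (proj₂ (h≢0 {x} ne)) o₁ (half-s (≋-trans (fixed e) (≋-sym e₁)))))
              where
              half-s : x + u * x ≋ x₁ + u * x₁ [ + Mx ] → x ≋ x₁ [ s ]
              half-s q = ≋⟨ cop-cancel (cop-sym (prime-cop prime p∤s)) (subst (s ∣_) (eq x x₁) (≋⇒∣ (≋-trans (≋-sym (dbl x)) (≋-trans (≋-weaken s∣M q) (dbl x₁))))) ⟩
                where
                dbl : ∀ x → x + u * x ≋ x + x [ s ]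
                dbl x = ≋-+ˡ x (≋-trans (≋-*ʳ x us) (≋-reflexive (ℤₚ.*-identityˡ x)))
                eq : ∀ x y → x + x - (y + y) ≡ + 2 * (x - y)
                eq = solve-∀

    -- Modulo 4, the number of ways to write g as a sum of two elements of A only counts the sums x + u x:
    -- the map x ↦ u (g − x) pairs off the remaining ones.
    K : ASet
    K = record { mem = λ g → ¬ + 4 ∣ + C g ; mem? = λ g → ¬? (+ 4 ∣? + C g) ; inv = λ h ¬d d → ¬d (subst (λ z → + 4 ∣ + z) (C-Inv (sym h)) d) }
      where
      C-Inv : ∀ {x y} → χ x ≡ χ y → C x ≡ C y
      C-Inv {x} {y} h = sym (conv-Inv Mx (∣N ag) ι-Perᴬ ι-Perᴬ ι-Perᴬ ι-Perᴬ (λ x y r → ι-Inv A (sym r)) (λ x y r → ι-Inv A (sym r)) y x h)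

    K-Periodic : Periodic Mx K
    K-Periodic h ¬d d = ¬d (subst (λ z → + 4 ∣ + z) (GroupSemiring.conv-Per Mx (ι A) ι-Perᴬ _ _ (≋-sym h)) d)

    private
      Qs : ASet
      Qs = frobenius-set ag K K-Periodic prime a

    opaque
      pair⇒K : ∀ {g} → 2 ↑ b ∣ g → Pair g → mem K g
      pair⇒K {g} dg pg d = go (pair-count dg)
        where
        go : (∃ λ h → (C g ≡ 2 ℕ.* h) × ((Pair g × ¬ + 2 ∣ + h) ⊎ ((¬ Pair g) × + 2 ∣ + h))) → ⊥
        go (h , e , inj₂ (¬p , _)) = ¬p pg
        go (h , e , inj₁ (_ , odd)) = odd (*-cancelˡ-∣ (+ 2) {+ 2} {+ h} (subst (+ 4 ∣_) (trans (cong +_ e) (ℤₚ.pos-* 2 h)) d))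

      K⇒pair : ∀ {g} → 2 ↑ b ∣ g → mem K g → Pair g
      K⇒pair {g} dg kg = go (pair-count dg)
        where
        go : (∃ λ h → (C g ≡ 2 ℕ.* h) × ((Pair g × ¬ + 2 ∣ + h) ⊎ ((¬ Pair g) × + 2 ∣ + h))) → Pair g
        go (h , e , inj₁ (p , _)) = p
        go (h , e , inj₂ (_ , even)) = ⊥-elim (kg (subst (+ 4 ∣_) (sym (trans (cong +_ e) (ℤₚ.pos-* 2 h))) (*-monoʳ-∣ (+ 2) {+ 2} {+ h} even)))

      K⇒E : ∀ {g} → mem K g → + E x₀ ∣ g
      K⇒E {g} kg = go (S-nonzero Mx (λ x → ι A x ℕ.* ι A (g - x)) (λ e → kg (subst (λ z → + 4 ∣ + z) (sym e) ∣0)))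
        where
        go : (∃ λ x → ι A x ℕ.* ι A (g - x) ≢ 0) → + E x₀ ∣ g
        go (x , ne) = subst (+ E x₀ ∣_) (eq x g) (∣m∣n⇒∣m+n (gen-∣ (genOf x₀) (ind-pos (mem? A x) (λ e → ne (cong (ℕ._* ι A (g - x)) e)))) (gen-∣ (genOf x₀) (ind-pos (mem? A (g - x)) (λ e → ne (trans (cong (ι A x ℕ.*_) e) (ℕₚ.*-zeroʳ (ι A x)))))))
          where
          eq : ∀ x g → x + (g - x) ≡ g
          eq = solve-∀

      C-u : ∀ g → C (u * g) ≡ C g
      C-u g = trans (sym (S-unit Mx {λ x → ι A x ℕ.* ι A (u * g - x)} (λ x y p → cong₂ ℕ._*_ (ι-Perᴬ x y p) (ι-Perᴬ _ _ (≋-+ˡ (u * g) (≋-neg p)))) u (proj₁ inverse) (proj₂ inverse)))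
        (S-cong Mx (λ x → cong₂ ℕ._*_ (ι-u x) (trans (cong (ι A) (eq u g x)) (ι-u (g - x)))))
        where
        eq : ∀ u g x → u * g - u * x ≡ u * (g - x)
        eq = solve-∀

      -- Multiplication by 2^a brings multiples of E up to 2^(b+1), as a + j = b + 1, so only the
      -- residue modulo s is left.
      top-≋ : ∀ {x y} → + E x₀ ∣ x → + E x₀ ∣ y → x ≋ y [ s ] → + (2 ℕ.^ a) * x ≋ + (2 ℕ.^ a) * y [ + Mx ]
      top-≋ {x} {y} dx dy h = ≋-local ≋⟨ ∣m∣n⇒∣m-n (up dx) (up dy) ⟩ (≋-*ˡ (+ (2 ℕ.^ a)) h)
        where
        up : ∀ {x} → + E x₀ ∣ x → 2 ↑ suc b ∣ + (2 ℕ.^ a) * x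
        up {x} d = subst₂ _∣_ (trans (sym (↑-+ 2 a j)) (cong (2 ↑_) a+j)) (cong (_* x) (sym (↑-as-+ 2 a))) (*-∣-* (∣-refl {2 ↑ a}) (j∣A d))

      pair-top : ∀ {x} → mem A x → + (2 ℕ.^ a) * (x + u * x) ≋ + (2 ℕ.^ a) * (+ 2 * x) [ + Mx ]
      pair-top {x} m = top-≋ (∣m∣n⇒∣m+n d (∣n⇒∣m*n u d)) (∣n⇒∣m*n (+ 2) d) (≋-trans (≋-+ˡ x (≋-trans (≋-*ʳ x us) (≋-reflexive (ℤₚ.*-identityˡ x)))) (≋-reflexive (eq x)))
        where
        d : + E x₀ ∣ x
        d = gen-∣ (genOf x₀) m
        eq : ∀ x → x + x ≡ + 2 * x
        eq = solve-∀

      private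
        weight : ℤ → ℤ → ℕ
        weight y g = ind (+ (2 ℕ.^ a) * g ≋? y [ + Mx ]) ℕ.* ι K g

        weight-Per : ∀ y → Per Mx (weight y)
        weight-Per y g g' p = cong₂ ℕ._*_ (ind-⇔ (+ (2 ℕ.^ a) * g ≋? y [ + Mx ]) (+ (2 ℕ.^ a) * g' ≋? y [ + Mx ]) (≋-trans (≋-*ˡ (+ (2 ℕ.^ a)) (≋-sym p))) (≋-trans (≋-*ˡ (+ (2 ℕ.^ a)) p))) (ι-Per K K-Periodic g g' p)

        weight≢0 : ∀ {y g} → weight y g ≢ 0 → (+ (2 ℕ.^ a) * g ≋ y [ + Mx ]) × mem K g
        weight≢0 {y} {g} ne = ind-pos (+ (2 ℕ.^ a) * g ≋? y [ + Mx ]) (λ e → ne (cong (ℕ._* ι K g) e)) , ind-pos (mem? K g) (λ e → ne (trans (cong (ind (+ (2 ℕ.^ a) * g ≋? y [ + Mx ]) ℕ.*_) e) (ℕₚ.*-zeroʳ (ind (+ (2 ℕ.^ a) * g ≋? y [ + Mx ])))))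

        ιK-u : ∀ g → ι K (u * g) ≡ ι K g
        ιK-u g = ind-⇔ (mem? K (u * g)) (mem? K g) (λ ¬d d → ¬d (subst (λ z → + 4 ∣ + z) (sym (C-u g)) d)) (λ ¬d d → ¬d (subst (λ z → + 4 ∣ + z) (C-u g) d))

        weight-u : ∀ y g → weight y (u * g) ≡ weight y g
        weight-u y g with mem? K g
        ... | no ¬k = trans (cong (ind (+ (2 ℕ.^ a) * (u * g) ≋? y [ + Mx ]) ℕ.*_) (trans (ιK-u g) (ind-no (mem? K g) ¬k))) (trans (ℕₚ.*-zeroʳ (ind (+ (2 ℕ.^ a) * (u * g) ≋? y [ + Mx ]))) (sym (ℕₚ.*-zeroʳ (ind (+ (2 ℕ.^ a) * g ≋? y [ + Mx ])))))
        ... | yes kg = cong₂ ℕ._*_ (ind-⇔ (+ (2 ℕ.^ a) * (u * g) ≋? y [ + Mx ]) (+ (2 ℕ.^ a) * g ≋? y [ + Mx ]) (≋-trans (≋-sym t)) (≋-trans t)) (trans (ιK-u g) (ind-yes (mem? K g) kg))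
          where
          t : + (2 ℕ.^ a) * (u * g) ≋ + (2 ℕ.^ a) * g [ + Mx ]
          t = top-≋ (∣n⇒∣m*n u (K⇒E kg)) (K⇒E kg) (≋-trans (≋-*ʳ g us) (≋-reflexive (ℤₚ.*-identityˡ g)))

        push-parity : ∀ y → + push Mx (+ (2 ℕ.^ a)) (ι K) y ≋ + S Mx (λ g → weight y g ℕ.* ind (u * g ≋? g [ + Mx ])) [ + 2 ]
        push-parity y = involution-parity Mx (weight-Per y) (u *_) (proj₁ inverse *_) (≋-*ˡ u) (≋-*ˡ (proj₁ inverse)) uv-x vu-x (weight-u y) (λ g ne → uu-fix (K⇒E (proj₂ (weight≢0 {y} {g} ne))))

      -- Modulo 2 the unit u pairs off the elements of `K` that it moves. Those it fixes are
      -- multiples of 2^b, hence sums x + u x, and 2^a sends them to 2^a times 2 x.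
      Q⇒ : ∀ {y} → mem Qs y → ∃ λ x → mem A x × (+ (2 ℕ.^ a) * (+ 2 * x) ≋ y [ + Mx ])
      Q⇒ {y} qy = go (S-nonzero Mx _ (λ e → qy (∣-≋ (≋-sym (≋-trans (push-parity y) (≋-reflexive (cong +_ e)))) ∣0)))
        where
        go : (∃ λ g → weight y g ℕ.* ind (u * g ≋? g [ + Mx ]) ≢ 0) → ∃ λ x → mem A x × (+ (2 ℕ.^ a) * (+ 2 * x) ≋ y [ + Mx ])
        go (g , ne) = go' (K⇒pair (u-unfix (ind-pos (u * g ≋? g [ + Mx ]) (λ e → ne (trans (cong (weight y g ℕ.*_) e) (ℕₚ.*-zeroʳ (weight y g)))))) (proj₂ wg))
          where
          wg : (+ (2 ℕ.^ a) * g ≋ y [ + Mx ]) × mem K g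
          wg = weight≢0 {y} {g} (λ e → ne (cong (ℕ._* ind (u * g ≋? g [ + Mx ])) e))
          go' : Pair g → ∃ λ x → mem A x × (+ (2 ℕ.^ a) * (+ 2 * x) ≋ y [ + Mx ])
          go' (x , m , h) = x , m , ≋-trans (≋-sym (pair-top m)) (≋-trans (≋-*ˡ (+ (2 ℕ.^ a)) h) (proj₁ wg))

      ⇒Q : ∀ {x y} → mem A x → + (2 ℕ.^ a) * (+ 2 * x) ≋ y [ + Mx ] → mem Qs y
      ⇒Q {x} {y} m h d = prime-∤1 prime (∣-≋ (≋-trans (push-parity y) (≋-reflexive (cong +_ (trans (S-cong Mx point) (S-δ1 Mx g₁))))) d)
        where
        g₁ : ℤ
        g₁ = x + u * x
        point : ∀ g → weight y g ℕ.* ind (u * g ≋? g [ + Mx ]) ≡ ind (g ≋? g₁ [ + Mx ])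
        point g with g ≋? g₁ [ + Mx ]
        ... | yes q = cong₂ ℕ._*_ (trans (weight-Per y g g₁ q) (cong₂ ℕ._*_ (ind-yes (+ (2 ℕ.^ a) * g₁ ≋? y [ + Mx ]) (≋-trans (pair-top m) h)) (ind-yes (mem? K g₁) (pair⇒K (sum-pair m) (x , m , ≋-refl)))))
            (ind-yes (u * g ≋? g [ + Mx ]) (≋-trans (≋-*ˡ u q) (≋-trans (u-fix (sum-pair m)) (≋-sym q))))
        ... | no ¬q with weight y g ℕ.≟ 0 | u * g ≋? g [ + Mx ]
        ...   | yes e | dd = cong (ℕ._* ind dd) e
        ...   | no _ | no _ = ℕₚ.*-zeroʳ (weight y g)
        ...   | no ne | yes e = ⊥-elim (bad (K⇒pair (u-unfix e) (proj₂ (weight≢0 {y} {g} ne))))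
          where
          bad : Pair g → ⊥
          bad (x₂ , m₂ , h₂) = ¬q (≋-trans (≋-sym h₂) (pair-cong m₂ m x₂≋x))
            where
            all : + (2 ℕ.^ a) * (+ 2 * x₂) ≋ + (2 ℕ.^ a) * (+ 2 * x) [ + Mx ]
            all = ≋-trans (≋-sym (pair-top m₂)) (≋-trans (≋-*ˡ (+ (2 ℕ.^ a)) h₂) (≋-trans (proj₁ (weight≢0 {y} {g} ne)) (≋-sym h)))
            x₂≋x : x₂ ≋ x [ s ]
            x₂≋x = ≋⟨ cop-cancel (cop-sym (cop-↑-∤ prime (suc a) p∤s)) (subst (s ∣_) (trans (eq (+ (2 ℕ.^ a)) x₂ x) (cong (_* (x₂ - x)) (trans (cong (+ 2 *_) (↑-as-+ 2 a)) (sym (↑-suc 2 a))))) (∣-trans s∣M (≋⇒∣ all))) ⟩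
              where
              eq : ∀ t x y → t * (+ 2 * x) - t * (+ 2 * y) ≡ + 2 * t * (x - y)
              eq = solve-∀

      -- `Qs` consists of 2^a times 2 A, with an unwanted factor 2. It does no harm: the index also
      -- divides M, which bounds its power of 2 by that of 2^a E, and the odd part is not affected.
      AG-twisted : IsAGroup (2 ℕ.^ a ℕ.* E x₀)
      AG-twisted = AG-≡ (gen-AG Gd) (subst (+ gen Gd ∣_) (sym (ℤₚ.pos-* (2 ℕ.^ a) (E x₀))) g∣) (subst (_∣ + gen Gd) (sym (ℤₚ.pos-* (2 ℕ.^ a) (E x₀))) ∣g)
        where
        t : ℤ
        t = + (2 ℕ.^ a)
        t≡ : t ≡ 2 ↑ a
        t≡ = ↑-as-+ 2 a
        tE∣M : t * + E x₀ ∣ + Mx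
        tE∣M = subst (λ z → z * + E x₀ ∣ + Mx) (sym t≡) (p↑a∣M reg pd)
        Gd : Generated Qs
        Gd = generated Qs
        ∣g : t * + E x₀ ∣ + gen Gd
        ∣g = gen-least Gd (∣-trans tE∣M (∣N ag)) (λ y qy → go (Q⇒ qy))
          where
          go : ∀ {y} → (∃ λ x → mem A x × (t * (+ 2 * x) ≋ y [ + Mx ])) → t * + E x₀ ∣ y
          go (x , m , h) = ∣-≋ (≋-weaken tE∣M h) (*-monoʳ-∣ t (∣n⇒∣m*n (+ 2) (gen-∣ (genOf x₀) m)))
        t≢0 : t ≢ 0ℤ
        t≢0 = ∣-nonZero N≢0 (∣-trans (∣-trans (∣m⇒∣m*n (+ E x₀) ∣-refl) tE∣M) (∣N ag))
        g∣M : + gen Gd ∣ + Mx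
        g∣M = subst (+ gen Gd ∣_) (eq (t * (+ 2 * x₀)) (+ Mx)) (∣m∣n⇒∣m-n (gen-∣ Gd (⇒Q refl (≋-sym (≋-shift (t * (+ 2 * x₀)) 1ℤ)))) (gen-∣ Gd (⇒Q refl ≋-refl)))
          where
          eq : ∀ a m → a + 1ℤ * m - a ≡ m
          eq = solve-∀
        g∣ : + gen Gd ∣ t * + E x₀
        g∣ = go (∣-trans (∣m⇒∣m*n (+ E x₀) (∣-refl {t})) ∣g)
          where
          go : t ∣ + gen Gd → + gen Gd ∣ t * + E x₀
          go (divides g' eg) = subst (_∣ t * + E x₀) (trans (ℤₚ.*-comm t g') (sym eg)) (*-monoʳ-∣ t (gen-least (genOf x₀) (∣-trans (divides t (trans eg (ℤₚ.*-comm g' t))) (∣N (gen-AG Gd))) (λ x m → sub x m)))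
            where
            cancel-t : ∀ {y} → + gen Gd ∣ t * y → g' ∣ y
            cancel-t {y} d = *-cancelˡ-∣ t {{≢-nonZero t≢0}} (subst (_∣ t * y) (trans eg (ℤₚ.*-comm g' t)) d)
            M-split : + Mx ≡ t * (2 ↑ j * s)
            M-split = trans M≡ᶻ (trans (cong (_* s) (trans (cong (2 ↑_) (sym a+j)) (↑-+ 2 a j))) (trans (ℤₚ.*-assoc (2 ↑ a) (2 ↑ j) s) (cong (_* (2 ↑ j * s)) (sym t≡))))
            g'∣ : g' ∣ 2 ↑ j * s
            g'∣ = cancel-t (subst (+ gen Gd ∣_) M-split g∣M)
            g'≢0 : g' ≢ 0ℤ
            g'≢0 refl = ∣-nonZero N≢0 (∣N (gen-AG Gd)) eg
            sub : ∀ x → mem A x → g' ∣ x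
            sub x m = go' (prime-split prime g'≢0)
              where
              2x : g' ∣ + 2 * x
              2x = cancel-t (gen-∣ Gd (⇒Q m ≋-refl))
              go' : (∃ λ i → ∃ λ o → (g' ≡ 2 ↑ i * o) × ¬ + 2 ∣ o) → g' ∣ x
              go' (i , o , eo , ¬o) = subst (_∣ x) (sym eo) (cop-∣-* (cop-↑-∤ prime i ¬o) (∣-trans (↑-∣ 2 (∣↑-≤ prime p∤s (∣-trans (divides o (trans eo (ℤₚ.*-comm (2 ↑ i) o))) g'∣))) (j∣A (gen-∣ (genOf x₀) m)))
                (cop-cancel (cop-sym (prime-cop prime ¬o)) (∣-trans (divides (2 ↑ i) eo) 2x)))

  opaque
    -- The index is p^(b+1) times the part of E prime to p. So for multiples of E, congruence modulo
    -- the full power of p in M is membership in an A-group.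
    AG-prime-power : ∀ {x₀} (reg : Regular x₀) {p} (pd : PrimeData x₀ p) → IsAGroup (p ℕ.^ AtPrime.a reg pd ℕ.* E x₀)
    AG-prime-power {x₀} reg {p} pd = go p pd (unramified-or-twist reg pd)
      where
      go : ∀ p (pd : PrimeData x₀ p) → Unramified reg pd ⊎ ((p ≡ 2) × ∃ (Twist reg pd)) → IsAGroup (p ℕ.^ AtPrime.a reg pd ℕ.* E x₀)
      go p pd (inj₁ Q) = AG-pa reg pd Q
      go .2 pd (inj₂ (refl , u , tw)) = AG-twisted reg pd tw

-- Images of A-groups and levels

Val : ℕ → ℕ → ℤ → Set
Val q w x = (q ↑ w ∣ x) × ¬ (q ↑ suc w ∣ x)

opaque
  form-val : ∀ {q} → Prime q → ∀ {w x x'} → x ≡ q ↑ w * x' → ¬ + q ∣ x' → Val q w x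
  form-val {q} pr {w} {x} {x'} refl ¬d = ∣m⇒∣m*n x' ∣-refl , λ h → ℕₚ.1+n≰n (∣↑-≤ pr ¬d h)

  val-form : ∀ {q} → Prime q → ∀ {w x} → Val q w x → ∃ λ x' → (x ≡ q ↑ w * x') × ¬ + q ∣ x'
  val-form {q} pr {w} (divides x' refl , ¬d) = x' , ℤₚ.*-comm x' (q ↑ w) , λ { (divides r refl) → ¬d (divides r (trans (ℤₚ.*-assoc r (+ q) (q ↑ w)) (cong (r *_) (sym (↑-suc q w))))) }

  val-≋ : ∀ {q w x y} → x ≋ y [ q ↑ suc w ] → Val q w x → Val q w y
  val-≋ {q} {w} h (d , ¬d) = ∣-≋ (≋-weaken (↑-∣ q (ℕₚ.n≤1+n w)) h) d , λ d' → ¬d (∣-≋ (≋-sym h) d')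

  val-cancel : ∀ {q} → Prime q → ∀ {w x} → Val q w x → ∀ k {t} → q ↑ (k ℕ.+ w) ∣ t * x → q ↑ k ∣ t
  val-cancel {q} pr {w} {x} v k {t} d = go (val-form pr v)
    where
    go : (∃ λ x' → (x ≡ q ↑ w * x') × ¬ + q ∣ x') → q ↑ k ∣ t
    go (x' , refl , ¬d) = cop-cancel (cop-↑-∤ pr k ¬d) (cancel-↑ pr w (subst₂ _∣_ (trans (cong (q ↑_) (ℕₚ.+-comm k w)) (↑-+ q w k)) (eq t (q ↑ w) x') d))
      where
      eq : ∀ t a x → t * (a * x) ≡ a * (x * t)
      eq = solve-∀

  val-unit : ∀ {q} → Prime q → ∀ {w x u} → Val q w x → ¬ + q ∣ u → Val q w (u * x)
  val-unit {q} pr {w} {x} {u} v ¬u = go (val-form pr v)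
    where
    go : (∃ λ x' → (x ≡ q ↑ w * x') × ¬ + q ∣ x') → Val q w (u * x)
    go (x' , refl , ¬d) = form-val pr (eq u (q ↑ w) x') (∤-* pr {u} {x'} ¬u ¬d)
      where
      eq : ∀ u a x → u * (a * x) ≡ a * (u * x)
      eq = solve-∀

  val-quotient : ∀ {q} → Prime q → ∀ {w x y} → Val q w x → Val q w y → ∀ k → ∃ λ t → (t * x ≋ y [ q ↑ k ]) × ¬ + q ∣ t
  val-quotient {q} pr {w} {x} {y} vx vy k = go (val-form pr vx) (val-form pr vy)
    where
    go : (∃ λ x' → (x ≡ q ↑ w * x') × ¬ + q ∣ x') → (∃ λ x' → (y ≡ q ↑ w * x') × ¬ + q ∣ x') → ∃ λ t → (t * x ≋ y [ q ↑ k ]) × ¬ + q ∣ t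
    go (x' , refl , ¬x') (y' , refl , ¬y') = go' (quotient-mod pr k ¬x' ¬y')
      where
      go' : (∃ λ t → (t * x' ≋ y' [ q ↑ k ]) × ¬ + q ∣ t) → ∃ λ t → (t * (q ↑ w * x') ≋ q ↑ w * y' [ q ↑ k ]) × ¬ + q ∣ t
      go' (t , h , ¬t) = t , ≋-trans (≋-reflexive (eq t (q ↑ w) x')) (≋-*ˡ (q ↑ w) h) , ¬t
        where
        eq : ∀ t a x → t * (a * x) ≡ a * (t * x)
        eq = solve-∀

  odd-diff : ∀ {w x y} → Val 2 w x → Val 2 w y → 2 ↑ suc w ∣ x - y
  odd-diff {w} {x} {y} vx vy = go (val-form prime[2] vx) (val-form prime[2] vy)
    where
    go : (∃ λ x' → (x ≡ 2 ↑ w * x') × ¬ + 2 ∣ x') → (∃ λ x' → (y ≡ 2 ↑ w * x') × ¬ + 2 ∣ x') → 2 ↑ suc w ∣ x - y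
    go (x' , refl , ¬x') (y' , refl , ¬y') = subst₂ _∣_ (trans (ℤₚ.*-comm (2 ↑ w) (+ 2)) (sym (↑-suc 2 w))) (eq (2 ↑ w) x' y') (*-monoʳ-∣ (2 ↑ w) (even ≋⟨ odd-pred ¬x' ⟩ ≋⟨ odd-pred ¬y' ⟩))
      where
      eq : ∀ a x y → a * (x - y) ≡ a * x - a * y
      eq = solve-∀
      even : x' ≋ 1ℤ [ + 2 ] → y' ≋ 1ℤ [ + 2 ] → + 2 ∣ x' - y'
      even h h' = ≋⇒∣ (≋-trans h (≋-sym h'))

module Images {n k : ℕ} (c : Colouring (suc n) k) (circ : IsCirculant c) (ρ : Fin k ↔ Fin k) (alg : IsAlgAut c ρ) where
  open Sets c circ
  open Theory c circ
  open TopLayer c circ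
  open SchurRing c circ using (module Morphism)
  open Morphism ρ alg

  opaque
    S-subgroup : ∀ {e} → IsAGroup e → e ℕ.* S N (λ x → ind (+ e ∣? x)) ≡ N
    S-subgroup {e} ag = go (∣⇒∣ᵤ (∣N ag))
      where
      instance
        e-nz : ℕ.NonZero e
        e-nz = nz ag
      per : Per e (λ x → ind (+ e ∣? x))
      per x y h = ind-⇔ (+ e ∣? x) (+ e ∣? y) (∣-≋ h) (∣-≋ (≋-sym h))
      one : S e (λ x → ind (+ e ∣? x)) ≡ 1
      one = trans (S-cong e (λ x → ind-⇔ (+ e ∣? x) (x ≋? 0ℤ [ + e ]) ∣⇒≋0 ≋0⇒∣)) (S-δ1 e 0ℤ)
      go : e ℕ∣.∣ N → e ℕ.* S N (λ x → ind (+ e ∣? x)) ≡ N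
      go (ℕ∣.divides m eq) = trans (cong (e ℕ.*_) (trans (cong (λ L → S L (λ x → ind (+ e ∣? x))) eq) (trans (S-multiple e per m) (trans (cong (m ℕ.*_) one) (ℕₚ.*-identityʳ m))))) (trans (ℕₚ.*-comm e m) (sym eq))

    -- The image of an A-group is an A-group of the same order, hence the same one.
    image-AG : ∀ {e} → IsAGroup e → ∀ {x y} → R x y → (+ e ∣ x → + e ∣ y) × (+ e ∣ y → + e ∣ x)
    image-AG {e} ag {x} {y} r = (λ d → subst (λ z → + z ∣ y) same (∈⇒∣ I (pre-of d))) , λ d → ag-inv ag (R-inj (pre-R y) r refl) (∣⇒∈ I (subst (λ z → + z ∣ y) (sym same) d))
      where
      pre : ℤ → ℤ
      pre y = proj₁ (R-cototal y)
      pre-R : ∀ y → R (pre y) y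
      pre-R y = proj₂ (R-cototal y)
      A : ASet
      A = record { mem = λ y → + e ∣ pre y ; mem? = λ y → + e ∣? pre y ; inv = λ {y} {y'} h → ag-inv ag (R-inj (pre-R y) (pre-R y') h) }
      pre-of : + e ∣ x → + e ∣ pre y
      pre-of = ag-inv ag (R-inj r (pre-R y) refl)
      add′ : ∀ {y y'} → mem A y → mem A y' → mem A (y + y')
      add′ {y} {y'} d d' = go (R-codecompose (pre-R (y + y')) y)
        where
        eq : ∀ y y' → y + y' - y ≡ y'
        eq = solve-∀
        eq' : ∀ z a → z - a + a ≡ z
        eq' = solve-∀
        go : (∃ λ a → R a y × R (pre (y + y') - a) (y + y' - y)) → mem A (y + y')
        go (a , ra , rb) = subst (+ e ∣_) (eq' (pre (y + y')) a) (∣m∣n⇒∣m+n (ag-inv ag (R-inj (pre-R y') rb (cong χ (sym (eq y y')))) d') (ag-inv ag (R-inj (pre-R y) ra refl) d))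
      I : Indexed (mem A)
      I = agroup-of A (ag-inv ag (R-inj R-0 (pre-R 0ℤ) refl) ∣0) add′
      F F' one : ℤ → ℕ
      F x = ind (+ e ∣? x)
      F' y = ind (+ index I ∣? y)
      one _ = 1
      rel : Related F F'
      rel x y r = ind-⇔ (+ e ∣? x) (+ index I ∣? y) (λ d → ∈⇒∣ I (ag-inv ag (R-inj r (pre-R y) refl) d)) (λ d → ag-inv ag (R-inj (pre-R y) r refl) (∣⇒∈ I d))
      sizes : S N F ≡ S N F'
      sizes = trans (S-cong N (λ x → sym (ℕₚ.*-identityʳ (F x)))) (trans (conv-Related-N {F} {F'} {one} {one} rel (λ _ _ _ → refl) 0ℤ 0ℤ R-0) (S-cong N (λ x → ℕₚ.*-identityʳ (F' x))))
      same : index I ≡ e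
      same = ℕₚ.*-cancelʳ-≡ (index I) e (S N F) {{ℕ.≢-nonZero (λ h → N≢0 (cong +_ (trans (sym (S-subgroup ag)) (trans (cong (e ℕ.*_) h) (ℕₚ.*-zeroʳ e)))))}}
        (trans (cong (index I ℕ.*_) sizes) (trans (S-subgroup (isAGroup I)) (sym (S-subgroup ag))))

    R-∣ : ∀ {e} → IsAGroup e → ∀ {x y} → R x y → + e ∣ x → + e ∣ y
    R-∣ ag r = proj₁ (image-AG ag r)

    R-∣⁻ : ∀ {e} → IsAGroup e → ∀ {x y} → R x y → + e ∣ y → + e ∣ x
    R-∣⁻ ag r = proj₂ (image-AG ag r)

    -- The difference y - y' is the image of some a in the same A-group, so y' is an image of x - a,
    -- which lies in the class of x.
    R-period : ∀ {m} → IsAGroup m → ∀ {x} → Periodic m (class x) → ∀ {y y'} → R x y → y ≋ y' [ + m ] → R x y'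
    R-period {m} ag {x} per {y} {y'} r h = go (R-codecompose r (y - y'))
      where
      eq : ∀ y y' → y - (y - y') ≡ y'
      eq = solve-∀
      go : (∃ λ a → R a (y - y') × R (x - a) (y - (y - y'))) → R x y'
      go (a , ra , rb) = R-resp (per {x} {x - a} (≋-sym (≋-trans (≋-+ˡ x (≋-neg (∣⇒≋0 (R-∣⁻ ag ra (≋⇒∣ h))))) (≋-reflexive (ℤₚ.+-identityʳ x)))) refl) (cong χ (eq y y')) rb

-- Levels: A-sections of prime order

module Levels {n k : ℕ} (c : Colouring (suc n) k) (circ : IsCirculant c) where
  open Sets c circ
  open Theory c circ
  open TopLayer c circ
  open RegularClasses c circ
  open RegularGroups c circ

  opaque
    IsAGroup? : ∀ e → Dec (IsAGroup e)
    IsAGroup? e with + e ∣? + N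
    ... | no ¬d = no (¬d ∘ ∣N)
    ... | yes d = map′ (λ h → record { ∣N = d ; ag-inv = λ {x} {y} → h x y }) (λ ag x y → ag-inv ag)
      (search-all (λ x → search-all (λ y → (χ x ≟F χ y) →-dec ((+ e ∣? x) →-dec (+ e ∣? y)))
        (λ h f e' dx → ∣-≋ (≋-weaken d h) (f (trans e' (χ-cong (≋-sym h))) dx)))
        (λ h f y e' dx → f y (trans (χ-cong h) e') (∣-≋ (≋-weaken d (≋-sym h)) dx)))

    meet-AG : ∀ {e f} → IsAGroup e → IsAGroup f → ∃ λ l → IsAGroup l × (+ e ∣ + l) × (+ f ∣ + l) × (∀ {x} → + e ∣ x → + f ∣ x → + l ∣ x)
    meet-AG {e} {f} ae af = index I , isAGroup I , proj₁ (∣⇒∈ I ∣-refl) , proj₂ (∣⇒∈ I ∣-refl) , λ d d' → ∈⇒∣ I (d , d')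
      where
      A : ASet
      A = record { mem = λ x → (+ e ∣ x) × (+ f ∣ x) ; mem? = λ x → (+ e ∣? x) ×-dec (+ f ∣? x) ; inv = λ h (d , d') → ag-inv ae h d , ag-inv af h d' }
      I : Indexed (mem A)
      I = agroup-of A (∣0 , ∣0) (λ (a , b) (a' , b') → ∣m∣n⇒∣m+n a a' , ∣m∣n⇒∣m+n b b')

    -- F divides qD and has a higher power of q than D, so the intersection of the groups of index D
    -- and F has index qD.
    raise-AG : ∀ {q} → Prime q → ∀ {w D F} → IsAGroup D → IsAGroup F → Val q w (+ D) → q ↑ suc w ∣ + F → + F ∣ + q * + D → IsAGroup (q ℕ.* D)
    raise-AG {q} pr {w} {D} {F} aD aF vD dF Fq = go (meet-AG aD aF)
      where
      go : (∃ λ l → IsAGroup l × (+ D ∣ + l) × (+ F ∣ + l) × (∀ {x} → + D ∣ x → + F ∣ x → + l ∣ x)) → IsAGroup (q ℕ.* D)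
      go (l , al , Dl , Fl , least) = AG-≡ al (subst (+ l ∣_) (sym (ℤₚ.pos-* q D)) (least (∣n⇒∣m*n (+ q) ∣-refl) Fq)) (subst (_∣ + l) (sym (ℤₚ.pos-* q D)) (go' (val-form pr vD)))
        where
        go' : (∃ λ x' → (+ D ≡ q ↑ w * x') × ¬ + q ∣ x') → + q * + D ∣ + l
        go' (D' , eD , ¬D') = subst (_∣ + l) (trans (cong (_* D') (↑-suc q w)) (trans (ℤₚ.*-assoc (+ q) (q ↑ w) D') (cong (+ q *_) (sym eD))))
          (cop-∣-* (cop-↑-∤ pr (suc w) ¬D') (∣-trans dF Fl) (∣-trans (divides (q ↑ w) eD) Dl))

  -- Indices of A-groups divide N, so quantifying over numbers up to N loses nothing and keeps the
  -- intersection decidable.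
  Below : ℕ → ℕ → ℤ → Set
  Below q l x = ∀ (i : Fin (suc N)) → IsAGroup (toℕ i) → ¬ q ↑ suc l ∣ + toℕ i → + toℕ i ∣ x

  opaque
    below : ∀ q l → Indexed (Below q l)
    below q l = agroup-of (record { mem = Below q l ; mem? = λ x → all? (λ i → IsAGroup? (toℕ i) →-dec (¬? (q ↑ suc l ∣? + toℕ i) →-dec (+ toℕ i ∣? x))) ; inv = λ h f i ag ¬d → ag-inv ag h (f i ag ¬d) })
      (λ i ag ¬d → ∣0) (λ f g i ag ¬d → ∣m∣n⇒∣m+n (f i ag ¬d) (g i ag ¬d))

  -- The least A-group among those whose index is not divisible by q^(l+1).
  D : ℕ → ℕ → ℕ
  D q l = index (below q l)

  opaque
    D-AG : ∀ q l → IsAGroup (D q l)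
    D-AG q l = isAGroup (below q l)

    D-∣ : ∀ {q l e} → IsAGroup e → ¬ q ↑ suc l ∣ + e → + e ∣ + D q l
    D-∣ {q} {l} {e} ag ¬d = subst (λ z → + z ∣ + D q l) ti (∣⇒∈ (below q l) ∣-refl (fromℕ< lt) (subst IsAGroup (sym ti) ag) (subst (λ z → ¬ q ↑ suc l ∣ + z) (sym ti) ¬d))
      where
      lt : e ℕ.< suc N
      lt = s≤s (ℕ∣.∣⇒≤ (∣⇒∣ᵤ (∣N ag)))
      ti : toℕ (fromℕ< lt) ≡ e
      ti = toℕ-fromℕ< lt

    -- With N = q^b s, each index involved divides q^l s, so their common multiple `D q l` does too.
    D-∤ : ∀ {q} → Prime q → ∀ l → ¬ q ↑ suc l ∣ + D q l
    D-∤ {q} pr l d = go (prime-split pr N≢0)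
      where
      go : (∃ λ b → ∃ λ s → (+ N ≡ q ↑ b * s) × ¬ + q ∣ s) → ⊥
      go (b , s , N≡ , ¬s) = ℕₚ.1+n≰n (∣↑-≤ pr ¬s (∣-trans d (∈⇒∣ (below q l) λ i ag ¬d → sub (toℕ i) ag ¬d)))
        where
        sub : ∀ e → IsAGroup e → ¬ q ↑ suc l ∣ + e → + e ∣ q ↑ l * s
        sub e ag ¬d = sub' (prime-split pr (∣-nonZero N≢0 (∣N ag)))
          where
          sub' : (∃ λ w → ∃ λ e' → (+ e ≡ q ↑ w * e') × ¬ + q ∣ e') → + e ∣ q ↑ l * s
          sub' (w , e' , ee , ¬e') = subst (_∣ q ↑ l * s) (sym ee) (*-∣-* (↑-∣ q w≤l) (cop-cancel (cop-sym (cop-↑-∤ pr b ¬e')) (subst (e' ∣_) N≡ (∣-trans (divides (q ↑ w) ee) (∣N ag)))))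
            where
            w≤l : w ℕ.≤ l
            w≤l = ℕₚ.≮⇒≥ (λ lt → ¬d (subst (q ↑ suc l ∣_) (sym ee) (∣m⇒∣m*n e' (↑-∣ q lt))))

  -- `D q l` and its q-fold bound a section of order q, in which a base tuple must have a generator;
  -- that base point has valuation exactly l at q.
  Level : ℕ → ℕ → Set
  Level q l = IsAGroup (q ℕ.* D q l) × (q ↑ l ∣ + D q l)

  Level? : ∀ q l → Dec (Level q l)
  Level? q l = IsAGroup? (q ℕ.* D q l) ×-dec (q ↑ l ∣? + D q l)

  opaque
    level-Val : ∀ {q} → Prime q → ∀ {l} → Level q l → Val q l (+ D q l)
    level-Val pr {l} (_ , d) = d , D-∤ pr l

    regular-Level : ∀ {x₀} → Regular x₀ → ∀ {q} (pd : PrimeData x₀ q) → Level q (PrimeData.j pd) × (+ E x₀ ∣ + D q (PrimeData.j pd))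
    regular-Level {x₀} reg {q} pd = (raise-AG prime (D-AG q j) (AG-p reg pd) vD (subst (q ↑ suc j ∣_) (sym qE) (subst (_∣ + q * + E x₀) (sym (↑-suc q j)) (*-monoʳ-∣ (+ q) (proj₁ vE)))) (subst (_∣ + q * + D q j) (sym qE) (*-monoʳ-∣ (+ q) E∣D)) , proj₁ vD) , E∣D
      where
      open PrimeData pd
      vE : Val q j (+ E x₀)
      vE = form-val prime e≡ p∤e'
      qE : + (q ℕ.* E x₀) ≡ + q * + E x₀
      qE = ℤₚ.pos-* q (E x₀)
      E∣D : + E x₀ ∣ + D q j
      E∣D = D-∣ (E-AG x₀) (proj₂ vE)
      vD : Val q j (+ D q j)
      vD = ∣-trans (proj₁ vE) E∣D , D-∤ prime j

    -- The greatest level not above i; the digits between two levels thus share the scalar of the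
    -- lower one. If there is none, the value is 0 and nothing is claimed of it.
    level : ∀ q i → ∃ λ l → l ℕ.≤ i × (∀ j → j ℕ.≤ i → Level q j → (j ℕ.≤ l) × Level q l)
    level q zero = 0 , z≤n , λ { zero z≤n h → z≤n , h }
    level q (suc i) with Level? q (suc i)
    ... | yes h = suc i , ℕₚ.≤-refl , λ j le _ → le , h
    ... | no ¬h = go (level q i)
      where
      go : (∃ λ l → l ℕ.≤ i × (∀ j → j ℕ.≤ i → Level q j → (j ℕ.≤ l) × Level q l)) → ∃ λ l → l ℕ.≤ suc i × (∀ j → j ℕ.≤ suc i → Level q j → (j ℕ.≤ l) × Level q l)
      go (l , le , h) = l , ℕₚ.m≤n⇒m≤1+n le , λ j le' hj → [ j , le' , hj ] (ℕₚ.m≤n⇒m<n∨m≡n le')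
        where
        [_,_,_] : ∀ j → j ℕ.≤ suc i → Level q j → (j ℕ.< suc i) ⊎ (j ≡ suc i) → (j ℕ.≤ l) × Level q l
        [ j , _ , hj ] (inj₁ (s≤s lt)) = h j lt hj
        [ j , _ , hj ] (inj₂ refl) = ⊥-elim (¬h hj)

-- Point extensions

opaque
  inum-hit : ∀ {N k} (d : Colouring N k) α β r s → inum d α β r s ≢ 0 → ∃ λ γ → (d α γ ≡ r) × (d γ β ≡ s)
  inum-hit {N} d α β r s ne = go (filter P? (allFin N)) refl ne
    where
    P? : (γ : Fin N) → Dec ((d α γ ≡ r) × (d γ β ≡ s))
    P? γ = (d α γ ≟F r) ×-dec (d γ β ≟F s)
    go : ∀ l → filter P? (allFin N) ≡ l → length l ≢ 0 → ∃ λ γ → (d α γ ≡ r) × (d γ β ≡ s)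
    go [] _ ne = ⊥-elim (ne refl)
    go (γ ∷ l) e _ = γ , proj₂ (∈-filter⁻ P? {xs = allFin N} (subst (γ ∈_) (sym e) (here refl)))

  inum-pos : ∀ {N k} (d : Colouring N k) α β γ → inum d α β (d α γ) (d γ β) ≢ 0
  inum-pos {N} d α β γ = go (∈-filter⁺ (λ δ → (d α δ ≟F d α γ) ×-dec (d δ β ≟F d γ β)) (∈-allFin γ) (refl , refl))
    where
    go : ∀ {l : List (Fin N)} → γ ∈ l → length l ≢ 0
    go (here _) ()
    go (there _) ()

module Frames {n k : ℕ} (c : Colouring (suc n) k) (circ : IsCirculant c) (φ : Fin k ↔ Fin k) (alg : IsAlgAut c φ) where
  open Sets c circ
  open SchurRing c circ using (module Morphism; toF; toF-≋; c-as-χ; ⊝-≋; mod-≋)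
  open Morphism φ alg

  -- What the extension of φ provides, in terms of `R` alone: two points can be placed
  -- simultaneously in the position prescribed by all base points and by each other. The base point
  -- 1 of the group and its image are normalised to 0.
  record Frame : Set where
    field
      t : ℕ
      X Y : Fin t → ℤ
      o : Fin t
      X-o : X o ≡ 0ℤ
      Y-o : Y o ≡ 0ℤ
      transfer : ∀ z w → ∃ λ z' → ∃ λ w' → (∀ i → R (z - X i) (z' - Y i)) × (∀ i → R (w - X i) (w' - Y i)) × R (z - w) (z' - w')
      points : ∀ {e q} → Prime q → IsAGroup e → IsAGroup (q ℕ.* e) → ∃ λ i → (+ e ∣ X i) × ¬ + (q ℕ.* e) ∣ X i

  opaque
    AGroup⇒XGroup : ∀ {e} → IsAGroup e → IsXGroup c e
    AGroup⇒XGroup {e} ag = ∣⇒∣ᵤ (∣N ag) , λ α β α' β' h d → ∣⇒∣ᵤ (∣-≋ (≋-sym (≋-weaken (∣N ag) (⊝-≋ β' α')))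
      (ag-inv ag (trans (sym (c-as-χ α β)) (trans h (c-as-χ α' β'))) (∣-≋ (≋-weaken (∣N ag) (⊝-≋ β α)) (∣ᵤ⇒∣ {+ e} {+ toℕ (β ⊝ α)} d))))

    -- Applied to the section of order q between the two groups: an entry in the smaller group could
    -- not generate it.
    base-points : ∀ {t} {x : Fin t → Fin (suc n)} → IsBaseTuple c x → ∀ {e q} → Prime q → IsAGroup e → IsAGroup (q ℕ.* e) →
      ∃ λ i → (+ e ∣ + toℕ (x i)) × ¬ + (q ℕ.* e) ∣ + toℕ (x i)
    base-points {t} {x} (_ , base) {e} {q} pr ae aqe = go (base sec (q , 1 , pr , sym (ℕₚ.*-identityʳ q)))
      where
      sec : Section c
      sec = record { eU = e ; m = q ; U-X = AGroup⇒XGroup ae ; L-X = AGroup⇒XGroup aqe }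
      go : (∃ λ i → (e ℕ∣.∣ toℕ (x i)) × (∀ (u : Fin (suc n)) → e ℕ∣.∣ toℕ u → ∃ λ j → q ℕ.* e ℕ∣.∣ toℕ (u ⊝ (j · x i)))) → ∃ λ i → (+ e ∣ + toℕ (x i)) × ¬ + (q ℕ.* e) ∣ + toℕ (x i)
      go (i , d , gens) = i , ∣ᵤ⇒∣ d , λ d' → go' d' (gens (toF (+ e)) (∣⇒∣ᵤ {+ e} (∣-≋ (≋-sym (≋-weaken (∣N ae) (toF-≋ (+ e)))) ∣-refl)))
        where
        go' : + (q ℕ.* e) ∣ + toℕ (x i) → (∃ λ j → q ℕ.* e ℕ∣.∣ toℕ (toF (+ e) ⊝ (j · x i))) → ⊥
        go' d' (j , h) = prime-∤1 pr (*-cancelˡ-∣ (+ e) {{nz ae}} (subst₂ _∣_ (trans (ℤₚ.pos-* q e) (ℤₚ.*-comm (+ q) (+ e))) (sym (ℤₚ.*-identityʳ (+ e))) qe∣e))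
          where
          m : ℤ
          m = + (q ℕ.* e)
          jx : + toℕ (j · x i) ≋ 0ℤ [ m ]
          jx = ≋-trans (≋-weaken (∣N aqe) (mod-≋ (j ℕ.* toℕ (x i)))) (∣⇒≋0 (subst (m ∣_) (sym (ℤₚ.pos-* j (toℕ (x i)))) (∣n⇒∣m*n (+ j) d')))
          qe∣e : m ∣ + e
          qe∣e = ∣-≋ (≋-trans (≋-weaken (∣N aqe) (⊝-≋ (toF (+ e)) (j · x i))) (≋-trans (≋-- (≋-weaken (∣N aqe) (toF-≋ (+ e))) jx) (≋-reflexive (ℤₚ.+-identityʳ (+ e))))) (∣ᵤ⇒∣ {m} {+ toℕ (toF (+ e) ⊝ (j · x i))} h)

    -- Choose any pair α, β whose colour is the image of that of z, w. For each base point, equality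
    -- of intersection numbers supplies an intermediate point, and as the images of base points are
    -- singletons it has to be `x' i`. Subtracting `x' o` throughout leaves all differences
    -- unchanged.
    frame : ∀ {t} {x : Fin t → Fin (suc n)} → IsBaseTuple c x → Extendable c φ x → Frame
    frame {t} {x} base@((o , xo) , _) (x' , k₁ , d₁ , k₂ , d₂ , ψ , _ , (cc₂ , _ , single , _) , iso , compat , diag) = record
      { t = t ; X = λ i → + toℕ (x i) ; Y = λ i → + toℕ (x' i) - + toℕ (x' o) ; o = o ; X-o = cong (λ α → + toℕ α) xo ; Y-o = ℤₚ.+-inverseʳ (+ toℕ (x' o))
      ; transfer = λ z w → trans′ z w (IsCC.nonempty cc₂ (to (d₁ (toF z) (toF w)))) ; points = base-points base }
      where
      open Inverse ψ using (to)
      step : ∀ {α β α' β'} → d₂ α' β' ≡ to (d₁ α β) → ∀ γ → ∃ λ γ' → (d₂ α' γ' ≡ to (d₁ α γ)) × (d₂ γ' β' ≡ to (d₁ γ β))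
      step {α} {β} {α'} {β'} h γ = inum-hit d₂ α' β' _ _ (λ e → inum-pos d₁ α β γ (trans (iso (d₁ α γ) (d₁ γ β) α β α' β' h) e))
      at : ∀ i {γ β z} → d₂ γ β ≡ to (d₁ (x i) z) → γ ≡ x' i
      at i {γ} {β} {z} h = go (step h (x i))
        where
        go : (∃ λ γ' → (d₂ γ γ' ≡ to (d₁ (x i) (x i))) × (d₂ γ' β ≡ to (d₁ (x i) z))) → γ ≡ x' i
        go (γ' , e , _) = proj₁ (single i γ γ' (trans e (sym (diag i))))
      rel : ∀ {α β α' β'} → d₂ α' β' ≡ to (d₁ α β) → R (+ toℕ β - + toℕ α) (+ toℕ β' - + toℕ α')
      rel {α} {β} {α'} {β'} h = trans (sym (c-as-χ α' β')) (trans (compat α β α' β' h) (cong (Inverse.to φ) (c-as-χ α β)))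
      flip : ∀ {a b a' b'} → R (a - b) (a' - b') → R (b - a) (b' - a')
      flip {a} {b} {a'} {b'} r = R-resp (cong χ (eq a b)) (cong χ (eq a' b')) (R-neg r)
        where
        eq : ∀ a b → - (a - b) ≡ b - a
        eq = solve-∀
      trans′ : ∀ z w → (∃ λ α → ∃ λ β → d₂ α β ≡ to (d₁ (toF z) (toF w))) → ∃ λ z' → ∃ λ w' →
        (∀ i → R (z - + toℕ (x i)) (z' - (+ toℕ (x' i) - + toℕ (x' o)))) × (∀ i → R (w - + toℕ (x i)) (w' - (+ toℕ (x' i) - + toℕ (x' o)))) × R (z - w) (z' - w')
      trans′ z w (α , β , h) = + toℕ α - x₀ , + toℕ β - x₀ , (λ i → left i (step h (x i))) , (λ i → right i (step h (x i))) ,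
          R-resp (χ-cong (≋-- (toF-≋ z) (toF-≋ w))) (cong χ (eq₁ (+ toℕ α) (+ toℕ β) x₀)) (flip {+ toℕ (toF w)} {+ toℕ (toF z)} {+ toℕ β} {+ toℕ α} (rel h))
        where
        x₀ : ℤ
        x₀ = + toℕ (x' o)
        eq₁ : ∀ a b c → a - b ≡ a - c - (b - c)
        eq₁ = solve-∀
        left : ∀ i → (∃ λ γ' → (d₂ α γ' ≡ to (d₁ (toF z) (x i))) × (d₂ γ' β ≡ to (d₁ (x i) (toF w)))) → R (z - + toℕ (x i)) (+ toℕ α - x₀ - (+ toℕ (x' i) - x₀))
        left i (γ' , e , e') = R-resp (χ-cong (≋-+ʳ (- + toℕ (x i)) (toF-≋ z))) (cong χ (eq₁ (+ toℕ α) (+ toℕ (x' i)) x₀))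
          (flip {+ toℕ (x i)} {+ toℕ (toF z)} {+ toℕ (x' i)} {+ toℕ α} (subst (λ γ → R (+ toℕ (x i) - + toℕ (toF z)) (+ toℕ γ - + toℕ α)) (at i e') (rel e)))
        right : ∀ i → (∃ λ γ' → (d₂ α γ' ≡ to (d₁ (toF z) (x i))) × (d₂ γ' β ≡ to (d₁ (x i) (toF w)))) → R (w - + toℕ (x i)) (+ toℕ β - x₀ - (+ toℕ (x' i) - x₀))
        right i (γ' , e , e') = R-resp (χ-cong (≋-+ʳ (- + toℕ (x i)) (toF-≋ w))) (cong χ (eq₁ (+ toℕ β) (+ toℕ (x' i)) x₀))
          (subst (λ γ → R (+ toℕ (toF w) - + toℕ (x i)) (+ toℕ β - + toℕ γ)) (at i e') (rel e'))

opaque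
  val-unique : ∀ {q w w' x} → Val q w x → Val q w' x → w ≡ w'
  val-unique {q} {w} {w'} (d , ¬d) (d' , ¬d') = ℕₚ.≤-antisym (ℕₚ.≮⇒≥ (λ l → ¬d' (∣-trans (↑-∣ q l) d))) (ℕₚ.≮⇒≥ (λ l → ¬d (∣-trans (↑-∣ q l) d')))

  val-lift : ∀ {q} → Prime q → ∀ {l e x} → Val q l e → e ∣ x → ¬ + q * e ∣ x → Val q l x
  val-lift {q} pr {l} {e} {x} v d ¬d = ∣-trans (proj₁ v) d , λ h → go h (val-form pr v)
    where
    go : q ↑ suc l ∣ x → (∃ λ e' → (e ≡ q ↑ l * e') × ¬ + q ∣ e') → ⊥
    go h (e' , ee , ¬e') = ¬d (subst (_∣ x) (trans (cong (_* e') (↑-suc q l)) (trans (ℤₚ.*-assoc (+ q) (q ↑ l) e') (cong (+ q *_) (sym ee))))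
      (cop-∣-* (cop-↑-∤ pr (suc l) ¬e') h (∣-trans (divides (q ↑ l) ee) d)))

-- The scalars of φ and their compatibility

module Scaling {n k : ℕ} (c : Colouring (suc n) k) (circ : IsCirculant c) (φ : Fin k ↔ Fin k) (alg : IsAlgAut c φ) (fr : Frames.Frame c circ φ alg) where
  open Sets c circ
  open TopLayer c circ
  open RegularClasses c circ
  open RegularGroups c circ
  open Twisted c circ
  open Levels c circ
  open SchurRing c circ using (module Morphism)
  open Morphism φ alg
  open Images c circ φ alg
  open Units c circ φ alg using (R-unit)
  open Frames.Frame fr

  opaque
    R-origin : ∀ {z z'} → R (z - X o) (z' - Y o) → R z z'
    R-origin {z} {z'} = R-resp (cong χ (trans (cong (λ w → z - w) X-o) (ℤₚ.+-identityʳ z))) (cong χ (trans (cong (λ w → z' - w) Y-o) (ℤₚ.+-identityʳ z')))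

    R-points : ∀ i → R (X i) (Y i)
    R-points i = go (transfer (X i) 0ℤ)
      where
      go : (∃ λ z' → ∃ λ w' → (∀ j → R (X i - X j) (z' - Y j)) × (∀ j → R (0ℤ - X j) (w' - Y j)) × R (X i - 0ℤ) (z' - w')) → R (X i) (Y i)
      go (z' , _ , h , _) = R-resp refl (χ-cong same) (R-origin (h o))
        where
        same : z' ≋ Y i [ + N ]
        same = ≋⟨ χ-0 (R-fun (h i) R-0 (cong χ (ℤₚ.+-inverseʳ (X i)))) ⟩

    anchor : ∀ q l → ∃ λ i → Prime q → Level q l → (+ D q l ∣ X i) × ¬ + (q ℕ.* D q l) ∣ X i
    anchor q l = go (any? {t} (λ i → (+ D q l ∣? X i) ×-dec ¬? (+ (q ℕ.* D q l) ∣? X i)))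
      where
      go : Dec (∃ λ i → (+ D q l ∣ X i) × ¬ + (q ℕ.* D q l) ∣ X i) → ∃ λ i → Prime q → Level q l → (+ D q l ∣ X i) × ¬ + (q ℕ.* D q l) ∣ X i
      go (yes (i , h)) = i , λ _ _ → h
      -- `o` is only a default: without an anchor, q is not prime or l is not a level.
      go (no ¬h) = o , λ pr lv → ⊥-elim (¬h (points pr (D-AG q l) (proj₁ lv)))

  P P' : ℕ → ℕ → ℤ
  P q l = X (proj₁ (anchor q l))
  P' q l = Y (proj₁ (anchor q l))

  opaque
    D∣P : ∀ {q} → Prime q → ∀ {l} → Level q l → + D q l ∣ P q l
    D∣P {q} pr {l} lv = proj₁ (proj₂ (anchor q l) pr lv)

    P-Val : ∀ {q} → Prime q → ∀ {l} → Level q l → Val q l (P q l)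
    P-Val {q} pr {l} lv = val-lift pr (level-Val pr lv) (D∣P pr lv) (λ h → proj₂ (proj₂ (anchor q l) pr lv) (subst (_∣ P q l) (sym (ℤₚ.pos-* q (D q l))) h))

    P'-Val : ∀ {q} → Prime q → ∀ {l} → Level q l → Val q l (P' q l)
    P'-Val {q} pr {l} lv = val-lift pr (level-Val pr lv) (R-∣ (D-AG q l) r (D∣P pr lv))
      (λ h → proj₂ (proj₂ (anchor q l) pr lv) (R-∣⁻ (proj₁ lv) r (subst (_∣ P' q l) (sym (ℤₚ.pos-* q (D q l))) h)))
      where
      r : R (P q l) (P' q l)
      r = R-points (proj₁ (anchor q l))

    scale : ∀ q l → ∃ λ τ → (Prime q → ¬ + q ∣ τ) × (Prime q → Level q l → ∀ k → q ↑ k ∣ + N → P' q l ≋ τ * P q l [ q ↑ k ])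
    scale q l = go (prime? q) (Level? q l)
      where
      go : Dec (Prime q) → Dec (Level q l) → ∃ λ τ → (Prime q → ¬ + q ∣ τ) × (Prime q → Level q l → ∀ k → q ↑ k ∣ + N → P' q l ≋ τ * P q l [ q ↑ k ])
      go (no ¬p) _ = 1ℤ , (λ p → ⊥-elim (¬p p)) , λ p → ⊥-elim (¬p p)
      go (yes pr) (no ¬l) = 1ℤ , (λ _ → prime-∤1 pr) , λ _ lv → ⊥-elim (¬l lv)
      go (yes pr) (yes lv) = go' (prime-split pr N≢0)
        where
        go' : (∃ λ b → ∃ λ s → (+ N ≡ q ↑ b * s) × ¬ + q ∣ s) → ∃ λ τ → (Prime q → ¬ + q ∣ τ) × (Prime q → Level q l → ∀ k → q ↑ k ∣ + N → P' q l ≋ τ * P q l [ q ↑ k ])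
        go' (b , s , N≡ , ¬s) = go″ (val-quotient pr (P-Val pr lv) (P'-Val pr lv) b)
          where
          go″ : (∃ λ τ → (τ * P q l ≋ P' q l [ q ↑ b ]) × ¬ + q ∣ τ) → ∃ λ τ → (Prime q → ¬ + q ∣ τ) × (Prime q → Level q l → ∀ k → q ↑ k ∣ + N → P' q l ≋ τ * P q l [ q ↑ k ])
          go″ (τ , h , ¬τ) = τ , (λ _ → ¬τ) , λ _ _ k d → ≋-sym (≋-weaken (↑-∣ q (∣↑-≤ pr ¬s (subst (q ↑ k ∣_) N≡ d))) h)

  τ : ℕ → ℕ → ℤ
  τ q l = proj₁ (scale q l)

  module _ {x₀ : ℤ} (reg : Regular x₀) where
    private
      e : ℤ
      e = + E x₀

      b : ∀ {q} → PrimeData x₀ q → ℕ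
      b = PrimeData.b

    opaque
      -- The valuation of E as a function of q alone, so that the scalar `τ q (jof q)` does not
      -- depend on the chosen `PrimeData`.
      jof : ℕ → ℕ
      jof q = go (prime? q)
        where
        go : Dec (Prime q) → ℕ
        go (yes pr) = proj₁ (prime-split pr (E≢0 x₀))
        go (no _) = 0

      E-Val : ∀ {q} → PrimeData x₀ q → Val q (jof q) e
      E-Val {q} pd with prime? q
      ... | no ¬p = ⊥-elim (¬p (PrimeData.prime pd))
      ... | yes pr = form-val pr (proj₁ (proj₂ (proj₂ (prime-split pr (E≢0 x₀))))) (proj₂ (proj₂ (proj₂ (prime-split pr (E≢0 x₀)))))

    opaque
      j≡ : ∀ {q} (pd : PrimeData x₀ q) → PrimeData.j pd ≡ jof q
      j≡ pd = val-unique (form-val (PrimeData.prime pd) (PrimeData.e≡ pd) (PrimeData.p∤e' pd)) (E-Val pd)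

      j≤b : ∀ {q} (pd : PrimeData x₀ q) → jof q ℕ.≤ b pd
      j≤b pd = subst (ℕ._≤ b pd) (j≡ pd) (AtPrime.j≤b reg pd)

      a+j : ∀ {q} (pd : PrimeData x₀ q) → AtPrime.a reg pd ℕ.+ jof q ≡ suc (b pd)
      a+j pd = subst (λ z → AtPrime.a reg pd ℕ.+ z ≡ suc (b pd)) (j≡ pd) (AtPrime.a+j reg pd)

      qE∣M : ∀ {q} → PrimeData x₀ q → + q * e ∣ + M x₀
      qE∣M pd = AtPrime.qe∣M reg pd

      qb∣M : ∀ {q} (pd : PrimeData x₀ q) → q ↑ suc (b pd) ∣ + M x₀
      qb∣M pd = AtPrime.qb∣M reg pd

      ≤b : ∀ {q} (pd : PrimeData x₀ q) {k} → q ↑ k ∣ + M x₀ → k ℕ.≤ suc (b pd)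
      ≤b {q} pd {k} d = ∣↑-≤ (PrimeData.prime pd) (PrimeData.p∤s pd) (subst (q ↑ k ∣_) (AtPrime.M≡ᶻ reg pd) d)

      level-j : ∀ {q} (pd : PrimeData x₀ q) → Level q (jof q)
      level-j {q} pd = subst (Level q) (j≡ pd) (proj₁ (regular-Level reg pd))

      E∣D : ∀ {q} (pd : PrimeData x₀ q) {l} → jof q ℕ.≤ l → e ∣ + D q l
      E∣D {q} pd {l} le = D-∣ (E-AG x₀) (λ h → proj₂ (E-Val pd) (∣-trans (↑-∣ q (s≤s le)) h))

      E∣P : ∀ {q} (pd : PrimeData x₀ q) {l} → Level q l → jof q ℕ.≤ l → e ∣ P q l
      E∣P pd lv le = ∣-trans (E∣D pd le) (D∣P (PrimeData.prime pd) lv)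

      P'≋ : ∀ {q} (pd : PrimeData x₀ q) {l} → Level q l → P' q l ≋ τ q l * P q l [ q ↑ suc (b pd) ]
      P'≋ {q} pd {l} lv = proj₂ (proj₂ (scale q l)) (PrimeData.prime pd) lv (suc (b pd)) (∣-trans (qb∣M pd) (∣N (M-AG x₀)))

      regular-at : ∀ {z} → e ∣ z → (∀ {q} (pd : PrimeData x₀ q) → Val q (jof q) z) → RegularAt x₀ z
      regular-at {z} d v = d , λ q pr dq h → proj₂ (v (prime-data x₀ pr dq)) (∣-trans (subst (_∣ + q * e) (sym (↑-suc q (jof q))) (*-monoʳ-∣ (+ q) (proj₁ (E-Val (prime-data x₀ pr dq))))) h)

      val-at : ∀ {z} → RegularAt x₀ z → ∀ {q} (pd : PrimeData x₀ q) → Val q (jof q) z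
      val-at (d , r) {q} pd = val-lift (PrimeData.prime pd) (E-Val pd) d (r q (PrimeData.prime pd) (qE∣M pd))

      off-E : ∀ {q} → Prime q → ¬ + q * e ∣ + M x₀ → ∀ {k} → q ↑ k ∣ + M x₀ → q ↑ k ∣ e
      off-E {q} pr ¬d {k} dk = go (E∣M x₀)
        where
        go : e ∣ + M x₀ → q ↑ k ∣ e
        go (divides m em) = cop-cancel (cop-↑-∤ pr k q∤m) (subst (q ↑ k ∣_) em dk)
          where
          q∤m : ¬ + q ∣ m
          q∤m (divides r er) = ¬d (divides r (trans em (trans (cong (_* e) er) (ℤₚ.*-assoc r (+ q) e))))

      -- At a prime q for which qE does not divide M, the power of q in M divides E already, so all
      -- multiples of E agree there.
      ≋-by-primes : ∀ {m} → m ∣ + M x₀ → ∀ {x y} → e ∣ x → e ∣ y → (∀ {q} (pd : PrimeData x₀ q) → + q ∣ m → x ≋ y [ q ↑ suc (b pd) ]) → x ≋ y [ m ]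
      ≋-by-primes {m} dm {x} {y} dx dy h = ≋⟨ local-∣ m (∣-nonZero N≢0 (∣-trans dm (∣N (M-AG x₀)))) loc ⟩
        where
        loc : PrimePowers m (λ _ z → z ∣ x - y)
        loc q pr zero d = 0↑∣
        loc q pr (suc k) d = go (+ q * e ∣? + M x₀)
          where
          go : Dec (+ q * e ∣ + M x₀) → q ↑ suc k ∣ x - y
          go (yes dq) = ∣-trans (↑-∣ q (≤b pd (∣-trans d dm))) (≋⇒∣ (h pd (∣-trans (p∣↑ q k) d)))
            where
            pd : PrimeData x₀ q
            pd = prime-data x₀ pr dq
          go (no ¬dq) = ∣-trans (off-E pr ¬dq (∣-trans d dm)) (∣m∣n⇒∣m-n dx dy)

      common : (f : ℕ → ℤ) → (∀ {q} → PrimeData x₀ q → e ∣ f q) → ∃ λ z → (e ∣ z) × (∀ {q} (pd : PrimeData x₀ q) → z ≋ f q [ q ↑ suc (b pd) ])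
      common f fe = go (CRT (+ M x₀) M≢0 r)
        where
        M≢0 : + M x₀ ≢ 0ℤ
        M≢0 = ∣-nonZero N≢0 (∣N (M-AG x₀))
        -- The value 0 at the remaining primes keeps the common solution divisible by e.
        r : ℕ → ℤ
        r q with + q * e ∣? + M x₀
        ... | yes _ = f q
        ... | no _ = 0ℤ
        r-yes : ∀ q → + q * e ∣ + M x₀ → r q ≡ f q
        r-yes q d with + q * e ∣? + M x₀
        ... | yes _ = refl
        ... | no ¬d = ⊥-elim (¬d d)
        r-no : ∀ q → ¬ + q * e ∣ + M x₀ → r q ≡ 0ℤ
        r-no q ¬d with + q * e ∣? + M x₀
        ... | yes d = ⊥-elim (¬d d)
        ... | no _ = refl
        go : (∃ λ z → PrimePowers (+ M x₀) (λ p m → z ≋ r p [ m ])) → ∃ λ z → (e ∣ z) × (∀ {q} (pd : PrimeData x₀ q) → z ≋ f q [ q ↑ suc (b pd) ])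
        go (z , h) = z , local-∣ e (E≢0 x₀) loc , λ {q} pd → ≋-trans (h q (PrimeData.prime pd) (suc (b pd)) (qb∣M pd)) (≋-reflexive (r-yes q (qE∣M pd)))
          where
          loc : PrimePowers e (λ _ m → m ∣ z)
          loc q pr k d = go' (+ q * e ∣? + M x₀)
            where
            hz : z ≋ r q [ q ↑ k ]
            hz = h q pr k (∣-trans d (E∣M x₀))
            go' : Dec (+ q * e ∣ + M x₀) → q ↑ k ∣ z
            go' (yes dq) = ∣-≋ (≋-sym (≋-trans hz (≋-reflexive (r-yes q dq)))) (∣-trans d (fe (prime-data x₀ pr dq)))
            go' (no ¬dq) = ≋0⇒∣ (≋-trans hz (≋-reflexive (r-no q ¬dq)))

      -- The hypotheses put z - X i into the group of index q^a E. By `AG-prime-power` this is an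
      -- A-group, so it contains z' - Y i too, and q^(b+1) divides its index.
      near : ∀ {q} (pd : PrimeData x₀ q) {z z'} i → e ∣ z → e ∣ X i → z ≋ X i [ q ↑ suc (b pd) ] → R (z - X i) (z' - Y i) → z' ≋ Y i [ q ↑ suc (b pd) ]
      near {q} pd {z} {z'} i dz dX h r = ≋⟨ ∣-trans (subst (q ↑ suc (b pd) ∣_) (sym qaE) (subst (_∣ q ↑ a * e) (trans (sym (↑-+ q a j)) (cong (q ↑_) (AtPrime.a+j reg pd))) (*-∣-* (∣-refl {q ↑ a}) (divides e' (trans e≡ (ℤₚ.*-comm (q ↑ j) e'))))))
          (R-∣ (AG-prime-power reg pd) r (subst (_∣ z - X i) (sym (trans qaE split)) (cop-∣-* (cop-↑-∤ prime (suc (b pd)) p∤e') (≋⇒∣ h) (∣-trans (divides (q ↑ j) e≡) (∣m∣n⇒∣m-n dz dX))))) ⟩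
        where
        open PrimeData pd using (prime; e'; e≡; p∤e'; j)
        a : ℕ
        a = AtPrime.a reg pd
        qaE : + (q ℕ.^ a ℕ.* E x₀) ≡ q ↑ a * e
        qaE = trans (ℤₚ.pos-* (q ℕ.^ a) (E x₀)) (cong (_* e) (↑-as-+ q a))
        split : q ↑ a * e ≡ q ↑ suc (b pd) * e'
        split = trans (cong (q ↑ a *_) e≡) (trans (sym (ℤₚ.*-assoc (q ↑ a) (q ↑ j) e')) (cong (_* e') (trans (sym (↑-+ q a j)) (cong (q ↑_) (AtPrime.a+j reg pd)))))

      -- A single regular element that agrees at every relevant prime q with the base point for the
      -- level of E, even if no base point is regular itself; its image is then known at all these
      -- primes.
      pivot : ∃ λ z → (e ∣ z) × (∀ {q} (pd : PrimeData x₀ q) → z ≋ P q (jof q) [ q ↑ suc (b pd) ])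
      pivot = common (λ q → P q (jof q)) (λ pd → E∣P pd (level-j pd) ℕₚ.≤-refl)

    private
      y₀ : ℤ
      y₀ = proj₁ pivot

    opaque
      y₀-Val : ∀ {q} (pd : PrimeData x₀ q) → Val q (jof q) y₀
      y₀-Val {q} pd = val-≋ (≋-weaken (↑-∣ q (s≤s (j≤b pd))) (≋-sym (proj₂ (proj₂ pivot) pd))) (P-Val (PrimeData.prime pd) (level-j pd))

      pivot-image : ∀ {y'} → (∀ i → R (y₀ - X i) (y' - Y i)) → ∀ {q} (pd : PrimeData x₀ q) → y' ≋ τ q (jof q) * y₀ [ q ↑ suc (b pd) ]
      pivot-image {y'} h {q} pd = ≋-trans (near pd i (proj₁ (proj₂ pivot)) (E∣P pd (level-j pd) ℕₚ.≤-refl) (proj₂ (proj₂ pivot) pd) (h i))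
          (≋-trans (P'≋ pd (level-j pd)) (≋-*ˡ (τ q (jof q)) (≋-sym (proj₂ (proj₂ pivot) pd))))
        where
        i : Fin t
        i = proj₁ (anchor q (jof q))

      -- Modulo M the element d is a unit multiple of the pivot, and multiplying by that unit
      -- commutes both with `R` and with the scalars. The period M of the class absorbs the rest.
      regular-image : ∀ {d d'} → RegularAt x₀ d → e ∣ d' → (∀ {q} (pd : PrimeData x₀ q) → d' ≋ τ q (jof q) * d [ q ↑ suc (b pd) ]) → R d d'
      regular-image {d} {d'} rd ed' hd = go (transfer y₀ y₀) (unit-between (regular-at (proj₁ (proj₂ pivot)) y₀-Val) rd)
        where
        go : (∃ λ z' → ∃ λ w' → (∀ i → R (y₀ - X i) (z' - Y i)) × (∀ i → R (y₀ - X i) (w' - Y i)) × R (y₀ - y₀) (z' - w')) → (∃ λ u → Cop (+ N) u × (u * y₀ ≋ d [ + M x₀ ])) → R d d'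
        go (z' , _ , h , _) (u , cu , hu) = R-period (M-AG x₀) (regular-Periodic reg rd) (R-resp (regular-Periodic reg rd (≋-sym hu) refl) refl (R-unit cu r))
            (≋-by-primes ∣-refl (∣n⇒∣m*n u (R-∣ (E-AG x₀) r (proj₁ (proj₂ pivot)))) ed' (λ {q} pd _ → ≋-trans (≋-*ˡ u (pivot-image h pd)) (≋-trans (≋-reflexive (eq u (τ q (jof q)) y₀)) (≋-trans (≋-*ˡ (τ q (jof q)) (≋-weaken (qb∣M pd) hu)) (≋-sym (hd pd))))))
          where
          r : R y₀ z'
          r = R-origin (h o)
          eq : ∀ u t y → u * (t * y) ≡ t * (u * y)
          eq = solve-∀

      stabiliser : ∀ {d v} → RegularAt x₀ d → Cop (+ N) v → χ (v * d) ≡ χ d → χ (v * x₀) ≡ χ x₀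
      stabiliser {d} {v} rd cv h = go (unit-between rd (regular-self reg refl))
        where
        eq : ∀ v u d → v * (u * d) ≡ u * (v * d)
        eq = solve-∀
        go : (∃ λ u → Cop (+ N) u × (u * d ≋ x₀ [ + M x₀ ])) → χ (v * x₀) ≡ χ x₀
        go (u , cu , hu) = trans (~-unit cv (sym ud)) (trans (cong χ (eq v u d)) (trans (~-unit cu h) ud))
          where
          ud : χ (u * d) ≡ χ x₀
          ud = class-Periodic x₀ (≋-sym hu) refl

      -- The stabilising unit relating the two images is congruent to 1 modulo q, and modulo 4 when q = 2, hence rigid.
      pin : ∀ {q} (pd : PrimeData x₀ q) {l} → Level q l → jof q ℕ.< l → l ℕ.≤ b pd → P' q l ≋ τ q (jof q) * P q l [ q ↑ suc (b pd) ]
      pin {q} pd {l} lv j<l l≤b = go (common f fe)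
        where
        open PrimeData pd using (prime; s; p∤s)
        j : ℕ
        j = jof q
        T x x' : ℤ
        T = τ q j
        x = P q l
        x' = P' q l
        i : Fin t
        i = proj₁ (anchor q l)
        qb : ℤ
        qb = q ↑ suc (b pd)
        x-Val : Val q l x
        x-Val = P-Val prime lv
        x'-Val : Val q l x'
        x'-Val = P'-Val prime lv
        -- The element z with these residues is the base point of level l at q and 0 at the other
        -- primes, so subtracting it from the pivot leaves a regular element.
        f : ℕ → ℤ
        f r with r ℕ.≟ q
        ... | yes _ = x
        ... | no _ = 0ℤ
        f-q : f q ≡ x
        f-q with q ℕ.≟ q
        ... | yes _ = refl
        ... | no ne = ⊥-elim (ne refl)
        f-off : ∀ r → r ≢ q → f r ≡ 0ℤ
        f-off r ne with r ℕ.≟ q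
        ... | yes h = ⊥-elim (ne h)
        ... | no _ = refl
        fe : ∀ {r} → PrimeData x₀ r → e ∣ f r
        fe {r} _ with r ℕ.≟ q
        ... | yes _ = E∣P pd lv (ℕₚ.<⇒≤ j<l)
        ... | no _ = ∣0
        go : (∃ λ z → (e ∣ z) × (∀ {r} (pr : PrimeData x₀ r) → z ≋ f r [ r ↑ suc (b pr) ])) → x' ≋ T * x [ qb ]
        go (z , ez , hz) = go' (transfer y₀ z)
          where
          z-q : z ≋ x [ qb ]
          z-q = ≋-trans (hz pd) (≋-reflexive f-q)
          z-off : ∀ {r} (pr : PrimeData x₀ r) → r ≢ q → z ≋ 0ℤ [ r ↑ suc (b pr) ]
          z-off {r} pr ne = ≋-trans (hz pr) (≋-reflexive (f-off r ne))
          z-deep : ∀ {r} (pr : PrimeData x₀ r) → r ↑ suc (jof r) ∣ z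
          z-deep {r} pr = cases r pr (r ℕ.≟ q)
            where
            cases : ∀ r (pr : PrimeData x₀ r) → Dec (r ≡ q) → r ↑ suc (jof r) ∣ z
            cases r pr (yes refl) = ∣-≋ (≋-sym (≋-weaken (↑-∣ q (s≤s (ℕₚ.≤-trans (ℕₚ.<⇒≤ j<l) l≤b))) z-q)) (∣-trans (↑-∣ q j<l) (proj₁ x-Val))
            cases r pr (no ne) = ≋0⇒∣ (≋-weaken (↑-∣ r (s≤s (j≤b pr))) (z-off pr ne))
          w : ℤ
          w = y₀ - z
          w-reg : RegularAt x₀ w
          w-reg = regular-at (∣m∣n⇒∣m-n (proj₁ (proj₂ pivot)) ez) (λ pr → val-≋ (≋-sym (≋-trans (≋-+ˡ y₀ (≋-neg (∣⇒≋0 (z-deep pr)))) (≋-reflexive (ℤₚ.+-identityʳ y₀)))) (y₀-Val pr))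
          go' : (∃ λ y' → ∃ λ z' → (∀ i → R (y₀ - X i) (y' - Y i)) × (∀ i → R (z - X i) (z' - Y i)) × R (y₀ - z) (y' - z')) → x' ≋ T * x [ qb ]
          go' (y' , z' , hy , hz' , r) = go″ (common (λ r → τ r (jof r) * w) (λ {r} _ → ∣n⇒∣m*n (τ r (jof r)) (proj₁ w-reg)))
            where
            w' : ℤ
            w' = y' - z'
            ew' : e ∣ w'
            ew' = R-∣ (E-AG x₀) r (proj₁ w-reg)
            go″ : (∃ λ d → (e ∣ d) × (∀ {r} (pr : PrimeData x₀ r) → d ≋ τ r (jof r) * w [ r ↑ suc (b pr) ])) → x' ≋ T * x [ qb ]
            go″ (d , ed , hd) = fin (val-form prime (val-at d-reg pd)) (val-form prime w'-Val)
              where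
              -- Two images of w: one from transferring the pivot and z together, one from the
              -- scalars at the levels of E. At q they differ by T x - x', the quantity in question.
              same : χ w' ≡ χ d
              same = R-fun r (regular-image w-reg ed hd) refl
              d-reg : RegularAt x₀ d
              d-reg = regular-at ed (λ {r} pr → val-≋ (≋-weaken (↑-∣ r (s≤s (j≤b pr))) (≋-sym (hd pr))) (val-unit (PrimeData.prime pr) (val-at w-reg pr) (proj₁ (proj₂ (scale r (jof r))) (PrimeData.prime pr))))
              w'-q : w' ≋ T * y₀ - x' [ qb ]
              w'-q = ≋-- (pivot-image {y'} hy pd) (near pd {z} {z'} i ez (E∣P pd lv (ℕₚ.<⇒≤ j<l)) z-q (hz' i))
              d-q : d ≋ T * y₀ - T * x [ qb ]
              d-q = ≋-trans (hd pd) (≋-trans (≋-*ˡ T (≋-+ˡ y₀ (≋-neg z-q))) (≋-reflexive (eq T y₀ x)))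
                where
                eq : ∀ t y x → t * (y - x) ≡ t * y - t * x
                eq = solve-∀
              off : ∀ {r} (pr : PrimeData x₀ r) → r ≢ q → d ≋ w' [ r ↑ suc (b pr) ]
              off {r} pr ne = ≋-trans (hd pr) (≋-trans (≋-*ˡ (τ r (jof r)) (≋-+ˡ y₀ (≋-neg (z-off pr ne)))) (≋-trans (≋-reflexive (eq (τ r (jof r)) y₀))
                  (≋-sym (≋-trans (≋-- (pivot-image {y'} hy pr) (≋-trans (near pr {z} {z'} o ez (subst (e ∣_) (sym X-o) ∣0) (≋-trans (z-off pr ne) (≋-reflexive (sym X-o))) (hz' o)) (≋-reflexive Y-o))) (≋-reflexive (ℤₚ.+-identityʳ (τ r (jof r) * y₀)))))))
                where
                eq : ∀ t y → t * (y - 0ℤ) ≡ t * y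
                eq = solve-∀
              d≋w' : d ≋ w' [ s ]
              d≋w' = ≋-by-primes (AtPrime.s∣M reg pd) ed ew' (λ {r} pr dr → off pr (λ { refl → p∤s dr }))
              qj1 : ∀ {y} → Val q l y → q ↑ suc j ∣ y
              qj1 v = ∣-trans (↑-∣ q j<l) (proj₁ v)
              w'-Val : Val q j w'
              w'-Val = val-≋ (≋-sym (≋-trans (≋-weaken (↑-∣ q (s≤s (j≤b pd))) w'-q) (≋-trans (≋-+ˡ (T * y₀) (≋-neg (∣⇒≋0 (qj1 x'-Val)))) (≋-reflexive (ℤₚ.+-identityʳ (T * y₀))))))
                (val-unit prime (y₀-Val pd) (proj₁ (proj₂ (scale q j)) prime))
              fin : (∃ λ d₁ → (d ≡ q ↑ j * d₁) × ¬ + q ∣ d₁) → (∃ λ w₁ → (w' ≡ q ↑ j * w₁) × ¬ + q ∣ w₁) → x' ≋ T * x [ qb ]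
              fin (d₁ , ed₁ , ¬d₁) (w₁ , ew₁ , ¬w₁) = fin' (AtPrime.associate-unit reg pd {j} ed₁ ew₁ ¬d₁ ¬w₁ d≋w' 0 z≤n ≋⟨ 0↑∣ ⟩)
                where
                fin' : (∃ λ u → Cop (+ N) u × (u ≋ 1ℤ [ s ]) × (u ≋ 1ℤ [ q ↑ 0 ]) × (u * d ≋ w' [ + M x₀ ])) → x' ≋ T * x [ qb ]
                fin' (v , cv , vs , _ , vd) = ≋-sym ≋⟨ ∣-≋ shift (subst (_∣ (v - 1ℤ) * d) (trans (sym (↑-+ q (AtPrime.a reg pd) j)) (cong (q ↑_) (a+j pd))) (*-∣-* (AtPrime.rigid reg pd cv vs stab p∣v four) (proj₁ (val-at d-reg pd)))) ⟩
                  where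
                  stab : χ (v * x₀) ≡ χ x₀
                  stab = stabiliser d-reg cv (regular-Periodic reg d-reg (≋-sym vd) same)
                  shift : (v - 1ℤ) * d ≋ T * x - x' [ qb ]
                  shift = ≋-trans (≋-reflexive (eq v d)) (≋-trans (≋-- (≋-trans (≋-weaken (qb∣M pd) vd) w'-q) d-q) (≋-reflexive (eq' (T * y₀) x' (T * x))))
                    where
                    eq : ∀ v d → (v - 1ℤ) * d ≡ v * d - d
                    eq = solve-∀
                    eq' : ∀ y x' x → y - x' - (y - x) ≡ x - x'
                    eq' = solve-∀
                  Tx-Val : Val q l (T * x)
                  Tx-Val = val-unit prime x-Val (proj₁ (proj₂ (scale q j)) prime)
                  down : ∀ k → k ℕ.+ j ℕ.≤ suc (b pd) → q ↑ (k ℕ.+ j) ∣ T * x - x' → q ↑ k ∣ v - 1ℤ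
                  down k le h = val-cancel prime (val-at d-reg pd) k (∣-≋ (≋-sym (≋-weaken (↑-∣ q le) shift)) h)
                  p∣v : + q ∣ v - 1ℤ
                  p∣v = subst (_∣ v - 1ℤ) (↑-1 q) (down 1 (s≤s (j≤b pd)) (∣m∣n⇒∣m-n (qj1 Tx-Val) (qj1 x'-Val)))
                  -- Two numbers of exact 2-valuation l differ by a multiple of 2^(l+1), and l > j
                  -- leaves two factors 2 for v - 1.
                  four : q ≡ 2 → + 4 ∣ v - 1ℤ
                  four h = subst (_∣ v - 1ℤ) (trans (cong (_↑ 2) h) (sym (↑-as-+ 2 2))) (down 2 (s≤s (ℕₚ.≤-trans j<l l≤b)) (∣-trans (↑-∣ q (s≤s j<l)) (subst (λ r → r ↑ suc l ∣ T * x - x') (sym h) (odd-diff (subst (λ r → Val r l (T * x)) h Tx-Val) (subst (λ r → Val r l x') h x'-Val)))))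

  digit : ℕ → ℕ → ℤ
  digit q i = τ q (proj₁ (level q i))

  opaque
    digit-unit : ∀ {q} → Prime q → ∀ i → ¬ + q ∣ digit q i
    digit-unit {q} pr i = proj₁ (proj₂ (scale q (proj₁ (level q i)))) pr

    -- `pin` compares the scalars of levels l and j after multiplication by a base point of
    -- valuation l, so they agree modulo q^(b+1-l), and l ≤ i.
    digit-≋ : ∀ {x₀} (reg : Regular x₀) {q} (pd : PrimeData x₀ q) → ∀ i → jof reg q ℕ.≤ i → i ℕ.≤ PrimeData.b pd →
      digit q i ≋ τ q (jof reg q) [ q ↑ (suc (PrimeData.b pd) ℕ.∸ i) ]
    digit-≋ {x₀} reg {q} pd i j≤i i≤b = go (level q i)
      where
      b : ℕ
      b = PrimeData.b pd
      j : ℕ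
      j = jof reg q
      go : (lv : ∃ λ l → l ℕ.≤ i × (∀ j → j ℕ.≤ i → Level q j → (j ℕ.≤ l) × Level q l)) → τ q (proj₁ lv) ≋ τ q j [ q ↑ (suc b ℕ.∸ i) ]
      go (l , l≤i , h) = go' (h j j≤i (level-j reg pd))
        where
        go' : (j ℕ.≤ l) × Level q l → τ q l ≋ τ q j [ q ↑ (suc b ℕ.∸ i) ]
        go' (j≤l , lv) = go″ (ℕₚ.m≤n⇒m<n∨m≡n j≤l)
          where
          l≤b : l ℕ.≤ b
          l≤b = ℕₚ.≤-trans l≤i i≤b
          go″ : (j ℕ.< l) ⊎ (j ≡ l) → τ q l ≋ τ q j [ q ↑ (suc b ℕ.∸ i) ]
          go″ (inj₂ h) = ≋-reflexive (cong (τ q) (sym h))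
          go″ (inj₁ j<l) = ≋-weaken (↑-∣ q (ℕₚ.∸-monoʳ-≤ (suc b) l≤i)) ≋⟨ val-cancel (PrimeData.prime pd) (P-Val (PrimeData.prime pd) lv) (suc b ℕ.∸ l)
              (subst₂ _∣_ (cong (q ↑_) (sym (ℕₚ.m∸n+n≡m (ℕₚ.m≤n⇒m≤1+n l≤b)))) (eq (τ q l) (τ q j) (P q l)) (≋⇒∣ (≋-trans (≋-sym (P'≋ reg pd lv)) (pin reg pd lv j<l l≤b)))) ⟩
            where
            eq : ∀ a b x → a * x - b * x ≡ (a - b) * x
            eq = solve-∀

-- Digitwise scaling

module Digits {p : ℕ} (pr : Prime p) (τ : ℕ → ℤ) (τ-unit : ∀ i → ¬ + p ∣ τ i) where
  private
    instance
      p-nz : ℕ.NonZero p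
      p-nz = prime⇒nonZero pr

    lo hi : ℤ → ℤ
    lo x = + (x %ℕ p)
    hi x = x /ℕ p

  opaque
    -- Multiplies the i-th digit of the p-adic expansion by τ i, keeping the K lowest digits.
    rescale : ℕ → ℕ → ℤ → ℤ
    rescale zero i x = 0ℤ
    rescale (suc K) i x = τ i * lo x + + p * rescale K (suc i) (hi x)

    private
      expand : ∀ x → x ≡ lo x + hi x * + p
      expand x = a≡a%ℕn+[a/ℕn]*n x p

      lo-≋ : ∀ x → lo x ≋ x [ + p ]
      lo-≋ x = ≋-sym (≋-trans (≋-reflexive (expand x)) (≋-shift (lo x) (hi x)))

      lo-≡ : ∀ {x y} → x ≋ y [ + p ] → lo x ≡ lo y
      lo-≡ {x} {y} h = cong +_ (residue-unique p (n%ℕd<d x p) (n%ℕd<d y p) (≋-trans (lo-≋ x) (≋-trans h (≋-sym (lo-≋ y)))))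

      hi-diff : ∀ {x y} → lo x ≡ lo y → x - y ≡ + p * (hi x - hi y)
      hi-diff {x} {y} h = trans (cong₂ _-_ (expand x) (trans (expand y) (cong (_+ hi y * + p) (sym h)))) (eq (lo x) (hi x) (hi y) (+ p))
        where
        eq : ∀ l a b p → l + a * p - (l + b * p) ≡ p * (a - b)
        eq = solve-∀

      rescale-diff : ∀ K i {x y} → lo x ≡ lo y → rescale (suc K) i x - rescale (suc K) i y ≡ + p * (rescale K (suc i) (hi x) - rescale K (suc i) (hi y))
      rescale-diff K i {x} {y} h = trans (cong (λ l → τ i * lo x + + p * rescale K (suc i) (hi x) - (τ i * l + + p * rescale K (suc i) (hi y))) (sym h)) (eq (τ i * lo x) (+ p) (rescale K (suc i) (hi x)) (rescale K (suc i) (hi y)))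
        where
        eq : ∀ l p a b → l + p * a - (l + p * b) ≡ p * (a - b)
        eq = solve-∀

      up : ∀ {k z} → p ↑ k ∣ z → p ↑ suc k ∣ + p * z
      up {k} {z} d = subst (_∣ + p * z) (sym (↑-suc p k)) (*-monoʳ-∣ (+ p) d)

      down : ∀ {k z} → p ↑ suc k ∣ + p * z → p ↑ k ∣ z
      down {k} {z} d = *-cancelˡ-∣ (+ p) {{prime-nonZero pr}} (subst (_∣ + p * z) (↑-suc p k) d)

      mod-p : ∀ {k x y} → p ↑ suc k ∣ x - y → x ≋ y [ + p ]
      mod-p {k} d = ≋⟨ ∣-trans (p∣↑ p k) d ⟩

    rescale-∣ : ∀ k K i {x y} → k ℕ.≤ K → p ↑ k ∣ x - y → p ↑ k ∣ rescale K i x - rescale K i y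
    rescale-∣ zero K i _ _ = 0↑∣
    rescale-∣ (suc k) (suc K) i {x} {y} (s≤s l) d = subst (p ↑ suc k ∣_) (sym (rescale-diff K i {x} {y} same)) (up (rescale-∣ k K (suc i) {hi x} {hi y} l (down (subst (p ↑ suc k ∣_) (hi-diff {x} {y} same) d))))
      where
      same : lo x ≡ lo y
      same = lo-≡ {x} {y} (mod-p {x = x} {y} d)

    rescale-∣⁻ : ∀ k K i {x y} → k ℕ.≤ K → p ↑ k ∣ rescale K i x - rescale K i y → p ↑ k ∣ x - y
    rescale-∣⁻ zero K i _ _ = 0↑∣
    rescale-∣⁻ (suc k) (suc K) i {x} {y} (s≤s l) d = subst (p ↑ suc k ∣_) (sym (hi-diff {x} {y} same)) (up (rescale-∣⁻ k K (suc i) {hi x} {hi y} l (down (subst (p ↑ suc k ∣_) (rescale-diff K i {x} {y} same) d))))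
      where
      low : ∀ x → rescale (suc K) i x ≋ τ i * x [ + p ]
      low x = ≋-trans (≋-trans (≋-reflexive (cong (λ z → τ i * lo x + z) (ℤₚ.*-comm (+ p) (rescale K (suc i) (hi x))))) (≋-shift (τ i * lo x) (rescale K (suc i) (hi x)))) (≋-*ˡ (τ i) (lo-≋ x))
      same : lo x ≡ lo y
      same = lo-≡ {x} {y} ≋⟨ cop-cancel (prime-cop pr (τ-unit i)) (subst (+ p ∣_) (eq (τ i) x y) (≋⇒∣ (≋-trans (≋-sym (low x)) (≋-trans (mod-p {k} {rescale (suc K) i x} {rescale (suc K) i y} d) (low y))))) ⟩
        where
        eq : ∀ t x y → t * x - t * y ≡ t * (x - y)
        eq = solve-∀

    -- A digit that sits m - i places higher contributes with the factor p^(m-i), so its scalar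
    -- matters only modulo p^(B-m).
    rescale-linear : ∀ {σ B} a K i x → i ℕ.+ a ≡ B → a ℕ.≤ K → (∀ m → i ℕ.≤ m → m ℕ.< B → τ m ≋ σ [ p ↑ (B ℕ.∸ m) ]) → rescale K i x ≋ σ * x [ p ↑ a ]
    rescale-linear zero K i x _ _ _ = ≋⟨ 0↑∣ ⟩
    rescale-linear {σ} {B} (suc a) (suc K) i x e (s≤s l) h = ≋-trans (≋-+ (≋-*ʳ (lo x) first) rest) (≋-reflexive (trans (eq σ (lo x) (hi x) (+ p)) (cong (σ *_) (sym (expand x)))))
      where
      eq : ∀ s l a p → s * l + p * (s * a) ≡ s * (l + a * p)
      eq = solve-∀
      first : τ i ≋ σ [ p ↑ suc a ]
      first = subst (λ z → τ i ≋ σ [ p ↑ z ]) (trans (cong (ℕ._∸ i) (sym e)) (ℕₚ.m+n∸m≡n i (suc a))) (h i ℕₚ.≤-refl (subst (i ℕ.<_) e (ℕₚ.m<m+n i (s≤s z≤n))))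
      rest : + p * rescale K (suc i) (hi x) ≋ + p * (σ * hi x) [ p ↑ suc a ]
      rest = ≋⟨ subst (p ↑ suc a ∣_) (eq' (+ p) (rescale K (suc i) (hi x)) (σ * hi x)) (up (≋⇒∣ (rescale-linear a K (suc i) (hi x) (trans (sym (ℕₚ.+-suc i a)) e) l (λ m l' → h m (ℕₚ.<⇒≤ l'))))) ⟩
        where
        eq' : ∀ p a b → p * (a - b) ≡ p * a - p * b
        eq' = solve-∀

    -- The j lowest digits of x and y coincide and cancel, whatever their scalars are; the remaining
    -- ones are covered by `rescale-linear`.
    rescale-≋ : ∀ {σ B} j a K i {x y} → i ℕ.+ j ℕ.+ a ≡ B → j ℕ.+ a ℕ.≤ K → p ↑ j ∣ x - y → (∀ m → i ℕ.+ j ℕ.≤ m → m ℕ.< B → τ m ≋ σ [ p ↑ (B ℕ.∸ m) ]) →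
      rescale K i x - rescale K i y ≋ σ * (x - y) [ p ↑ (j ℕ.+ a) ]
    rescale-≋ {σ} {B} zero a K i {x} {y} e l d h = ≋-trans (≋-- (rescale-linear a K i x e' l h') (rescale-linear a K i y e' l h')) (≋-reflexive (eq σ x y))
      where
      e' : i ℕ.+ a ≡ B
      e' = trans (cong (ℕ._+ a) (sym (ℕₚ.+-identityʳ i))) e
      h' : ∀ m → i ℕ.≤ m → m ℕ.< B → τ m ≋ σ [ p ↑ (B ℕ.∸ m) ]
      h' m lm = h m (subst (ℕ._≤ m) (sym (ℕₚ.+-identityʳ i)) lm)
      eq : ∀ s x y → s * x - s * y ≡ s * (x - y)
      eq = solve-∀
    rescale-≋ {σ} {B} (suc j) a (suc K) i {x} {y} e (s≤s l) d h = ≋⟨ subst (p ↑ suc (j ℕ.+ a) ∣_) (trans (eq (+ p) (rescale K (suc i) (hi x) - rescale K (suc i) (hi y)) σ (hi x - hi y)) (cong₂ (λ u v → u - σ * v) (sym (rescale-diff K i {x} {y} same)) (sym (hi-diff {x} {y} same))))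
        (up (≋⇒∣ (rescale-≋ j a K (suc i) {hi x} {hi y} (trans (cong (ℕ._+ a) (sym (ℕₚ.+-suc i j))) e) l (down (subst (p ↑ suc j ∣_) (hi-diff {x} {y} same) d)) (λ m lm → h m (subst (ℕ._≤ m) (sym (ℕₚ.+-suc i j)) lm))))) ⟩
      where
      same : lo x ≡ lo y
      same = lo-≡ {x} {y} (mod-p {x = x} {y} d)
      eq : ∀ p u s v → p * (u - s * v) ≡ p * u - s * (p * v)
      eq = solve-∀

opaque
  injective⇒onto : ∀ {n} (f : Fin n → Fin n) → (∀ {i j} → f i ≡ f j → i ≡ j) → ∀ y → ∃ λ x → f x ≡ y
  injective⇒onto {suc n} f inj y = go (any? (λ x → f x ≟F y))
    where
    go : Dec (∃ λ x → f x ≡ y) → ∃ λ x → f x ≡ y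
    go (yes h) = h
    go (no ¬h) = ⊥-elim (ℕₚ.1+n≰n (injective⇒≤ {f = λ x → punchOut {i = y} {j = f x} (λ e → ¬h (x , sym e))} (λ {i} {j} e → inj (punchOut-injective (λ e → ¬h (i , sym e)) (λ e → ¬h (j , sym e)) e))))

-- The permutation and its effect on all classes

module Isomorphism {n k : ℕ} (c : Colouring (suc n) k) (circ : IsCirculant c) (φ : Fin k ↔ Fin k) (alg : IsAlgAut c φ) (fr : Frames.Frame c circ φ alg) where
  open Sets c circ
  open Theory c circ
  open TopLayer c circ
  open Reduction c circ
  open RegularClasses c circ
  open SchurRing c circ using (module Morphism; toF; toF-≋; c-as-χ; c-toF)
  open Morphism φ alg
  open Images c circ φ alg
  open Scaling c circ φ alg fr

  record Local-map (q : ℕ) (g : ℤ → ℤ) : Set where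
    field
      g-∣ : ∀ {k x y} → q ↑ k ∣ + N → q ↑ k ∣ x - y → q ↑ k ∣ g x - g y
      g-∣⁻ : ∀ {k x y} → q ↑ k ∣ + N → q ↑ k ∣ g x - g y → q ↑ k ∣ x - y
      g-≋ : ∀ {x₀} (reg : Regular x₀) (pd : PrimeData x₀ q) {x y} → + E x₀ ∣ x - y → g x - g y ≋ τ q (jof reg q) * (x - y) [ q ↑ suc (PrimeData.b pd) ]
  open Local-map

  opaque
    -- This makes N digits enough for every prime.
    power-bound : ∀ {q} → Prime q → ∀ {k} → q ↑ k ∣ + N → k ℕ.≤ N
    power-bound {q} pr {k} d = ℕₚ.≮⇒≥ (λ l → ↑abs∤ pr N≢0 (∣-trans (↑-∣ q (ℕₚ.<⇒≤ l)) d))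

    local-map : ∀ q → ∃ λ g → Prime q → Local-map q g
    local-map q = go (prime? q)
      where
      go : Dec (Prime q) → ∃ λ g → Prime q → Local-map q g
      go (no ¬p) = (λ x → x) , λ p → ⊥-elim (¬p p)
      go (yes pr) = rescale N 0 , λ _ → record
        { g-∣ = λ {k} {x} {y} dk → rescale-∣ k N 0 {x} {y} (power-bound pr dk)
        ; g-∣⁻ = λ {k} {x} {y} dk → rescale-∣⁻ k N 0 {x} {y} (power-bound pr dk)
        ; g-≋ = λ {x₀} reg pd {x} {y} d → lin′ {x₀} reg pd {x} {y} d }
        where
        open Digits pr (digit q) (digit-unit pr)
        lin′ : ∀ {x₀} (reg : Regular x₀) (pd : PrimeData x₀ q) {x y} → + E x₀ ∣ x - y → rescale N 0 x - rescale N 0 y ≋ τ q (jof reg q) * (x - y) [ q ↑ suc (PrimeData.b pd) ]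
        lin′ {x₀} reg pd {x} {y} d = subst (λ z → rescale N 0 x - rescale N 0 y ≋ τ q j * (x - y) [ q ↑ z ]) j+a
            (rescale-≋ {τ q j} {suc b} j (suc b ℕ.∸ j) N 0 {x} {y} j+a (subst (ℕ._≤ N) (sym j+a) (power-bound pr (∣-trans (qb∣M reg pd) (∣N (M-AG x₀)))))
              (∣-trans (proj₁ (E-Val reg pd)) d) (λ m lm lb → digit-≋ reg pd m lm (ℕₚ.≤-pred lb)))
          where
          b j : ℕ
          b = PrimeData.b pd
          j = jof reg q
          j+a : j ℕ.+ (suc b ℕ.∸ j) ≡ suc b
          j+a = ℕₚ.m+[n∸m]≡n (ℕₚ.m≤n⇒m≤1+n (j≤b reg pd))

    f : ℤ → ℤ
    f x = proj₁ (CRT (+ N) N≢0 (λ q → proj₁ (local-map q) x))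

    f-local : ∀ {q} → Prime q → ∀ {k} → q ↑ k ∣ + N → ∀ x → f x ≋ proj₁ (local-map q) x [ q ↑ k ]
    f-local {q} pr {k} d x = proj₂ (CRT (+ N) N≢0 (λ q → proj₁ (local-map q) x)) q pr k d

  opaque
    f-∣ : ∀ {m} → m ∣ + N → ∀ {x y} → m ∣ x - y → m ∣ f x - f y
    f-∣ {m} dm {x} {y} d = local-∣ m (∣-nonZero N≢0 dm) (λ q pr k dk →
      ∣-≋ (≋-sym (≋-- (f-local pr (∣-trans dk dm) x) (f-local pr (∣-trans dk dm) y))) (g-∣ (proj₂ (local-map q) pr) {k} {x} {y} (∣-trans dk dm) (∣-trans dk d)))

    f-∣⁻ : ∀ {m} → m ∣ + N → ∀ {x y} → m ∣ f x - f y → m ∣ x - y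
    f-∣⁻ {m} dm {x} {y} d = local-∣ m (∣-nonZero N≢0 dm) (λ q pr k dk →
      g-∣⁻ (proj₂ (local-map q) pr) {k} {x} {y} (∣-trans dk dm) (∣-≋ (≋-- (f-local pr (∣-trans dk dm) x) (f-local pr (∣-trans dk dm) y)) (∣-trans dk d)))

    f-scales : ∀ {x₀} (reg : Regular x₀) {q} (pd : PrimeData x₀ q) {x y} → + E x₀ ∣ x - y → f x - f y ≋ τ q (jof reg q) * (x - y) [ q ↑ suc (PrimeData.b pd) ]
    f-scales {x₀} reg {q} pd {x} {y} d = ≋-trans (≋-- (f-local (PrimeData.prime pd) dk x) (f-local (PrimeData.prime pd) dk y)) (g-≋ (proj₂ (local-map q) (PrimeData.prime pd)) reg pd {x} {y} d)
      where
      dk : q ↑ suc (PrimeData.b pd) ∣ + N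
      dk = ∣-trans (qb∣M reg pd) (∣N (M-AG x₀))

    f-R : ∀ α β → R (β - α) (f β - f α)
    f-R α β = go (β - α) (ℕI.<-wellFounded (N ℕ.∸ E (β - α))) α β refl
      where
      go : ∀ x₀ → Acc ℕ._<_ (N ℕ.∸ E x₀) → ∀ α β → χ (β - α) ≡ χ x₀ → R (β - α) (f β - f α)
      go x₀ (acc rec) α β m = cases (dichotomy x₀)
        where
        cases : Regular x₀ ⊎ (∃ λ q → Prime q × (+ q * + E x₀ ∣ + M x₀) × Splitting x₀ (+ q * + E x₀)) → R (β - α) (f β - f α)
        cases (inj₁ reg) = regular-image reg (regular-self reg m) (f-∣ (∣N (E-AG x₀)) {β} {α} E∣) (λ pd → f-scales reg pd {β} {α} E∣)
          where
          E∣ : + E x₀ ∣ β - α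
          E∣ = gen-∣ (genOf x₀) m
        -- β - α is in the class of h₀ + w₀, so it splits in the same way, through an intermediate
        -- point γ.
        cases (inj₂ (q , pr , dq , sp)) = split (~-decompose (trans (sum-in H∣h₀ V∤h₀ refl) (sym m)) h₀)
          where
          open Splitting sp
          smaller : N ℕ.∸ E w₀ ℕ.< N ℕ.∸ E x₀
          smaller = ℕₚ.∸-monoʳ-< E< (ℕ∣.∣⇒≤ (∣⇒∣ᵤ (∣N (E-AG w₀))))
            where
            E< : E x₀ ℕ.< E w₀
            E< = ℕₚ.<-≤-trans (ℕₚ.<-≤-trans (ℕₚ.m<m*n (E x₀) q {{nz (E-AG x₀)}} (ℕ.nonTrivial⇒n>1 q {{prime⇒nonTrivial pr}})) (ℕₚ.≤-reflexive (ℕₚ.*-comm (E x₀) q)))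
              (ℕ∣.∣⇒≤ {{nz (E-AG w₀)}} (∣⇒∣ᵤ (subst (_∣ + E w₀) (sym (ℤₚ.pos-* q (E x₀))) (gen-least (genOf w₀) (∣-trans dq (∣N (M-AG x₀))) (λ w ew → deep ew)))))
          split : (∃ λ h → (χ h ≡ χ h₀) × (χ (β - α - h) ≡ χ (h₀ + w₀ - h₀))) → R (β - α) (f β - f α)
          split (h , eh , ew) = finish (R-cototal (f β - f α))
            where
            γ : ℤ
            γ = α + h
            eq₁ : ∀ β α h → β - α - h ≡ β - (α + h)
            eq₁ = solve-∀
            eq₂ : ∀ h w → h + w - h ≡ w
            eq₂ = solve-∀
            eq₃ : ∀ α h → α + h - α ≡ h
            eq₃ = solve-∀
            eq₄ : ∀ a b c → a - b - (c - b) ≡ a - c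
            eq₄ = solve-∀
            eq₅ : ∀ a x → a + (x - a) ≡ x
            eq₅ = solve-∀
            w~ : χ (β - γ) ≡ χ w₀
            w~ = trans (cong χ (sym (eq₁ β α h))) (trans ew (cong χ (eq₂ h₀ w₀)))
            ih : R (β - γ) (f β - f γ)
            ih = go w₀ (rec smaller) γ β w~
            h∈ : + H ∣ f γ - f α
            h∈ = f-∣ (∣N H-AG) {γ} {α} (subst (+ H ∣_) (sym (eq₃ α h)) (ag-inv H-AG (sym eh) H∣h₀))
            h∉ : ¬ + V ∣ f γ - f α
            h∉ d = V∤h₀ (ag-inv V-AG eh (subst (+ V ∣_) (eq₃ α h) (f-∣⁻ (∣N V-AG) {γ} {α} d)))
            finish : (∃ λ x₁ → R x₁ (f β - f α)) → R (β - α) (f β - f α)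
            finish (x₁ , r) = finish' (R-codecompose r (f γ - f α))
              where
              -- A preimage x₁ of f β - f α is split along f γ - f α. Its parts lie in H outside V,
              -- as f respects divisibility in both directions, and in the class of w₀, by
              -- induction; so `sum-in` puts x₁ into the class of β - α.
              finish' : (∃ λ a → R a (f γ - f α) × R (x₁ - a) (f β - f α - (f γ - f α))) → R (β - α) (f β - f α)
              finish' (a , ra , rb) = R-resp (trans (trans (cong χ (sym (eq₅ a x₁))) (sum-in (R-∣⁻ H-AG ra h∈) (λ d → h∉ (R-∣ V-AG ra d)) (trans (R-inj rb ih (cong χ (eq₄ (f β) (f α) (f γ)))) w~))) (sym m)) refl r

  opaque
    isomorphism : Σ (Fin (suc n) ↔ Fin (suc n)) (λ F → ∀ α β → c (Inverse.to F α) (Inverse.to F β) ≡ Inverse.to φ (c α β))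
    isomorphism = mk↔ₛ′ F F⁻ (λ y → proj₂ (injective⇒onto F inj y)) (λ x → inj (proj₂ (injective⇒onto F inj (F x)))) ,
        λ α β → trans (c-toF (f (+ toℕ α)) (f (+ toℕ β))) (trans (f-R (+ toℕ α) (+ toℕ β)) (cong (Inverse.to φ) (sym (c-as-χ α β))))
      where
      F : Fin N → Fin N
      F α = toF (f (+ toℕ α))
      inj : ∀ {α β} → F α ≡ F β → α ≡ β
      inj {α} {β} h = toℕ-injective (residue-unique N (toℕ<n α) (toℕ<n β) ≋⟨ f-∣⁻ ∣-refl {+ toℕ α} {+ toℕ β} (≋⇒∣ (≋-trans (≋-sym (toF-≋ (f (+ toℕ α)))) (≋-trans (≋-reflexive (cong (λ γ → + toℕ γ) h)) (toF-≋ (f (+ toℕ β)))))) ⟩)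
      F⁻ : Fin N → Fin N
      F⁻ y = proj₁ (injective⇒onto F inj y)

theorem7p4 : ∀ {n k : ℕ} (c : Colouring (suc n) k) → IsCirculant c → IsQuasinormal c →
  (φ : Fin k ↔ Fin k) → IsAlgAut c φ →
  Σ ℕ (λ t → Σ (Fin t → Fin (suc n)) (λ x → IsBaseTuple c x × Extendable c φ x)) →
  Σ (Fin (suc n) ↔ Fin (suc n)) (λ f →
    ∀ α β → c (Inverse.to f α) (Inverse.to f β) ≡ Inverse.to φ (c α β))
theorem7p4 c circ _ φ alg (t , x , base , ext) = Isomorphism.isomorphism c circ φ alg (Frames.frame c circ φ alg base ext)
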